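{- Let $X=\{x_1,\ldots,x_n\}$ and $Y=\{y_1,\ldots,y_m\}$ be two alphabets of commuting indeterminates (with $n,m$ possibly different). For nonempty $S\subseteq[n]$ and $T\subseteq[m]$ put $X_S=\sum_{i\in S}x_i$ and $Y_T=\sum_{i\in T}y_i$. For positive integers $j,k$ define \[ \mathcal{P}_{j,k}(X,Y)=\prod_{S\subseteq[n],\,|S|=j}\ \prod_{T\subseteq[m],\,|T|=k}(X_S+Y_T). \] Then $\mathcal{P}_{j,k}(X,Y)$ is Schur-positive: there exist nonnegative integers $a_{\lambda\mu}$ such that \[ \mathcal{P}_{j,k}(X,Y)=\sum_{\lambda,\mu}a_{\lambda\mu}\, s_\lambda(x_1,\ldots,x_n)\, s_\mu(y_1,\ldots,y_m). \]
   Context: $s_\lambda(x_1,\ldots,x_n)$ and $s_\mu(y_1,\ldots,y_m)$ denote Schur polynomials in the indicated variables, indexed by partitions $\lambda$, $\mu$. -}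

module Defs where

open import Data.Nat using (ℕ; zero; suc; _+_; _*_; _≤ᵇ_; _<ᵇ_; _≡ᵇ_; _≤_; _<_; _≥_)
import Data.Nat.Properties as ℕP
open import Data.Bool using (Bool; true; false; _∧_; if_then_else_)
open import Data.List using (List; []; _∷_; [_]; _++_; map; concatMap; foldr; filterᵇ)
open import Data.List.Relation.Unary.All using (All)
open import Data.List.Relation.Unary.Linked using (Linked)
open import Data.Vec as V using (Vec)
import Data.Vec.Properties as VP
open import Data.Fin using (Fin; toℕ; _↑ˡ_; _↑ʳ_)
import Data.Fin as F
open import Data.Fin.Subset using (Subset; ∣_∣)
open import Data.Product using (Σ; _×_; _,_; proj₁)
open import Relation.Nullary using (does)
open import Relation.Binary.PropositionalEquality using (_≡_)

-- Polynomials with nonnegative integer coefficients in k commuting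
-- indeterminates, as finite formal sums  Σ c · z^e  (sparse term lists).
-- Two term lists denote the same polynomial iff all coefficients agree.

Mono : ℕ → Set
Mono k = Vec ℕ k

Poly : ℕ → Set
Poly k = List (ℕ × Mono k)

coeff : ∀ {k} → Poly k → Mono k → ℕ
coeff [] e = 0
coeff ((c , d) ∷ p) e =
  (if does (VP.≡-dec ℕP._≟_ d e) then c else 0) + coeff p e

infix 4 _≈P_
_≈P_ : ∀ {k} → Poly k → Poly k → Set
p ≈P q = ∀ e → coeff p e ≡ coeff q e

0P : ∀ {k} → Poly k
0P = []

1P : ∀ {k} → Poly k
1P {k} = [ (1 , V.replicate k 0) ]

infixl 6 _+P_
infixl 7 _*P_
_+P_ : ∀ {k} → Poly k → Poly k → Poly k
_+P_ = _++_

_*P_ : ∀ {k} → Poly k → Poly k → Poly k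
p *P q = concatMap (λ { (c , d) → map (λ { (c' , d') → (c * c' , V.zipWith _+_ d d') }) q }) p

scaleP : ∀ {k} → ℕ → Poly k → Poly k
scaleP a p = map (λ { (c , d) → (a * c , d) }) p

sumP : ∀ {k} → List (Poly k) → Poly k
sumP = foldr _+P_ 0P

prodP : ∀ {k} → List (Poly k) → Poly k
prodP = foldr _*P_ 1P

unitMono : ∀ {k} → Fin k → Mono k
unitMono {k} i = V.replicate k 0 V.[ i ]≔ 1

var : ∀ {k} → Fin k → Poly k
var i = [ (1 , unitMono i) ]

xv : ∀ {n} m → Fin n → Poly (n + m)
xv m i = var (i ↑ˡ m)

yv : ∀ n {m} → Fin m → Poly (n + m)
yv n t = var (n ↑ʳ t)

liftX : ∀ {n} m → Poly n → Poly (n + m)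
liftX m = map (λ { (c , d) → (c , d V.++ V.replicate m 0) })

liftY : ∀ n {m} → Poly m → Poly (n + m)
liftY n = map (λ { (c , d) → (c , V.replicate n 0 V.++ d) })

allSubsets : ∀ n → List (Subset n)
allSubsets zero = [ V.[] ]
allSubsets (suc n) = concatMap (λ s → (false V.∷ s) ∷ (true V.∷ s) ∷ []) (allSubsets n)

elems : ∀ {n} → Subset n → List (Fin n)
elems V.[] = []
elems (b V.∷ s) = (if b then [ F.zero ] else []) ++ map F.suc (elems s)

subsetsOfSize : ∀ n → ℕ → List (Subset n)
subsetsOfSize n j = filterᵇ (λ S → ∣ S ∣ ≡ᵇ j) (allSubsets n)

XS : ∀ {n} m → Subset n → Poly (n + m)
XS m S = sumP (map (xv m) (elems S))

YT : ∀ n {m} → Subset m → Poly (n + m)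
YT n T = sumP (map (yv n) (elems T))

Pjk : ∀ n m → ℕ → ℕ → Poly (n + m)
Pjk n m j k =
  prodP (concatMap (λ S → map (λ T → XS m S +P YT n T) (subsetsOfSize m k))
                   (subsetsOfSize n j))

IsPartition : List ℕ → Set
IsPartition ps = Linked _≥_ ps × All (λ p → 1 ≤ p) ps

Partition : Set
Partition = Σ (List ℕ) IsPartition

-- Schur polynomials via semistandard Young tableaux.
-- A filling of shape (l₁ ≥ l₂ ≥ …) is a list of rows, row i of length lᵢ,
-- with entries in Fin n (entry a stands for the letter a+1 ∈ [n]).

rowsOfLen : ∀ n → ℕ → List (List (Fin n))
rowsOfLen n zero = [ [] ]
rowsOfLen n (suc l) = concatMap (λ i → map (i ∷_) (rowsOfLen n l)) (V.toList (V.allFin n))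

fillings : ∀ n → List ℕ → List (List (List (Fin n)))
fillings n [] = [ [] ]
fillings n (l ∷ ls) = concatMap (λ r → map (r ∷_) (fillings n ls)) (rowsOfLen n l)

rowOK : ∀ {n} → List (Fin n) → Bool
rowOK (a ∷ b ∷ r) = (toℕ a ≤ᵇ toℕ b) ∧ rowOK (b ∷ r)
rowOK _ = true

colOK : ∀ {n} → List (Fin n) → List (Fin n) → Bool
colOK (a ∷ u) (b ∷ l) = (toℕ a <ᵇ toℕ b) ∧ colOK u l
colOK _ [] = true
colOK [] (_ ∷ _) = false

isSSYT : ∀ {n} → List (List (Fin n)) → Bool
isSSYT [] = true
isSSYT (r ∷ []) = rowOK r
isSSYT (r ∷ r' ∷ rs) = rowOK r ∧ colOK r r' ∧ isSSYT (r' ∷ rs)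

SSYTs : ∀ n → Partition → List (List (List (Fin n)))
SSYTs n la = filterᵇ isSSYT (fillings n (proj₁ la))

content : ∀ {n} → List (List (Fin n)) → Mono n
content {n} T = foldr (λ r acc → foldr (λ a v → V.zipWith _+_ (unitMono a) v) acc r)
                      (V.replicate n 0) T

schur : ∀ n → Partition → Poly n
schur n la = map (λ T → (1 , content T)) (SSYTs n la)

{-# OPTIONS --safe #-}

-- Write E = ℤⁿ and F = ℤᵐ, so that P_{j,k} is the determinant of the torus acting
-- on U = Λʲ E ⊗ Λᵏ F by X_S + Y_T, and let R = rank U.  The generator ω of
-- Λᴿ U ⊂ U^⊗ᴿ is killed by all E_{ab} (a ≠ b in the same alphabet).  Splitting one
-- vector off each tensor factor, U → (Λʲ⁻¹E ⊗ ΛᵏF) ⊗ E ⊕ (ΛʲE ⊗ Λᵏ⁻¹F) ⊗ F,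
-- turns ω into an integer matrix Ω with rows indexed by words, and
-- R! P_{j,k} = ∑ Ω(w,·)² x^w is the trace of ρ x for the positive semidefinite
-- ρ = Ω Ωᵀ, which commutes with gl(n) × gl(m).
--
-- Let C be the Casimir operator on words.  From x E_{ab} x⁻¹ = (x_a/x_b) E_{ab} and
-- cyclicity of the trace, t' = tr(C ρ x) satisfies Δ t' = L(Δ t) - t L(Δ), where
-- t = tr(ρ x), Δ is the Vandermonde product and L = ∑ (x_i ∂_i)² + x_i ∂_i.  Since
-- s_μ Δ is an alternant, an eigenvector of L, the expansion t = ∑ a_μ s_μ (with
-- integer coefficients, by triangularity) yields tr(C ρ x) = ∑ c_μ a_μ s_μ, where
-- the eigenvalue c_μ increases strictly in the dominance order.  Now apply (C - c)²
-- for every c = c_μ ≠ c_λ: the coefficient of x^λ is a sum of squares, and on the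
-- other side only a positive multiple of a_λ survives, so a_λ ≥ 0.
module Submission where

open import Defs
open import Level using (0ℓ)
open import Algebra.Bundles using (CommutativeRing)
open import Algebra.Solver.Ring.AlmostCommutativeRing using (_-Raw-AlmostCommutative⟶_; fromCommutativeRing; -raw-almostCommutative⟶)
import Algebra.Solver.Ring as RingSolver
import Algebra.Properties.Ring as RingProperties
import Relation.Binary.Reasoning.Setoid as SetoidReasoning
open import Data.Nat using (_!; ℕ; zero; suc; _≤_; _<_; z≤n; s≤s; _∸_)
import Data.Nat as ℕ
import Data.Nat.Properties as ℕP
open import Data.Integer using (ℤ; +_; -[1+_]) renaming (_+_ to _+ᶻ_; _*_ to _*ᶻ_; -_ to -ᶻ_; _-_ to _-ᶻ_)
import Data.Integer as ℤ
import Data.Integer.Properties as ℤP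
open import Data.Nat.Solver using (module +-*-Solver)
open import Data.Bool using (Bool; true; false; if_then_else_; _∧_; T)
open import Data.Empty using (⊥; ⊥-elim)
open import Data.Unit using (⊤; tt)
open import Data.Fin using (Fin; toℕ)
import Data.Fin as F
import Data.Fin.Properties as FP
open import Data.Fin.Subset using (Subset; ∣_∣)
open import Data.List using (List; []; _∷_; _++_; map; concatMap; filterᵇ)
import Data.List as L
open import Data.Vec using (Vec; []; _∷_)
import Data.Vec as V
import Data.Vec.Properties as VP
open import Data.Maybe using (Maybe; just; nothing)
open import Data.Product using (∃; _×_; _,_; proj₁; proj₂)
open import Data.Sum using (_⊎_; inj₁; inj₂)
open import Function using (id; _∘_)
open import Relation.Nullary using (¬_; Dec; yes; no; does)
open import Relation.Binary.PropositionalEquality as ≡ using (_≡_; _≢_)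
open import Data.Vec.Relation.Binary.Pointwise.Inductive using (Pointwise; []; _∷_)
open import Data.List.Membership.Propositional using (_∈_; _∉_; lose; find)
open import Data.List.Relation.Unary.Any using (here; there)
open import Data.List.Relation.Unary.All as All using (All; []; _∷_)
open import Data.List.Relation.Unary.AllPairs as AllPairs using (AllPairs; []; _∷_)
open import Data.List.Membership.Propositional.Properties using (∈-map⁺; ∈-map⁻; ∈-concatMap⁺; ∈-concatMap⁻; ∈-filter⁺; ∈-filter⁻; ∈-downFrom⁺)
import Data.List.Relation.Unary.All.Properties as AllP
import Data.List.Relation.Unary.AllPairs.Properties as AllPairsP
open import Relation.Nullary.Decidable using (_×-dec_; T?)
open import Data.List.Relation.Unary.Linked using (Linked; []; [-]; _∷_)

-- The usual route to a nonnegative multiplicity decomposes representations into irreducibles. Here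
-- only relations between traces are used, over the integers and without division, and the
-- eigenvalues of C stand in for irreducibility. They need not separate all partitions: if c_μ = c_λ
-- with μ ≠ λ, then μ does not dominate λ, hence x^λ does not occur in s_μ, and reading off the
-- coefficient of x^λ removes such μ. The factors C - c enter squared because (C - c)Ω is again an
-- integer matrix with the same invariance, so its trace form is again a sum of squares. The
-- factorial R! counts the orderings of a basis of U inside the antisymmetric tensor ω. Both
-- alphabets are merged into one of size N = n + m, and U sits in the exterior algebra on N letters
-- as the span of the unions of S and T; the two splittings then form a single contraction.
-- Coefficients live in iterated formal power series, where reading a coefficient is application,
-- exchanging variables is transposing indices, and the quotient by Δ becomes cancellation of a
-- non-zero-divisor.

record Alg : Set₁ where
  field
    ring : CommutativeRing 0ℓ 0ℓ
    structure : CommutativeRing.rawRing ℤP.+-*-commutativeRing -Raw-AlmostCommutative⟶ fromCommutativeRing ring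

ℤAlg : Alg
ℤAlg = record
  { ring = ℤP.+-*-commutativeRing
  ; structure = -raw-almostCommutative⟶ (fromCommutativeRing ℤP.+-*-commutativeRing)
  }

-- Finite sums, products and powers in a commutative ring

module Kit (A : Alg) where
  open Alg A public
  open CommutativeRing ring public hiding (ring; zero)
  open _-Raw-AlmostCommutative⟶_ structure public
    using (+-homo; *-homo; -‿homo; 0-homo; 1-homo) renaming (⟦_⟧ to ι)
  open RingProperties (CommutativeRing.ring ring) public
    using (-‿involutive; -0#≈0#; -‿distribˡ-*; -‿distribʳ-*; -‿+-comm)
  module R≈ = SetoidReasoning setoid

  ι-weakDec : ∀ a b → Maybe (ι a ≈ ι b)
  ι-weakDec a b with a ℤP.≟ b
  ... | yes e = just (reflexive (≡.cong ι e))
  ... | no _ = nothing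

  open RingSolver (CommutativeRing.rawRing ℤP.+-*-commutativeRing) (fromCommutativeRing ring) structure ι-weakDec public
    using (solve; _:=_; _:+_; _:*_; _:-_; :-_; con)

  infixr 8 _^_
  _^_ : Carrier → ℕ → Carrier
  x ^ zero = 1#
  x ^ suc k = x * x ^ k

  ^-cong : ∀ {x y} k → x ≈ y → x ^ k ≈ y ^ k
  ^-cong zero e = refl
  ^-cong (suc k) e = *-cong e (^-cong k e)

  ^-+ : ∀ x a b → x ^ (a ℕ.+ b) ≈ x ^ a * x ^ b
  ^-+ x zero b = sym (*-identityˡ _)
  ^-+ x (suc a) b = trans (*-congˡ (^-+ x a b)) (sym (*-assoc _ _ _))

  ∑ : ∀ {I : Set} → List I → (I → Carrier) → Carrier
  ∑ [] f = 0#
  ∑ (i ∷ is) f = f i + ∑ is f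

  module _ {I : Set} where
    ∑-cong : ∀ (is : List I) {f g} → (∀ i → f i ≈ g i) → ∑ is f ≈ ∑ is g
    ∑-cong [] e = refl
    ∑-cong (i ∷ is) e = +-cong (e i) (∑-cong is e)

    ∑-zero : ∀ (is : List I) {f} → (∀ i → f i ≈ 0#) → ∑ is f ≈ 0#
    ∑-zero [] e = refl
    ∑-zero (i ∷ is) e = trans (+-cong (e i) (∑-zero is e)) (+-identityˡ _)

    ∑-+ : ∀ (is : List I) f g → ∑ is (λ i → f i + g i) ≈ ∑ is f + ∑ is g
    ∑-+ [] f g = sym (+-identityˡ _)
    ∑-+ (i ∷ is) f g = trans (+-congˡ (∑-+ is f g))
      (solve 4 (λ a b c d → (a :+ b) :+ (c :+ d) := (a :+ c) :+ (b :+ d)) refl (f i) (g i) (∑ is f) (∑ is g))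

    ∑-neg : ∀ (is : List I) f → ∑ is (λ i → - f i) ≈ - ∑ is f
    ∑-neg [] f = sym -0#≈0#
    ∑-neg (i ∷ is) f = trans (+-congˡ (∑-neg is f)) (-‿+-comm _ _)

    ∑-*ˡ : ∀ (is : List I) c f → ∑ is (λ i → c * f i) ≈ c * ∑ is f
    ∑-*ˡ [] c f = sym (zeroʳ c)
    ∑-*ˡ (i ∷ is) c f = trans (+-congˡ (∑-*ˡ is c f)) (sym (distribˡ _ _ _))

    ∑-*ʳ : ∀ (is : List I) c f → ∑ is (λ i → f i * c) ≈ ∑ is f * c
    ∑-*ʳ is c f = trans (∑-cong is λ i → *-comm (f i) c) (trans (∑-*ˡ is c f) (*-comm _ _))

    ∑-++ : ∀ (is js : List I) f → ∑ (is ++ js) f ≈ ∑ is f + ∑ js f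
    ∑-++ [] js f = sym (+-identityˡ _)
    ∑-++ (i ∷ is) js f = trans (+-congˡ (∑-++ is js f)) (sym (+-assoc _ _ _))

  module _ {I J : Set} where
    ∑-map : ∀ (h : I → J) (is : List I) f → ∑ (map h is) f ≈ ∑ is (f ∘ h)
    ∑-map h [] f = refl
    ∑-map h (i ∷ is) f = +-congˡ (∑-map h is f)

    ∑-concatMap : ∀ (h : I → List J) (is : List I) f → ∑ (concatMap h is) f ≈ ∑ is (λ i → ∑ (h i) f)
    ∑-concatMap h [] f = refl
    ∑-concatMap h (i ∷ is) f = trans (∑-++ (h i) _ f) (+-congˡ (∑-concatMap h is f))

    ∑-swap : ∀ (is : List I) (js : List J) (f : I → J → Carrier) → ∑ is (λ i → ∑ js (f i)) ≈ ∑ js (λ j → ∑ is (λ i → f i j))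
    ∑-swap [] js f = sym (∑-zero js λ _ → refl)
    ∑-swap (i ∷ is) js f = trans (+-congˡ (∑-swap is js f)) (sym (∑-+ js _ _))

  ∏ : ∀ {I : Set} → List I → (I → Carrier) → Carrier
  ∏ [] f = 1#
  ∏ (i ∷ is) f = f i * ∏ is f

  ∏-cong : ∀ {I : Set} (is : List I) {f g} → (∀ i → f i ≈ g i) → ∏ is f ≈ ∏ is g
  ∏-cong [] e = refl
  ∏-cong (i ∷ is) e = *-cong (e i) (∏-cong is e)

-- Power series rings

module PowerSeries (A : Alg) where
  open Kit A

  Series : Set
  Series = ℕ → Carrier

  infix 4 _≋_
  _≋_ : Series → Series → Set
  f ≋ g = ∀ k → f k ≈ g k

  tail : Series → Series
  tail f k = f (suc k)

  infixl 7 _⊛_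
  -- The Cauchy product, unfolded one coefficient of the left factor at a time, so that no index is
  -- ever subtracted.
  _⊛_ : Series → Series → Series
  (f ⊛ g) zero = f 0 * g 0
  (f ⊛ g) (suc k) = f 0 * g (suc k) + (tail f ⊛ g) k

  const : Carrier → Series
  const a zero = a
  const a (suc k) = 0#

  ⊛-cong : ∀ {f f′ g g′} → f ≋ f′ → g ≋ g′ → f ⊛ g ≋ f′ ⊛ g′
  ⊛-cong e e′ zero = *-cong (e 0) (e′ 0)
  ⊛-cong e e′ (suc k) = +-cong (*-cong (e 0) (e′ _)) (⊛-cong (λ i → e (suc i)) e′ k)

  ⊛-zeroˡ : ∀ f g → (∀ k → f k ≈ 0#) → ∀ k → (f ⊛ g) k ≈ 0#
  ⊛-zeroˡ f g e zero = trans (*-congʳ (e 0)) (zeroˡ _)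
  ⊛-zeroˡ f g e (suc k) = trans (+-cong (trans (*-congʳ (e 0)) (zeroˡ _)) (⊛-zeroˡ (tail f) g (e ∘ suc) k)) (+-identityˡ _)

  const-⊛ : ∀ a g k → (const a ⊛ g) k ≈ a * g k
  const-⊛ a g zero = refl
  const-⊛ a g (suc k) = trans (+-congˡ (⊛-zeroˡ _ g (λ _ → refl) k)) (+-identityʳ _)

  ⊛-distribʳ : ∀ f g h k → ((λ i → g i + h i) ⊛ f) k ≈ (g ⊛ f) k + (h ⊛ f) k
  ⊛-distribʳ f g h zero = distribʳ _ _ _
  ⊛-distribʳ f g h (suc k) = trans (+-cong (distribʳ _ _ _) (⊛-distribʳ f (tail g) (tail h) k))
    (solve 4 (λ a b c d → (a :+ b) :+ (c :+ d) := (a :+ c) :+ (b :+ d)) refl _ _ _ _)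

  ⊛-scaleˡ : ∀ c f g k → ((λ i → c * f i) ⊛ g) k ≈ c * (f ⊛ g) k
  ⊛-scaleˡ c f g zero = *-assoc _ _ _
  ⊛-scaleˡ c f g (suc k) = trans (+-cong (*-assoc _ _ _) (⊛-scaleˡ c (tail f) g k)) (sym (distribˡ _ _ _))

  -- The mirror image of the defining recursion, peeling the right factor; the two recursions
  -- together give commutativity.
  ⊛-last : ∀ f g k → (f ⊛ g) (suc k) ≈ f (suc k) * g 0 + (f ⊛ tail g) k
  ⊛-last f g zero = +-comm _ _
  ⊛-last f g (suc k) = trans (+-congˡ (⊛-last (tail f) g k))
    (solve 3 (λ a b c → a :+ (b :+ c) := b :+ (a :+ c)) refl _ _ _)

  ⊛-comm : ∀ f g → f ⊛ g ≋ g ⊛ f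
  ⊛-comm f g zero = *-comm _ _
  ⊛-comm f g (suc k) = trans (⊛-last f g k) (+-cong (*-comm _ _) (⊛-comm f (tail g) k))

  ⊛-assoc : ∀ f g h → (f ⊛ g) ⊛ h ≋ f ⊛ (g ⊛ h)
  ⊛-assoc f g h zero = *-assoc _ _ _
  ⊛-assoc f g h (suc k) = begin
    f 0 * g 0 * h (suc k) + (tail (f ⊛ g) ⊛ h) k
      ≈⟨ +-congˡ (⊛-distribʳ h _ _ k) ⟩
    f 0 * g 0 * h (suc k) + (((λ i → f 0 * g (suc i)) ⊛ h) k + ((tail f ⊛ g) ⊛ h) k)
      ≈⟨ +-congˡ (+-cong (⊛-scaleˡ (f 0) (tail g) h k) (⊛-assoc (tail f) g h k)) ⟩
    f 0 * g 0 * h (suc k) + (f 0 * (tail g ⊛ h) k + (tail f ⊛ (g ⊛ h)) k)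
      ≈⟨ solve 5 (λ a b c d e → a :* b :* c :+ (a :* d :+ e) := a :* (b :* c :+ d) :+ e) refl _ _ _ _ _ ⟩
    f 0 * (g 0 * h (suc k) + (tail g ⊛ h) k) + (tail f ⊛ (g ⊛ h)) k ∎
    where open R≈

  ⊛-identityˡ : ∀ g → const 1# ⊛ g ≋ g
  ⊛-identityˡ g k = trans (const-⊛ 1# g k) (*-identityˡ _)

  seriesRing : CommutativeRing 0ℓ 0ℓ
  seriesRing = record
    { Carrier = Series
    ; _≈_ = _≋_
    ; _+_ = λ f g k → f k + g k
    ; _*_ = _⊛_
    ; -_ = λ f k → - f k
    ; 0# = λ _ → 0#
    ; 1# = const 1#
    ; isCommutativeRing = record
      { isRing = record
        { +-isAbelianGroup = record
          { isGroup = record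
            { isMonoid = record
              { isSemigroup = record
                { isMagma = record
                  { isEquivalence = record { refl = λ _ → refl ; sym = λ e k → sym (e k) ; trans = λ e e′ k → trans (e k) (e′ k) }
                  ; ∙-cong = λ e e′ k → +-cong (e k) (e′ k) }
                ; assoc = λ f g h k → +-assoc _ _ _ }
              ; identity = (λ f k → +-identityˡ _) , (λ f k → +-identityʳ _) }
            ; inverse = (λ f k → -‿inverseˡ _) , (λ f k → -‿inverseʳ _)
            ; ⁻¹-cong = λ e k → -‿cong (e k) }
          ; comm = λ f g k → +-comm _ _ }
        ; *-cong = ⊛-cong
        ; *-assoc = ⊛-assoc
        ; *-identity = ⊛-identityˡ , (λ g k → trans (⊛-comm g _ k) (⊛-identityˡ g k))
        ; distrib = (λ f g h k → trans (⊛-comm f _ k) (trans (⊛-distribʳ f g h k) (+-cong (⊛-comm g f k) (⊛-comm h f k))))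
                  , ⊛-distribʳ }
      ; *-comm = ⊛-comm }
    }

  const-+ : ∀ a b → const (a + b) ≋ (λ k → const a k + const b k)
  const-+ a b zero = refl
  const-+ a b (suc k) = sym (+-identityˡ _)

  const-neg : ∀ a → const (- a) ≋ (λ k → - const a k)
  const-neg a zero = refl
  const-neg a (suc k) = sym -0#≈0#

  const-* : ∀ a b → const (a * b) ≋ const a ⊛ const b
  const-* a b zero = refl
  const-* a b (suc k) = sym (trans (const-⊛ a (const b) (suc k)) (zeroʳ a))

  const-cong : ∀ {a b} → a ≈ b → const a ≋ const b
  const-cong e zero = e
  const-cong e (suc k) = refl

  series : Alg
  series = record
    { ring = seriesRing
    ; structure = record
      { ⟦_⟧ = const ∘ ι
      ; +-homo = λ a b k → trans (const-cong (+-homo a b) k) (const-+ _ _ k)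
      ; *-homo = λ a b k → trans (const-cong (*-homo a b) k) (const-* _ _ k)
      ; -‿homo = λ a k → trans (const-cong (-‿homo a) k) (const-neg _ k)
      ; 0-homo = λ { zero → 0-homo ; (suc k) → refl }
      ; 1-homo = const-cong 1-homo } }

  indeterminate : Series
  indeterminate zero = 0#
  indeterminate (suc k) = const 1# k

  shift : Series → Series
  shift f zero = 0#
  shift f (suc k) = f k

  indeterminate-⊛ : ∀ f → indeterminate ⊛ f ≋ shift f
  indeterminate-⊛ f zero = zeroˡ _
  indeterminate-⊛ f (suc k) = trans (+-cong (zeroˡ _) (⊛-identityˡ f k)) (+-identityˡ _)

-- Derivations, regular elements and ring homomorphisms

module _ (A : Alg) where
  open Kit A

  record Derivation : Set where
    field
      ∂ : Carrier → Carrier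
      ∂-cong : ∀ {x y} → x ≈ y → ∂ x ≈ ∂ y
      ∂-+ : ∀ x y → ∂ (x + y) ≈ ∂ x + ∂ y
      ∂-* : ∀ x y → ∂ (x * y) ≈ ∂ x * y + x * ∂ y
      ∂-ι : ∀ z → ∂ (ι z) ≈ 0#

  -- Quotients of alternants are never formed; identities are multiplied by a Vandermonde product
  -- and that factor is cancelled.
  Regular : Carrier → Set
  Regular x = ∀ g → x * g ≈ 0# → g ≈ 0#

  module _ where
    regular-cong : ∀ {x y} → x ≈ y → Regular x → Regular y
    regular-cong e r g p = r g (trans (*-congʳ e) p)

    regular-* : ∀ {x y} → Regular x → Regular y → Regular (x * y)
    regular-* r s g p = s g (r _ (trans (sym (*-assoc _ _ _)) p))

    regular-1 : Regular 1#
    regular-1 g p = trans (sym (*-identityˡ g)) p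

    regular-neg : ∀ {x} → Regular x → Regular (- x)
    regular-neg {x} r g p = r g (begin
      x * g ≈⟨ solve 2 (λ x g → x :* g := :- ((:- x) :* g)) refl x g ⟩
      - (- x * g) ≈⟨ -‿cong p ⟩
      - 0# ≈⟨ -0#≈0# ⟩
      0# ∎)
      where open R≈

    regular-cancel : ∀ {x} → Regular x → ∀ {g h} → x * g ≈ x * h → g ≈ h
    regular-cancel {x} r {g} {h} p = begin
      g ≈⟨ solve 2 (λ g h → g := (g :- h) :+ h) refl g h ⟩
      (g - h) + h ≈⟨ +-congʳ (r (g - h) (begin
        x * (g - h) ≈⟨ solve 3 (λ x g h → x :* (g :- h) := x :* g :- x :* h) refl x g h ⟩
        x * g - x * h ≈⟨ +-congʳ p ⟩
        x * h - x * h ≈⟨ -‿inverseʳ _ ⟩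
        0# ∎)) ⟩
      0# + h ≈⟨ +-identityˡ h ⟩
      h ∎
      where open R≈

module _ (A B : Alg) where
  private
    module A = Kit A
    module B = Kit B

  record Hom : Set where
    field
      ⟪_⟫ : A.Carrier → B.Carrier
      ⟪⟫-cong : ∀ {x y} → x A.≈ y → ⟪ x ⟫ B.≈ ⟪ y ⟫
      ⟪⟫-+ : ∀ x y → ⟪ x A.+ y ⟫ B.≈ ⟪ x ⟫ B.+ ⟪ y ⟫
      ⟪⟫-* : ∀ x y → ⟪ x A.* y ⟫ B.≈ ⟪ x ⟫ B.* ⟪ y ⟫
      ⟪⟫-ι : ∀ z → ⟪ A.ι z ⟫ B.≈ B.ι z

    ⟪⟫-0 : ⟪ A.0# ⟫ B.≈ B.0#
    ⟪⟫-0 = B.trans (⟪⟫-cong (A.sym A.0-homo)) (B.trans (⟪⟫-ι (+ 0)) B.0-homo)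

    ⟪⟫-1 : ⟪ A.1# ⟫ B.≈ B.1#
    ⟪⟫-1 = B.trans (⟪⟫-cong (A.sym A.1-homo)) (B.trans (⟪⟫-ι (+ 1)) B.1-homo)

    ⟪⟫-^ : ∀ x k → ⟪ x A.^ k ⟫ B.≈ ⟪ x ⟫ B.^ k
    ⟪⟫-^ x zero = ⟪⟫-1
    ⟪⟫-^ x (suc k) = B.trans (⟪⟫-* _ _) (B.*-congˡ (⟪⟫-^ x k))

    ⟪⟫-∑ : ∀ {I : Set} (is : List I) f → ⟪ A.∑ is f ⟫ B.≈ B.∑ is (λ i → ⟪ f i ⟫)
    ⟪⟫-∑ [] f = ⟪⟫-0
    ⟪⟫-∑ (i ∷ is) f = B.trans (⟪⟫-+ _ _) (B.+-congˡ (⟪⟫-∑ is f))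

    ⟪⟫-∏ : ∀ {I : Set} (is : List I) f → ⟪ A.∏ is f ⟫ B.≈ B.∏ is (λ i → ⟪ f i ⟫)
    ⟪⟫-∏ [] f = ⟪⟫-1
    ⟪⟫-∏ (i ∷ is) f = B.trans (⟪⟫-* _ _) (B.*-congˡ (⟪⟫-∏ is f))

open Derivation public
open Hom public

idHom : ∀ A → Hom A A
idHom A = record { ⟪_⟫ = id ; ⟪⟫-cong = id ; ⟪⟫-+ = λ _ _ → refl ; ⟪⟫-* = λ _ _ → refl ; ⟪⟫-ι = λ _ → refl }
  where open Kit A

-- Derivations, homomorphisms and regular elements of power series rings

module SeriesMaps (A : Alg) where
  open Kit A
  open PowerSeries A
  module S = Kit series

  euler : Derivation series
  euler = record
    { ∂ = E
    ; ∂-cong = λ e k → *-congˡ (e k)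
    ; ∂-+ = λ x y k → distribˡ _ _ _
    ; ∂-* = leibniz
    ; ∂-ι = λ { z zero → trans (*-congʳ 0-homo) (zeroˡ _) ; z (suc k) → zeroʳ _ } }
    where
    E : Series → Series
    E f k = ι (+ k) * f k
    leibniz : ∀ f g k → E (f ⊛ g) k ≈ (E f ⊛ g) k + (f ⊛ E g) k
    leibniz f g zero = solve 2 (λ a b → con (+ 0) :* (a :* b) := con (+ 0) :* a :* b :+ a :* (con (+ 0) :* b)) refl (f 0) (g 0)
    leibniz f g (suc k) = begin
      ι (+ suc k) * (f 0 * g (suc k) + (tail f ⊛ g) k)
        ≈⟨ *-congʳ (+-homo (+ 1) (+ k)) ⟩
      (ι (+ 1) + ι (+ k)) * (f 0 * g (suc k) + (tail f ⊛ g) k)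
        ≈⟨ solve 5 (λ o n a b c → (o :+ n) :* (a :* b :+ c) := a :* ((o :+ n) :* b) :+ (o :* c :+ n :* c)) refl (ι (+ 1)) (ι (+ k)) (f 0) (g (suc k)) ((tail f ⊛ g) k) ⟩
      f 0 * ((ι (+ 1) + ι (+ k)) * g (suc k)) + (ι (+ 1) * (tail f ⊛ g) k + ι (+ k) * (tail f ⊛ g) k)
        ≈⟨ +-cong (*-congˡ (*-congʳ (sym (+-homo (+ 1) (+ k))))) (+-congˡ (leibniz (tail f) g k)) ⟩
      f 0 * (ι (+ suc k) * g (suc k)) + (ι (+ 1) * (tail f ⊛ g) k + ((E (tail f) ⊛ g) k + (tail f ⊛ E g) k))
        ≈⟨ solve 6 (λ a b c d e z → z :+ (con (+ 1) :* c :+ (d :+ e)) := (con (+ 0) :* a :* b :+ (con (+ 1) :* c :+ d)) :+ (z :+ e)) refl (f 0) (g (suc k)) ((tail f ⊛ g) k) ((E (tail f) ⊛ g) k) ((tail f ⊛ E g) k) (f 0 * (ι (+ suc k) * g (suc k))) ⟩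
      (ι (+ 0) * f 0 * g (suc k) + (ι (+ 1) * (tail f ⊛ g) k + (E (tail f) ⊛ g) k)) + (f 0 * (ι (+ suc k) * g (suc k)) + (tail f ⊛ E g) k)
        ≈⟨ +-congʳ (+-congˡ (trans (+-congʳ (sym (⊛-scaleˡ _ (tail f) g k))) (trans (sym (⊛-distribʳ g _ _ k))
             (⊛-cong (λ i → trans (sym (distribʳ _ _ _)) (*-congʳ (sym (+-homo (+ 1) (+ i))))) (λ _ → refl) k)))) ⟩
      (E f ⊛ g) (suc k) + (f ⊛ E g) (suc k) ∎
      where open R≈

  mapDerivation : Derivation A → Derivation series
  mapDerivation d = record
    { ∂ = λ f k → ∂ d (f k)
    ; ∂-cong = λ e k → ∂-cong d (e k)
    ; ∂-+ = λ x y k → ∂-+ d _ _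
    ; ∂-* = leibniz
    ; ∂-ι = λ { z zero → ∂-ι d z ; z (suc k) → trans (∂-cong d (sym 0-homo)) (∂-ι d (+ 0)) } }
    where
    leibniz : ∀ f g k → ∂ d ((f ⊛ g) k) ≈ ((λ k → ∂ d (f k)) ⊛ g) k + (f ⊛ (λ k → ∂ d (g k))) k
    leibniz f g zero = ∂-* d _ _
    leibniz f g (suc k) = trans (∂-+ d _ _) (trans (+-cong (∂-* d _ _) (leibniz (tail f) g k))
      (solve 4 (λ a b c e → (a :+ b) :+ (c :+ e) := (a :+ c) :+ (b :+ e)) refl _ _ _ _))

  constHom : Hom A series
  constHom = record
    { ⟪_⟫ = const ; ⟪⟫-cong = const-cong ; ⟪⟫-+ = const-+ ; ⟪⟫-* = const-* ; ⟪⟫-ι = λ _ _ → refl }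

  mapHom : Hom A A → Hom series series
  mapHom h = record
    { ⟪_⟫ = λ f k → ⟪ h ⟫ (f k)
    ; ⟪⟫-cong = λ e k → ⟪⟫-cong h (e k)
    ; ⟪⟫-+ = λ x y k → ⟪⟫-+ h _ _
    ; ⟪⟫-* = mult
    ; ⟪⟫-ι = λ { z zero → ⟪⟫-ι h z ; z (suc k) → trans (⟪⟫-cong h (sym 0-homo)) (trans (⟪⟫-ι h (+ 0)) 0-homo) } }
    where
    mult : ∀ f g k → ⟪ h ⟫ ((f ⊛ g) k) ≈ ((λ k → ⟪ h ⟫ (f k)) ⊛ (λ k → ⟪ h ⟫ (g k))) k
    mult f g zero = ⟪⟫-* h _ _
    mult f g (suc k) = trans (⟪⟫-+ h _ _) (+-cong (⟪⟫-* h _ _) (mult (tail f) g k))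

  regular-const : ∀ {a} → Regular A a → Regular series (const a)
  regular-const r g p k = r _ (trans (sym (const-⊛ _ g k)) (p k))

  regular-indeterminate : Regular series indeterminate
  regular-indeterminate g p k = trans (sym (indeterminate-⊛ g (suc k))) (p (suc k))

  -- With t the indeterminate, comparing coefficients in (t - a) g = 0 gives a g₀ = 0 and a g_(k+1)
  -- = g_k, so the coefficients of g vanish one after another.
  regular-indeterminate-const : ∀ {a} → Regular A a → Regular series (indeterminate S.- const a)
  regular-indeterminate-const {a} r g p = vanish
    where
    coefficient : ∀ k → shift g k - a * g k ≈ 0#
    coefficient k = trans (+-cong (sym (indeterminate-⊛ g k)) (-‿cong (sym (const-⊛ a g k))))
      (trans (sym (S.trans (S.distribʳ g indeterminate (S.- const a))
        (S.+-congˡ {indeterminate ⊛ g} (S.sym (S.-‿distribˡ-* (const a) g))) k)) (p k))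
    vanish : ∀ k → g k ≈ 0#
    vanish zero = r _ (trans (solve 1 (λ x → x := :- (con (+ 0) :- x)) refl _)
      (trans (-‿cong (trans (+-congʳ 0-homo) (coefficient 0))) -0#≈0#))
    vanish (suc k) = r _ (begin
      a * g (suc k) ≈⟨ solve 2 (λ x y → y := x :- (x :- y)) refl (g k) _ ⟩
      g k - (g k - a * g (suc k)) ≈⟨ +-cong (vanish k) (-‿cong (coefficient (suc k))) ⟩
      0# - 0# ≈⟨ -‿inverseʳ _ ⟩
      0# ∎)
      where open R≈

module SeriesSwap (A : Alg) where
  open Kit A
  open PowerSeries A
  module S₁ = PowerSeries series
  module K₁ = Kit series
  module K₂ = Kit (PowerSeries.series series)

  transpose : K₂.Carrier → K₂.Carrier
  transpose f a b = f b a

  -- A recursion in the inner index, splitting off column 0 of `f` instead of row 0. It is the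
  -- defining recursion of the product of the transposes, so that `transpose-⊛` follows by
  -- induction.
  ⊛-column : ∀ f g q p → (f S₁.⊛ g) q (suc p) ≈
    (transpose f 0 ⊛ transpose g (suc p)) q + ((λ i → tail (f i)) S₁.⊛ g) q p
  ⊛-column f g zero p = refl
  ⊛-column f g (suc q) p = trans (+-congˡ (⊛-column (S₁.tail f) g q p))
    (solve 4 (λ a b c d → (a :+ b) :+ (c :+ d) := (a :+ c) :+ (b :+ d)) refl _ _ _ _)

  transpose-⊛ : ∀ f g p q → (f S₁.⊛ g) q p ≈ (transpose f S₁.⊛ transpose g) p q
  transpose-⊛ f g zero zero = refl
  transpose-⊛ f g zero (suc q) = +-congˡ (transpose-⊛ (S₁.tail f) g zero q)
  transpose-⊛ f g (suc p) q = trans (⊛-column f g q p) (+-congˡ (transpose-⊛ (λ i → tail (f i)) g p q))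

  transposeHom : Hom S₁.series S₁.series
  transposeHom = record
    { ⟪_⟫ = transpose
    ; ⟪⟫-cong = λ e a b → e b a
    ; ⟪⟫-+ = λ x y a b → refl
    ; ⟪⟫-* = λ x y a b → transpose-⊛ x y a b
    ; ⟪⟫-ι = λ { z zero zero → refl ; z zero (suc b) → refl ; z (suc a) zero → refl ; z (suc a) (suc b) → refl } }

-- Iterated power series over the integers

𝕊 : ℕ → Alg
𝕊 zero = ℤAlg
𝕊 (suc n) = PowerSeries.series (𝕊 n)

module 𝕂 (n : ℕ) = Kit (𝕊 n)

ℂ : ℕ → Set
ℂ n = 𝕂.Carrier n

gen : ∀ n → Fin n → ℂ n
gen (suc n) F.zero = PowerSeries.indeterminate (𝕊 n)
gen (suc n) (F.suc i) = PowerSeries.const (𝕊 n) (gen n i)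

at : ∀ n → ℂ n → Vec ℕ n → ℤ
at zero f [] = f
at (suc n) f (k ∷ α) = at n (f k) α

-- The Euler operator of one variable: the coefficient at an exponent vector α is multiplied by the
-- i-th entry of α.
θ : ∀ n → Fin n → Derivation (𝕊 n)
θ (suc n) F.zero = SeriesMaps.euler (𝕊 n)
θ (suc n) (F.suc i) = SeriesMaps.mapDerivation (𝕊 n) (θ n i)

module _ where
  open PowerSeries
  θ-0 : ∀ A (d : Derivation A) → Kit._≈_ A (∂ d (Kit.0# A)) (Kit.0# A)
  θ-0 A d = trans (∂-cong d (sym 0-homo)) (∂-ι d (+ 0))
    where open Kit A

  ∂-∑ : ∀ A (d : Derivation A) {I : Set} (is : List I) f → Kit._≈_ A (∂ d (Kit.∑ A is f)) (Kit.∑ A is (λ i → ∂ d (f i)))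
  ∂-∑ A d [] f = θ-0 A d
  ∂-∑ A d (i ∷ is) f = trans (∂-+ d _ _) (+-congˡ (∂-∑ A d is f))
    where open Kit A

  θ-gen-same : ∀ n i → 𝕂._≈_ n (∂ (θ n i) (gen n i)) (gen n i)
  θ-gen-same (suc n) F.zero zero = zeroʳ _ where open 𝕂 n
  θ-gen-same (suc n) F.zero (suc zero) = trans (*-congʳ 1-homo) (*-identityˡ _) where open 𝕂 n
  θ-gen-same (suc n) F.zero (suc (suc k)) = zeroʳ _ where open 𝕂 n
  θ-gen-same (suc n) (F.suc i) zero = θ-gen-same n i
  θ-gen-same (suc n) (F.suc i) (suc k) = θ-0 (𝕊 n) (θ n i)

  θ-gen-diff : ∀ n i j → i ≢ j → 𝕂._≈_ n (∂ (θ n i) (gen n j)) (𝕂.0# n)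
  θ-gen-diff (suc n) F.zero F.zero ne = ⊥-elim (ne ≡.refl)
  θ-gen-diff (suc n) F.zero (F.suc j) ne zero = trans (*-congʳ 0-homo) (zeroˡ _) where open 𝕂 n
  θ-gen-diff (suc n) F.zero (F.suc j) ne (suc k) = zeroʳ _ where open 𝕂 n
  θ-gen-diff (suc n) (F.suc i) F.zero ne zero = θ-0 (𝕊 n) (θ n i)
  θ-gen-diff (suc n) (F.suc i) F.zero ne (suc zero) = trans (∂-cong (θ n i) (sym 1-homo)) (∂-ι (θ n i) (+ 1)) where open 𝕂 n
  θ-gen-diff (suc n) (F.suc i) F.zero ne (suc (suc k)) = θ-0 (𝕊 n) (θ n i)
  θ-gen-diff (suc n) (F.suc i) (F.suc j) ne zero = θ-gen-diff n i j (ne ∘ ≡.cong F.suc)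
  θ-gen-diff (suc n) (F.suc i) (F.suc j) ne (suc k) = θ-0 (𝕊 n) (θ n i)

regular-gen : ∀ n i → Regular (𝕊 n) (gen n i)
regular-gen (suc n) F.zero = SeriesMaps.regular-indeterminate (𝕊 n)
regular-gen (suc n) (F.suc i) = SeriesMaps.regular-const (𝕊 n) (regular-gen n i)

at-cong : ∀ n {f g} → 𝕂._≈_ n f g → ∀ α → at n f α ≡ at n g α
at-cong zero e [] = e
at-cong (suc n) e (k ∷ α) = at-cong n (e k) α

at-ext : ∀ n {f g} → (∀ α → at n f α ≡ at n g α) → 𝕂._≈_ n f g
at-ext zero e = e []
at-ext (suc n) e k = at-ext n (λ α → e (k ∷ α))

at-+ : ∀ n f g α → at n (𝕂._+_ n f g) α ≡ at n f α ℤ.+ at n g α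
at-+ zero f g [] = ≡.refl
at-+ (suc n) f g (k ∷ α) = at-+ n (f k) (g k) α

at-0 : ∀ n α → at n (𝕂.0# n) α ≡ + 0
at-0 zero [] = ≡.refl
at-0 (suc n) (k ∷ α) = at-0 n α

at-ι* : ∀ n z f α → at n (𝕂._*_ n (𝕂.ι n z) f) α ≡ z ℤ.* at n f α
at-ι* zero z f [] = ≡.refl
at-ι* (suc n) z f (k ∷ α) = ≡.trans (at-cong n (PowerSeries.const-⊛ (𝕊 n) (𝕂.ι n z) f k) α) (at-ι* n z (f k) α)

at-∑ : ∀ n {I : Set} (is : List I) f α → at n (𝕂.∑ n is f) α ≡ Kit.∑ ℤAlg is (λ i → at n (f i) α)
at-∑ n [] f α = at-0 n α
at-∑ n (i ∷ is) f α = ≡.trans (at-+ n (f i) _ α) (≡.cong (λ z → at n (f i) α ℤ.+ z) (at-∑ n is f α))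

-- Coefficientwise nonnegativity

Nonneg : ∀ n → ℂ n → Set
Nonneg zero z = + 0 ℤ.≤ z
Nonneg (suc n) f = ∀ k → Nonneg n (f k)

nonneg-at : ∀ n f → Nonneg n f → ∀ α → + 0 ℤ.≤ at n f α
nonneg-at zero f p [] = p
nonneg-at (suc n) f p (k ∷ α) = nonneg-at n (f k) (p k) α

nonneg-0 : ∀ n → Nonneg n (𝕂.0# n)
nonneg-0 zero = ℤP.≤-refl
nonneg-0 (suc n) k = nonneg-0 n

nonneg-+ : ∀ n f g → Nonneg n f → Nonneg n g → Nonneg n (𝕂._+_ n f g)
nonneg-+ zero f g p q = ℤP.+-mono-≤ p q
nonneg-+ (suc n) f g p q k = nonneg-+ n (f k) (g k) (p k) (q k)

nonneg-* : ∀ n f g → Nonneg n f → Nonneg n g → Nonneg n (𝕂._*_ n f g)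
nonneg-* zero (+ a) (+ b) p q = ≡.subst (+ 0 ℤ.≤_) (ℤP.pos-* a b) (ℤ.+≤+ z≤n)
nonneg-* (suc n) f g p q zero = nonneg-* n (f 0) (g 0) (p 0) (q 0)
nonneg-* (suc n) f g p q (suc k) = nonneg-+ n (𝕂._*_ n (f 0) (g (suc k))) _ (nonneg-* n (f 0) (g (suc k)) (p 0) (q (suc k)))
  (nonneg-* (suc n) (f ∘ suc) g (p ∘ suc) q k)

nonneg-const : ∀ n a → Nonneg n a → Nonneg (suc n) (PowerSeries.const (𝕊 n) a)
nonneg-const n a p zero = p
nonneg-const n a p (suc k) = nonneg-0 n

nonneg-ι : ∀ n z → + 0 ℤ.≤ z → Nonneg n (𝕂.ι n z)
nonneg-ι zero z p = p
nonneg-ι (suc n) z p = nonneg-const n _ (nonneg-ι n z p)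

nonneg-1 : ∀ n → Nonneg n (𝕂.1# n)
nonneg-1 zero = ℤ.+≤+ z≤n
nonneg-1 (suc n) = nonneg-const n _ (nonneg-1 n)

nonneg-gen : ∀ n i → Nonneg n (gen n i)
nonneg-gen (suc n) F.zero zero = nonneg-0 n
nonneg-gen (suc n) F.zero (suc k) = nonneg-const n _ (nonneg-1 n) k
nonneg-gen (suc n) (F.suc i) = nonneg-const n _ (nonneg-gen n i)

nonneg-∑ : ∀ n {I : Set} (is : List I) f → (∀ i → Nonneg n (f i)) → Nonneg n (𝕂.∑ n is f)
nonneg-∑ n [] f p = nonneg-0 n
nonneg-∑ n (i ∷ is) f p = nonneg-+ n (f i) _ (p i) (nonneg-∑ n is f p)

-- Alternants and Schur polynomials


Decreasing : ∀ {n} → Vec ℕ n → Set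
Decreasing [] = ⊤
Decreasing (m ∷ []) = ⊤
Decreasing (m ∷ m′ ∷ μ) = m′ ≤ m × Decreasing (m′ ∷ μ)

decreasing-zero : ∀ n → Decreasing (V.replicate n 0)
decreasing-zero zero = tt
decreasing-zero (suc zero) = tt
decreasing-zero (suc (suc n)) = z≤n , decreasing-zero (suc n)

-- The skew shape μ / ν is a horizontal strip, which is the summation condition of the branching
-- rule.
Interlaced : ∀ {n} → Vec ℕ (suc n) → Vec ℕ n → Set
Interlaced (m ∷ []) [] = ⊤
Interlaced (m ∷ m′ ∷ μ) (v ∷ ν) = m′ ≤ v × v ≤ m × Interlaced (m′ ∷ μ) ν

interlaced-decreasing : ∀ {n} (μ : Vec ℕ (suc n)) ν → Interlaced μ ν → Decreasing ν
interlaced-decreasing (m ∷ []) [] _ = tt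
interlaced-decreasing (m ∷ m′ ∷ []) (v ∷ []) _ = tt
interlaced-decreasing (m ∷ m′ ∷ m″ ∷ μ) (v ∷ v′ ∷ ν) (p , _ , r@(_ , q , _)) =
  ℕP.≤-trans q p , interlaced-decreasing (m′ ∷ m″ ∷ μ) (v′ ∷ ν) r

smallest : ∀ {n} → Vec ℕ (suc n) → ℕ
smallest (m ∷ []) = m
smallest (m ∷ m′ ∷ μ) = smallest (m′ ∷ μ)

-- μ ↦ μ + (n-1, …, 1, 0)
staircase : ∀ {n} → Vec ℕ n → Vec ℕ n
staircase [] = []
staircase {suc n} (m ∷ μ) = (n ℕ.+ m) ∷ staircase μ

infix 4 _~_
-- Permutations are generated from adjacent exchanges because each generator has an evident sign on
-- alternants.
data _~_ {X : Set} : ∀ {n} → Vec X n → Vec X n → Set where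
  ~-refl : ∀ {n} {xs : Vec X n} → xs ~ xs
  ~-swap : ∀ {n} a b (xs : Vec X n) → (a ∷ b ∷ xs) ~ (b ∷ a ∷ xs)
  ~-prep : ∀ {n} a {xs ys : Vec X n} → xs ~ ys → (a ∷ xs) ~ (a ∷ ys)
  ~-trans : ∀ {n} {xs ys zs : Vec X n} → xs ~ ys → ys ~ zs → xs ~ zs

∷ʳ-~ : ∀ {X : Set} {n} (xs : Vec X n) y → (xs V.∷ʳ y) ~ (y ∷ xs)
∷ʳ-~ [] y = ~-refl
∷ʳ-~ (x ∷ xs) y = ~-trans (~-prep x (∷ʳ-~ xs y)) (~-swap x y xs)

module Wedge (A : Alg) where
  open Kit A

  -- Exterior multiplication by the covector g, on functions of tuples.
  δ : ∀ {X : Set} {n} → (X → Carrier) → (Vec X n → Carrier) → Vec X (suc n) → Carrier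
  δ {n = zero} g φ (a ∷ l) = g a * φ l
  δ {n = suc n} g φ (a ∷ l) = g a * φ l - δ g (φ ∘ (a ∷_)) l

  -- Conditions on neighbouring arguments at every depth. Vanishing on repetitions is a separate
  -- clause, since 2 may be a zero divisor in the ring.
  Alternating : ∀ {X : Set} {n} → (Vec X n → Carrier) → Set
  Alternating {n = zero} φ = ⊤
  Alternating {n = suc zero} φ = ⊤
  Alternating {n = suc (suc n)} φ =
    (∀ a b l → φ (a ∷ b ∷ l) ≈ - φ (b ∷ a ∷ l)) × (∀ a l → φ (a ∷ a ∷ l) ≈ 0#) × (∀ a → Alternating (φ ∘ (a ∷_)))

  module _ {X : Set} where
    δ-cong : ∀ {n} {g h : X → Carrier} {φ ψ : Vec X n → Carrier} → (∀ a → g a ≈ h a) → (∀ l → φ l ≈ ψ l) → ∀ l → δ g φ l ≈ δ h ψ l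
    δ-cong {zero} d e (a ∷ l) = *-cong (d a) (e l)
    δ-cong {suc n} d e (a ∷ l) = +-cong (*-cong (d a) (e l)) (-‿cong (δ-cong d (e ∘ (a ∷_)) l))

    δ-linear : ∀ {n} (g : X → Carrier) c (φ ψ : Vec X n → Carrier) l →
      δ g (λ m → c * φ m - ψ m) l ≈ c * δ g φ l - δ g ψ l
    δ-linear {zero} g c φ ψ (a ∷ l) =
      solve 4 (λ g c x y → g :* (c :* x :- y) := c :* (g :* x) :- (g :* y)) refl (g a) c (φ l) (ψ l)
    δ-linear {suc n} g c φ ψ (a ∷ l) = trans (+-congˡ (-‿cong (δ-linear g c _ _ l)))
      (solve 6 (λ g c x y u v → g :* (c :* x :- y) :- (c :* u :- v) := c :* (g :* x :- u) :- (g :* y :- v))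
        refl (g a) c (φ l) (ψ l) _ _)

    δ-zero : ∀ {n} (g : X → Carrier) {φ : Vec X n → Carrier} → (∀ l → φ l ≈ 0#) → ∀ l → δ g φ l ≈ 0#
    δ-zero {zero} g e (a ∷ l) = trans (*-congˡ (e l)) (zeroʳ _)
    δ-zero {suc n} g e (a ∷ l) = trans (+-cong (trans (*-congˡ (e l)) (zeroʳ _)) (-‿cong (δ-zero g (e ∘ (a ∷_)) l))) (-‿inverseʳ _)

    δ-scaleˡ : ∀ {n} c (g : X → Carrier) (φ : Vec X n → Carrier) l → δ (λ a → c * g a) φ l ≈ c * δ g φ l
    δ-scaleˡ {zero} c g φ (a ∷ l) = *-assoc _ _ _
    δ-scaleˡ {suc n} c g φ (a ∷ l) = trans (+-cong (*-assoc _ _ _) (-‿cong (δ-scaleˡ c g _ l)))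
      (solve 3 (λ c x y → c :* x :- c :* y := c :* (x :- y)) refl c _ _)

    δ-neg : ∀ {n} g (φ : Vec X n → Carrier) l → δ g (λ m → - φ m) l ≈ - δ g φ l
    δ-neg g φ l = trans (δ-cong (λ _ → refl) (λ m → solve 1 (λ x → :- x := con (+ 0) :* x :- x) refl (φ m)) l)
      (trans (δ-linear g _ φ φ l) (solve 1 (λ x → con (+ 0) :* x :- x := :- x) refl _))

    δ-anticomm : ∀ {n} g h (φ : Vec X n → Carrier) l → δ g (δ h φ) l ≈ - δ h (δ g φ) l
    δ-anticomm {zero} g h φ (a ∷ b ∷ []) =
      solve 5 (λ ga gb ha hb x → ga :* (hb :* x) :- gb :* (ha :* x) := :- (ha :* (gb :* x) :- hb :* (ga :* x)))
        refl (g a) (g b) (h a) (h b) (φ [])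
    δ-anticomm {suc n} g h φ (a ∷ l) = begin
      g a * δ h φ l - δ g (λ m → h a * φ m - δ h (φ ∘ (a ∷_)) m) l
        ≈⟨ +-congˡ (-‿cong (δ-linear g (h a) φ _ l)) ⟩
      g a * δ h φ l - (h a * δ g φ l - δ g (δ h (φ ∘ (a ∷_))) l)
        ≈⟨ +-congˡ (-‿cong (+-congˡ (-‿cong (δ-anticomm g h (φ ∘ (a ∷_)) l)))) ⟩
      g a * δ h φ l - (h a * δ g φ l - - δ h (δ g (φ ∘ (a ∷_))) l)
        ≈⟨ solve 3 (λ x y z → x :- (y :- (:- z)) := :- (y :- (x :- z))) refl _ _ _ ⟩
      - (h a * δ g φ l - (g a * δ h φ l - δ h (δ g (φ ∘ (a ∷_))) l))
        ≈⟨ -‿cong (+-congˡ (-‿cong (sym (δ-linear h (g a) φ _ l)))) ⟩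
      - δ h (δ g φ) (a ∷ l) ∎
      where open R≈

    δ-square : ∀ {n} g (φ : Vec X n → Carrier) l → δ g (δ g φ) l ≈ 0#
    δ-square {zero} g φ (a ∷ b ∷ []) =
      trans (solve 3 (λ ga gb x → ga :* (gb :* x) :- gb :* (ga :* x) := con (+ 0)) refl (g a) (g b) (φ [])) 0-homo
    δ-square {suc n} g φ (a ∷ l) = begin
      g a * δ g φ l - δ g (λ m → g a * φ m - δ g (φ ∘ (a ∷_)) m) l
        ≈⟨ +-congˡ (-‿cong (δ-linear g (g a) φ _ l)) ⟩
      g a * δ g φ l - (g a * δ g φ l - δ g (δ g (φ ∘ (a ∷_))) l)
        ≈⟨ solve 2 (λ x y → x :- (x :- y) := y) refl _ _ ⟩
      δ g (δ g (φ ∘ (a ∷_))) l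
        ≈⟨ δ-square g (φ ∘ (a ∷_)) l ⟩
      0# ∎
      where open R≈

    δ-alternating : ∀ {n} g (φ : Vec X n → Carrier) → Alternating φ → Alternating (δ g φ)
    δ-alternating {zero} g φ alt = tt
    δ-alternating {suc zero} g φ alt =
        (λ { a b [] → solve 2 (λ x y → x :- y := :- (y :- x)) refl _ _ })
      , (λ { a [] → -‿inverseʳ _ })
      , (λ a → tt)
    δ-alternating {suc (suc n)} g φ (sw , eq , alt) =
        (λ a b l → trans (+-congˡ (-‿cong (+-congˡ (-‿cong (trans (δ-cong (λ _ → refl) (sw a b) l) (δ-neg g _ l))))))
          (solve 3 (λ x y z → x :- (y :- (:- z)) := :- (y :- (x :- z))) refl _ _ _))
      , (λ a l → trans (+-congˡ (-‿cong (+-congˡ (-‿cong (δ-zero g (eq a) l)))))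
          (trans (solve 2 (λ x z → x :- (x :- z) := z) refl _ _) refl))
      , (λ a → alternating-sub (g a) φ (δ g (φ ∘ (a ∷_))) (sw , eq , alt) (δ-alternating g (φ ∘ (a ∷_)) (alt a)))
      where
      alternating-sub : ∀ {n} c (φ ψ : Vec X n → Carrier) → Alternating φ → Alternating ψ → Alternating (λ l → c * φ l - ψ l)
      alternating-sub {zero} c φ ψ _ _ = tt
      alternating-sub {suc zero} c φ ψ _ _ = tt
      alternating-sub {suc (suc n)} c φ ψ (s , e , r) (s′ , e′ , r′) =
          (λ a b l → trans (+-cong (*-congˡ (s a b l)) (-‿cong (s′ a b l)))
            (solve 3 (λ c x y → c :* (:- x) :- (:- y) := :- (c :* x :- y)) refl c _ _))
        , (λ a l → trans (+-cong (trans (*-congˡ (e a l)) (zeroʳ c)) (-‿cong (e′ a l))) (-‿inverseʳ _))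
        , (λ a → alternating-sub c (φ ∘ (a ∷_)) (ψ ∘ (a ∷_)) (r a) (r′ a))

    alternating-swap : ∀ {n} (φ : Vec X (suc n) → Carrier) → Alternating φ → ∀ a → Alternating (φ ∘ (a ∷_))
    alternating-swap {zero} φ _ a = tt
    alternating-swap {suc n} φ (_ , _ , alt) a = alt a

module Alternants (A : Alg) where
  open Kit A
  open Wedge A

  -- The alternant det(x_i ^ l_j), built as an iterated exterior product of the covectors `x_i ^_`.
  Alt : ∀ {n} → Vec Carrier n → Vec ℕ n → Carrier
  Alt [] l = 1#
  Alt (y ∷ xs) l = δ (y ^_) (Alt xs) l

  Alt-alternating : ∀ {n} (xs : Vec Carrier n) → Alternating (Alt xs)
  Alt-alternating [] = tt
  Alt-alternating (y ∷ xs) = δ-alternating (y ^_) (Alt xs) (Alt-alternating xs)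

  differences : ∀ {n} → Carrier → Vec Carrier n → Carrier
  differences y [] = 1#
  differences y (x ∷ xs) = (y - x) * differences y xs

  Δ : ∀ {n} → Vec Carrier n → Carrier
  Δ [] = 1#
  Δ (y ∷ xs) = differences y xs * Δ xs

  -- The operator ∏ (y - T_j) over all positions j, where T_j raises the j-th exponent by one.
  spread : ∀ {n} → Carrier → (Vec ℕ n → Carrier) → Vec ℕ n → Carrier
  spread y φ [] = φ []
  spread y φ (a ∷ l) = y * spread y (φ ∘ (a ∷_)) l - spread y (φ ∘ (suc a ∷_)) l

  spread-linear : ∀ {n} y c (φ ψ : Vec ℕ n → Carrier) l → spread y (λ m → c * φ m - ψ m) l ≈ c * spread y φ l - spread y ψ l
  spread-linear y c φ ψ [] = refl
  spread-linear y c φ ψ (a ∷ l) = trans (+-cong (*-congˡ (spread-linear y c _ _ l)) (-‿cong (spread-linear y c _ _ l)))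
    (solve 6 (λ y c p q r s → y :* (c :* p :- q) :- (c :* r :- s) := c :* (y :* p :- r) :- (y :* q :- s)) refl y c _ _ _ _)

  spread-δ : ∀ {n} y x (φ : Vec ℕ n → Carrier) l → spread y (δ (x ^_) φ) l ≈ (y - x) * δ (x ^_) (spread y φ) l
  spread-δ {zero} y x φ (a ∷ []) =
    solve 4 (λ y x p f → y :* (p :* f) :- (x :* p) :* f := (y :- x) :* (p :* f)) refl y x (x ^ a) (φ [])
  spread-δ {suc n} y x φ (a ∷ l) = begin
    y * spread y (λ m → x ^ a * φ m - δ (x ^_) (φ ∘ (a ∷_)) m) l
      - spread y (λ m → x ^ suc a * φ m - δ (x ^_) (φ ∘ (suc a ∷_)) m) l
      ≈⟨ +-cong (*-congˡ (spread-linear y _ φ _ l)) (-‿cong (spread-linear y _ φ _ l)) ⟩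
    y * (x ^ a * spread y φ l - spread y (δ (x ^_) (φ ∘ (a ∷_))) l)
      - (x ^ suc a * spread y φ l - spread y (δ (x ^_) (φ ∘ (suc a ∷_))) l)
      ≈⟨ +-cong (*-congˡ (+-congˡ (-‿cong (spread-δ y x _ l)))) (-‿cong (+-congˡ (-‿cong (spread-δ y x _ l)))) ⟩
    y * (x ^ a * spread y φ l - (y - x) * δ (x ^_) (spread y (φ ∘ (a ∷_))) l)
      - (x ^ suc a * spread y φ l - (y - x) * δ (x ^_) (spread y (φ ∘ (suc a ∷_))) l)
      ≈⟨ solve 6 (λ y x p f u v → y :* (p :* f :- (y :- x) :* u) :- ((x :* p) :* f :- (y :- x) :* v)
                     := (y :- x) :* (p :* f :- (y :* u :- v))) refl y x (x ^ a) _ _ _ ⟩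
    (y - x) * (x ^ a * spread y φ l - (y * δ (x ^_) (spread y (φ ∘ (a ∷_))) l - δ (x ^_) (spread y (φ ∘ (suc a ∷_))) l))
      ≈⟨ *-congˡ (+-congˡ (-‿cong (sym (δ-linear (x ^_) y _ _ l)))) ⟩
    (y - x) * δ (x ^_) (spread y φ) (a ∷ l) ∎
    where open R≈

  -- On a term of the alternant T_j is multiplication by the variable that sits in column j. Every
  -- variable occupies exactly one column, so ∏ (y - T_j) acts as ∏ (y - x_i).
  differences-Alt : ∀ {n} y (xs : Vec Carrier n) l → differences y xs * Alt xs l ≈ spread y (Alt xs) l
  differences-Alt y [] [] = *-identityˡ _
  differences-Alt y (x ∷ xs) l = begin
    (y - x) * differences y xs * δ (x ^_) (Alt xs) l
      ≈⟨ *-assoc _ _ _ ⟩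
    (y - x) * (differences y xs * δ (x ^_) (Alt xs) l)
      ≈⟨ *-congˡ (sym (δ-* (x ^_) _ (Alt xs) l)) ⟩
    (y - x) * δ (x ^_) (λ m → differences y xs * Alt xs m) l
      ≈⟨ *-congˡ (δ-cong (λ _ → refl) (differences-Alt y xs) l) ⟩
    (y - x) * δ (x ^_) (spread y (Alt xs)) l
      ≈⟨ sym (spread-δ y x (Alt xs) l) ⟩
    spread y (Alt (x ∷ xs)) l ∎
    where
    open R≈
    δ-* : ∀ {n} g c (φ : Vec ℕ n → Carrier) l → δ g (λ m → c * φ m) l ≈ c * δ g φ l
    δ-* g c φ l = trans (δ-cong (λ _ → refl) (λ m → solve 2 (λ c x → c :* x := (c :+ con (+ 1)) :* x :- x) refl c (φ m)) l)
      (trans (δ-linear g _ φ φ l) (solve 2 (λ c x → (c :+ con (+ 1)) :* x :- x := c :* x) refl c _))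

  -- ∑ of y^(b+k-v) g(v) over b ≤ v ≤ b+k
  interval : Carrier → ℕ → ℕ → (ℕ → Carrier) → Carrier
  interval y b zero g = g b
  interval y b (suc k) g = y * interval y b k g + g (suc (b ℕ.+ k))

  branch : ∀ {n} → Carrier → Vec ℕ (suc n) → (Vec ℕ n → Carrier) → Carrier
  branch y (m ∷ []) φ = φ []
  branch y (m ∷ m′ ∷ μ) φ = interval y m′ (m ∸ m′) (λ v → branch y (m′ ∷ μ) (φ ∘ (v ∷_)))

  -- The Schur polynomial s_μ(xs), by the branching rule that splits off the variable at the head.
  s : ∀ {n} → Vec Carrier n → Vec ℕ n → Carrier
  s [] μ = 1#
  s (y ∷ xs) μ = y ^ smallest μ * branch y μ (s xs)

  interval-cong : ∀ y b k {g h} → (∀ v → b ≤ v → v ≤ b ℕ.+ k → g v ≈ h v) → interval y b k g ≈ interval y b k h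
  interval-cong y b zero e = e b ℕP.≤-refl (ℕP.m≤m+n b 0)
  interval-cong y b (suc k) e = +-cong
    (*-congˡ (interval-cong y b k (λ v p q → e v p (ℕP.≤-trans q (ℕP.+-monoʳ-≤ b (ℕP.n≤1+n k))))))
    (e _ (ℕP.≤-trans (ℕP.m≤m+n b k) (ℕP.n≤1+n _)) (ℕP.≤-reflexive (≡.sym (ℕP.+-suc b k))))

  interval-linear : ∀ y b k c (g h : ℕ → Carrier) → interval y b k (λ v → c * g v - h v) ≈ c * interval y b k g - interval y b k h
  interval-linear y b zero c g h = refl
  interval-linear y b (suc k) c g h = trans (+-congʳ (*-congˡ (interval-linear y b k c g h)))
    (solve 6 (λ y c p q r s → y :* (c :* p :- q) :+ (c :* r :- s) := c :* (y :* p :+ r) :- (y :* q :+ s)) refl y c _ _ _ _)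

  interval-telescope : ∀ y b k (g : ℕ → Carrier) → interval y b k (λ v → y * g v - g (suc v)) ≈ y ^ suc k * g b - g (suc (b ℕ.+ k))
  interval-telescope y b zero g = +-cong (*-congʳ (sym (*-identityʳ y))) (-‿cong (reflexive (≡.cong (g ∘ suc) (≡.sym (ℕP.+-identityʳ b)))))
  interval-telescope y b (suc k) g = begin
    y * interval y b k (λ v → y * g v - g (suc v)) + (y * g (suc (b ℕ.+ k)) - g (suc (suc (b ℕ.+ k))))
      ≈⟨ +-cong (*-congˡ (interval-telescope y b k g)) (+-congˡ (-‿cong (reflexive (≡.cong (g ∘ suc) (≡.sym (ℕP.+-suc b k)))))) ⟩
    y * (y ^ suc k * g b - g (suc (b ℕ.+ k))) + (y * g (suc (b ℕ.+ k)) - g (suc (b ℕ.+ suc k)))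
      ≈⟨ solve 5 (λ y p f u v → y :* (p :* f :- u) :+ (y :* u :- v) := (y :* p) :* f :- v) refl y (y ^ suc k) _ _ _ ⟩
    y ^ suc (suc k) * g b - g (suc (b ℕ.+ suc k)) ∎
    where open R≈

  branch-cong : ∀ {n} y (μ : Vec ℕ (suc n)) {φ ψ : Vec ℕ n → Carrier} → Decreasing μ →
    (∀ ν → Interlaced μ ν → φ ν ≈ ψ ν) → branch y μ φ ≈ branch y μ ψ
  branch-cong y (m ∷ []) _ e = e [] tt
  branch-cong y (m ∷ m′ ∷ μ) (p , d) e = interval-cong y m′ (m ∸ m′) λ v q r →
    branch-cong y (m′ ∷ μ) d λ ν i → e (v ∷ ν) (q , ℕP.≤-trans r (ℕP.≤-reflexive (ℕP.m+[n∸m]≡n p)) , i)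

  branch-linear : ∀ {n} y (μ : Vec ℕ (suc n)) c (φ ψ : Vec ℕ n → Carrier) → Decreasing μ →
    branch y μ (λ ν → c * φ ν - ψ ν) ≈ c * branch y μ φ - branch y μ ψ
  branch-linear y (m ∷ []) c φ ψ _ = refl
  branch-linear y (m ∷ m′ ∷ μ) c φ ψ (p , d) = trans
    (interval-cong y m′ (m ∸ m′) λ v _ _ → branch-linear y (m′ ∷ μ) c _ _ d)
    (interval-linear y m′ (m ∸ m′) c _ _)

  branch-* : ∀ {n} y (μ : Vec ℕ (suc n)) c (φ : Vec ℕ n → Carrier) → Decreasing μ →
    branch y μ (λ ν → φ ν * c) ≈ branch y μ φ * c
  branch-* y μ c φ d = trans
    (branch-cong y μ d λ ν _ → solve 2 (λ c x → x :* c := (c :+ con (+ 1)) :* x :- x) refl c (φ ν))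
    (trans (branch-linear y μ _ φ φ d) (solve 2 (λ c x → (c :+ con (+ 1)) :* x :- x := x :* c) refl c _))

  -- Each coordinate of ν contributes a telescoping sum; what remains is the
  -- expansion of δ, since the mixed terms repeat an argument of φ.
  branch-spread : ∀ {n} y (μ : Vec ℕ (suc n)) (φ : Vec ℕ n → Carrier) → Decreasing μ → Alternating φ →
    y ^ smallest μ * branch y μ (λ ν → spread y φ (staircase ν)) ≈ δ (y ^_) φ (staircase μ)
  branch-spread y (m ∷ []) φ _ _ = refl
  branch-spread {suc n} y (m ∷ m′ ∷ μ) φ (p , d) alt = begin
    y ^ e * interval y m′ k (λ v → branch y μ′ (λ ν → y * spread y (φ ∘ (n ℕ.+ v ∷_)) (staircase ν) - spread y (φ ∘ (suc (n ℕ.+ v) ∷_)) (staircase ν)))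
      ≈⟨ *-congˡ (interval-cong y m′ k λ v _ _ → trans (branch-linear y μ′ y _ _ d)
           (+-congˡ (-‿cong (reflexive (≡.cong (λ a → branch y μ′ (λ ν → spread y (φ ∘ (a ∷_)) (staircase ν))) (≡.sym (ℕP.+-suc n v))))))) ⟩
    y ^ e * interval y m′ k (λ v → y * G (n ℕ.+ v) - G (n ℕ.+ suc v))
      ≈⟨ *-congˡ (interval-telescope y m′ k (λ v → G (n ℕ.+ v))) ⟩
    y ^ e * (y ^ suc k * G (n ℕ.+ m′) - G (n ℕ.+ suc (m′ ℕ.+ k)))
      ≈⟨ solve 4 (λ a b c d → a :* (b :* c :- d) := b :* (a :* c) :- a :* d) refl _ _ _ _ ⟩
    y ^ suc k * (y ^ e * G (n ℕ.+ m′)) - y ^ e * G (n ℕ.+ suc (m′ ℕ.+ k))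
      ≈⟨ +-cong (*-congˡ (branch-spread y μ′ (φ ∘ (n ℕ.+ m′ ∷_)) d (alternating-swap φ alt _)))
                (-‿cong (branch-spread y μ′ (φ ∘ (n ℕ.+ suc (m′ ℕ.+ k) ∷_)) d (alternating-swap φ alt _))) ⟩
    y ^ suc k * δ (y ^_) (φ ∘ (n ℕ.+ m′ ∷_)) (staircase μ′) - δ (y ^_) (φ ∘ (n ℕ.+ suc (m′ ℕ.+ k) ∷_)) (staircase μ′)
      ≈⟨ +-congʳ (*-congˡ (repeated φ alt (n ℕ.+ m′) (staircase μ))) ⟩
    y ^ suc k * (y ^ (n ℕ.+ m′) * φ (n ℕ.+ m′ ∷ staircase μ)) - δ (y ^_) (φ ∘ (n ℕ.+ suc (m′ ℕ.+ k) ∷_)) (staircase μ′)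
      ≈⟨ +-cong (trans (sym (*-assoc _ _ _)) (*-congʳ (trans (sym (^-+ y (suc k) _)) (reflexive (≡.cong (y ^_) exponent)))))
                (-‿cong (reflexive (≡.cong (λ a → δ (y ^_) (φ ∘ (a ∷_)) (staircase μ′)) top))) ⟩
    y ^ (suc n ℕ.+ m) * φ (staircase μ′) - δ (y ^_) (φ ∘ (suc n ℕ.+ m ∷_)) (staircase μ′) ∎
    where
    open R≈
    μ′ = m′ ∷ μ
    e = smallest μ′
    k = m ∸ m′
    G : ℕ → Carrier
    G a = branch y μ′ (λ ν → spread y (φ ∘ (a ∷_)) (staircase ν))
    top : n ℕ.+ suc (m′ ℕ.+ k) ≡ suc n ℕ.+ m
    top = ≡.trans (ℕP.+-suc n _) (≡.cong (λ z → suc (n ℕ.+ z)) (ℕP.m+[n∸m]≡n p))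
    exponent : suc k ℕ.+ (n ℕ.+ m′) ≡ suc n ℕ.+ m
    exponent = ≡.cong suc (≡.trans (ℕP.+-comm k _) (≡.trans (ℕP.+-assoc n m′ k) (≡.cong (n ℕ.+_) (ℕP.m+[n∸m]≡n p))))
    repeated : ∀ {n} (φ : Vec ℕ (suc n) → Carrier) → Alternating φ → ∀ a l →
      δ (y ^_) (φ ∘ (a ∷_)) (a ∷ l) ≈ y ^ a * φ (a ∷ l)
    repeated {zero} φ _ a l = refl
    repeated {suc n} φ (_ , z , _) a l = trans (+-congˡ (trans (-‿cong (δ-zero _ (z a) l)) -0#≈0#)) (+-identityʳ _)

  -- The bialternant formula, by induction on the variables: the factors y - x_i of `Δ` move inside
  -- the branching sum, turn into `spread`, and the sum telescopes by `branch-spread`.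
  s-Δ : ∀ {n} (xs : Vec Carrier n) μ → Decreasing μ → s xs μ * Δ xs ≈ Alt xs (staircase μ)
  s-Δ [] [] _ = *-identityˡ _
  s-Δ (y ∷ xs) μ d = begin
    y ^ smallest μ * branch y μ (s xs) * (differences y xs * Δ xs)
      ≈⟨ solve 4 (λ p b d v → p :* b :* (d :* v) := p :* (b :* (d :* v))) refl _ _ _ _ ⟩
    y ^ smallest μ * (branch y μ (s xs) * (differences y xs * Δ xs))
      ≈⟨ *-congˡ (sym (branch-* y μ _ (s xs) d)) ⟩
    y ^ smallest μ * branch y μ (λ ν → s xs ν * (differences y xs * Δ xs))
      ≈⟨ *-congˡ (branch-cong y μ d λ ν i → trans (solve 3 (λ s d v → s :* (d :* v) := d :* (s :* v)) refl _ _ _)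
           (trans (*-congˡ (s-Δ xs ν (interlaced-decreasing μ ν i))) (differences-Alt y xs (staircase ν)))) ⟩
    y ^ smallest μ * branch y μ (λ ν → spread y (Alt xs) (staircase ν))
      ≈⟨ branch-spread y μ (Alt xs) d (Alt-alternating xs) ⟩
    Alt (y ∷ xs) (staircase μ) ∎
    where open R≈

  SameUpToSign : ∀ {n} → Vec Carrier n → Vec Carrier n → Set
  SameUpToSign xs ys = (Δ ys ≈ Δ xs × (∀ l → Alt ys l ≈ Alt xs l)) ⊎ (Δ ys ≈ - Δ xs × (∀ l → Alt ys l ≈ - Alt xs l))

  differences-~ : ∀ {n} y {xs xs′ : Vec Carrier n} → xs ~ xs′ → differences y xs′ ≈ differences y xs
  differences-~ y ~-refl = refl
  differences-~ y (~-swap a b xs) = solve 3 (λ p q r → p :* (q :* r) := q :* (p :* r)) refl _ _ _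
  differences-~ y (~-prep a p) = *-congˡ (differences-~ y p)
  differences-~ y (~-trans p q) = trans (differences-~ y q) (differences-~ y p)

  ~-sameUpToSign : ∀ {n} {xs ys : Vec Carrier n} → xs ~ ys → SameUpToSign xs ys
  ~-sameUpToSign ~-refl = inj₁ (refl , λ _ → refl)
  ~-sameUpToSign (~-swap a b xs) = inj₂
    ( solve 5 (λ a b p q r → (b :- a) :* p :* (q :* r) := :- ((a :- b) :* q :* (p :* r))) refl a b _ _ _
    , λ l → δ-anticomm (b ^_) (a ^_) (Alt xs) l )
  ~-sameUpToSign (~-prep a p) with ~-sameUpToSign p
  ... | inj₁ (e , f) = inj₁ (*-cong (differences-~ a p) e , λ l → δ-cong (λ _ → refl) f l)
  ... | inj₂ (e , f) = inj₂ (trans (*-cong (differences-~ a p) e) (sym (-‿distribʳ-* _ _))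
                            , λ l → trans (δ-cong (λ _ → refl) f l) (δ-neg _ _ l))
  ~-sameUpToSign (~-trans p q) with ~-sameUpToSign p | ~-sameUpToSign q
  ... | inj₁ (e , f) | inj₁ (e′ , f′) = inj₁ (trans e′ e , λ l → trans (f′ l) (f l))
  ... | inj₁ (e , f) | inj₂ (e′ , f′) = inj₂ (trans e′ (-‿cong e) , λ l → trans (f′ l) (-‿cong (f l)))
  ... | inj₂ (e , f) | inj₁ (e′ , f′) = inj₂ (trans e′ e , λ l → trans (f′ l) (f l))
  ... | inj₂ (e , f) | inj₂ (e′ , f′) = inj₁ (trans e′ (trans (-‿cong e) (-‿involutive _)) , λ l → trans (f′ l) (trans (-‿cong (f l)) (-‿involutive _)))

  -- Symmetry is hidden by the branching definition, which singles out one variable. In the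
  -- bialternant formula numerator and denominator change by the same sign, and the Vandermonde
  -- product cancels.
  s-~ : ∀ {n} {xs ys : Vec Carrier n} → Regular A (Δ xs) → xs ~ ys → ∀ μ → Decreasing μ → s ys μ ≈ s xs μ
  s-~ {xs = xs} {ys} r p μ d = regular-cancel A r (trans (*-comm _ _) (trans (main (~-sameUpToSign p)) (*-comm _ _)))
    where
    open R≈
    main : SameUpToSign xs ys → s ys μ * Δ xs ≈ s xs μ * Δ xs
    main (inj₁ (e , f)) = begin
      s ys μ * Δ xs ≈⟨ *-congˡ (sym e) ⟩
      s ys μ * Δ ys ≈⟨ s-Δ ys μ d ⟩
      Alt ys (staircase μ) ≈⟨ f _ ⟩
      Alt xs (staircase μ) ≈⟨ sym (s-Δ xs μ d) ⟩
      s xs μ * Δ xs ∎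
    main (inj₂ (e , f)) = begin
      s ys μ * Δ xs ≈⟨ *-congˡ (sym (-‿involutive _)) ⟩
      s ys μ * - - Δ xs ≈⟨ *-congˡ (-‿cong (sym e)) ⟩
      s ys μ * - Δ ys ≈⟨ sym (-‿distribʳ-* _ _) ⟩
      - (s ys μ * Δ ys) ≈⟨ -‿cong (trans (s-Δ ys μ d) (f _)) ⟩
      - - Alt xs (staircase μ) ≈⟨ -‿involutive _ ⟩
      Alt xs (staircase μ) ≈⟨ sym (s-Δ xs μ d) ⟩
      s xs μ * Δ xs ∎

module _ {A B : Alg} (h : Hom A B) where
  private
    module A = Kit A
    module SA = Alternants A
    module SB = Alternants B
  open Kit B

  Image : ∀ {n} → Vec A.Carrier n → Vec Carrier n → Set
  Image = Pointwise (λ x y → ⟪ h ⟫ x ≈ y)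

  hom-branch : ∀ {n x y} → ⟪ h ⟫ x ≈ y → ∀ (μ : Vec ℕ (suc n)) {φ ψ} → (∀ ν → ⟪ h ⟫ (φ ν) ≈ ψ ν) →
    ⟪ h ⟫ (SA.branch x μ φ) ≈ SB.branch y μ ψ
  hom-branch e (m ∷ []) f = f []
  hom-branch {x = x} {y} e (m ∷ m′ ∷ μ) {φ} {ψ} f = hom-interval (m ∸ m′)
    where
    hom-interval : ∀ k → ⟪ h ⟫ (SA.interval x m′ k (λ v → SA.branch x (m′ ∷ μ) (φ ∘ (v ∷_))))
      ≈ SB.interval y m′ k (λ v → SB.branch y (m′ ∷ μ) (ψ ∘ (v ∷_)))
    hom-interval zero = hom-branch e (m′ ∷ μ) (f ∘ (m′ ∷_))
    hom-interval (suc k) = trans (⟪⟫-+ h _ _) (+-cong (trans (⟪⟫-* h _ _) (*-cong e (hom-interval k))) (hom-branch e (m′ ∷ μ) (f ∘ (_ ∷_))))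

  hom-^ : ∀ {x y} → ⟪ h ⟫ x ≈ y → ∀ k → ⟪ h ⟫ (x A.^ k) ≈ y ^ k
  hom-^ e k = trans (⟪⟫-^ h _ k) (^-cong k e)

  hom-s : ∀ {n xs ys} → Image {n} xs ys → ∀ μ → ⟪ h ⟫ (SA.s xs μ) ≈ SB.s ys μ
  hom-s [] [] = ⟪⟫-1 h
  hom-s (e ∷ es) μ = trans (⟪⟫-* h _ _) (*-cong (hom-^ e (smallest μ)) (hom-branch e μ (hom-s es)))

-- Second-order operators and the Vandermonde product

fins : ∀ n → List (Fin n)
fins zero = []
fins (suc n) = F.zero ∷ map F.suc (fins n)

-- The eigenvalue of `L` on the monomial with exponents l, since (x d/dx)² + x d/dx multiplies x^a
-- by a(a + 1).
energy : ∀ {n} → Vec ℕ n → ℕ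
energy [] = 0
energy (a ∷ l) = a ℕ.* suc a ℕ.+ energy l

module Indexed (A : Alg) where
  open Kit A

  ∑-fins : ∀ n (f : Fin (suc n) → Carrier) → ∑ (fins (suc n)) f ≈ f F.zero + ∑ (fins n) (f ∘ F.suc)
  ∑-fins n f = +-congˡ (∑-map F.suc (fins n) f)

  ∑-single : ∀ n (f : Fin n → Carrier) i → (∀ k → k ≢ i → f k ≈ 0#) → ∑ (fins n) f ≈ f i
  ∑-single (suc n) f F.zero z = trans (∑-fins n f)
    (trans (+-congˡ (∑-zero (fins n) λ k → z (F.suc k) λ ())) (+-identityʳ _))
  ∑-single (suc n) f (F.suc i) z = trans (∑-fins n f)
    (trans (+-cong (z F.zero λ ()) (∑-single n (f ∘ F.suc) i λ k ne → z (F.suc k) (ne ∘ FP.suc-injective))) (+-identityˡ _))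

  pairSum : ∀ n → (Fin n → Fin n → Carrier) → Carrier
  pairSum zero v = 0#
  pairSum (suc n) v = ∑ (fins n) (λ j → v F.zero (F.suc j)) + pairSum n (λ i j → v (F.suc i) (F.suc j))

  ∑∑-pairSum : ∀ n (h : Fin n → Fin n → Carrier) →
    ∑ (fins n) (λ i → ∑ (fins n) (h i)) ≈ ∑ (fins n) (λ i → h i i) + pairSum n (λ i j → h i j + h j i)
  ∑∑-pairSum zero h = sym (+-identityˡ _)
  ∑∑-pairSum (suc n) h = begin
    ∑ (fins (suc n)) (λ i → ∑ (fins (suc n)) (h i))
      ≈⟨ trans (∑-fins n _) (+-cong (∑-fins n _) (∑-cong (fins n) λ i → ∑-fins n _)) ⟩
    (h F.zero F.zero + R) + ∑ (fins n) (λ i → h (F.suc i) F.zero + ∑ (fins n) (λ j → h (F.suc i) (F.suc j)))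
      ≈⟨ +-congˡ (trans (∑-+ (fins n) _ _) (+-congˡ (∑∑-pairSum n (λ i j → h (F.suc i) (F.suc j))))) ⟩
    (h F.zero F.zero + R) + (C + (D + P))
      ≈⟨ solve 5 (λ z r c d p → (z :+ r) :+ (c :+ (d :+ p)) := (z :+ d) :+ ((r :+ c) :+ p)) refl _ _ _ _ _ ⟩
    (h F.zero F.zero + D) + ((R + C) + P)
      ≈⟨ +-cong (sym (∑-fins n _)) (+-congʳ (sym (∑-+ (fins n) _ _))) ⟩
    ∑ (fins (suc n)) (λ i → h i i) + pairSum (suc n) (λ i j → h i j + h j i) ∎
    where
    open R≈
    R = ∑ (fins n) (λ j → h F.zero (F.suc j))
    C = ∑ (fins n) (λ i → h (F.suc i) F.zero)
    D = ∑ (fins n) (λ i → h (F.suc i) (F.suc i))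
    P = pairSum n (λ i j → h (F.suc i) (F.suc j) + h (F.suc j) (F.suc i))

module SecondOrder (A : Alg) where
  open Kit A
  open Indexed A
  open Wedge A
  open Alternants A

  ∂-neg : ∀ (d : Derivation A) x → ∂ d (- x) ≈ - ∂ d x
  ∂-neg d x = begin
    ∂ d (- x) ≈⟨ ∂-cong d (solve 1 (λ x → :- x := con (ℤ.- (+ 1)) :* x) refl x) ⟩
    ∂ d (ι (ℤ.- (+ 1)) * x) ≈⟨ ∂-* d _ _ ⟩
    ∂ d (ι (ℤ.- (+ 1))) * x + ι (ℤ.- (+ 1)) * ∂ d x ≈⟨ +-congʳ (trans (*-congʳ (∂-ι d _)) (zeroˡ x)) ⟩
    0# + ι (ℤ.- (+ 1)) * ∂ d x ≈⟨ trans (+-identityˡ _) (solve 1 (λ x → con (ℤ.- (+ 1)) :* x := :- x) refl _) ⟩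
    - ∂ d x ∎
    where open R≈

  ∂-1 : ∀ (d : Derivation A) → ∂ d 1# ≈ 0#
  ∂-1 d = trans (∂-cong d (sym 1-homo)) (∂-ι d (+ 1))

  ∂-constant-* : ∀ (d : Derivation A) {x} y → ∂ d x ≈ 0# → ∂ d (x * y) ≈ x * ∂ d y
  ∂-constant-* d y e = trans (∂-* d _ _) (trans (+-congʳ (trans (*-congʳ e) (zeroˡ y))) (+-identityˡ _))

  ∂-zero-* : ∀ (d : Derivation A) {x y} → ∂ d x ≈ 0# → ∂ d y ≈ 0# → ∂ d (x * y) ≈ 0#
  ∂-zero-* d e f = trans (∂-constant-* d _ e) (trans (*-congˡ f) (zeroʳ _))

  ∂-zero-^ : ∀ (d : Derivation A) {x} k → ∂ d x ≈ 0# → ∂ d (x ^ k) ≈ 0#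
  ∂-zero-^ d zero e = ∂-1 d
  ∂-zero-^ d (suc k) e = ∂-zero-* d e (∂-zero-^ d k e)

  ∂-zero-δ : ∀ (d : Derivation A) {X : Set} {n} {g : X → Carrier} {φ : Vec X n → Carrier} →
    (∀ a → ∂ d (g a) ≈ 0#) → (∀ l → ∂ d (φ l) ≈ 0#) → ∀ l → ∂ d (δ g φ l) ≈ 0#
  ∂-zero-δ d {n = zero} e f (a ∷ l) = ∂-zero-* d (e a) (f l)
  ∂-zero-δ d {n = suc n} e f (a ∷ l) = trans (∂-+ d _ _)
    (trans (+-cong (∂-zero-* d (e a) (f l)) (trans (∂-neg d _) (-‿cong (∂-zero-δ d e (f ∘ (a ∷_)) l)))) (-‿inverseʳ _))

  ∂-zero-Alt : ∀ (d : Derivation A) {n} (x : Fin n → Carrier) → (∀ i → ∂ d (x i) ≈ 0#) → ∀ l → ∂ d (Alt (V.tabulate x) l) ≈ 0#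
  ∂-zero-Alt d {zero} x e l = ∂-1 d
  ∂-zero-Alt d {suc n} x e l = ∂-zero-δ d (λ a → ∂-zero-^ d a (e F.zero)) (∂-zero-Alt d (x ∘ F.suc) (e ∘ F.suc)) l

  L₁ : Derivation A → Carrier → Carrier
  L₁ d f = ∂ d (∂ d f) + ∂ d f

  L : ∀ n → (Fin n → Derivation A) → Carrier → Carrier
  L n D f = ∑ (fins n) λ i → L₁ (D i) f

  L₁-cong : ∀ d {f g} → f ≈ g → L₁ d f ≈ L₁ d g
  L₁-cong d e = +-cong (∂-cong d (∂-cong d e)) (∂-cong d e)

  L₁-+ : ∀ d f g → L₁ d (f + g) ≈ L₁ d f + L₁ d g
  L₁-+ d f g = trans (+-cong (trans (∂-cong d (∂-+ d f g)) (∂-+ d _ _)) (∂-+ d f g))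
    (solve 4 (λ a b c e → (a :+ b) :+ (c :+ e) := (a :+ c) :+ (b :+ e)) refl _ _ _ _)

  L₁-neg : ∀ d f → L₁ d (- f) ≈ - L₁ d f
  L₁-neg d f = trans (+-cong (trans (∂-cong d (∂-neg d f)) (∂-neg d _)) (∂-neg d f)) (-‿+-comm _ _)

  L₁-constant-* : ∀ d {f} g → ∂ d f ≈ 0# → L₁ d (f * g) ≈ f * L₁ d g
  L₁-constant-* d g e = trans (+-cong (trans (∂-cong d (∂-constant-* d g e)) (∂-constant-* d _ e)) (∂-constant-* d g e)) (sym (distribˡ _ _ _))

  module _ {n : ℕ} (D : Fin n → Derivation A) where
    L-cong : ∀ {f g} → f ≈ g → L n D f ≈ L n D g
    L-cong e = ∑-cong (fins n) λ i → L₁-cong (D i) e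

    L-+ : ∀ f g → L n D (f + g) ≈ L n D f + L n D g
    L-+ f g = trans (∑-cong (fins n) λ i → L₁-+ (D i) f g) (∑-+ (fins n) _ _)

    L-neg : ∀ f → L n D (- f) ≈ - L n D f
    L-neg f = trans (∑-cong (fins n) λ i → L₁-neg (D i) f) (∑-neg (fins n) _)

    L-constant-* : ∀ {f} g → (∀ i → ∂ (D i) f ≈ 0#) → L n D (f * g) ≈ f * L n D g
    L-constant-* g e = trans (∑-cong (fins n) λ i → L₁-constant-* (D i) g (e i)) (∑-*ˡ (fins n) _ _)

    L-0 : L n D 0# ≈ 0#
    L-0 = trans (L-cong (sym (zeroˡ 0#))) (trans (L-constant-* 0# λ i → θ-0 A (D i)) (zeroˡ _))

    L-∑ : ∀ {I : Set} (is : List I) f → L n D (∑ is f) ≈ ∑ is (λ i → L n D (f i))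
    L-∑ [] f = L-0
    L-∑ (i ∷ is) f = trans (L-+ _ _) (+-congˡ (L-∑ is f))

    -- The first-order cross term of `L`: it measures how far `L` is from being a derivation, and is
    -- itself a derivation in each argument.
    Γ : Carrier → Carrier → Carrier
    Γ f g = ∑ (fins n) λ k → ∂ (D k) f * ∂ (D k) g

    L-* : ∀ f g → L n D (f * g) ≈ f * L n D g + g * L n D f + ι (+ 2) * Γ f g
    L-* f g = begin
      ∑ (fins n) (λ i → L₁ (D i) (f * g))
        ≈⟨ ∑-cong (fins n) (λ i → term (D i)) ⟩
      ∑ (fins n) (λ i → f * L₁ (D i) g + g * L₁ (D i) f + ι (+ 2) * (∂ (D i) f * ∂ (D i) g))
        ≈⟨ trans (∑-+ (fins n) _ _) (+-cong (trans (∑-+ (fins n) _ _) (+-cong (∑-*ˡ (fins n) _ _) (∑-*ˡ (fins n) _ _))) (∑-*ˡ (fins n) _ _)) ⟩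
      f * L n D g + g * L n D f + ι (+ 2) * Γ f g ∎
      where
      open R≈
      term : ∀ d → L₁ d (f * g) ≈ f * L₁ d g + g * L₁ d f + ι (+ 2) * (∂ d f * ∂ d g)
      term d = trans (+-cong (trans (∂-cong d (∂-* d f g)) (trans (∂-+ d _ _) (+-cong (∂-* d _ _) (∂-* d _ _)))) (∂-* d f g))
        (solve 6 (λ f g f′ g′ f″ g″ → (f″ :* g :+ f′ :* g′) :+ (f′ :* g′ :+ f :* g″) :+ (f′ :* g :+ f :* g′)
          := f :* (g″ :+ g′) :+ g :* (f″ :+ f′) :+ con (+ 2) :* (f′ :* g′)) refl f g _ _ _ _)

    Γ-* : ∀ f g h → Γ (f * g) h ≈ f * Γ g h + g * Γ f h
    Γ-* f g h = trans (∑-cong (fins n) λ k → trans (*-congʳ (∂-* (D k) f g))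
        (solve 5 (λ f g h f′ g′ → (f′ :* g :+ f :* g′) :* h := f :* (g′ :* h) :+ g :* (f′ :* h)) refl f g _ _ _))
      (trans (∑-+ (fins n) _ _) (+-cong (∑-*ˡ (fins n) _ _) (∑-*ˡ (fins n) _ _)))

    Γ-minus : ∀ f g h → Γ (f - g) h ≈ Γ f h - Γ g h
    Γ-minus f g h = trans (∑-cong (fins n) λ k → trans (*-congʳ (trans (∂-+ (D k) _ _) (+-congˡ (∂-neg (D k) g))))
        (solve 3 (λ a b c → (a :- b) :* c := a :* c :- b :* c) refl _ _ _))
      (trans (∑-+ (fins n) _ _) (+-congˡ (∑-neg (fins n) _)))

    Γ-1 : ∀ h → Γ 1# h ≈ 0#
    Γ-1 h = ∑-zero (fins n) λ k → trans (*-congʳ (∂-1 (D k))) (zeroˡ _)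

    module _ (t : Carrier) where
      -- As Γ(-, t) is a derivation, logarithmic derivatives of the factors add up over a product.
      -- Here `v` plays their role, and stating everything multiplied out avoids quotients.
      2Γ-differences : ∀ {p} y (x : Fin p → Carrier) (v : Fin p → Carrier) →
        (∀ j → ι (+ 2) * Γ (y - x j) t ≈ (y - x j) * v j) →
        ι (+ 2) * Γ (differences y (V.tabulate x)) t ≈ differences y (V.tabulate x) * ∑ (fins p) v
      2Γ-differences {zero} y x v e = trans (*-congˡ (Γ-1 t)) (trans (zeroʳ _) (sym (zeroʳ _)))
      2Γ-differences {suc p} y x v e = begin
        ι (+ 2) * Γ (a * b) t
          ≈⟨ *-congˡ (Γ-* a b t) ⟩
        ι (+ 2) * (a * Γ b t + b * Γ a t)
          ≈⟨ solve 4 (λ a b u w → con (+ 2) :* (a :* u :+ b :* w) := a :* (con (+ 2) :* u) :+ b :* (con (+ 2) :* w)) refl a b _ _ ⟩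
        a * (ι (+ 2) * Γ b t) + b * (ι (+ 2) * Γ a t)
          ≈⟨ +-cong (*-congˡ (2Γ-differences y (x ∘ F.suc) (v ∘ F.suc) (e ∘ F.suc))) (*-congˡ (e F.zero)) ⟩
        a * (b * ∑ (fins p) (v ∘ F.suc)) + b * (a * v F.zero)
          ≈⟨ solve 4 (λ a b u w → a :* (b :* u) :+ b :* (a :* w) := a :* b :* (w :+ u)) refl a b _ _ ⟩
        a * b * (v F.zero + ∑ (fins p) (v ∘ F.suc))
          ≈⟨ *-congˡ (sym (∑-fins p v)) ⟩
        a * b * ∑ (fins (suc p)) v ∎
        where
        open R≈
        a = y - x F.zero
        b = differences y (V.tabulate (x ∘ F.suc))

      2Γ-Δ : ∀ {p} (x : Fin p → Carrier) (v : Fin p → Fin p → Carrier) →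
        (∀ i j → i ≢ j → ι (+ 2) * Γ (x i - x j) t ≈ (x i - x j) * v i j) →
        ι (+ 2) * Γ (Δ (V.tabulate x)) t ≈ Δ (V.tabulate x) * pairSum p v
      2Γ-Δ {zero} x v e = trans (*-congˡ (Γ-1 t)) (trans (zeroʳ _) (sym (zeroʳ _)))
      2Γ-Δ {suc p} x v e = begin
        ι (+ 2) * Γ (a * b) t
          ≈⟨ *-congˡ (Γ-* a b t) ⟩
        ι (+ 2) * (a * Γ b t + b * Γ a t)
          ≈⟨ solve 4 (λ a b u w → con (+ 2) :* (a :* u :+ b :* w) := a :* (con (+ 2) :* u) :+ b :* (con (+ 2) :* w)) refl a b _ _ ⟩
        a * (ι (+ 2) * Γ b t) + b * (ι (+ 2) * Γ a t)
          ≈⟨ +-cong (*-congˡ (2Γ-Δ (x ∘ F.suc) (λ i j → v (F.suc i) (F.suc j)) (λ i j ne → e (F.suc i) (F.suc j) (ne ∘ FP.suc-injective))))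
               (*-congˡ (2Γ-differences (x F.zero) (x ∘ F.suc) (v F.zero ∘ F.suc) (λ j → e F.zero (F.suc j) λ ()))) ⟩
        a * (b * pairSum p (λ i j → v (F.suc i) (F.suc j))) + b * (a * ∑ (fins p) (v F.zero ∘ F.suc))
          ≈⟨ solve 4 (λ a b u w → a :* (b :* u) :+ b :* (a :* w) := a :* b :* (w :+ u)) refl a b _ _ ⟩
        a * b * pairSum (suc p) v ∎
        where
        open R≈
        a = differences (x F.zero) (V.tabulate (x ∘ F.suc))
        b = Δ (V.tabulate (x ∘ F.suc))

  record Coordinates (n : ℕ) : Set where
    field
      X : Fin n → Carrier
      D : Fin n → Derivation A
      D-same : ∀ i → ∂ (D i) (X i) ≈ X i
      D-diff : ∀ i j → i ≢ j → ∂ (D i) (X j) ≈ 0#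

    xs : Vec Carrier n
    xs = V.tabulate X

  open Coordinates public

  shiftCoordinates : ∀ {n} → Coordinates (suc n) → Coordinates n
  shiftCoordinates c = record { X = X c ∘ F.suc ; D = D c ∘ F.suc ; D-same = D-same c ∘ F.suc
    ; D-diff = λ i j ne → D-diff c (F.suc i) (F.suc j) (ne ∘ FP.suc-injective) }

  ∂-^-same : ∀ (d : Derivation A) {x} → ∂ d x ≈ x → ∀ a → ∂ d (x ^ a) ≈ ι (+ a) * x ^ a
  ∂-^-same d e zero = trans (∂-1 d) (sym (trans (*-congʳ 0-homo) (zeroˡ _)))
  ∂-^-same d {x} e (suc a) = trans (∂-* d _ _) (trans (+-cong (*-congʳ e) (*-congˡ (∂-^-same d e a)))
    (trans (solve 3 (λ x p k → x :* p :+ x :* (k :* p) := (con (+ 1) :+ k) :* (x :* p)) refl x (x ^ a) (ι (+ a)))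
      (*-congʳ (sym (+-homo (+ 1) (+ a))))))

  -- The number `c` collects the energy of exponents that the expansion has already fixed; with it
  -- every term of the expansion has one and the same eigenvalue.
  L-δ : ∀ {n p} (D : Fin p → Derivation A) g (φ : Vec ℕ n → Carrier) c →
    (∀ a l → L p D (g a * φ l) ≈ ι (+ (c ℕ.+ (a ℕ.* suc a ℕ.+ energy l))) * (g a * φ l)) →
    ∀ l → L p D (δ g φ l) ≈ ι (+ (c ℕ.+ energy l)) * δ g φ l
  L-δ {zero} D g φ c e (a ∷ []) = e a []
  L-δ {suc n} {p} D g φ c e (a ∷ l) = begin
    L p D (g a * φ l - δ g (φ ∘ (a ∷_)) l)
      ≈⟨ trans (L-+ D _ _) (+-congˡ (L-neg D _)) ⟩
    L p D (g a * φ l) - L p D (δ g (φ ∘ (a ∷_)) l)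
      ≈⟨ +-cong (e a l) (-‿cong (L-δ D g (φ ∘ (a ∷_)) (c ℕ.+ a ℕ.* suc a)
           (λ b m → trans (e b (a ∷ m)) (*-congʳ (reflexive (≡.cong (ι ∘ +_) (rearrange (b ℕ.* suc b) (energy m))))))  l)) ⟩
    ι (+ E) * (g a * φ l) - ι (+ (c ℕ.+ a ℕ.* suc a ℕ.+ energy l)) * δ g (φ ∘ (a ∷_)) l
      ≈⟨ +-congˡ (-‿cong (*-congʳ (reflexive (≡.cong (ι ∘ +_) (ℕP.+-assoc c (a ℕ.* suc a) (energy l)))))) ⟩
    ι (+ E) * (g a * φ l) - ι (+ E) * δ g (φ ∘ (a ∷_)) l
      ≈⟨ solve 3 (λ e x y → e :* x :- e :* y := e :* (x :- y)) refl _ _ _ ⟩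
    ι (+ E) * δ g φ (a ∷ l) ∎
    where
    open R≈
    E = c ℕ.+ energy (a ∷ l)
    rearrange : ∀ B M → c ℕ.+ (B ℕ.+ (a ℕ.* suc a ℕ.+ M)) ≡ c ℕ.+ a ℕ.* suc a ℕ.+ (B ℕ.+ M)
    rearrange B M = ≡.trans (≡.cong (c ℕ.+_) (≡.trans (≡.sym (ℕP.+-assoc B _ M)) (≡.trans (≡.cong (ℕ._+ M) (ℕP.+-comm B _)) (ℕP.+-assoc (a ℕ.* suc a) B M))))
      (≡.sym (ℕP.+-assoc c _ _))

  L-Alt : ∀ {n} (c : Coordinates n) l → L n (D c) (Alt (xs c) l) ≈ ι (+ energy l) * Alt (xs c) l
  L-Alt {zero} c [] = sym (trans (*-congʳ 0-homo) (zeroˡ _))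
  L-Alt {suc n} c l = L-δ (D c) (X c F.zero ^_) (Alt (xs (shiftCoordinates c))) 0 monomial l
    where
    open R≈
    d₀ = D c F.zero
    x₀ = X c F.zero
    module _ (a : ℕ) (l : Vec ℕ n) where
      F = Alt (xs (shiftCoordinates c)) l
      head : L₁ d₀ (x₀ ^ a * F) ≈ ι (+ (a ℕ.* suc a)) * (x₀ ^ a * F)
      head = begin
        L₁ d₀ (x₀ ^ a * F) ≈⟨ +-cong (trans (∂-cong d₀ euler) (trans (∂-constant-* d₀ _ (∂-ι d₀ _)) (*-congˡ euler))) euler ⟩
        ι (+ a) * (ι (+ a) * (x₀ ^ a * F)) + ι (+ a) * (x₀ ^ a * F)
          ≈⟨ solve 2 (λ k m → k :* (k :* m) :+ k :* m := (k :* (con (+ 1) :+ k)) :* m) refl _ _ ⟩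
        ι (+ a) * (ι (+ 1) + ι (+ a)) * (x₀ ^ a * F)
          ≈⟨ *-congʳ (trans (*-congˡ (sym (+-homo (+ 1) (+ a)))) (trans (sym (*-homo (+ a) (+ suc a))) (reflexive (≡.cong ι (≡.sym (ℤP.pos-* a (suc a))))))) ⟩
        ι (+ (a ℕ.* suc a)) * (x₀ ^ a * F) ∎
        where
        euler : ∂ d₀ (x₀ ^ a * F) ≈ ι (+ a) * (x₀ ^ a * F)
        euler = trans (trans (∂-cong d₀ (*-comm _ _)) (∂-constant-* d₀ _ (∂-zero-Alt d₀ _ (λ i → D-diff c F.zero (F.suc i) λ ()) l)))
          (trans (*-congˡ (∂-^-same d₀ (D-same c F.zero) a)) (solve 3 (λ f k p → f :* (k :* p) := k :* (p :* f)) refl F _ _))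
      monomial : L (suc n) (D c) (x₀ ^ a * F) ≈ ι (+ (a ℕ.* suc a ℕ.+ energy l)) * (x₀ ^ a * F)
      monomial = begin
        L (suc n) (D c) (x₀ ^ a * F)
          ≈⟨ ∑-fins n _ ⟩
        L₁ d₀ (x₀ ^ a * F) + L n (D c ∘ F.suc) (x₀ ^ a * F)
          ≈⟨ +-cong head (trans (L-constant-* (D c ∘ F.suc) F λ i → ∂-zero-^ (D c (F.suc i)) a (D-diff c (F.suc i) F.zero λ ()))
               (*-congˡ (L-Alt (shiftCoordinates c) l))) ⟩
        ι (+ (a ℕ.* suc a)) * (x₀ ^ a * F) + x₀ ^ a * (ι (+ energy l) * F)
          ≈⟨ solve 4 (λ u v p f → u :* (p :* f) :+ p :* (v :* f) := (u :+ v) :* (p :* f)) refl _ _ _ _ ⟩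
        (ι (+ (a ℕ.* suc a)) + ι (+ energy l)) * (x₀ ^ a * F)
          ≈⟨ *-congʳ (sym (+-homo _ _)) ⟩
        ι (+ (a ℕ.* suc a ℕ.+ energy l)) * (x₀ ^ a * F) ∎

  s-zero : ∀ {n} (xs : Vec Carrier n) → s xs (V.replicate n 0) ≈ 1#
  s-zero [] = refl
  s-zero {suc n} (y ∷ xs) = trans (*-congʳ (reflexive (≡.cong (y ^_) (smallest-zero n))))
    (trans (*-identityˡ _) (trans (branch-zero n y (s xs)) (s-zero xs)))
    where
    smallest-zero : ∀ n → smallest (V.replicate (suc n) 0) ≡ 0
    smallest-zero zero = ≡.refl
    smallest-zero (suc n) = smallest-zero n
    branch-zero : ∀ n y (φ : Vec ℕ n → Carrier) → branch y (V.replicate (suc n) 0) φ ≈ φ (V.replicate n 0)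
    branch-zero zero y φ = refl
    branch-zero (suc n) y φ = branch-zero n y (φ ∘ (0 ∷_))

  -- The bialternant formula for the empty partition; it makes `Δ` itself an eigenvector of `L`.
  Δ-Alt : ∀ {n} (xs : Vec Carrier n) → Δ xs ≈ Alt xs (staircase (V.replicate n 0))
  Δ-Alt {n} xs = trans (sym (trans (*-congʳ (s-zero xs)) (*-identityˡ _))) (s-Δ xs _ (decreasing-zero n))

  -- t plays the role of the trace of ρ x over a polynomial representation, and
  -- T i j that of the trace of E i j E j i ρ x, for ρ commuting with all E i j.
  record TraceRelations {n} (c : Coordinates n) (t : Carrier) (T : Fin n → Fin n → Carrier) : Set where
    field
      diagonal : ∀ i → T i i ≈ ∂ (D c i) (∂ (D c i) t)
      conjugate : ∀ i j → i ≢ j → X c j * T i j ≈ X c i * T j i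
      commutator : ∀ i j → i ≢ j → T i j - T j i ≈ ∂ (D c i) t - ∂ (D c j) t

  module _ {n} (c : Coordinates n) {t T} (rel : TraceRelations c t T) where
    open TraceRelations rel
    open R≈

    -- The trace of ∑ E_ij E_ji + n ∑ E_ii. The linear term is chosen so that the diagonal part
    -- becomes `L` applied to t and each pair i < j contributes precisely the bracket of `2Γ-pair`.
    casimir : Carrier
    casimir = ∑ (fins n) λ i → ∑ (fins n) λ j → T i j + ∂ (D c i) t

    Γ-X : ∀ i → Γ (D c) (X c i) t ≈ X c i * ∂ (D c i) t
    Γ-X i = trans (∑-single n _ i λ k ne → trans (*-congʳ (D-diff c k i ne)) (zeroˡ _)) (*-congʳ (D-same c i))

    -- Writing 2(x a - y b) as (x + y)(a - b) + (x - y)(a + b), the relation `commutator` trades a -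
    -- b for the difference of traces. What then fails to be divisible by x - y is a multiple of the
    -- relation `conjugate`.
    2Γ-pair : ∀ i j → i ≢ j → ι (+ 2) * Γ (D c) (X c i - X c j) t ≈
      (X c i - X c j) * ((T i j + ∂ (D c i) t) + (T j i + ∂ (D c j) t))
    2Γ-pair i j ne = begin
      ι (+ 2) * Γ (D c) (X c i - X c j) t
        ≈⟨ *-congˡ (trans (Γ-minus (D c) _ _ t) (+-cong (Γ-X i) (-‿cong (Γ-X j)))) ⟩
      ι (+ 2) * (x * a - y * b)
        ≈⟨ solve 4 (λ x y a b → con (+ 2) :* (x :* a :- y :* b) := (x :+ y) :* (a :- b) :+ (x :- y) :* (a :+ b)) refl x y a b ⟩
      (x + y) * (a - b) + (x - y) * (a + b)
        ≈⟨ +-congʳ (*-congˡ (sym (commutator i j ne))) ⟩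
      (x + y) * (T i j - T j i) + (x - y) * (a + b)
        ≈⟨ solve 6 (λ x y a b u v → (x :+ y) :* (u :- v) :+ (x :- y) :* (a :+ b)
             := (x :- y) :* ((u :+ a) :+ (v :+ b)) :+ con (+ 2) :* (y :* u :- x :* v)) refl x y a b (T i j) (T j i) ⟩
      (x - y) * ((T i j + a) + (T j i + b)) + ι (+ 2) * (y * T i j - x * T j i)
        ≈⟨ +-congˡ (trans (*-congˡ (trans (+-congʳ (conjugate i j ne)) (-‿inverseʳ _))) (zeroʳ _)) ⟩
      (x - y) * ((T i j + a) + (T j i + b)) + 0#
        ≈⟨ +-identityʳ _ ⟩
      (x - y) * ((T i j + a) + (T j i + b)) ∎
      where
      x = X c i
      y = X c j
      a = ∂ (D c i) t
      b = ∂ (D c j) t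

    -- The off-diagonal pairs add up to 2Γ(Δ, t) by `2Γ-Δ`, so the two sides agree by the product
    -- rule `L-*`.
    Δ-casimir : Δ (xs c) * casimir ≈ L n (D c) (Δ (xs c) * t) - t * L n (D c) (Δ (xs c))
    Δ-casimir = begin
      Δ (xs c) * casimir
        ≈⟨ *-congˡ (trans (∑∑-pairSum n _) (+-congʳ (∑-cong (fins n) λ i → +-congʳ (diagonal i)))) ⟩
      Δ (xs c) * (L n (D c) t + P)
        ≈⟨ trans (distribˡ _ _ _) (+-congˡ (sym (2Γ-Δ (D c) t (X c) _ 2Γ-pair))) ⟩
      Δ (xs c) * L n (D c) t + ι (+ 2) * Γ (D c) (Δ (xs c)) t
        ≈⟨ solve 4 (λ a b g k → a :+ k :* g := (a :+ b :+ k :* g) :- b) refl _ _ _ _ ⟩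
      (Δ (xs c) * L n (D c) t + t * L n (D c) (Δ (xs c)) + ι (+ 2) * Γ (D c) (Δ (xs c)) t) - t * L n (D c) (Δ (xs c))
        ≈⟨ +-congʳ (sym (L-* (D c) _ _)) ⟩
      L n (D c) (Δ (xs c) * t) - t * L n (D c) (Δ (xs c)) ∎
      where
      P = pairSum n (λ i j → (T i j + ∂ (D c i) t) + (T j i + ∂ (D c j) t))

  -- The subtracted constant is the eigenvalue of `Δ`; it comes from the term t L(Δ) and gives the
  -- empty partition the value 0.
  eigenvalue : ∀ {n} → Vec ℕ n → ℤ
  eigenvalue {n} μ = + energy (staircase μ) ℤ.- + energy (staircase (V.replicate n 0))

  -- The factors `κ i` are constants for the derivations at hand: in the application they are Schur
  -- polynomials in the other alphabet. Multiplying by `Δ` turns every summand into an alternant,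
  -- hence into an eigenvector of `L`.
  casimir-s : ∀ {n} (c : Coordinates n) {t T} (rel : TraceRelations c t T) → Regular A (Δ (xs c)) →
    ∀ {I : Set} (is : List I) (a : I → ℤ) (μ : I → Vec ℕ n) (κ : I → Carrier) →
    (∀ i → Decreasing (μ i)) → (∀ k i → ∂ (D c k) (κ i) ≈ 0#) →
    t ≈ ∑ is (λ i → ι (a i) * (s (xs c) (μ i) * κ i)) →
    casimir c rel ≈ ∑ is (λ i → ι (a i) * (ι (eigenvalue (μ i)) * (s (xs c) (μ i) * κ i)))
  casimir-s {n} c {t} rel reg is a μ κ dec const e = regular-cancel A reg (begin
    Δ (xs c) * casimir c rel
      ≈⟨ Δ-casimir c rel ⟩
    L n (D c) (Δ (xs c) * t) - t * L n (D c) (Δ (xs c))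
      ≈⟨ +-cong (trans (L-cong (D c) (*-congˡ e)) L-term) (-‿cong (trans (*-cong e L-Δ) (*-comm _ _))) ⟩
    ∑ is (λ i → ι (a i) * (ι (E i) * (Δ (xs c) * (S i * κ i)))) - (ι E₀ * Δ (xs c)) * ∑ is (λ i → ι (a i) * (S i * κ i))
      ≈⟨ +-congˡ (trans (-‿cong (sym (∑-*ˡ is _ _))) (sym (∑-neg is _))) ⟩
    ∑ is (λ i → ι (a i) * (ι (E i) * (Δ (xs c) * (S i * κ i)))) + ∑ is (λ i → - ((ι E₀ * Δ (xs c)) * (ι (a i) * (S i * κ i))))
      ≈⟨ sym (∑-+ is _ _) ⟩
    ∑ is (λ i → ι (a i) * (ι (E i) * (Δ (xs c) * (S i * κ i))) + - ((ι E₀ * Δ (xs c)) * (ι (a i) * (S i * κ i))))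
      ≈⟨ ∑-cong is (λ i → trans (solve 5 (λ a e z d w → a :* (e :* (d :* w)) :- (z :* d) :* (a :* w) := d :* (a :* ((e :- z) :* w))) refl _ _ _ _ _)
           (*-congˡ (*-congˡ (*-congʳ (sym (trans (+-homo _ _) (+-congˡ (-‿homo _)))))))) ⟩
    ∑ is (λ i → Δ (xs c) * (ι (a i) * (ι (eigenvalue (μ i)) * (S i * κ i))))
      ≈⟨ ∑-*ˡ is _ _ ⟩
    Δ (xs c) * ∑ is (λ i → ι (a i) * (ι (eigenvalue (μ i)) * (S i * κ i))) ∎)
    where
    open R≈
    S = λ i → s (xs c) (μ i)
    E = λ i → + energy (staircase (μ i))
    E₀ = + energy (staircase (V.replicate n 0))
    L-Δ : L n (D c) (Δ (xs c)) ≈ ι E₀ * Δ (xs c)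
    L-Δ = trans (L-cong (D c) (Δ-Alt (xs c))) (trans (L-Alt c _) (*-congˡ (sym (Δ-Alt (xs c)))))
    L-term : L n (D c) (Δ (xs c) * ∑ is (λ i → ι (a i) * (S i * κ i))) ≈ ∑ is (λ i → ι (a i) * (ι (E i) * (Δ (xs c) * (S i * κ i))))
    L-term = begin
      L n (D c) (Δ (xs c) * ∑ is (λ i → ι (a i) * (S i * κ i)))
        ≈⟨ L-cong (D c) (sym (∑-*ˡ is _ _)) ⟩
      L n (D c) (∑ is (λ i → Δ (xs c) * (ι (a i) * (S i * κ i))))
        ≈⟨ L-∑ (D c) is _ ⟩
      ∑ is (λ i → L n (D c) (Δ (xs c) * (ι (a i) * (S i * κ i))))
        ≈⟨ ∑-cong is (λ i → begin
          L n (D c) (Δ (xs c) * (ι (a i) * (S i * κ i)))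
            ≈⟨ L-cong (D c) (trans (solve 4 (λ d a s k → d :* (a :* (s :* k)) := (a :* k) :* (s :* d)) refl _ _ _ _) (*-congˡ (s-Δ (xs c) (μ i) (dec i)))) ⟩
          L n (D c) ((ι (a i) * κ i) * Alt (xs c) (staircase (μ i)))
            ≈⟨ L-constant-* (D c) _ (λ k → ∂-zero-* (D c k) (∂-ι (D c k) _) (const k i)) ⟩
          (ι (a i) * κ i) * L n (D c) (Alt (xs c) (staircase (μ i)))
            ≈⟨ *-congˡ (trans (L-Alt c _) (*-congˡ (sym (s-Δ (xs c) (μ i) (dec i))))) ⟩
          (ι (a i) * κ i) * (ι (E i) * (S i * Δ (xs c)))
            ≈⟨ solve 5 (λ a k e s d → (a :* k) :* (e :* (s :* d)) := a :* (e :* (d :* (s :* k)))) refl _ _ _ _ _ ⟩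
          ι (a i) * (ι (E i) * (Δ (xs c) * (S i * κ i))) ∎) ⟩
      ∑ is (λ i → ι (a i) * (ι (E i) * (Δ (xs c) * (S i * κ i)))) ∎

module ℤK = Kit ℤAlg
module ℤW = Wedge ℤAlg

-- Operators on tensor powers

-- A matrix with at most one nonzero entry in each row, acting on functions. Matrix units, creation
-- and annihilation are all of this kind, so composition needs no summation.
record Op (P Q : Set) : Set where
  constructor op
  field
    weight : P → ℤ
    target : P → Q
open Op public

infixr 5 _·_
_·_ : ∀ {P Q} → Op P Q → (Q → ℤ) → P → ℤ
(a · ψ) p = weight a p *ᶻ ψ (target a p)

infixr 5 _⊙_
_⊙_ : ∀ {P Q R} → Op P Q → Op Q R → Op P R
weight (a ⊙ b) p = weight a p *ᶻ weight b (target a p)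
target (a ⊙ b) p = target b (target a p)

⊙-· : ∀ {P Q R} (a : Op P Q) (b : Op Q R) ψ p → ((a ⊙ b) · ψ) p ≡ (a · (b · ψ)) p
⊙-· a b ψ p = ℤP.*-assoc (weight a p) _ _

module _ {Q : Set} where
  -- a acting as a derivation on a tensor power.
  dΓ : ∀ {r} → Op Q Q → (Vec Q r → ℤ) → Vec Q r → ℤ
  dΓ a φ [] = + 0
  dΓ a φ (q ∷ qs) = (a · (λ p → φ (p ∷ qs))) q +ᶻ dΓ a (φ ∘ (q ∷_)) qs

  dΓ-cong : ∀ {r} a {φ ψ : Vec Q r → ℤ} → (∀ qs → φ qs ≡ ψ qs) → ∀ qs → dΓ a φ qs ≡ dΓ a ψ qs
  dΓ-cong a e [] = ≡.refl
  dΓ-cong a e (q ∷ qs) = ≡.cong₂ _+ᶻ_ (≡.cong (weight a q *ᶻ_) (e _)) (dΓ-cong a (e ∘ (q ∷_)) qs)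

  dΓ-linear : ∀ {r} a c (φ ψ : Vec Q r → ℤ) qs → dΓ a (λ m → c *ᶻ φ m +ᶻ ψ m) qs ≡ c *ᶻ dΓ a φ qs +ᶻ dΓ a ψ qs
  dΓ-linear a c φ ψ [] = ≡.sym (≡.trans (ℤP.+-identityʳ _) (ℤP.*-zeroʳ c))
  dΓ-linear a c φ ψ (q ∷ qs) = ≡.trans (≡.cong (weight a q *ᶻ (c *ᶻ φ (target a q ∷ qs) +ᶻ ψ (target a q ∷ qs)) +ᶻ_) (dΓ-linear a c _ _ qs))
    (solve 6 (λ w c x y u v → w :* (c :* x :+ y) :+ (c :* u :+ v) := c :* (w :* x :+ u) :+ (w :* y :+ v)) ≡.refl
      (weight a q) c (φ (target a q ∷ qs)) (ψ (target a q ∷ qs)) _ _)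
    where open ℤK

  dΓ-* : ∀ {r} a c (φ : Vec Q r → ℤ) qs → dΓ a (λ m → c *ᶻ φ m) qs ≡ c *ᶻ dΓ a φ qs
  dΓ-* a c φ qs = ≡.trans (dΓ-cong a (λ m → solve 2 (λ c x → c :* x := (c :- con (+ 1)) :* x :+ x) ≡.refl c (φ m)) qs)
    (≡.trans (dΓ-linear a (c -ᶻ + 1) φ φ qs) (solve 2 (λ c x → (c :- con (+ 1)) :* x :+ x := c :* x) ≡.refl c (dΓ a φ qs)))
    where open ℤK

  dΓ-+ : ∀ {r} a (φ ψ : Vec Q r → ℤ) qs → dΓ a (λ m → φ m +ᶻ ψ m) qs ≡ dΓ a φ qs +ᶻ dΓ a ψ qs
  dΓ-+ a φ ψ qs = ≡.trans (dΓ-cong a (λ m → ≡.cong (_+ᶻ ψ m) (≡.sym (ℤP.*-identityˡ (φ m)))) qs)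
    (≡.trans (dΓ-linear a (+ 1) φ ψ qs) (≡.cong (_+ᶻ dΓ a ψ qs) (ℤP.*-identityˡ (dΓ a φ qs))))

  dΓ-neg : ∀ {r} a (φ : Vec Q r → ℤ) qs → dΓ a (λ m → -ᶻ φ m) qs ≡ -ᶻ dΓ a φ qs
  dΓ-neg a φ qs = ≡.trans (dΓ-cong a (λ m → ≡.sym (ℤP.-1*i≡-i (φ m))) qs) (≡.trans (dΓ-* a (-ᶻ (+ 1)) φ qs) (ℤP.-1*i≡-i (dΓ a φ qs)))

  dΓ-∑ : ∀ {r} a {I : Set} (is : List I) (φ : I → Vec Q r → ℤ) qs →
    dΓ a (λ m → ℤK.∑ is (λ i → φ i m)) qs ≡ ℤK.∑ is (λ i → dΓ a (φ i) qs)
  dΓ-∑ a [] φ qs = dΓ-zero qs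
    where
    dΓ-zero : ∀ {r} (qs : Vec Q r) → dΓ a (λ _ → + 0) qs ≡ + 0
    dΓ-zero [] = ≡.refl
    dΓ-zero (q ∷ qs) = ≡.cong₂ _+ᶻ_ (ℤP.*-zeroʳ (weight a q)) (dΓ-zero qs)
  dΓ-∑ a (i ∷ is) φ qs = ≡.trans (dΓ-+ a (φ i) _ qs) (≡.cong (dΓ a (φ i) qs +ᶻ_) (dΓ-∑ a is φ qs))

  -- Operators in different slots commute, so only commutators within a slot remain. The shape c x -
  -- d y is that of the commutation relations of gl.
  dΓ-commutator : ∀ a b c x d y → (∀ ψ q → (a · b · ψ) q ≡ (b · a · ψ) q +ᶻ (c *ᶻ (x · ψ) q -ᶻ d *ᶻ (y · ψ) q)) →
    ∀ {r} (φ : Vec Q r → ℤ) qs → dΓ a (dΓ b φ) qs ≡ dΓ b (dΓ a φ) qs +ᶻ (c *ᶻ dΓ x φ qs -ᶻ d *ᶻ dΓ y φ qs)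
  dΓ-commutator a b c x d y h φ [] = solve 2 (λ c d → con (+ 0) := con (+ 0) :+ (c :* con (+ 0) :- d :* con (+ 0))) ≡.refl c d
    where open ℤK
  dΓ-commutator a b c x d y h φ (q ∷ qs) = begin
    α *ᶻ (β′ *ᶻ φ₁ +ᶻ B₁) +ᶻ dΓ a (λ m → β *ᶻ φ (target b q ∷ m) +ᶻ dΓ b (φ ∘ (q ∷_)) m) qs
      ≡⟨ ≡.cong (α *ᶻ (β′ *ᶻ φ₁ +ᶻ B₁) +ᶻ_) (≡.trans (dΓ-linear a β _ _ qs) (≡.cong (β *ᶻ A₁ +ᶻ_) (dΓ-commutator a b c x d y h (φ ∘ (q ∷_)) qs))) ⟩
    α *ᶻ (β′ *ᶻ φ₁ +ᶻ B₁) +ᶻ (β *ᶻ A₁ +ᶻ (BA +ᶻ (c *ᶻ X₁ -ᶻ d *ᶻ Y₁)))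
      ≡⟨ solve 10 (λ α β′ φ₁ B₁ β A₁ BA XY u v → α :* (β′ :* φ₁ :+ B₁) :+ (β :* A₁ :+ (BA :+ XY))
           := α :* (β′ :* φ₁) :+ (α :* B₁ :+ (β :* A₁ :+ (BA :+ XY)))) ≡.refl α β′ φ₁ B₁ β A₁ BA (c *ᶻ X₁ -ᶻ d *ᶻ Y₁) (+ 0) (+ 0) ⟩
    α *ᶻ (β′ *ᶻ φ₁) +ᶻ (α *ᶻ B₁ +ᶻ (β *ᶻ A₁ +ᶻ (BA +ᶻ (c *ᶻ X₁ -ᶻ d *ᶻ Y₁))))
      ≡⟨ ≡.cong (_+ᶻ (α *ᶻ B₁ +ᶻ (β *ᶻ A₁ +ᶻ (BA +ᶻ (c *ᶻ X₁ -ᶻ d *ᶻ Y₁))))) (h (λ p → φ (p ∷ qs)) q) ⟩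
    (β *ᶻ (α′ *ᶻ φ₂) +ᶻ (c *ᶻ X₀ -ᶻ d *ᶻ Y₀)) +ᶻ (α *ᶻ B₁ +ᶻ (β *ᶻ A₁ +ᶻ (BA +ᶻ (c *ᶻ X₁ -ᶻ d *ᶻ Y₁))))
      ≡⟨ collect β α′ φ₂ c X₀ d Y₀ α B₁ A₁ BA X₁ Y₁ ⟩
    (β *ᶻ (α′ *ᶻ φ₂ +ᶻ A₁) +ᶻ (α *ᶻ B₁ +ᶻ BA)) +ᶻ (c *ᶻ (X₀ +ᶻ X₁) -ᶻ d *ᶻ (Y₀ +ᶻ Y₁))
      ≡⟨ ≡.cong (λ z → (β *ᶻ (α′ *ᶻ φ₂ +ᶻ A₁) +ᶻ z) +ᶻ (c *ᶻ (X₀ +ᶻ X₁) -ᶻ d *ᶻ (Y₀ +ᶻ Y₁))) (≡.sym (dΓ-linear b α _ _ qs)) ⟩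
    dΓ b (dΓ a φ) (q ∷ qs) +ᶻ (c *ᶻ dΓ x φ (q ∷ qs) -ᶻ d *ᶻ dΓ y φ (q ∷ qs)) ∎
    where
    open ℤK using (solve; _:=_; _:+_; _:*_; _:-_)
    open ≡.≡-Reasoning
    α = weight a q
    α′ = weight a (target b q)
    β = weight b q
    β′ = weight b (target a q)
    φ₁ = φ (target b (target a q) ∷ qs)
    φ₂ = φ (target a (target b q) ∷ qs)
    A₁ = dΓ a (φ ∘ (target b q ∷_)) qs
    B₁ = dΓ b (φ ∘ (target a q ∷_)) qs
    BA = dΓ b (dΓ a (φ ∘ (q ∷_))) qs
    X₀ = (x · (λ p → φ (p ∷ qs))) q
    Y₀ = (y · (λ p → φ (p ∷ qs))) q
    X₁ = dΓ x (φ ∘ (q ∷_)) qs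
    Y₁ = dΓ y (φ ∘ (q ∷_)) qs
    collect : ∀ β α′ φ₂ c X₀ d Y₀ α B₁ A₁ BA X₁ Y₁ →
      (β *ᶻ (α′ *ᶻ φ₂) +ᶻ (c *ᶻ X₀ -ᶻ d *ᶻ Y₀)) +ᶻ (α *ᶻ B₁ +ᶻ (β *ᶻ A₁ +ᶻ (BA +ᶻ (c *ᶻ X₁ -ᶻ d *ᶻ Y₁)))) ≡
      (β *ᶻ (α′ *ᶻ φ₂ +ᶻ A₁) +ᶻ (α *ᶻ B₁ +ᶻ BA)) +ᶻ (c *ᶻ (X₀ +ᶻ X₁) -ᶻ d *ᶻ (Y₀ +ᶻ Y₁))
    collect = solve 13 (λ β α′ φ₂ c X₀ d Y₀ α B₁ A₁ BA X₁ Y₁ →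
      (β :* (α′ :* φ₂) :+ (c :* X₀ :- d :* Y₀)) :+ (α :* B₁ :+ (β :* A₁ :+ (BA :+ (c :* X₁ :- d :* Y₁))))
      := (β :* (α′ :* φ₂ :+ A₁) :+ (α :* B₁ :+ BA)) :+ (c :* (X₀ :+ X₁) :- d :* (Y₀ :+ Y₁))) ≡.refl

  Commute : Op Q Q → Op Q Q → Set
  Commute a b = ∀ ψ q → (a · b · ψ) q ≡ (b · a · ψ) q

  dΓ-commute : ∀ a b → Commute a b → ∀ {r} (φ : Vec Q r → ℤ) qs → dΓ a (dΓ b φ) qs ≡ dΓ b (dΓ a φ) qs
  dΓ-commute a b h φ qs = ≡.trans
    (dΓ-commutator a b (+ 0) a (+ 0) a (λ ψ q → ≡.trans (h ψ q) (pad ((b · a · ψ) q) ((a · ψ) q))) φ qs) (≡.sym (pad (dΓ b (dΓ a φ) qs) (dΓ a φ qs)))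
    where
    pad : ∀ z w → z ≡ z +ᶻ (+ 0 *ᶻ w -ᶻ + 0 *ᶻ w)
    pad = solve 2 (λ z w → z := z :+ (con (+ 0) :* w :- con (+ 0) :* w)) ≡.refl
      where open ℤK

  -- A Leibniz rule: a derivation of the tensor algebra hits either the new covector or the old
  -- factors.
  dΓ-δ : ∀ {n} a (g : Q → ℤ) (φ : Vec Q n → ℤ) l → dΓ a (ℤW.δ g φ) l ≡ ℤW.δ (a · g) φ l +ᶻ ℤW.δ g (dΓ a φ) l
  dΓ-δ {zero} a g φ (q ∷ []) = solve 4 (λ w x y z → w :* (x :* y) :+ con (+ 0) := w :* x :* y :+ z :* con (+ 0)) ≡.refl (weight a q) _ _ (g q)
    where open ℤK
  dΓ-δ {suc n} a g φ (q ∷ l) = begin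
    w *ᶻ (g′ *ᶻ φ l -ᶻ δ g (φ ∘ (target a q ∷_)) l) +ᶻ dΓ a (λ m → g q *ᶻ φ m -ᶻ δ g (φ ∘ (q ∷_)) m) l
      ≡⟨ ≡.cong (w *ᶻ (g′ *ᶻ φ l -ᶻ δ g (φ ∘ (target a q ∷_)) l) +ᶻ_) (≡.trans (dΓ-linear a (g q) φ _ l)
           (≡.cong (g q *ᶻ dΓ a φ l +ᶻ_) (≡.trans (dΓ-neg a _ l) (≡.cong -ᶻ_ (dΓ-δ a g (φ ∘ (q ∷_)) l))))) ⟩
    w *ᶻ (g′ *ᶻ φ l -ᶻ δ g (φ ∘ (target a q ∷_)) l) +ᶻ (g q *ᶻ dΓ a φ l +ᶻ -ᶻ (δ (a · g) (φ ∘ (q ∷_)) l +ᶻ δ g (dΓ a (φ ∘ (q ∷_))) l))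
      ≡⟨ solve 8 (λ w g′ f d gq v p r → w :* (g′ :* f :- d) :+ (gq :* v :+ :- (p :+ r))
           := (w :* g′ :* f :- p) :+ (gq :* v :- (w :* d :- (:- r)))) ≡.refl w g′ (φ l) _ (g q) _ _ _ ⟩
    (w *ᶻ g′ *ᶻ φ l -ᶻ δ (a · g) (φ ∘ (q ∷_)) l) +ᶻ (g q *ᶻ dΓ a φ l -ᶻ (w *ᶻ δ g (φ ∘ (target a q ∷_)) l -ᶻ -ᶻ δ g (dΓ a (φ ∘ (q ∷_))) l))
      ≡⟨ ≡.cong (λ z → (w *ᶻ g′ *ᶻ φ l -ᶻ δ (a · g) (φ ∘ (q ∷_)) l) +ᶻ (g q *ᶻ dΓ a φ l -ᶻ z))
           (≡.trans (≡.cong (λ z → w *ᶻ δ g (φ ∘ (target a q ∷_)) l -ᶻ z) (≡.sym (ℤW.δ-neg g _ l)))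
             (≡.trans (≡.sym (ℤW.δ-linear g w _ _ l)) (ℤW.δ-cong (λ _ → ≡.refl) (λ m → ≡.cong (w *ᶻ φ (target a q ∷ m) +ᶻ_) (ℤP.neg-involutive _)) l))) ⟩
    δ (a · g) φ (q ∷ l) +ᶻ δ g (dΓ a φ) (q ∷ l) ∎
    where
    open ℤK using (solve; _:=_; _:+_; _:*_; _:-_; :-_)
    open ≡.≡-Reasoning
    open ℤW
    w = weight a q
    g′ = g (target a q)

module _ {Q U : Set} (j : Op Q U) where
  tensor : ∀ {r} → (Vec U r → ℤ) → Vec Q r → ℤ
  tensor φ [] = φ []
  tensor φ (q ∷ qs) = weight j q *ᶻ tensor (φ ∘ (target j q ∷_)) qs

  tensor-linear : ∀ {r} c (φ ψ : Vec U r → ℤ) qs → tensor (λ m → c *ᶻ φ m +ᶻ ψ m) qs ≡ c *ᶻ tensor φ qs +ᶻ tensor ψ qs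
  tensor-linear c φ ψ [] = ≡.refl
  tensor-linear c φ ψ (q ∷ qs) = ≡.trans (≡.cong (weight j q *ᶻ_) (tensor-linear c _ _ qs))
    (solve 4 (λ w c x y → w :* (c :* x :+ y) := c :* (w :* x) :+ w :* y) ≡.refl (weight j q) c _ _)
    where open ℤK

  tensor-zero : ∀ {r} {φ : Vec U r → ℤ} → (∀ m → φ m ≡ + 0) → ∀ qs → tensor φ qs ≡ + 0
  tensor-zero e [] = e []
  tensor-zero e (q ∷ qs) = ≡.trans (≡.cong (weight j q *ᶻ_) (tensor-zero (λ m → e (target j q ∷ m)) qs)) (ℤP.*-zeroʳ (weight j q))

  -- The hypothesis is the relation (a + b) j = j e in a single slot. Each summand of `dΓ` acts in
  -- one slot only, while all others see just j.
  tensor-intertwines : ∀ (a b : Op Q Q) (e : Op U U) → (∀ ψ q → (a · j · ψ) q +ᶻ (b · j · ψ) q ≡ (j · e · ψ) q) →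
    ∀ {r} (φ : Vec U r → ℤ) qs → dΓ a (tensor φ) qs +ᶻ dΓ b (tensor φ) qs ≡ tensor (dΓ e φ) qs
  tensor-intertwines a b e h φ [] = ≡.refl
  tensor-intertwines a b e h φ (q ∷ qs) = begin
    (u₁ +ᶻ dΓ a (λ m → w *ᶻ tensor φ′ m) qs) +ᶻ (u₂ +ᶻ dΓ b (λ m → w *ᶻ tensor φ′ m) qs)
      ≡⟨ ≡.cong₂ (λ x y → (u₁ +ᶻ x) +ᶻ (u₂ +ᶻ y)) (dΓ-* a w _ qs) (dΓ-* b w _ qs) ⟩
    (u₁ +ᶻ w *ᶻ dΓ a (tensor φ′) qs) +ᶻ (u₂ +ᶻ w *ᶻ dΓ b (tensor φ′) qs)
      ≡⟨ solve 5 (λ u v w x y → (u :+ w :* x) :+ (v :+ w :* y) := (u :+ v) :+ w :* (x :+ y)) ≡.refl u₁ u₂ w _ _ ⟩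
    (u₁ +ᶻ u₂) +ᶻ w *ᶻ (dΓ a (tensor φ′) qs +ᶻ dΓ b (tensor φ′) qs)
      ≡⟨ ≡.cong₂ (λ x y → x +ᶻ w *ᶻ y) (h (λ u → tensor (φ ∘ (u ∷_)) qs) q) (tensor-intertwines a b e h φ′ qs) ⟩
    w *ᶻ (weight e (target j q) *ᶻ tensor φ″ qs) +ᶻ w *ᶻ tensor (dΓ e φ′) qs
      ≡⟨ ≡.trans (≡.sym (ℤP.*-distribˡ-+ w _ _)) (≡.cong (w *ᶻ_) (≡.sym (tensor-linear (weight e (target j q)) (φ ∘ (target e (target j q) ∷_)) (dΓ e φ′) qs))) ⟩
    tensor (dΓ e φ) (q ∷ qs) ∎
    where
    open ℤK using (solve; _:=_; _:+_; _:*_)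
    open ≡.≡-Reasoning
    w = weight j q
    φ′ = φ ∘ (target j q ∷_)
    φ″ = φ ∘ (target e (target j q) ∷_)
    u₁ = (a · j · (λ u → tensor (φ ∘ (u ∷_)) qs)) q
    u₂ = (b · j · (λ u → tensor (φ ∘ (u ∷_)) qs)) q

module Pairing (A : Alg) {Q : Set} (Qs : List Q) (X : Q → Kit.Carrier A) where
  open Kit A

  -- The sum of x^w φ(w) ψ(w) over words w, which is the trace of ρ x when φ and ψ are two matrices
  -- flattened to functions and ρ is the product of one with the transpose of the other. The weight
  -- is distributed over the recursion.
  ⟨_,_⟩ : ∀ {r} → (Vec Q r → ℤ) → (Vec Q r → ℤ) → Carrier
  ⟨_,_⟩ {zero} φ ψ = ι (φ [] *ᶻ ψ [])
  ⟨_,_⟩ {suc r} φ ψ = ∑ Qs λ q → X q * ⟨ φ ∘ (q ∷_) , ψ ∘ (q ∷_) ⟩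

  pairing-cong : ∀ {r} {φ φ′ ψ ψ′ : Vec Q r → ℤ} → (∀ m → φ m ≡ φ′ m) → (∀ m → ψ m ≡ ψ′ m) → ⟨ φ , ψ ⟩ ≈ ⟨ φ′ , ψ′ ⟩
  pairing-cong {zero} e f = reflexive (≡.cong₂ (λ x y → ι (x *ᶻ y)) (e []) (f []))
  pairing-cong {suc r} e f = ∑-cong Qs λ q → *-congˡ (pairing-cong (e ∘ (q ∷_)) (f ∘ (q ∷_)))

  pairing-sym : ∀ {r} (φ ψ : Vec Q r → ℤ) → ⟨ φ , ψ ⟩ ≈ ⟨ ψ , φ ⟩
  pairing-sym {zero} φ ψ = reflexive (≡.cong ι (ℤP.*-comm (φ []) (ψ [])))
  pairing-sym {suc r} φ ψ = ∑-cong Qs λ q → *-congˡ (pairing-sym (φ ∘ (q ∷_)) (ψ ∘ (q ∷_)))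

  pairing-linear : ∀ {r} c (φ χ ψ : Vec Q r → ℤ) → ⟨ (λ m → c *ᶻ φ m +ᶻ χ m) , ψ ⟩ ≈ ι c * ⟨ φ , ψ ⟩ + ⟨ χ , ψ ⟩
  pairing-linear {zero} c φ χ ψ = trans (reflexive (≡.cong ι (≡.trans (ℤP.*-distribʳ-+ (ψ []) (c *ᶻ φ []) (χ [])) (≡.cong (_+ᶻ χ [] *ᶻ ψ []) (ℤP.*-assoc c (φ []) (ψ []))))))
    (trans (+-homo _ _) (+-congʳ (*-homo _ _)))
  pairing-linear {suc r} c φ χ ψ = begin
    ∑ Qs (λ q → X q * ⟨ (λ m → c *ᶻ φ (q ∷ m) +ᶻ χ (q ∷ m)) , ψ ∘ (q ∷_) ⟩)
      ≈⟨ ∑-cong Qs (λ q → trans (*-congˡ (pairing-linear c (φ ∘ (q ∷_)) (χ ∘ (q ∷_)) (ψ ∘ (q ∷_)))) (solve 4 (λ x c a b → x :* (c :* a :+ b) := c :* (x :* a) :+ x :* b) refl (X q) (ι c) _ _)) ⟩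
    ∑ Qs (λ q → ι c * (X q * ⟨ φ ∘ (q ∷_) , ψ ∘ (q ∷_) ⟩) + X q * ⟨ χ ∘ (q ∷_) , ψ ∘ (q ∷_) ⟩)
      ≈⟨ trans (∑-+ Qs _ _) (+-congʳ (∑-*ˡ Qs _ _)) ⟩
    ι c * ⟨ φ , ψ ⟩ + ⟨ χ , ψ ⟩ ∎
    where open R≈

  pairing-+ : ∀ {r} (φ χ ψ : Vec Q r → ℤ) → ⟨ (λ m → φ m +ᶻ χ m) , ψ ⟩ ≈ ⟨ φ , ψ ⟩ + ⟨ χ , ψ ⟩
  pairing-+ φ χ ψ = trans (pairing-cong (λ m → ≡.cong (_+ᶻ χ m) (≡.sym (ℤP.*-identityˡ (φ m)))) (λ _ → ≡.refl))
    (trans (pairing-linear (+ 1) φ χ ψ) (+-congʳ (trans (*-congʳ 1-homo) (*-identityˡ _))))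

  pairing-* : ∀ {r} c (φ ψ : Vec Q r → ℤ) → ⟨ (λ m → c *ᶻ φ m) , ψ ⟩ ≈ ι c * ⟨ φ , ψ ⟩
  pairing-* c φ ψ = trans (pairing-cong (λ m → ℤK.solve 2 (λ c x → c ℤK.:* x ℤK.:= (c ℤK.:- ℤK.con (+ 1)) ℤK.:* x ℤK.:+ x) ≡.refl c (φ m)) (λ _ → ≡.refl))
    (trans (pairing-linear (c -ᶻ + 1) φ φ ψ) (trans (+-congʳ (*-congʳ (trans (+-homo c (-ᶻ (+ 1))) (+-congˡ (-‿homo (+ 1))))))
      (solve 2 (λ c x → (c :- con (+ 1)) :* x :+ x := c :* x) refl (ι c) _)))

  pairing-zero : ∀ {r} {φ : Vec Q r → ℤ} ψ → (∀ m → φ m ≡ + 0) → ⟨ φ , ψ ⟩ ≈ 0#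
  pairing-zero {φ = φ} ψ e = trans (pairing-cong {ψ = ψ} (λ m → ≡.trans (e m) (≡.sym (≡.cong (_-ᶻ (+ 0)) (e m)))) (λ _ → ≡.refl))
    (trans (pairing-cong {ψ = ψ} (λ m → ≡.trans (ℤP.+-identityʳ (φ m)) (≡.trans (e m) (≡.sym (ℤP.*-zeroˡ (φ m))))) (λ _ → ≡.refl))
      (trans (pairing-* (+ 0) φ ψ) (trans (*-congʳ 0-homo) (zeroˡ _))))

  pairing-∑ : ∀ {r} {I : Set} (is : List I) (φ : I → Vec Q r → ℤ) ψ → ⟨ (λ m → ℤK.∑ is (λ i → φ i m)) , ψ ⟩ ≈ ∑ is (λ i → ⟨ φ i , ψ ⟩)
  pairing-∑ [] φ ψ = pairing-zero ψ λ _ → ≡.refl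
  pairing-∑ (i ∷ is) φ ψ = trans (pairing-+ (φ i) _ ψ) (+-congˡ (pairing-∑ is φ ψ))

  -- y a* = z b with respect to the weights X, in one tensor factor.
  Adjoint : Carrier → Carrier → Op Q Q → Op Q Q → Set
  Adjoint y z a b = ∀ (G : Q → Q → Carrier) →
    y * ∑ Qs (λ q → X q * (ι (weight a q) * G (target a q) q)) ≈ z * ∑ Qs (λ q → X q * (ι (weight b q) * G q (target b q)))

  -- A summand of `dΓ` touches a single slot. Packing all other slots into the function `G` reduces
  -- the claim to the one-slot hypothesis.
  dΓ-adjoint : ∀ {y z a b} → Adjoint y z a b → ∀ {r} (φ ψ : Vec Q r → ℤ) → y * ⟨ dΓ a φ , ψ ⟩ ≈ z * ⟨ φ , dΓ b ψ ⟩
  dΓ-adjoint {y} {z} adj {zero} φ ψ = trans (trans (*-congˡ 0-homo) (zeroʳ y))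
    (sym (trans (*-congˡ (trans (reflexive (≡.cong ι (ℤP.*-zeroʳ (φ [])))) 0-homo)) (zeroʳ z)))
  dΓ-adjoint {y} {z} {a} {b} adj {suc r} φ ψ = begin
    y * ∑ Qs (λ q → X q * ⟨ (λ m → weight a q *ᶻ φ (target a q ∷ m) +ᶻ dΓ a (φ ∘ (q ∷_)) m) , ψ ∘ (q ∷_) ⟩)
      ≈⟨ *-congˡ (∑-cong Qs λ q → trans (*-congˡ (pairing-linear (weight a q) (φ ∘ (target a q ∷_)) (dΓ a (φ ∘ (q ∷_))) (ψ ∘ (q ∷_)))) (distribˡ _ _ _)) ⟩
    y * ∑ Qs (λ q → X q * (ι (weight a q) * G (target a q) q) + X q * ⟨ dΓ a (φ ∘ (q ∷_)) , ψ ∘ (q ∷_) ⟩)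
      ≈⟨ trans (*-congˡ (∑-+ Qs _ _)) (distribˡ _ _ _) ⟩
    y * ∑ Qs (λ q → X q * (ι (weight a q) * G (target a q) q)) + y * ∑ Qs (λ q → X q * ⟨ dΓ a (φ ∘ (q ∷_)) , ψ ∘ (q ∷_) ⟩)
      ≈⟨ +-cong (adj G) rest ⟩
    z * ∑ Qs (λ q → X q * (ι (weight b q) * G q (target b q))) + z * ∑ Qs (λ q → X q * ⟨ φ ∘ (q ∷_) , dΓ b (ψ ∘ (q ∷_)) ⟩)
      ≈⟨ trans (sym (distribˡ _ _ _)) (*-congˡ (sym (∑-+ Qs _ _))) ⟩
    z * ∑ Qs (λ q → X q * (ι (weight b q) * G q (target b q)) + X q * ⟨ φ ∘ (q ∷_) , dΓ b (ψ ∘ (q ∷_)) ⟩)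
      ≈⟨ *-congˡ (∑-cong Qs λ q → trans (sym (distribˡ _ _ _)) (*-congˡ (sym (linearʳ q)))) ⟩
    z * ⟨ φ , dΓ b ψ ⟩ ∎
    where
    open R≈
    G : Q → Q → Carrier
    G p q = ⟨ φ ∘ (p ∷_) , ψ ∘ (q ∷_) ⟩
    rest : y * ∑ Qs (λ q → X q * ⟨ dΓ a (φ ∘ (q ∷_)) , ψ ∘ (q ∷_) ⟩) ≈ z * ∑ Qs (λ q → X q * ⟨ φ ∘ (q ∷_) , dΓ b (ψ ∘ (q ∷_)) ⟩)
    rest = begin
      y * ∑ Qs (λ q → X q * ⟨ dΓ a (φ ∘ (q ∷_)) , ψ ∘ (q ∷_) ⟩)
        ≈⟨ sym (∑-*ˡ Qs _ _) ⟩
      ∑ Qs (λ q → y * (X q * ⟨ dΓ a (φ ∘ (q ∷_)) , ψ ∘ (q ∷_) ⟩))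
        ≈⟨ ∑-cong Qs (λ q → trans (solve 3 (λ y x u → y :* (x :* u) := x :* (y :* u)) refl y (X q) _)
             (trans (*-congˡ (dΓ-adjoint adj (φ ∘ (q ∷_)) (ψ ∘ (q ∷_)))) (solve 3 (λ y x u → x :* (y :* u) := y :* (x :* u)) refl z (X q) _))) ⟩
      ∑ Qs (λ q → z * (X q * ⟨ φ ∘ (q ∷_) , dΓ b (ψ ∘ (q ∷_)) ⟩))
        ≈⟨ ∑-*ˡ Qs _ _ ⟩
      z * ∑ Qs (λ q → X q * ⟨ φ ∘ (q ∷_) , dΓ b (ψ ∘ (q ∷_)) ⟩) ∎
    linearʳ : ∀ q → ⟨ φ ∘ (q ∷_) , (λ m → weight b q *ᶻ ψ (target b q ∷ m) +ᶻ dΓ b (ψ ∘ (q ∷_)) m) ⟩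
      ≈ ι (weight b q) * G q (target b q) + ⟨ φ ∘ (q ∷_) , dΓ b (ψ ∘ (q ∷_)) ⟩
    linearʳ q = trans (pairing-sym φ′ _) (trans (pairing-linear (weight b q) ψ′ ψ″ φ′) (+-cong (*-congˡ (pairing-sym ψ′ φ′)) (pairing-sym ψ″ φ′)))
      where
      φ′ = φ ∘ (q ∷_)
      ψ′ = ψ ∘ (target b q ∷_)
      ψ″ = dΓ b (ψ ∘ (q ∷_))

  -- Differentiating the weight x^w counts letters of w, and letter counting is the diagonal
  -- operator `a` extended to words.
  dΓ-∂ : ∀ (d : Derivation A) (a : Op Q Q) (h : Q → ℤ) → (∀ ψ q → (a · ψ) q ≡ h q *ᶻ ψ q) → (∀ q → ∂ d (X q) ≈ ι (h q) * X q) →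
    ∀ {r} (φ ψ : Vec Q r → ℤ) → ∂ d ⟨ φ , ψ ⟩ ≈ ⟨ dΓ a φ , ψ ⟩
  dΓ-∂ d a h e f {zero} φ ψ = trans (∂-ι d _) (sym 0-homo)
  dΓ-∂ d a h e f {suc r} φ ψ = begin
    ∂ d ⟨ φ , ψ ⟩
      ≈⟨ ∂-∑ A d Qs _ ⟩
    ∑ Qs (λ q → ∂ d (X q * ⟨ φ ∘ (q ∷_) , ψ ∘ (q ∷_) ⟩))
      ≈⟨ ∑-cong Qs (λ q → trans (∂-* d _ _) (trans (+-cong (*-congʳ (f q)) (*-congˡ (dΓ-∂ d a h e f (φ ∘ (q ∷_)) (ψ ∘ (q ∷_)))))
           (trans (solve 4 (λ h x u v → h :* x :* u :+ x :* v := x :* (h :* u :+ v)) refl (ι (h q)) (X q) _ _)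
             (*-congˡ (trans (sym (pairing-linear (h q) (φ ∘ (q ∷_)) (dΓ a (φ ∘ (q ∷_))) (ψ ∘ (q ∷_)))) (pairing-cong {ψ = ψ ∘ (q ∷_)} (λ m → ≡.cong (_+ᶻ dΓ a (φ ∘ (q ∷_)) m) (≡.sym (e (λ p → φ (p ∷ m)) q))) (λ _ → ≡.refl))))))) ⟩
    ⟨ dΓ a φ , ψ ⟩ ∎
    where open R≈

nonneg-pairing : ∀ n {Q : Set} (Qs : List Q) X → (∀ q → Nonneg n (X q)) → ∀ {r} (φ : Vec Q r → ℤ) →
  Nonneg n (Pairing.⟨_,_⟩ (𝕊 n) Qs X φ φ)
nonneg-pairing n Qs X p {zero} φ = nonneg-ι n _ (square (φ []))
  where
  square : ∀ z → + 0 ℤ.≤ z *ᶻ z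
  square (+ a) = ≡.subst (+ 0 ℤ.≤_) (ℤP.pos-* a a) (ℤ.+≤+ z≤n)
  square -[1+ a ] = ℤ.+≤+ z≤n
nonneg-pairing n Qs X p {suc r} φ = nonneg-∑ n Qs _ λ q → nonneg-* n (X q) _ (p q) (nonneg-pairing n Qs X p (φ ∘ (q ∷_)))

kronecker : ∀ {n} → Fin n → Fin n → ℤ
kronecker i j = if does (i F.≟ j) then + 1 else + 0

kronecker-refl : ∀ {n} (i : Fin n) → kronecker i i ≡ + 1
kronecker-refl i with i F.≟ i
... | yes _ = ≡.refl
... | no ne = ⊥-elim (ne ≡.refl)

kronecker-≢ : ∀ {n} {i j : Fin n} → i ≢ j → kronecker i j ≡ + 0
kronecker-≢ {i = i} {j} ne with i F.≟ j
... | yes e = ⊥-elim (ne e)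
... | no _ = ≡.refl

∑-kroneckerʳ : ∀ {n} (k : Fin n) (g : Fin n → ℤ) → ℤK.∑ (fins n) (λ i → kronecker i k *ᶻ g i) ≡ g k
∑-kroneckerʳ {n} k g = ≡.trans
  (Indexed.∑-single ℤAlg n _ k λ i ne → ≡.trans (≡.cong (_*ᶻ g i) (kronecker-≢ ne)) (ℤP.*-zeroˡ (g i)))
  (≡.trans (≡.cong (_*ᶻ g k) (kronecker-refl k)) (ℤP.*-identityˡ (g k)))

∑-kroneckerˡ : ∀ {n} (k : Fin n) (g : Fin n → ℤ) → ℤK.∑ (fins n) (λ i → kronecker k i *ᶻ g i) ≡ g k
∑-kroneckerˡ {n} k g = ≡.trans
  (Indexed.∑-single ℤAlg n _ k λ i ne → ≡.trans (≡.cong (_*ᶻ g i) (kronecker-≢ (ne ∘ ≡.sym))) (ℤP.*-zeroˡ (g i)))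
  (≡.trans (≡.cong (_*ᶻ g k) (kronecker-refl k)) (ℤP.*-identityˡ (g k)))

-- Commuting actions of gl and the Casimir operator

module _ (A : Alg) {Q : Set} (Qs : List Q) (wt : Q → Kit.Carrier A) where
  open Kit A
  open SecondOrder A
  open Pairing A Qs wt

  -- E is the action of gl(n) on the letter of a site, F its action on the rest of the site.
  record Action {n} (c : Coordinates n) : Set where
    field
      E F : Fin n → Fin n → Op Q Q
      E-commutator : ∀ i j k l ψ q → (E i j · E k l · ψ) q ≡
        (E k l · E i j · ψ) q +ᶻ (kronecker j k *ᶻ (E i l · ψ) q -ᶻ kronecker l i *ᶻ (E k j · ψ) q)
      E-F-commute : ∀ i j k l → Commute (E i j) (F k l)
      E-adjoint : ∀ i j → i ≢ j → Adjoint (X c j) (X c i) (E i j) (E j i)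
      F-adjoint : ∀ i j → Adjoint 1# 1# (F i j) (F j i)
      degree : Fin n → Q → ℤ
      E-diagonal : ∀ i ψ q → (E i i · ψ) q ≡ degree i q *ᶻ ψ q
      ∂-degree : ∀ i q → ∂ (D c i) (wt q) ≈ ι (degree i q) * wt q

  module _ {n} {c : Coordinates n} (act : Action c) where
    open Action act

    -- Restricted to i ≠ j because diagonal operators multiply ω by its weight, which need not be
    -- zero.
    Invariant : ∀ {r} → (Vec Q r → ℤ) → Set
    Invariant Ψ = ∀ i j → i ≢ j → ∀ qs → dΓ (E i j) Ψ qs ≡ -ᶻ dΓ (F i j) Ψ qs

    -- The inner sum repeats the diagonal term n times, in accordance with `casimir`.
    Cas : ∀ {r} → (Vec Q r → ℤ) → Vec Q r → ℤ
    Cas Ψ qs = ℤK.∑ (fins n) λ i → ℤK.∑ (fins n) λ j → dΓ (E i j) (dΓ (E j i) Ψ) qs +ᶻ dΓ (E i i) Ψ qs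

    dΓ-E : ∀ i j k l {r} (φ : Vec Q r → ℤ) qs → dΓ (E i j) (dΓ (E k l) φ) qs ≡
      dΓ (E k l) (dΓ (E i j) φ) qs +ᶻ (kronecker j k *ᶻ dΓ (E i l) φ qs -ᶻ kronecker l i *ᶻ dΓ (E k j) φ qs)
    dΓ-E i j k l = dΓ-commutator (E i j) (E k l) (kronecker j k) (E i l) (kronecker l i) (E k j) (E-commutator i j k l)

    Cas-cong : ∀ {r} {φ ψ : Vec Q r → ℤ} → (∀ qs → φ qs ≡ ψ qs) → ∀ qs → Cas φ qs ≡ Cas ψ qs
    Cas-cong e qs = ℤK.∑-cong (fins n) λ i → ℤK.∑-cong (fins n) λ j →
      ≡.cong₂ _+ᶻ_ (dΓ-cong (E i j) (dΓ-cong (E j i) e) qs) (dΓ-cong (E i i) e qs)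

    Cas-neg : ∀ {r} (φ : Vec Q r → ℤ) qs → Cas (λ m → -ᶻ φ m) qs ≡ -ᶻ Cas φ qs
    Cas-neg φ qs = ≡.trans (ℤK.∑-cong (fins n) λ i → ≡.trans (ℤK.∑-cong (fins n) λ j →
        ≡.trans (≡.cong₂ _+ᶻ_ (≡.trans (dΓ-cong (E i j) (dΓ-neg (E j i) φ) qs) (dΓ-neg (E i j) _ qs)) (dΓ-neg (E i i) φ qs))
          (≡.sym (ℤP.neg-distrib-+ (dΓ (E i j) (dΓ (E j i) φ) qs) (dΓ (E i i) φ qs))))
        (ℤK.∑-neg (fins n) _)) (ℤK.∑-neg (fins n) _)

    dΓ-Cas : ∀ b {r} (φ : Vec Q r → ℤ) qs → dΓ b (Cas φ) qs ≡
      ℤK.∑ (fins n) (λ i → ℤK.∑ (fins n) (λ j → dΓ b (dΓ (E i j) (dΓ (E j i) φ)) qs +ᶻ dΓ b (dΓ (E i i) φ) qs))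
    dΓ-Cas b φ qs = ≡.trans (dΓ-∑ b (fins n) _ qs) (ℤK.∑-cong (fins n) λ i →
      ≡.trans (dΓ-∑ b (fins n) _ qs) (ℤK.∑-cong (fins n) λ j → dΓ-+ b _ _ qs))

    Cas-commute : ∀ b → (∀ i j → Commute (E i j) b) → ∀ {r} (φ : Vec Q r → ℤ) qs → dΓ b (Cas φ) qs ≡ Cas (dΓ b φ) qs
    Cas-commute b h φ qs = ≡.trans (dΓ-Cas b φ qs) (ℤK.∑-cong (fins n) λ i → ℤK.∑-cong (fins n) λ j → ≡.cong₂ _+ᶻ_
      (≡.trans (≡.sym (dΓ-commute (E i j) b (h i j) _ qs)) (dΓ-cong (E i j) (λ m → ≡.sym (dΓ-commute (E j i) b (h j i) φ m)) qs))
      (≡.sym (dΓ-commute (E i i) b (h i i) φ qs)))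

    -- The Kronecker symbols in the commutators with E_kl contract one index. What remains cancels
    -- in pairs: `a` against `d`, `c′` against `b`, and the linear terms against each other.
    Cas-central : ∀ k l {r} (φ : Vec Q r → ℤ) qs → dΓ (E k l) (Cas φ) qs ≡ Cas (dΓ (E k l) φ) qs
    Cas-central k l φ qs = ≡.sym (begin
      Cas (dΓ (E k l) φ) qs
        ≡⟨ ℤK.∑-cong (fins n) (λ i → ℤK.∑-cong (fins n) (λ j → ≡.trans (≡.cong₂ _+ᶻ_ (quadratic i j) (dΓ-E i i k l φ qs))
             (regroup (P i j) (H i) (kronecker j k *ᶻ a i j) (kronecker l i *ᶻ b i j) (kronecker i k *ᶻ c′ i j) (kronecker l j *ᶻ d i j)
               (kronecker i k *ᶻ e i l) (kronecker l i *ᶻ e k i)))) ⟩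
      ∑ᶻ (fins n) (λ i → ∑ᶻ (fins n) (λ j → (P i j +ᶻ H i) +ᶻ (f₁ i j +ᶻ (f₂ i j +ᶻ f₃ i))))
        ≡⟨ ∑∑-+ (λ i j → P i j +ᶻ H i) _ ⟩
      PH +ᶻ ∑ᶻ (fins n) (λ i → ∑ᶻ (fins n) (λ j → f₁ i j +ᶻ (f₂ i j +ᶻ f₃ i)))
        ≡⟨ ≡.cong (PH +ᶻ_) (≡.trans (∑∑-+ f₁ _) (≡.cong₂ _+ᶻ_ (∑ᶻ-zero (fins n) λ i → cancel (a i) (d i) ≡.refl)
             (≡.trans (∑ᶻ-swap (fins n) (fins n) _) (∑ᶻ-zero (fins n) λ j → ≡.trans (∑ᶻ-+ (fins n) _ _)
               (≡.cong₂ _+ᶻ_ (cancel (λ i → c′ i j) (λ i → b i j) ≡.refl) (cancel (λ i → e i l) (e k) ≡.refl)))))) ⟩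
      PH +ᶻ + 0
        ≡⟨ ℤP.+-identityʳ PH ⟩
      PH
        ≡⟨ ≡.sym (dΓ-Cas (E k l) φ qs) ⟩
      dΓ (E k l) (Cas φ) qs ∎)
      where
      open ℤK using () renaming (∑ to ∑ᶻ; ∑-+ to ∑ᶻ-+; ∑-zero to ∑ᶻ-zero; ∑-swap to ∑ᶻ-swap)
      open ≡.≡-Reasoning
      P = λ i j → dΓ (E k l) (dΓ (E i j) (dΓ (E j i) φ)) qs
      H = λ i → dΓ (E k l) (dΓ (E i i) φ) qs
      PH = ∑ᶻ (fins n) (λ i → ∑ᶻ (fins n) (λ j → P i j +ᶻ H i))
      a = λ i j → dΓ (E i l) (dΓ (E j i) φ) qs
      b = λ i j → dΓ (E k j) (dΓ (E j i) φ) qs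
      c′ = λ i j → dΓ (E i j) (dΓ (E j l) φ) qs
      d = λ i j → dΓ (E i j) (dΓ (E k i) φ) qs
      e = λ i j → dΓ (E i j) φ qs
      f₁ = λ i j → kronecker j k *ᶻ a i j -ᶻ kronecker l j *ᶻ d i j
      f₂ = λ i j → kronecker i k *ᶻ c′ i j -ᶻ kronecker l i *ᶻ b i j
      f₃ = λ i → kronecker i k *ᶻ e i l -ᶻ kronecker l i *ᶻ e k i
      cancel : ∀ (g g′ : Fin n → ℤ) → g k ≡ g′ l → ∑ᶻ (fins n) (λ i → kronecker i k *ᶻ g i -ᶻ kronecker l i *ᶻ g′ i) ≡ + 0
      cancel g g′ eq = ≡.trans (∑ᶻ-+ (fins n) _ _) (≡.trans (≡.cong₂ _+ᶻ_ (≡.trans (∑-kroneckerʳ k g) eq)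
        (≡.trans (ℤK.∑-neg (fins n) _) (≡.cong -ᶻ_ (∑-kroneckerˡ l g′)))) (ℤP.+-inverseʳ (g′ l)))
      ∑∑-+ : ∀ (f g : Fin n → Fin n → ℤ) → ∑ᶻ (fins n) (λ i → ∑ᶻ (fins n) (λ j → f i j +ᶻ g i j)) ≡
        ∑ᶻ (fins n) (λ i → ∑ᶻ (fins n) (f i)) +ᶻ ∑ᶻ (fins n) (λ i → ∑ᶻ (fins n) (g i))
      ∑∑-+ f g = ≡.trans (ℤK.∑-cong (fins n) λ i → ∑ᶻ-+ (fins n) (f i) (g i)) (∑ᶻ-+ (fins n) _ _)
      regroup : ∀ p h a b c d u v → (p +ᶻ (a -ᶻ b) +ᶻ (c -ᶻ d)) +ᶻ (h +ᶻ (u -ᶻ v)) ≡ (p +ᶻ h) +ᶻ ((a -ᶻ d) +ᶻ ((c -ᶻ b) +ᶻ (u -ᶻ v)))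
      regroup = ℤK.solve 8 (λ p h a b c d u v → (p ℤK.:+ (a ℤK.:- b) ℤK.:+ (c ℤK.:- d)) ℤK.:+ (h ℤK.:+ (u ℤK.:- v))
        ℤK.:= (p ℤK.:+ h) ℤK.:+ ((a ℤK.:- d) ℤK.:+ ((c ℤK.:- b) ℤK.:+ (u ℤK.:- v)))) ≡.refl
      quadratic : ∀ i j → dΓ (E i j) (dΓ (E j i) (dΓ (E k l) φ)) qs ≡
        P i j +ᶻ (kronecker j k *ᶻ a i j -ᶻ kronecker l i *ᶻ b i j) +ᶻ (kronecker i k *ᶻ c′ i j -ᶻ kronecker l j *ᶻ d i j)
      quadratic i j = ≡.trans (dΓ-cong (E i j) (dΓ-E j i k l φ) qs) (≡.trans (dΓ-+ (E i j) _ _ qs) (≡.cong₂ _+ᶻ_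
        (dΓ-E i j k l (dΓ (E j i) φ) qs)
        (≡.trans (dΓ-linear (E i j) (kronecker i k) (dΓ (E j l) φ) _ qs) (≡.cong (kronecker i k *ᶻ c′ i j +ᶻ_)
          (≡.trans (dΓ-neg (E i j) _ qs) (≡.cong -ᶻ_ (dΓ-* (E i j) (kronecker l j) (dΓ (E k i) φ) qs)))))))

    Cas-invariant : ∀ {r} {Ψ : Vec Q r → ℤ} → Invariant Ψ → Invariant (Cas Ψ)
    Cas-invariant {Ψ = Ψ} inv i j ne qs = begin
      dΓ (E i j) (Cas Ψ) qs ≡⟨ Cas-central i j Ψ qs ⟩
      Cas (dΓ (E i j) Ψ) qs ≡⟨ Cas-cong (inv i j ne) qs ⟩
      Cas (λ m → -ᶻ dΓ (F i j) Ψ m) qs ≡⟨ Cas-neg (dΓ (F i j) Ψ) qs ⟩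
      -ᶻ Cas (dΓ (F i j) Ψ) qs ≡⟨ ≡.cong -ᶻ_ (≡.sym (Cas-commute (F i j) (λ k l → E-F-commute k l i j) Ψ qs)) ⟩
      -ᶻ dΓ (F i j) (Cas Ψ) qs ∎
      where open ≡.≡-Reasoning

    pairing-neg : ∀ {r} (φ ψ : Vec Q r → ℤ) → ⟨ (λ m → -ᶻ φ m) , ψ ⟩ ≈ - ⟨ φ , ψ ⟩
    pairing-neg φ ψ = trans (pairing-cong {ψ = ψ} (λ m → ≡.sym (ℤP.-1*i≡-i (φ m))) (λ _ → ≡.refl))
        (trans (pairing-* (-ᶻ (+ 1)) φ ψ) (solve 1 (λ x → con (-ᶻ (+ 1)) :* x := :- x) refl ⟨ φ , ψ ⟩))

    -- This is cyclicity of the trace for a ρ that commutes with gl: invariance replaces E_ji by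
    -- -F_ji, which commutes past E_ij, is carried to the other argument as F_ij, and is turned back
    -- into E_ij there.
    trace-middle : ∀ {r} {Ψ Ψ′ : Vec Q r → ℤ} → Invariant Ψ → Invariant Ψ′ → ∀ i j → i ≢ j →
      ⟨ dΓ (E i j) (dΓ (E j i) Ψ) , Ψ′ ⟩ ≈ ⟨ dΓ (E i j) Ψ , dΓ (E i j) Ψ′ ⟩
    trace-middle {Ψ = Ψ} {Ψ′} inv inv′ i j ne = begin
      ⟨ dΓ (E i j) (dΓ (E j i) Ψ) , Ψ′ ⟩
        ≈⟨ pairing-cong {ψ = Ψ′} (λ m → ≡.trans (dΓ-cong (E i j) (inv j i (ne ∘ ≡.sym)) m)
             (≡.trans (dΓ-neg (E i j) (dΓ (F j i) Ψ) m) (≡.cong -ᶻ_ (dΓ-commute (E i j) (F j i) (E-F-commute i j j i) Ψ m)))) (λ _ → ≡.refl) ⟩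
      ⟨ (λ m → -ᶻ dΓ (F j i) (dΓ (E i j) Ψ) m) , Ψ′ ⟩
        ≈⟨ pairing-neg _ Ψ′ ⟩
      - ⟨ dΓ (F j i) (dΓ (E i j) Ψ) , Ψ′ ⟩
        ≈⟨ -‿cong (trans (sym (*-identityˡ _)) (trans (dΓ-adjoint (F-adjoint j i) (dΓ (E i j) Ψ) Ψ′) (*-identityˡ _))) ⟩
      - ⟨ dΓ (E i j) Ψ , dΓ (F i j) Ψ′ ⟩
        ≈⟨ trans (-‿cong (pairing-sym (dΓ (E i j) Ψ) (dΓ (F i j) Ψ′))) (trans (sym (pairing-neg _ (dΓ (E i j) Ψ))) (pairing-sym _ (dΓ (E i j) Ψ))) ⟩
      ⟨ dΓ (E i j) Ψ , (λ m → -ᶻ dΓ (F i j) Ψ′ m) ⟩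
        ≈⟨ pairing-cong {φ = dΓ (E i j) Ψ} (λ _ → ≡.refl) (λ m → ≡.sym (inv′ i j ne m)) ⟩
      ⟨ dΓ (E i j) Ψ , dΓ (E i j) Ψ′ ⟩ ∎
      where open R≈

    module _ {r} {Ψ Ψ′ : Vec Q r → ℤ} (inv : Invariant Ψ) (inv′ : Invariant Ψ′) where
      open R≈

      trace : Fin n → Fin n → Carrier
      trace i j = ⟨ dΓ (E i j) (dΓ (E j i) Ψ) , Ψ′ ⟩

      trace-relations : TraceRelations c ⟨ Ψ , Ψ′ ⟩ trace
      trace-relations = record { diagonal = diagonal ; conjugate = conjugate ; commutator = commutator }
        where
        ∂-pairing : ∀ i (φ : Vec Q r → ℤ) → ∂ (D c i) ⟨ φ , Ψ′ ⟩ ≈ ⟨ dΓ (E i i) φ , Ψ′ ⟩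
        ∂-pairing i φ = dΓ-∂ (D c i) (E i i) (degree i) (E-diagonal i) (∂-degree i) φ Ψ′
        diagonal : ∀ i → trace i i ≈ ∂ (D c i) (∂ (D c i) ⟨ Ψ , Ψ′ ⟩)
        diagonal i = sym (trans (∂-cong (D c i) (∂-pairing i Ψ)) (∂-pairing i (dΓ (E i i) Ψ)))
        conjugate : ∀ i j → i ≢ j → X c j * trace i j ≈ X c i * trace j i
        conjugate i j ne = begin
          X c j * ⟨ dΓ (E i j) (dΓ (E j i) Ψ) , Ψ′ ⟩
            ≈⟨ *-congˡ (trace-middle inv inv′ i j ne) ⟩
          X c j * ⟨ dΓ (E i j) Ψ , dΓ (E i j) Ψ′ ⟩
            ≈⟨ dΓ-adjoint (E-adjoint i j ne) Ψ (dΓ (E i j) Ψ′) ⟩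
          X c i * ⟨ Ψ , dΓ (E j i) (dΓ (E i j) Ψ′) ⟩
            -- The symmetric form lets `trace-middle` be applied with the two arguments exchanged,
            -- and then be undone in the original order.
            ≈⟨ *-congˡ (trans (pairing-sym Ψ _) (trans (trace-middle inv′ inv j i (ne ∘ ≡.sym))
                 (trans (pairing-sym (dΓ (E j i) Ψ′) (dΓ (E j i) Ψ)) (sym (trace-middle inv inv′ j i (ne ∘ ≡.sym)))))) ⟩
          X c i * ⟨ dΓ (E j i) (dΓ (E i j) Ψ) , Ψ′ ⟩ ∎
        commutator : ∀ i j → i ≢ j → trace i j - trace j i ≈ ∂ (D c i) ⟨ Ψ , Ψ′ ⟩ - ∂ (D c j) ⟨ Ψ , Ψ′ ⟩
        commutator i j ne = begin
          trace i j - trace j i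
            ≈⟨ +-congʳ (trans (pairing-cong {ψ = Ψ′} bracket (λ _ → ≡.refl)) (trans (pairing-+ _ _ Ψ′) (+-congˡ (trans (pairing-+ _ _ Ψ′) (+-congˡ (pairing-neg _ Ψ′)))))) ⟩
          (trace j i + (⟨ dΓ (E i i) Ψ , Ψ′ ⟩ - ⟨ dΓ (E j j) Ψ , Ψ′ ⟩)) - trace j i
            ≈⟨ solve 3 (λ x u v → (x :+ (u :- v)) :- x := u :- v) refl _ _ _ ⟩
          ⟨ dΓ (E i i) Ψ , Ψ′ ⟩ - ⟨ dΓ (E j j) Ψ , Ψ′ ⟩
            ≈⟨ +-cong (sym (∂-pairing i Ψ)) (-‿cong (sym (∂-pairing j Ψ))) ⟩
          ∂ (D c i) ⟨ Ψ , Ψ′ ⟩ - ∂ (D c j) ⟨ Ψ , Ψ′ ⟩ ∎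
          where
          bracket : ∀ m → dΓ (E i j) (dΓ (E j i) Ψ) m ≡ dΓ (E j i) (dΓ (E i j) Ψ) m +ᶻ (dΓ (E i i) Ψ m -ᶻ dΓ (E j j) Ψ m)
          bracket m = ≡.trans (dΓ-E i j j i Ψ m) (≡.cong (dΓ (E j i) (dΓ (E i j) Ψ) m +ᶻ_)
            (≡.cong₂ _-ᶻ_ (one j (dΓ (E i i) Ψ m)) (one i (dΓ (E j j) Ψ m))))
            where
            one : ∀ k z → kronecker k k *ᶻ z ≡ z
            one k z = ≡.trans (≡.cong (_*ᶻ z) (kronecker-refl k)) (ℤP.*-identityˡ z)

      pairing-Cas : ⟨ Cas Ψ , Ψ′ ⟩ ≈ casimir c trace-relations
      pairing-Cas = trans (pairing-∑ (fins n) _ Ψ′) (∑-cong (fins n) λ i →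
        trans (pairing-∑ (fins n) _ Ψ′) (∑-cong (fins n) λ j →
          trans (pairing-+ _ _ Ψ′) (+-congˡ (sym (dΓ-∂ (D c i) (E i i) (degree i) (E-diagonal i) (∂-degree i) Ψ Ψ′)))))

sign : Bool → ℤ
sign false = + 1
sign true = -[1+ 0 ]

sign-square : ∀ b z → sign b *ᶻ (sign b *ᶻ z) ≡ z
sign-square false z = ≡.trans (ℤP.*-identityˡ _) (ℤP.*-identityˡ z)
sign-square true z = ≡.trans (ℤP.-1*i≡-i _) (≡.trans (≡.cong -ᶻ_ (ℤP.-1*i≡-i z)) (ℤP.neg-involutive z))

-- Exterior algebras

-- Fermionic operators with Jordan–Wigner signs; as they act on functions of
-- subsets, the operator that removes i evaluates at P ∪ {i}.
annihilate create : ∀ {N} → Fin N → Op (Subset N) (Subset N)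
weight (annihilate F.zero) (true ∷ P) = + 0
weight (annihilate F.zero) (false ∷ P) = + 1
weight (annihilate (F.suc i)) (b ∷ P) = sign b *ᶻ weight (annihilate i) P
target (annihilate F.zero) (b ∷ P) = true ∷ P
target (annihilate (F.suc i)) (b ∷ P) = b ∷ target (annihilate i) P
weight (create F.zero) (true ∷ P) = + 1
weight (create F.zero) (false ∷ P) = + 0
weight (create (F.suc i)) (b ∷ P) = sign b *ᶻ weight (create i) P
target (create F.zero) (b ∷ P) = false ∷ P
target (create (F.suc i)) (b ∷ P) = b ∷ target (create i) P

kronecker-suc : ∀ {n} (i j : Fin n) → kronecker (F.suc i) (F.suc j) ≡ kronecker i j
kronecker-suc i j with i F.≟ j
... | yes _ = ≡.refl
... | no _ = ≡.refl

module _ where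
  open ℤK using (solve; _:=_; _:+_; _:*_; :-_; con)

  suc-suc : ∀ b u v z → sign b *ᶻ u *ᶻ (sign b *ᶻ v *ᶻ z) ≡ u *ᶻ (v *ᶻ z)
  suc-suc b u v z = ≡.trans
    (solve 4 (λ s u v z → s :* u :* (s :* v :* z) := s :* (s :* (u :* (v :* z)))) ≡.refl (sign b) u v z)
    (sign-square b _)

  annihilate-annihilate : ∀ {N} (i j : Fin N) ψ P →
    (annihilate i · annihilate j · ψ) P ≡ -ᶻ (annihilate j · annihilate i · ψ) P
  annihilate-annihilate F.zero F.zero ψ (true ∷ P) = ≡.refl
  annihilate-annihilate F.zero F.zero ψ (false ∷ P) = ≡.refl
  annihilate-annihilate F.zero (F.suc j) ψ (true ∷ P) =
    solve 3 (λ s w z → con (+ 0) :* z := :- (s :* w :* (con (+ 0) :* z))) ≡.refl (sign true) (weight (annihilate j) P) (+ 0)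
  annihilate-annihilate F.zero (F.suc j) ψ (false ∷ P) =
    solve 2 (λ w z → con (+ 1) :* (con (-ᶻ (+ 1)) :* w :* z) := :- (con (+ 1) :* w :* (con (+ 1) :* z))) ≡.refl (weight (annihilate j) P) _
  annihilate-annihilate (F.suc i) F.zero ψ (true ∷ P) =
    solve 3 (λ s w z → s :* w :* (con (+ 0) :* z) := :- (con (+ 0) :* z)) ≡.refl (sign true) (weight (annihilate i) P) (+ 0)
  annihilate-annihilate (F.suc i) F.zero ψ (false ∷ P) =
    solve 2 (λ w z → con (+ 1) :* w :* (con (+ 1) :* z) := :- (con (+ 1) :* (con (-ᶻ (+ 1)) :* w :* z))) ≡.refl (weight (annihilate i) P) _
  annihilate-annihilate (F.suc i) (F.suc j) ψ (b ∷ P) = ≡.trans (suc-suc b (weight (annihilate i) P) _ _)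
    (≡.trans (annihilate-annihilate i j (λ R → ψ (b ∷ R)) P)
      (≡.cong -ᶻ_ (≡.sym (suc-suc b (weight (annihilate j) P) _ _))))

  -- The canonical anticommutation relation. Crossing a position occupied by the other letter flips
  -- the Jordan-Wigner sign, which produces the minus for distinct letters.
  annihilate-create : ∀ {N} (i j : Fin N) ψ P →
    (annihilate i · create j · ψ) P ≡ kronecker i j *ᶻ ψ P +ᶻ -ᶻ (create j · annihilate i · ψ) P
  annihilate-create F.zero F.zero ψ (true ∷ P) =
    solve 2 (λ x y → con (+ 0) :* (con (+ 1) :* y) := con (+ 1) :* x :+ :- (con (+ 1) :* (con (+ 1) :* x))) ≡.refl (ψ (true ∷ P)) (ψ (false ∷ P))
  annihilate-create F.zero F.zero ψ (false ∷ P) =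
    solve 2 (λ x y → con (+ 1) :* (con (+ 1) :* x) := con (+ 1) :* x :+ :- (con (+ 0) :* (con (+ 1) :* y))) ≡.refl (ψ (false ∷ P)) (ψ (true ∷ P))
  annihilate-create F.zero (F.suc j) ψ (true ∷ P) =
    solve 4 (λ s w z x → con (+ 0) :* z := con (+ 0) :* x :+ :- (s :* w :* (con (+ 0) :* z))) ≡.refl (sign true) (weight (create j) P) (+ 0) (ψ (true ∷ P))
  annihilate-create F.zero (F.suc j) ψ (false ∷ P) =
    solve 3 (λ w z x → con (+ 1) :* (con (-ᶻ (+ 1)) :* w :* z) := con (+ 0) :* x :+ :- (con (+ 1) :* w :* (con (+ 1) :* z))) ≡.refl (weight (create j) P) _ (ψ (false ∷ P))
  annihilate-create (F.suc i) F.zero ψ (true ∷ P) =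
    solve 3 (λ w z x → con (-ᶻ (+ 1)) :* w :* (con (+ 1) :* z) := con (+ 0) :* x :+ :- (con (+ 1) :* (con (+ 1) :* w :* z))) ≡.refl (weight (annihilate i) P) _ (ψ (true ∷ P))
  annihilate-create (F.suc i) F.zero ψ (false ∷ P) =
    solve 3 (λ w z x → con (+ 1) :* w :* (con (+ 0) :* z) := con (+ 0) :* x :+ :- (con (+ 0) :* z)) ≡.refl (weight (annihilate i) P) (+ 0) (ψ (false ∷ P))
  annihilate-create (F.suc i) (F.suc j) ψ (b ∷ P) = ≡.trans (suc-suc b (weight (annihilate i) P) _ _)
    (≡.trans (annihilate-create i j (λ R → ψ (b ∷ R)) P)
      (≡.cong₂ (λ u v → u *ᶻ ψ (b ∷ P) +ᶻ -ᶻ v) (≡.sym (kronecker-suc i j)) (≡.sym (suc-suc b (weight (create j) P) _ _))))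

-- The matrix unit E_ij acting on the exterior algebra, seen on functions: it evaluates at the set
-- with i replaced by j.
hop : ∀ {N} → Fin N → Fin N → Op (Subset N) (Subset N)
hop i j = create i ⊙ annihilate j

match : Bool → Bool → ℤ
match true true = + 1
match false false = + 1
match _ _ = + 0

indicator : ∀ {N} → Subset N → Subset N → ℤ
indicator [] [] = + 1
indicator (a ∷ P) (b ∷ R) = match a b *ᶻ indicator P R

indicator-refl : ∀ {N} (P : Subset N) → indicator P P ≡ + 1
indicator-refl [] = ≡.refl
indicator-refl (true ∷ P) = ≡.trans (ℤP.*-identityˡ _) (indicator-refl P)
indicator-refl (false ∷ P) = ≡.trans (ℤP.*-identityˡ _) (indicator-refl P)

indicator-≢ : ∀ {N} (P R : Subset N) → P ≢ R → indicator P R ≡ + 0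
indicator-≢ [] [] ne = ⊥-elim (ne ≡.refl)
indicator-≢ (true ∷ P) (true ∷ R) ne = ≡.trans (ℤP.*-identityˡ _) (indicator-≢ P R (ne ∘ ≡.cong (true ∷_)))
indicator-≢ (false ∷ P) (false ∷ R) ne = ≡.trans (ℤP.*-identityˡ _) (indicator-≢ P R (ne ∘ ≡.cong (false ∷_)))
indicator-≢ (true ∷ P) (false ∷ R) ne = ℤP.*-zeroˡ (indicator P R)
indicator-≢ (false ∷ P) (true ∷ R) ne = ℤP.*-zeroˡ (indicator P R)

module _ where
  open ℤK using (solve; _:=_; _:+_; _:*_; :-_; con)

  step-indicator : ∀ b c u x v y → u *ᶻ x ≡ v *ᶻ y → sign c *ᶻ u *ᶻ (match b c *ᶻ x) ≡ sign b *ᶻ v *ᶻ (match b c *ᶻ y)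
  step-indicator b c u x v y e = begin
    sign c *ᶻ u *ᶻ (match b c *ᶻ x) ≡⟨ shuffle (sign c) (match b c) u x ⟩
    sign c *ᶻ match b c *ᶻ (u *ᶻ x) ≡⟨ ≡.cong₂ _*ᶻ_ (same b c) e ⟩
    sign b *ᶻ match b c *ᶻ (v *ᶻ y) ≡⟨ ≡.sym (shuffle (sign b) (match b c) v y) ⟩
    sign b *ᶻ v *ᶻ (match b c *ᶻ y) ∎
    where
    open ≡.≡-Reasoning
    shuffle : ∀ s m u x → s *ᶻ u *ᶻ (m *ᶻ x) ≡ s *ᶻ m *ᶻ (u *ᶻ x)
    shuffle = solve 4 (λ s m u x → s :* u :* (m :* x) := s :* m :* (u :* x)) ≡.refl
    same : ∀ b c → sign c *ᶻ match b c ≡ sign b *ᶻ match b c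
    same true true = ≡.refl
    same true false = ≡.refl
    same false true = ≡.refl
    same false false = ≡.refl

  annihilate-indicator : ∀ {N} (i : Fin N) P R →
    (annihilate i · indicator P) R ≡ weight (create i) P *ᶻ indicator (target (create i) P) R
  annihilate-indicator F.zero (true ∷ P) (true ∷ R) = solve 1 (λ x → con (+ 0) :* (con (+ 1) :* x) := con (+ 1) :* (con (+ 0) :* x)) ≡.refl (indicator P R)
  annihilate-indicator F.zero (true ∷ P) (false ∷ R) = ≡.refl
  annihilate-indicator F.zero (false ∷ P) (true ∷ R) = ≡.refl
  annihilate-indicator F.zero (false ∷ P) (false ∷ R) = solve 1 (λ x → con (+ 1) :* (con (+ 0) :* x) := con (+ 0) :* (con (+ 1) :* x)) ≡.refl (indicator P R)
  annihilate-indicator (F.suc i) (b ∷ P) (c ∷ R) = step-indicator b c (weight (annihilate i) R) _ (weight (create i) P) _ (annihilate-indicator i P R)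

  create-indicator : ∀ {N} (i : Fin N) P R →
    (create i · indicator P) R ≡ weight (annihilate i) P *ᶻ indicator (target (annihilate i) P) R
  create-indicator F.zero (true ∷ P) (true ∷ R) = solve 1 (λ x → con (+ 1) :* (con (+ 0) :* x) := con (+ 0) :* (con (+ 1) :* x)) ≡.refl (indicator P R)
  create-indicator F.zero (true ∷ P) (false ∷ R) = ≡.refl
  create-indicator F.zero (false ∷ P) (true ∷ R) = ≡.refl
  create-indicator F.zero (false ∷ P) (false ∷ R) = solve 1 (λ x → con (+ 0) :* (con (+ 1) :* x) := con (+ 1) :* (con (+ 0) :* x)) ≡.refl (indicator P R)
  create-indicator (F.suc i) (b ∷ P) (c ∷ R) = step-indicator b c (weight (create i) R) _ (weight (annihilate i) P) _ (create-indicator i P R)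

  -- Basis vectors are moved by the transposed operator, which is why the two letters change places.
  hop-indicator : ∀ {N} (i j : Fin N) P R → (hop i j · indicator P) R ≡ weight (hop j i) P *ᶻ indicator (target (hop j i) P) R
  hop-indicator i j P R = begin
    (hop i j · indicator P) R
      ≡⟨ ⊙-· (create i) (annihilate j) (indicator P) R ⟩
    weight (create i) R *ᶻ (annihilate j · indicator P) (target (create i) R)
      ≡⟨ ≡.cong (weight (create i) R *ᶻ_) (annihilate-indicator j P _) ⟩
    weight (create i) R *ᶻ (w *ᶻ indicator P′ (target (create i) R))
      ≡⟨ exchange (weight (create i) R) w _ ⟩
    w *ᶻ (create i · indicator P′) R
      ≡⟨ ≡.cong (w *ᶻ_) (create-indicator i P′ R) ⟩
    w *ᶻ (weight (annihilate i) P′ *ᶻ indicator (target (hop j i) P) R)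
      ≡⟨ ≡.sym (ℤP.*-assoc w _ _) ⟩
    weight (hop j i) P *ᶻ indicator (target (hop j i) P) R ∎
    where
    open ≡.≡-Reasoning
    w = weight (create j) P
    P′ = target (create j) P
    exchange : ∀ u v z → u *ᶻ (v *ᶻ z) ≡ v *ᶻ (u *ᶻ z)
    exchange = solve 3 (λ u v z → u :* (v :* z) := v :* (u :* z)) ≡.refl

infix 4 _∈ᵇ_
_∈ᵇ_ : ∀ {N} → Fin N → Subset N → Bool
i ∈ᵇ P = V.lookup P i

create-cases : ∀ {N} (i : Fin N) P → weight (create i) P ≡ + 0 ⊎ (i ∈ᵇ P) ≡ true
create-cases F.zero (true ∷ P) = inj₂ ≡.refl
create-cases F.zero (false ∷ P) = inj₁ ≡.refl
create-cases (F.suc i) (b ∷ P) with create-cases i P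
... | inj₁ e = inj₁ (≡.trans (≡.cong (sign b *ᶻ_) e) (ℤP.*-zeroʳ (sign b)))
... | inj₂ e = inj₂ e

annihilate-cases : ∀ {N} (i : Fin N) P → weight (annihilate i) P ≡ + 0 ⊎ (i ∈ᵇ P) ≡ false
annihilate-cases F.zero (true ∷ P) = inj₁ ≡.refl
annihilate-cases F.zero (false ∷ P) = inj₂ ≡.refl
annihilate-cases (F.suc i) (b ∷ P) with annihilate-cases i P
... | inj₁ e = inj₁ (≡.trans (≡.cong (sign b *ᶻ_) e) (ℤP.*-zeroʳ (sign b)))
... | inj₂ e = inj₂ e

create-target : ∀ {N} (i : Fin N) P → target (create i) P ≡ P V.[ i ]≔ false
create-target F.zero (b ∷ P) = ≡.refl
create-target (F.suc i) (b ∷ P) = ≡.cong (b ∷_) (create-target i P)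

annihilate-target : ∀ {N} (i : Fin N) P → target (annihilate i) P ≡ P V.[ i ]≔ true
annihilate-target F.zero (b ∷ P) = ≡.refl
annihilate-target (F.suc i) (b ∷ P) = ≡.cong (b ∷_) (annihilate-target i P)

hop-target : ∀ {N} (i j : Fin N) P → target (hop i j) P ≡ (P V.[ i ]≔ false) V.[ j ]≔ true
hop-target i j P = ≡.trans (annihilate-target j _) (≡.cong (V._[ j ]≔ true) (create-target i P))

hop-cases : ∀ {N} (i j : Fin N) → i ≢ j → ∀ P → weight (hop i j) P ≡ + 0 ⊎ ((i ∈ᵇ P) ≡ true × (j ∈ᵇ P) ≡ false)
hop-cases i j ne P with create-cases i P | annihilate-cases j (target (create i) P)
... | inj₁ e | _ = inj₁ (≡.trans (≡.cong (_*ᶻ weight (annihilate j) (target (create i) P)) e) (ℤP.*-zeroˡ (weight (annihilate j) (target (create i) P))))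
... | inj₂ _ | inj₁ e = inj₁ (≡.trans (≡.cong (weight (create i) P *ᶻ_) e) (ℤP.*-zeroʳ (weight (create i) P)))
... | inj₂ e | inj₂ e′ = inj₂ (e , ≡.trans (≡.sym (VP.lookup∘updateAt′ j i (ne ∘ ≡.sym) P))
        (≡.trans (≡.cong (λ R → V.lookup R j) (≡.sym (create-target i P))) e′))

module _ {N : ℕ} where
  open ℤW

  -- The wedge of the basis vectors in `bs`, realised as an alternating function on tuples.
  ω : (bs : List (Subset N)) → Vec (Subset N) (L.length bs) → ℤ
  ω [] _ = + 1
  ω (b ∷ bs) = δ (indicator b) (ω bs)

  ω-alternating : ∀ bs → Alternating (ω bs)
  ω-alternating [] = tt
  ω-alternating (b ∷ bs) = δ-alternating (indicator b) (ω bs) (ω-alternating bs)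

  wedge-length : List (Subset N) → ℕ → ℕ
  wedge-length [] n = n
  wedge-length (p ∷ ps) n = wedge-length ps (suc n)

  -- Holds the basis vectors already passed while an operator is moved through ω, so that the
  -- induction of `dΓ-ω-zero` can shift vectors from `bs` to `ps`. Its length is counted by an
  -- accumulator, which spares transports.
  wedge : ∀ (ps : List (Subset N)) {n} → (Vec (Subset N) n → ℤ) → Vec (Subset N) (wedge-length ps n) → ℤ
  wedge [] φ = φ
  wedge (p ∷ ps) φ = wedge ps (δ (indicator p) φ)

  wedge-cong : ∀ ps {n} {φ ψ : Vec (Subset N) n → ℤ} → (∀ l → φ l ≡ ψ l) → ∀ l → wedge ps φ l ≡ wedge ps ψ l
  wedge-cong [] e = e
  wedge-cong (p ∷ ps) e = wedge-cong ps (δ-cong (λ _ → ≡.refl) e)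

  wedge-linear : ∀ ps {n} c (φ ψ : Vec (Subset N) n → ℤ) l → wedge ps (λ m → c *ᶻ φ m -ᶻ ψ m) l ≡ c *ᶻ wedge ps φ l -ᶻ wedge ps ψ l
  wedge-linear [] c φ ψ l = ≡.refl
  wedge-linear (p ∷ ps) c φ ψ l = ≡.trans (wedge-cong ps (δ-linear (indicator p) c φ ψ) l) (wedge-linear ps c _ _ l)

  wedge-zero : ∀ ps {n} {φ : Vec (Subset N) n → ℤ} → (∀ l → φ l ≡ + 0) → ∀ l → wedge ps φ l ≡ + 0
  wedge-zero [] e = e
  wedge-zero (p ∷ ps) e = wedge-zero ps (δ-zero (indicator p) e)

  wedge-neg : ∀ ps {n} {φ : Vec (Subset N) n → ℤ} → (∀ l → wedge ps φ l ≡ + 0) → ∀ l → wedge ps (λ m → -ᶻ φ m) l ≡ + 0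
  wedge-neg ps {φ = φ} e l = ≡.trans (wedge-cong ps (λ m → ≡.sym (≡.trans (≡.cong (_-ᶻ φ m) (ℤP.*-zeroˡ (φ m))) (ℤP.+-identityˡ (-ᶻ φ m)))) l)
    (≡.trans (wedge-linear ps (+ 0) φ φ l) (≡.trans (≡.cong₂ (λ u v → + 0 *ᶻ u -ᶻ v) (e l) (e l)) ≡.refl))

  wedge-repeated : ∀ {p ps} → p ∈ ps → ∀ {n} (φ : Vec (Subset N) n → ℤ) l → wedge ps (δ (indicator p) φ) l ≡ + 0
  wedge-repeated {p} {p ∷ ps} (here ≡.refl) φ = wedge-zero ps (δ-square (indicator p) φ)
  wedge-repeated {p} {q ∷ ps} (there i) φ l = ≡.trans (wedge-cong ps (δ-anticomm (indicator q) (indicator p) φ) l)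
    (wedge-neg ps (wedge-repeated i (δ (indicator q) φ)) l)

  ω-repeated : ∀ {p bs} → p ∈ bs → ∀ l → δ (indicator p) (ω bs) l ≡ + 0
  ω-repeated {p} {p ∷ bs} (here ≡.refl) = δ-square (indicator p) (ω bs)
  ω-repeated {p} {b ∷ bs} (there i) l = ≡.trans (δ-anticomm (indicator p) (indicator b) (ω bs) l)
    (≡.cong -ᶻ_ (δ-zero (indicator b) (ω-repeated i) l))

  -- An operator that moves every basis vector to a multiple of another one
  -- among bs is traceless and so kills the top exterior power.
  dΓ-ω-zero : ∀ (e : Op (Subset N) (Subset N)) (c : Subset N → ℤ) (t : Subset N → Subset N) →
    (∀ b u → (e · indicator b) u ≡ c b *ᶻ indicator (t b) u) →
    ∀ ps bs → (∀ {b} → b ∈ bs → c b ≡ + 0 ⊎ ((t b ∈ ps ⊎ t b ∈ bs) × t b ≢ b)) →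
    ∀ l → wedge ps (dΓ e (ω bs)) l ≡ + 0
  dΓ-ω-zero e c t h ps [] k = wedge-zero ps λ { [] → ≡.refl }
  dΓ-ω-zero e c t h ps (b ∷ bs) k l = begin
    wedge ps (dΓ e (δ (indicator b) (ω bs))) l
      ≡⟨ wedge-cong ps (λ m → ≡.trans (dΓ-δ e (indicator b) (ω bs) m) (≡.cong (_+ᶻ δ (indicator b) (dΓ e (ω bs)) m)
           (≡.trans (δ-cong (h b) (λ _ → ≡.refl) m) (δ-scaleˡ (c b) (indicator (t b)) (ω bs) m)))) l ⟩
    wedge ps (λ m → c b *ᶻ δ (indicator (t b)) (ω bs) m +ᶻ δ (indicator b) (dΓ e (ω bs)) m) l
      ≡⟨ wedge-cong ps (λ m → ≡.cong (c b *ᶻ δ (indicator (t b)) (ω bs) m +ᶻ_) (≡.sym (ℤP.neg-involutive _))) l ⟩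
    wedge ps (λ m → c b *ᶻ δ (indicator (t b)) (ω bs) m -ᶻ -ᶻ δ (indicator b) (dΓ e (ω bs)) m) l
      ≡⟨ wedge-linear ps (c b) _ _ l ⟩
    c b *ᶻ wedge ps (δ (indicator (t b)) (ω bs)) l -ᶻ wedge ps (λ m → -ᶻ δ (indicator b) (dΓ e (ω bs)) m) l
      ≡⟨ ≡.cong₂ _-ᶻ_ (first (k (here ≡.refl))) (wedge-neg ps (dΓ-ω-zero e c t h (b ∷ ps) bs (λ i → shift (k (there i)))) l) ⟩
    + 0 ∎
    where
    open ≡.≡-Reasoning
    shift : ∀ {b′} → c b′ ≡ + 0 ⊎ ((t b′ ∈ ps ⊎ t b′ ∈ b ∷ bs) × t b′ ≢ b′) → c b′ ≡ + 0 ⊎ ((t b′ ∈ b ∷ ps ⊎ t b′ ∈ bs) × t b′ ≢ b′)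
    shift (inj₁ e) = inj₁ e
    shift (inj₂ (inj₁ i , ne)) = inj₂ (inj₁ (there i) , ne)
    shift (inj₂ (inj₂ (here e) , ne)) = inj₂ (inj₁ (here e) , ne)
    shift (inj₂ (inj₂ (there i) , ne)) = inj₂ (inj₂ i , ne)
    first : c b ≡ + 0 ⊎ ((t b ∈ ps ⊎ t b ∈ b ∷ bs) × t b ≢ b) → c b *ᶻ wedge ps (δ (indicator (t b)) (ω bs)) l ≡ + 0
    first (inj₁ e) = ≡.trans (≡.cong (_*ᶻ wedge ps (δ (indicator (t b)) (ω bs)) l) e) (ℤP.*-zeroˡ (wedge ps (δ (indicator (t b)) (ω bs)) l))
    first (inj₂ (inj₁ i , ne)) = ≡.trans (≡.cong (c b *ᶻ_) (wedge-repeated i (ω bs) l)) (ℤP.*-zeroʳ (c b))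
    first (inj₂ (inj₂ (here e) , ne)) = ⊥-elim (ne e)
    first (inj₂ (inj₂ (there i) , ne)) = ≡.trans (≡.cong (c b *ᶻ_) (wedge-zero ps (ω-repeated i) l)) (ℤP.*-zeroʳ (c b))

  -- By `closed`, exchanging the letter j for i sends a member of `bs` to another member, and
  -- membership of i shows the two to be different; this is what `dΓ-ω-zero` asks for.
  hop-ω : ∀ bs i j → i ≢ j →
    (∀ {b} → b ∈ bs → (j ∈ᵇ b) ≡ true → (i ∈ᵇ b) ≡ false → ((b V.[ j ]≔ false) V.[ i ]≔ true) ∈ bs) →
    ∀ l → dΓ (hop i j) (ω bs) l ≡ + 0
  hop-ω bs i j ne closed = dΓ-ω-zero (hop i j) (weight (hop j i)) (target (hop j i)) (hop-indicator i j) [] bs λ {b} mem → cases mem (hop-cases j i (ne ∘ ≡.sym) b)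
    where
    cases : ∀ {b} → b ∈ bs → weight (hop j i) b ≡ + 0 ⊎ ((j ∈ᵇ b) ≡ true × (i ∈ᵇ b) ≡ false) →
      weight (hop j i) b ≡ + 0 ⊎ ((target (hop j i) b ∈ [] ⊎ target (hop j i) b ∈ bs) × target (hop j i) b ≢ b)
    cases _ (inj₁ e) = inj₁ e
    cases {b} mem (inj₂ (p , q)) = inj₂ (inj₂ (≡.subst (_∈ bs) (≡.sym (hop-target j i b)) (closed mem p q)) , λ e →
      true≢false (≡.trans (≡.sym (VP.lookup∘updateAt i (b V.[ j ]≔ false))) (≡.trans (≡.cong (λ R → V.lookup R i) (≡.trans (≡.sym (hop-target j i b)) e)) q)))
      where
      true≢false : true ≢ false
      true≢false ()

  -- A first argument outside `bs` is orthogonal to every factor of the wedge. The equation `eq`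
  -- makes room for that first argument in a tuple whose length is computed from `bs`.
  ω-missing : ∀ bs b → b ∉ bs → ∀ {n} (eq : L.length bs ≡ suc n) (l : Vec (Subset N) n) → ω bs (≡.subst (Vec (Subset N)) (≡.sym eq) (b ∷ l)) ≡ + 0
  ω-missing (c ∷ []) b ∉bs ≡.refl [] = ≡.trans (≡.cong (_*ᶻ + 1) (indicator-≢ c b (∉bs ∘ here ∘ ≡.sym))) (ℤP.*-zeroˡ (+ 1))
  ω-missing (c ∷ d ∷ bs) b ∉bs ≡.refl l = ≡.cong₂ _-ᶻ_
    (≡.trans (≡.cong (_*ᶻ ω (d ∷ bs) l) (indicator-≢ c b (∉bs ∘ here ∘ ≡.sym))) (ℤP.*-zeroˡ (ω (d ∷ bs) l)))
    (δ-zero (indicator c) (λ m → ω-missing (d ∷ bs) b (∉bs ∘ there) ≡.refl m) l)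

  ω-head : ∀ b bs → b ∉ bs → ∀ l → ω (b ∷ bs) (b ∷ l) ≡ ω bs l
  ω-head b [] ∉bs [] = ≡.trans (ℤP.*-identityʳ _) (indicator-refl b)
  ω-head b (c ∷ bs) ∉bs l = ≡.trans (≡.cong₂ _-ᶻ_
      (≡.trans (≡.cong (_*ᶻ ω (c ∷ bs) l) (indicator-refl b)) (ℤP.*-identityˡ (ω (c ∷ bs) l)))
      (δ-zero (indicator b) (λ m → ω-missing (c ∷ bs) b ∉bs ≡.refl m) l))
    (ℤP.+-identityʳ (ω (c ∷ bs) l))

membership : Bool → ℤ
membership true = + 1
membership false = + 0

kronecker-injective : ∀ {n N} (f : Fin n → Fin N) → (∀ {i j} → f i ≡ f j → i ≡ j) → ∀ i j → kronecker (f i) (f j) ≡ kronecker i j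
kronecker-injective f inj i j with i F.≟ j
... | yes ≡.refl = kronecker-refl (f i)
... | no ne = kronecker-≢ (ne ∘ inj)

-- Splitting one letter off every exterior factor

module Fermions (A : Alg) {N : ℕ} (cs : SecondOrder.Coordinates A N) where
  open Kit A
  open SecondOrder A
  open Indexed A

  Us : List (Subset N)
  Us = allSubsets N

  -- A letter together with what is left of a subset once that letter is taken away. Letters of both
  -- alphabets are treated alike.
  Site : Set
  Site = Fin N × Subset N

  Qs : List Site
  Qs = concatMap (λ a → map (a ,_) Us) (fins N)

  wt : Site → Carrier
  wt (a , P) = X cs a

  -- The factor X_S + Y_T of the product, when u is the union of S and T.
  W : Subset N → Carrier
  W u = ∑ (fins N) λ a → ι (membership (a ∈ᵇ u)) * X cs a

  module P = Pairing A Qs wt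
  module PU = Pairing A Us W

  ∑-Qs : ∀ (f : Site → Carrier) → ∑ Qs f ≈ ∑ (fins N) (λ a → ∑ Us (λ R → f (a , R)))
  ∑-Qs f = trans (∑-concatMap _ (fins N) f) (∑-cong (fins N) λ a → ∑-map (a ,_) Us f)

  ∑-subsets : ∀ n (f : Subset (suc n) → Carrier) →
    ∑ (allSubsets (suc n)) f ≈ ∑ (allSubsets n) (λ s → f (false ∷ s)) + ∑ (allSubsets n) (λ s → f (true ∷ s))
  ∑-subsets n f = trans (∑-concatMap _ (allSubsets n) f)
    (trans (∑-cong (allSubsets n) λ s → +-congˡ (+-identityʳ _)) (∑-+ (allSubsets n) _ _))

  1*_ : ∀ z → ι (+ 1) * z ≈ z
  1* z = trans (*-congʳ 1-homo) (*-identityˡ z)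

  0*_ : ∀ z → ι (+ 0) * z ≈ 0#
  0* z = trans (*-congʳ 0-homo) (zeroˡ z)

  ι-1* : ∀ z → ι (+ 1 *ᶻ z) ≈ ι z
  ι-1* z = reflexive (≡.cong ι (ℤP.*-identityˡ z))

  ∑-indicator : ∀ {n} (b : Subset n) (f : Subset n → Carrier) → ∑ (allSubsets n) (λ u → ι (indicator b u) * f u) ≈ f b
  ∑-indicator [] f = trans (+-identityʳ _) (1* _)
  ∑-indicator {suc n} (true ∷ b) f = trans (∑-subsets n _)
    (trans (+-cong (∑-zero (allSubsets n) λ s → 0* _) (trans (∑-cong (allSubsets n) λ s → *-congʳ (ι-1* _)) (∑-indicator b (f ∘ (true ∷_)))))
      (+-identityˡ _))
  ∑-indicator {suc n} (false ∷ b) f = trans (∑-subsets n _)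
    (trans (+-cong (trans (∑-cong (allSubsets n) λ s → *-congʳ (ι-1* _)) (∑-indicator b (f ∘ (false ∷_)))) (∑-zero (allSubsets n) λ s → 0* _))
      (+-identityʳ _))

  ι-** : ∀ a b z → ι (a *ᶻ b) * z ≈ ι a * (ι b * z)
  ι-** a b z = trans (*-congʳ (*-homo a b)) (*-assoc _ _ _)

  annihilate-adjoint : ∀ {n} (i : Fin n) (G : Subset n → Subset n → Carrier) →
    ∑ (allSubsets n) (λ R → ι (weight (annihilate i) R) * G (target (annihilate i) R) R) ≈
    ∑ (allSubsets n) (λ R → ι (weight (create i) R) * G R (target (create i) R))
  annihilate-adjoint {suc n} F.zero G = begin
    ∑ (allSubsets (suc n)) (λ R → ι (weight (annihilate F.zero) R) * G (target (annihilate F.zero) R) R)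
      ≈⟨ trans (∑-subsets n _) (trans (+-congˡ (∑-zero (allSubsets n) λ s → 0* _)) (+-identityʳ _)) ⟩
    ∑ (allSubsets n) (λ s → ι (+ 1) * G (true ∷ s) (false ∷ s))
      ≈⟨ sym (trans (∑-subsets n _) (trans (+-congʳ (∑-zero (allSubsets n) λ s → 0* _)) (+-identityˡ _))) ⟩
    ∑ (allSubsets (suc n)) (λ R → ι (weight (create F.zero) R) * G R (target (create F.zero) R)) ∎
    where open R≈
  annihilate-adjoint {suc n} (F.suc i) G = trans (∑-subsets n _) (trans (+-cong (half false) (half true)) (sym (∑-subsets n _)))
    where
    half : ∀ b → ∑ (allSubsets n) (λ s → ι (sign b *ᶻ weight (annihilate i) s) * G (b ∷ target (annihilate i) s) (b ∷ s)) ≈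
      ∑ (allSubsets n) (λ s → ι (sign b *ᶻ weight (create i) s) * G (b ∷ s) (b ∷ target (create i) s))
    half b = trans (∑-cong (allSubsets n) λ s → ι-** (sign b) _ _) (trans (∑-*ˡ (allSubsets n) _ _)
      (trans (*-congˡ (annihilate-adjoint i (λ R S → G (b ∷ R) (b ∷ S)))) (sym (trans (∑-cong (allSubsets n) λ s → ι-** (sign b) _ _) (∑-*ˡ (allSubsets n) _ _)))))

  -- Inserting i is a bijection from the sets without i to those with i; the weight is a sign on the
  -- former and 0 on the rest.
  annihilate-square : ∀ {n} (i : Fin n) (g : Subset n → Carrier) →
    ∑ (allSubsets n) (λ R → ι (weight (annihilate i) R *ᶻ weight (annihilate i) R) * g (target (annihilate i) R)) ≈
    ∑ (allSubsets n) (λ R → ι (membership (i ∈ᵇ R)) * g R)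
  annihilate-square {suc n} F.zero g = begin
    ∑ (allSubsets (suc n)) (λ R → ι (weight (annihilate F.zero) R *ᶻ weight (annihilate F.zero) R) * g (target (annihilate F.zero) R))
      ≈⟨ trans (∑-subsets n _) (trans (+-congˡ (∑-zero (allSubsets n) λ s → 0* _)) (+-comm _ _)) ⟩
    0# + ∑ (allSubsets n) (λ s → ι (+ 1) * g (true ∷ s))
      ≈⟨ sym (trans (∑-subsets n _) (+-congʳ (∑-zero (allSubsets n) λ s → 0* _))) ⟩
    ∑ (allSubsets (suc n)) (λ R → ι (membership (F.zero ∈ᵇ R)) * g R) ∎
    where open R≈
  annihilate-square {suc n} (F.suc i) g = trans (∑-subsets n _) (trans (+-cong (half false) (half true)) (sym (∑-subsets n _)))
    where
    half : ∀ b → ∑ (allSubsets n) (λ s → ι (sign b *ᶻ weight (annihilate i) s *ᶻ (sign b *ᶻ weight (annihilate i) s)) * g (b ∷ target (annihilate i) s)) ≈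
      ∑ (allSubsets n) (λ s → ι (membership (i ∈ᵇ s)) * g (b ∷ s))
    half b = trans (∑-cong (allSubsets n) λ s → *-congʳ (reflexive (≡.cong ι (square b (weight (annihilate i) s)))))
      (annihilate-square i (λ R → g (b ∷ R)))
      where
      square : ∀ b w → sign b *ᶻ w *ᶻ (sign b *ᶻ w) ≡ w *ᶻ w
      square b w = ≡.trans (ℤK.solve 2 (λ s w → s ℤK.:* w ℤK.:* (s ℤK.:* w) ℤK.:= s ℤK.:* (s ℤK.:* (w ℤK.:* w))) ≡.refl (sign b) w) (sign-square b (w *ᶻ w))

  hop-adjoint : ∀ (i j : Fin N) (G : Subset N → Subset N → Carrier) →
    ∑ Us (λ R → ι (weight (hop i j) R) * G (target (hop i j) R) R) ≈ ∑ Us (λ R → ι (weight (hop j i) R) * G R (target (hop j i) R))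
  hop-adjoint i j G = begin
    ∑ Us (λ R → ι (wc i R *ᶻ wa j (tc i R)) * G (ta j (tc i R)) R)
      ≈⟨ ∑-cong Us (λ R → ι-** (wc i R) _ _) ⟩
    ∑ Us (λ R → ι (wc i R) * (ι (wa j (tc i R)) * G (ta j (tc i R)) R))
      ≈⟨ sym (annihilate-adjoint i (λ S R → ι (wa j R) * G (ta j R) S)) ⟩
    ∑ Us (λ R → ι (wa i R) * (ι (wa j R) * G (ta j R) (ta i R)))
      ≈⟨ ∑-cong Us (λ R → solve 3 (λ a b c → a :* (b :* c) := b :* (a :* c)) refl _ _ _) ⟩
    ∑ Us (λ R → ι (wa j R) * (ι (wa i R) * G (ta j R) (ta i R)))
      ≈⟨ annihilate-adjoint j (λ S R → ι (wa i R) * G S (ta i R)) ⟩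
    ∑ Us (λ R → ι (wc j R) * (ι (wa i (tc j R)) * G R (ta i (tc j R))))
      ≈⟨ ∑-cong Us (λ R → sym (ι-** (wc j R) _ _)) ⟩
    ∑ Us (λ R → ι (weight (hop j i) R) * G R (target (hop j i) R)) ∎
    where
    open R≈
    wc = λ k → weight (create {N} k)
    wa = λ k → weight (annihilate {N} k)
    tc = λ k → target (create {N} k)
    ta = λ k → target (annihilate {N} k)

  E F : Fin N → Fin N → Op Site Site
  E i j = op (λ (a , R) → kronecker a i) (λ (a , R) → j , R)
  F i j = op (λ (a , R) → weight (hop i j) R) (λ (a , R) → a , target (hop i j) R)

  -- The contraction that splits off a letter: the value at (a, R) is, up to sign, the value at R
  -- with a inserted.
  J : Op Site (Subset N)
  J = op (λ (a , R) → weight (annihilate a) R) (λ (a , R) → target (annihilate a) R)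

  E-commutator : ∀ i j k l (ψ : Site → ℤ) q → (E i j · E k l · ψ) q ≡
    (E k l · E i j · ψ) q +ᶻ (kronecker j k *ᶻ (E i l · ψ) q -ᶻ kronecker l i *ᶻ (E k j · ψ) q)
  E-commutator i j k l ψ (a , R) = ℤK.solve 6 (λ ai jk ak li x y →
    ai ℤK.:* (jk ℤK.:* x) ℤK.:= ak ℤK.:* (li ℤK.:* y) ℤK.:+ (jk ℤK.:* (ai ℤK.:* x) ℤK.:- li ℤK.:* (ak ℤK.:* y))) ≡.refl
    (kronecker a i) (kronecker j k) (kronecker a k) (kronecker l i) (ψ (l , R)) (ψ (j , R))

  E-F-commute : ∀ i j k l → Commute (E i j) (F k l)
  E-F-commute i j k l ψ (a , R) = ℤK.solve 3 (λ u v z → u ℤK.:* (v ℤK.:* z) ℤK.:= v ℤK.:* (u ℤK.:* z)) ≡.refl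
    (kronecker a i) (weight (hop k l) R) (ψ (j , target (hop k l) R))

  E-commute : ∀ i j k l → j ≢ k → l ≢ i → Commute (E i j) (E k l)
  E-commute i j k l ne ne′ ψ q = ≡.trans (E-commutator i j k l ψ q)
    (≡.trans (≡.cong₂ (λ u v → (E k l · E i j · ψ) q +ᶻ (u *ᶻ (E i l · ψ) q -ᶻ v *ᶻ (E k j · ψ) q)) (kronecker-≢ ne) (kronecker-≢ ne′))
      (ℤK.solve 3 (λ x y z → x ℤK.:+ (ℤK.con (+ 0) ℤK.:* y ℤK.:- ℤK.con (+ 0) ℤK.:* z) ℤK.:= x) ≡.refl
        ((E k l · E i j · ψ) q) ((E i l · ψ) q) ((E k j · ψ) q)))

  -- Move `annihilate a` through the hop. Its anticommutator with `create i` leaves the term E_ij,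
  -- and the signs from passing both factors cancel to leave F_ij.
  J-intertwines : ∀ i j (ψ : Subset N → ℤ) q → (E i j · J · ψ) q +ᶻ (F i j · J · ψ) q ≡ (J · hop i j · ψ) q
  J-intertwines i j ψ (a , R) = ≡.sym (begin
    weight (annihilate a) R *ᶻ (hop i j · ψ) (target (annihilate a) R)
      ≡⟨ ≡.cong (weight (annihilate a) R *ᶻ_) (⊙-· (create i) (annihilate j) ψ _) ⟩
    (annihilate a · create i · annihilate j · ψ) R
      ≡⟨ annihilate-create a i (annihilate j · ψ) R ⟩
    kronecker a i *ᶻ (annihilate j · ψ) R +ᶻ -ᶻ (create i · annihilate a · annihilate j · ψ) R
      ≡⟨ ≡.cong (λ z → kronecker a i *ᶻ (annihilate j · ψ) R +ᶻ -ᶻ (weight (create i) R *ᶻ z)) (annihilate-annihilate a j ψ (target (create i) R)) ⟩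
    kronecker a i *ᶻ (annihilate j · ψ) R +ᶻ -ᶻ (weight (create i) R *ᶻ -ᶻ (annihilate j · annihilate a · ψ) (target (create i) R))
      ≡⟨ ≡.cong (kronecker a i *ᶻ (annihilate j · ψ) R +ᶻ_) (≡.trans (neg-neg (weight (create i) R) ((annihilate j · annihilate a · ψ) (target (create i) R)))
           (≡.sym (⊙-· (create i) (annihilate j) (annihilate a · ψ) R))) ⟩
    (E i j · J · ψ) (a , R) +ᶻ (F i j · J · ψ) (a , R) ∎)
    where
    open ≡.≡-Reasoning
    neg-neg : ∀ u v → -ᶻ (u *ᶻ -ᶻ v) ≡ u *ᶻ v
    neg-neg = ℤK.solve 2 (λ u v → ℤK.:- (u ℤK.:* (ℤK.:- v)) ℤK.:= u ℤK.:* v) ≡.refl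

  ∑-kronecker : ∀ (i : Fin N) (f : Fin N → Carrier) → ∑ (fins N) (λ a → ι (kronecker a i) * f a) ≈ f i
  ∑-kronecker i f = trans (∑-single N _ i λ k ne → trans (*-congʳ (reflexive (≡.cong ι (kronecker-≢ ne)))) (0* _))
    (trans (*-congʳ (reflexive (≡.cong ι (kronecker-refl i)))) (1* _))

  -- Both sides collapse to X_i X_j times one sum over the remaining subsets; this is the relation
  -- between E_ij and its conjugate by x.
  E-adjoint : ∀ i j → P.Adjoint (X cs j) (X cs i) (E i j) (E j i)
  E-adjoint i j G = begin
    X cs j * ∑ Qs (λ q → wt q * (ι (weight (E i j) q) * G (target (E i j) q) q))
      ≈⟨ *-congˡ (collapse i (λ a R → G (j , R) (a , R))) ⟩
    X cs j * (X cs i * ∑ Us (λ R → G (j , R) (i , R)))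
      ≈⟨ solve 3 (λ x y z → x :* (y :* z) := y :* (x :* z)) refl _ _ _ ⟩
    X cs i * (X cs j * ∑ Us (λ R → G (j , R) (i , R)))
      ≈⟨ *-congˡ (sym (collapse j (λ a R → G (a , R) (i , R)))) ⟩
    X cs i * ∑ Qs (λ q → wt q * (ι (weight (E j i) q) * G q (target (E j i) q))) ∎
    where
    open R≈
    collapse : ∀ k (H : Fin N → Subset N → Carrier) → ∑ Qs (λ (a , R) → X cs a * (ι (kronecker a k) * H a R)) ≈ X cs k * ∑ Us (H k)
    collapse k H = trans (∑-Qs _) (trans (∑-cong (fins N) λ a →
        trans (∑-cong Us λ R → solve 3 (λ x k h → x :* (k :* h) := k :* (x :* h)) refl _ _ _) (∑-*ˡ Us _ _))
      (trans (∑-kronecker k _) (∑-*ˡ Us _ _)))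

  F-adjoint : ∀ i j → P.Adjoint 1# 1# (F i j) (F j i)
  F-adjoint i j G = *-congˡ (trans (∑-Qs _) (trans (∑-cong (fins N) λ a →
    trans (∑-*ˡ Us _ _) (trans (*-congˡ (hop-adjoint i j (λ R S → G (a , R) (a , S)))) (sym (∑-*ˡ Us _ _)))) (sym (∑-Qs _))))

  subCoordinates : ∀ {n} (inc : Fin n → Fin N) → (∀ {i j} → inc i ≡ inc j → i ≡ j) → Coordinates n
  subCoordinates inc inj = record { X = X cs ∘ inc ; D = D cs ∘ inc ; D-same = D-same cs ∘ inc
    ; D-diff = λ i j ne → D-diff cs (inc i) (inc j) (ne ∘ inj) }

  action : ∀ {n} (inc : Fin n → Fin N) (inj : ∀ {i j} → inc i ≡ inc j → i ≡ j) → Action A Qs wt (subCoordinates inc inj)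
  action inc inj = record
    { E = λ i j → E (inc i) (inc j)
    ; F = λ i j → F (inc i) (inc j)
    ; E-commutator = λ i j k l ψ q → ≡.trans (E-commutator (inc i) (inc j) (inc k) (inc l) ψ q)
        (≡.cong₂ (λ u v → (E (inc k) (inc l) · E (inc i) (inc j) · ψ) q +ᶻ (u *ᶻ (E (inc i) (inc l) · ψ) q -ᶻ v *ᶻ (E (inc k) (inc j) · ψ) q))
          (kronecker-injective inc inj j k) (kronecker-injective inc inj l i))
    ; E-F-commute = λ i j k l → E-F-commute (inc i) (inc j) (inc k) (inc l)
    ; E-adjoint = λ i j _ → E-adjoint (inc i) (inc j)
    ; F-adjoint = λ i j → F-adjoint (inc i) (inc j)
    ; degree = λ i (a , R) → kronecker a (inc i)
    ; E-diagonal = λ { i ψ (a , R) → diagonal a (inc i) (λ b → ψ (b , R)) }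
    ; ∂-degree = λ { i (a , R) → ∂-X a (inc i) } }
    where
    diagonal : ∀ a i (f : Fin N → ℤ) → kronecker a i *ᶻ f i ≡ kronecker a i *ᶻ f a
    diagonal a i f with a F.≟ i
    ... | yes ≡.refl = ≡.refl
    ... | no _ = ≡.refl
    ∂-X : ∀ a i → ∂ (D cs i) (X cs a) ≈ ι (kronecker a i) * X cs a
    ∂-X a i with a F.≟ i
    ... | yes ≡.refl = trans (D-same cs a) (sym (1* _))
    ... | no ne = trans (D-diff cs i a (ne ∘ ≡.sym)) (sym (0* _))

  module _ (bs : List (Subset N)) where
    Ω : Vec Site (L.length bs) → ℤ
    Ω = tensor J (ω bs)

    Ω-invariant : ∀ {n} (inc : Fin n → Fin N) (inj : ∀ {i j} → inc i ≡ inc j → i ≡ j) →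
      (∀ i j → i ≢ j → ∀ {b} → b ∈ bs → (inc j ∈ᵇ b) ≡ true → (inc i ∈ᵇ b) ≡ false → ((b V.[ inc j ]≔ false) V.[ inc i ]≔ true) ∈ bs) →
      Invariant A Qs wt (action inc inj) Ω
    Ω-invariant inc inj closed i j ne qs = move (≡.trans
      (tensor-intertwines J (E (inc i) (inc j)) (F (inc i) (inc j)) (hop (inc i) (inc j)) (J-intertwines (inc i) (inc j)) (ω bs) qs)
      (tensor-zero J (hop-ω bs (inc i) (inc j) (ne ∘ inj) (closed i j ne)) qs))
      where
      move : ∀ {u v} → u +ᶻ v ≡ + 0 → u ≡ -ᶻ v
      move {u} {v} e = ≡.trans (ℤK.solve 2 (λ u v → u ℤK.:= (u ℤK.:+ v) ℤK.:- v) ≡.refl u v) (≡.trans (≡.cong (_-ᶻ v) e) (ℤP.+-identityˡ (-ᶻ v)))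

  -- In each slot the squared entries of `J`, weighted by their letters, sum to ∑ X_a over the
  -- letters a of u, which is `W u`.
  tensor-pairing : ∀ {r} (φ ψ : Vec (Subset N) r → ℤ) → P.⟨ tensor J φ , tensor J ψ ⟩ ≈ PU.⟨ φ , ψ ⟩
  tensor-pairing {zero} φ ψ = refl
  tensor-pairing {suc r} φ ψ = begin
    ∑ Qs (λ q → wt q * P.⟨ (λ m → w q *ᶻ tensor J (φ ∘ (target J q ∷_)) m) , (λ m → w q *ᶻ tensor J (ψ ∘ (target J q ∷_)) m) ⟩)
      ≈⟨ ∑-cong Qs (λ q → *-congˡ (begin
        P.⟨ (λ m → w q *ᶻ tensor J (φ ∘ (target J q ∷_)) m) , (λ m → w q *ᶻ tensor J (ψ ∘ (target J q ∷_)) m) ⟩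
          ≈⟨ P.pairing-* (w q) (tensor J (φ ∘ (target J q ∷_))) (λ m → w q *ᶻ tensor J (ψ ∘ (target J q ∷_)) m) ⟩
        ι (w q) * P.⟨ tensor J (φ ∘ (target J q ∷_)) , (λ m → w q *ᶻ tensor J (ψ ∘ (target J q ∷_)) m) ⟩
          ≈⟨ *-congˡ (trans (P.pairing-sym (tensor J (φ ∘ (target J q ∷_))) _) (trans (P.pairing-* (w q) (tensor J (ψ ∘ (target J q ∷_))) (tensor J (φ ∘ (target J q ∷_))))
               (*-congˡ (trans (P.pairing-sym (tensor J (ψ ∘ (target J q ∷_))) (tensor J (φ ∘ (target J q ∷_)))) (tensor-pairing (φ ∘ (target J q ∷_)) (ψ ∘ (target J q ∷_))))))) ⟩
        ι (w q) * (ι (w q) * g (target J q))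
          ≈⟨ sym (ι-** (w q) (w q) _) ⟩
        ι (w q *ᶻ w q) * g (target J q) ∎)) ⟩
    ∑ Qs (λ q → wt q * (ι (w q *ᶻ w q) * g (target J q)))
      ≈⟨ trans (∑-Qs _) (∑-cong (fins N) λ a → trans (∑-*ˡ Us _ _) (trans (*-congˡ (annihilate-square a g)) (sym (∑-*ˡ Us _ _)))) ⟩
    ∑ (fins N) (λ a → ∑ Us (λ u → X cs a * (ι (membership (a ∈ᵇ u)) * g u)))
      ≈⟨ ∑-swap (fins N) Us _ ⟩
    ∑ Us (λ u → ∑ (fins N) (λ a → X cs a * (ι (membership (a ∈ᵇ u)) * g u)))
      ≈⟨ ∑-cong Us (λ u → trans (∑-cong (fins N) λ a → solve 3 (λ x m g → x :* (m :* g) := (m :* x) :* g) refl _ _ _) (∑-*ʳ (fins N) _ _)) ⟩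
    PU.⟨ φ , ψ ⟩ ∎
    where
    open R≈
    w : Site → ℤ
    w = weight J
    g : Subset N → Carrier
    g u = PU.⟨ φ ∘ (u ∷_) , ψ ∘ (u ∷_) ⟩

  open ℤW using (δ; Alternating; alternating-swap)

  -- Contraction with b is adjoint to exterior multiplication by b; on
  -- alternating functions the r+1 slots contribute equally.
  δ-contraction : ∀ b {r} (φ : Vec (Subset N) r → ℤ) (ψ : Vec (Subset N) (suc r) → ℤ) → Alternating ψ →
    PU.⟨ δ (indicator b) φ , ψ ⟩ ≈ ι (+ suc r) * (W b * PU.⟨ φ , ψ ∘ (b ∷_) ⟩)
  δ-contraction b {zero} φ ψ _ = begin
    ∑ Us (λ u → W u * ι (indicator b u *ᶻ φ [] *ᶻ ψ (u ∷ [])))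
      ≈⟨ ∑-cong Us (λ u → trans (*-congˡ (trans (reflexive (≡.cong ι (ℤP.*-assoc (indicator b u) (φ []) (ψ (u ∷ []))))) (*-homo _ _)))
           (solve 3 (λ w i z → w :* (i :* z) := i :* (w :* z)) refl _ _ _)) ⟩
    ∑ Us (λ u → ι (indicator b u) * (W u * ι (φ [] *ᶻ ψ (u ∷ []))))
      ≈⟨ ∑-indicator b _ ⟩
    W b * ι (φ [] *ᶻ ψ (b ∷ []))
      ≈⟨ sym (1* _) ⟩
    ι (+ 1) * (W b * ι (φ [] *ᶻ ψ (b ∷ []))) ∎
    where open R≈
  δ-contraction b {suc r} φ ψ alt@(swap , _ , _) = begin
    ∑ Us (λ u → W u * PU.⟨ (λ m → indicator b u *ᶻ φ m +ᶻ -ᶻ δ (indicator b) (φ ∘ (u ∷_)) m) , ψ ∘ (u ∷_) ⟩)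
      ≈⟨ ∑-cong Us (λ u → *-congˡ (trans (PU.pairing-linear (indicator b u) φ (λ m → -ᶻ δ (indicator b) (φ ∘ (u ∷_)) m) (ψ ∘ (u ∷_))) (+-congˡ (term u)))) ⟩
    ∑ Us (λ u → W u * (ι (indicator b u) * PU.⟨ φ , ψ ∘ (u ∷_) ⟩ + ι (+ suc r) * (W b * G u)))
      ≈⟨ ∑-cong Us (λ u → solve 6 (λ w i p n v g → w :* (i :* p :+ n :* (v :* g)) := i :* (w :* p) :+ (n :* v) :* (w :* g)) refl (W u) (ι (indicator b u)) PU.⟨ φ , ψ ∘ (u ∷_) ⟩ (ι (+ suc r)) (W b) (G u)) ⟩
    ∑ Us (λ u → ι (indicator b u) * (W u * PU.⟨ φ , ψ ∘ (u ∷_) ⟩) + (ι (+ suc r) * W b) * (W u * G u))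
      ≈⟨ trans (∑-+ Us _ _) (+-cong (∑-indicator b (λ u → W u * PU.⟨ φ , ψ ∘ (u ∷_) ⟩)) (∑-*ˡ Us _ _)) ⟩
    W b * PU.⟨ φ , ψ ∘ (b ∷_) ⟩ + (ι (+ suc r) * W b) * PU.⟨ φ , ψ ∘ (b ∷_) ⟩
      ≈⟨ solve 3 (λ w n p → w :* p :+ (n :* w) :* p := (con (+ 1) :+ n) :* (w :* p)) refl _ _ _ ⟩
    (ι (+ 1) + ι (+ suc r)) * (W b * PU.⟨ φ , ψ ∘ (b ∷_) ⟩)
      ≈⟨ *-congʳ (sym (+-homo (+ 1) (+ suc r))) ⟩
    ι (+ suc (suc r)) * (W b * PU.⟨ φ , ψ ∘ (b ∷_) ⟩) ∎
    where
    open R≈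
    G : Subset N → Carrier
    G u = PU.⟨ φ ∘ (u ∷_) , (λ m → ψ (b ∷ u ∷ m)) ⟩
    pairing-negate : ∀ {r} (α β : Vec (Subset N) r → ℤ) → PU.⟨ (λ m → -ᶻ α m) , β ⟩ ≈ - PU.⟨ α , β ⟩
    pairing-negate α β = trans (PU.pairing-cong {ψ = β} (λ m → ≡.sym (ℤP.-1*i≡-i (α m))) (λ _ → ≡.refl))
      (trans (PU.pairing-* (-ᶻ (+ 1)) α β) (solve 1 (λ x → con (-ᶻ (+ 1)) :* x := :- x) refl PU.⟨ α , β ⟩))
    term : ∀ u → PU.⟨ (λ m → -ᶻ δ (indicator b) (φ ∘ (u ∷_)) m) , ψ ∘ (u ∷_) ⟩ ≈ ι (+ suc r) * (W b * G u)
    term u = begin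
      PU.⟨ (λ m → -ᶻ δ (indicator b) (φ ∘ (u ∷_)) m) , ψ ∘ (u ∷_) ⟩
        ≈⟨ trans (pairing-negate (δ (indicator b) (φ ∘ (u ∷_))) (ψ ∘ (u ∷_))) (-‿cong (δ-contraction b (φ ∘ (u ∷_)) (ψ ∘ (u ∷_)) (alternating-swap ψ alt u))) ⟩
      - (ι (+ suc r) * (W b * PU.⟨ φ ∘ (u ∷_) , (λ m → ψ (u ∷ b ∷ m)) ⟩))
        -- Antisymmetry of ψ brings b in front of u, and its sign cancels the sign in the expansion
        -- of δ.
        ≈⟨ -‿cong (*-congˡ (*-congˡ (trans (PU.pairing-cong {φ = φ ∘ (u ∷_)} (λ _ → ≡.refl) (swap u b))
             (trans (PU.pairing-sym (φ ∘ (u ∷_)) _) (trans (pairing-negate (λ m → ψ (b ∷ u ∷ m)) (φ ∘ (u ∷_))) (-‿cong (PU.pairing-sym (λ m → ψ (b ∷ u ∷ m)) (φ ∘ (u ∷_))))))))) ⟩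
      - (ι (+ suc r) * (W b * - G u))
        ≈⟨ solve 3 (λ n w g → :- (n :* (w :* (:- g))) := n :* (w :* g)) refl _ _ _ ⟩
      ι (+ suc r) * (W b * G u) ∎

  -- Contracting the basis vectors one by one yields a factor `W b` and the number of slots still
  -- present; these numbers multiply to the factorial.
  ω-norm : ∀ bs → AllPairs _≢_ bs → PU.⟨ ω bs , ω bs ⟩ ≈ ι (+ (L.length bs !)) * ∏ bs W
  ω-norm [] _ = sym (*-identityʳ _)
  ω-norm (b ∷ bs) (fresh ∷ uniq) = begin
    PU.⟨ δ (indicator b) (ω bs) , ω (b ∷ bs) ⟩
      ≈⟨ δ-contraction b (ω bs) (ω (b ∷ bs)) (ω-alternating (b ∷ bs)) ⟩
    ι (+ suc r) * (W b * PU.⟨ ω bs , (λ l → ω (b ∷ bs) (b ∷ l)) ⟩)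
      ≈⟨ *-congˡ (*-congˡ (trans (PU.pairing-cong {φ = ω bs} (λ _ → ≡.refl) (ω-head b bs λ i → All.lookup fresh i ≡.refl)) (ω-norm bs uniq))) ⟩
    ι (+ suc r) * (W b * (ι (+ (r !)) * ∏ bs W))
      ≈⟨ solve 4 (λ n w k p → n :* (w :* (k :* p)) := (n :* k) :* (w :* p)) refl _ _ _ _ ⟩
    (ι (+ suc r) * ι (+ (r !))) * (W b * ∏ bs W)
      ≈⟨ *-congʳ (trans (sym (*-homo _ _)) (reflexive (≡.cong ι (≡.sym (ℤP.pos-* (suc r) (r !)))))) ⟩
    ι (+ (suc r !)) * ∏ (b ∷ bs) W ∎
    where
    open R≈
    r = L.length bs

  Ω-norm : ∀ bs → AllPairs _≢_ bs → P.⟨ Ω bs , Ω bs ⟩ ≈ ι (+ (L.length bs !)) * ∏ bs W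
  Ω-norm bs u = trans (tensor-pairing (ω bs) (ω bs)) (ω-norm bs u)

-- Adjacent transpositions of variables

data Adjacent : ℕ → Set where
  here : ∀ {n} → Adjacent (suc (suc n))
  there : ∀ {n} → Adjacent n → Adjacent (suc n)

swapVec : ∀ {X : Set} {n} → Adjacent n → Vec X n → Vec X n
swapVec here (a ∷ b ∷ l) = b ∷ a ∷ l
swapVec (there k) (a ∷ l) = a ∷ swapVec k l

swapFin : ∀ {n} → Adjacent n → Fin n → Fin n
swapFin here F.zero = F.suc F.zero
swapFin here (F.suc F.zero) = F.zero
swapFin here (F.suc (F.suc i)) = F.suc (F.suc i)
swapFin (there k) F.zero = F.zero
swapFin (there k) (F.suc i) = F.suc (swapFin k i)

tabulate-swapFin : ∀ {X : Set} {n} (k : Adjacent n) (f : Fin n → X) → V.tabulate f ~ V.tabulate (f ∘ swapFin k)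
tabulate-swapFin here f = ~-swap _ _ _
tabulate-swapFin (there k) f = ~-prep _ (tabulate-swapFin k (f ∘ F.suc))

swapHom : ∀ {N} → Adjacent N → Hom (𝕊 N) (𝕊 N)
swapHom (here {N}) = SeriesSwap.transposeHom (𝕊 N)
swapHom (there {N} k) = SeriesMaps.mapHom (𝕊 N) (swapHom k)

swapHom-gen : ∀ {N} (k : Adjacent N) i → 𝕂._≈_ N (⟪ swapHom k ⟫ (gen N i)) (gen N (swapFin k i))
swapHom-gen (here {N}) F.zero zero zero = 𝕂.refl N
swapHom-gen (here {N}) F.zero zero (suc zero) = 𝕂.refl N
swapHom-gen (here {N}) F.zero zero (suc (suc b)) = 𝕂.refl N
swapHom-gen (here {N}) F.zero (suc a) zero = 𝕂.refl N
swapHom-gen (here {N}) F.zero (suc a) (suc zero) = 𝕂.refl N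
swapHom-gen (here {N}) F.zero (suc a) (suc (suc b)) = 𝕂.refl N
swapHom-gen (here {N}) (F.suc F.zero) zero zero = 𝕂.refl N
swapHom-gen (here {N}) (F.suc F.zero) (suc zero) zero = 𝕂.refl N
swapHom-gen (here {N}) (F.suc F.zero) (suc (suc a)) zero = 𝕂.refl N
swapHom-gen (here {N}) (F.suc F.zero) zero (suc b) = 𝕂.refl N
swapHom-gen (here {N}) (F.suc F.zero) (suc zero) (suc b) = 𝕂.refl N
swapHom-gen (here {N}) (F.suc F.zero) (suc (suc a)) (suc b) = 𝕂.refl N
swapHom-gen (here {N}) (F.suc (F.suc i)) zero zero = 𝕂.refl N
swapHom-gen (here {N}) (F.suc (F.suc i)) zero (suc b) = 𝕂.refl N
swapHom-gen (here {N}) (F.suc (F.suc i)) (suc a) zero = 𝕂.refl N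
swapHom-gen (here {N}) (F.suc (F.suc i)) (suc a) (suc b) = 𝕂.refl N
swapHom-gen (there k) F.zero zero = ⟪⟫-0 (swapHom k)
swapHom-gen (there k) F.zero (suc zero) = ⟪⟫-1 (swapHom k)
swapHom-gen (there k) F.zero (suc (suc a)) = ⟪⟫-0 (swapHom k)
swapHom-gen (there k) (F.suc i) zero = swapHom-gen k i
swapHom-gen (there k) (F.suc i) (suc a) = ⟪⟫-0 (swapHom k)

at-swapHom : ∀ {N} (k : Adjacent N) f α → at N (⟪ swapHom k ⟫ f) α ≡ at N f (swapVec k α)
at-swapHom here f (a ∷ b ∷ α) = ≡.refl
at-swapHom (there k) f (a ∷ α) = at-swapHom k (f a) α

adjacentˡ : ∀ {n} m → Adjacent n → Adjacent (n ℕ.+ m)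
adjacentˡ m here = here
adjacentˡ m (there k) = there (adjacentˡ m k)

adjacentʳ : ∀ n {m} → Adjacent m → Adjacent (n ℕ.+ m)
adjacentʳ zero k = k
adjacentʳ (suc n) k = there (adjacentʳ n k)

module _ {X : Set} where
  swapVec-++ˡ : ∀ {n m} (k : Adjacent n) (u : Vec X n) (v : Vec X m) → swapVec (adjacentˡ m k) (u V.++ v) ≡ swapVec k u V.++ v
  swapVec-++ˡ here (a ∷ b ∷ u) v = ≡.refl
  swapVec-++ˡ (there k) (a ∷ u) v = ≡.cong (a ∷_) (swapVec-++ˡ k u v)

  swapVec-++ʳ : ∀ {n m} (k : Adjacent m) (u : Vec X n) (v : Vec X m) → swapVec (adjacentʳ n k) (u V.++ v) ≡ u V.++ swapVec k v
  swapVec-++ʳ k [] v = ≡.refl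
  swapVec-++ʳ k (a ∷ u) v = ≡.cong (a ∷_) (swapVec-++ʳ k u v)

swapFin-ˡˡ : ∀ {n} m (k : Adjacent n) i → swapFin (adjacentˡ m k) (i F.↑ˡ m) ≡ swapFin k i F.↑ˡ m
swapFin-ˡˡ m here F.zero = ≡.refl
swapFin-ˡˡ m here (F.suc F.zero) = ≡.refl
swapFin-ˡˡ m here (F.suc (F.suc i)) = ≡.refl
swapFin-ˡˡ m (there k) F.zero = ≡.refl
swapFin-ˡˡ m (there k) (F.suc i) = ≡.cong F.suc (swapFin-ˡˡ m k i)

swapFin-ˡʳ : ∀ {n} m (k : Adjacent n) (j : Fin m) → swapFin (adjacentˡ m k) (n F.↑ʳ j) ≡ n F.↑ʳ j
swapFin-ˡʳ m here j = ≡.refl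
swapFin-ˡʳ m (there k) j = ≡.cong F.suc (swapFin-ˡʳ m k j)

swapFin-ʳˡ : ∀ n {m} (k : Adjacent m) (i : Fin n) → swapFin (adjacentʳ n k) (i F.↑ˡ m) ≡ i F.↑ˡ m
swapFin-ʳˡ (suc n) k F.zero = ≡.refl
swapFin-ʳˡ (suc n) k (F.suc i) = ≡.cong F.suc (swapFin-ʳˡ n k i)

swapFin-ʳʳ : ∀ n {m} (k : Adjacent m) (j : Fin m) → swapFin (adjacentʳ n k) (n F.↑ʳ j) ≡ n F.↑ʳ swapFin k j
swapFin-ʳʳ zero k j = ≡.refl
swapFin-ʳʳ (suc n) k j = ≡.cong F.suc (swapFin-ʳʳ n k j)

image-tabulate : ∀ {A B : Alg} (h : Hom A B) {n} (f : Fin n → Kit.Carrier A) (g : Fin n → Kit.Carrier B) →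
  (∀ i → Kit._≈_ B (⟪ h ⟫ (f i)) (g i)) → Image h (V.tabulate f) (V.tabulate g)
image-tabulate h {zero} f g e = []
image-tabulate h {suc n} f g e = e F.zero ∷ image-tabulate h (f ∘ F.suc) (g ∘ F.suc) (e ∘ F.suc)

module _ (N : ℕ) where
  open Kit (𝕊 N)
  open Alternants (𝕊 N)

  regular-gen-difference : ∀ N i j → i ≢ j → Regular (𝕊 N) (𝕂._-_ N (gen N i) (gen N j))
  regular-gen-difference (suc N) F.zero F.zero ne = ⊥-elim (ne ≡.refl)
  regular-gen-difference (suc N) F.zero (F.suc j) ne = SeriesMaps.regular-indeterminate-const (𝕊 N) (regular-gen N j)
  regular-gen-difference (suc N) (F.suc i) F.zero ne = regular-cong (𝕊 (suc N)) (K.solve 2 (λ a b → K.:- (a K.:- b) K.:= b K.:- a) K.refl (gen (suc N) F.zero) (gen (suc N) (F.suc i)))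
    (regular-neg (𝕊 (suc N)) (SeriesMaps.regular-indeterminate-const (𝕊 N) (regular-gen N i)))
    where module K = Kit (𝕊 (suc N))
  regular-gen-difference (suc N) (F.suc i) (F.suc j) ne = regular-cong (𝕊 (suc N)) {PS.const (gen N i K.- gen N j)}
    (KS.trans {PS.const (gen N i K.- gen N j)} (PS.const-+ _ _) (KS.+-congˡ {PS.const (gen N i)} (PS.const-neg _)))
    (SeriesMaps.regular-const (𝕊 N) (regular-gen-difference N i j (ne ∘ ≡.cong F.suc)))
    where
    module K = Kit (𝕊 N)
    module KS = Kit (𝕊 (suc N))
    module PS = PowerSeries (𝕊 N)

  regular-Δ : ∀ {n} (f : Fin n → Fin N) → (∀ {i j} → f i ≡ f j → i ≡ j) → Regular (𝕊 N) (Δ (V.tabulate (gen N ∘ f)))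
  regular-Δ {zero} f inj = regular-1 (𝕊 N)
  regular-Δ {suc n} f inj = regular-* (𝕊 N) (regular-differences (f F.zero) (f ∘ F.suc) (λ j e → absurd (inj e)))
    (regular-Δ (f ∘ F.suc) (FP.suc-injective ∘ inj))
    where
    absurd : ∀ {n} {j : Fin n} → F.zero ≢ F.suc j
    absurd ()
    regular-differences : ∀ {n} i (g : Fin n → Fin N) → (∀ j → i ≢ g j) → Regular (𝕊 N) (differences (gen N i) (V.tabulate (gen N ∘ g)))
    regular-differences {zero} i g ne = regular-1 (𝕊 N)
    regular-differences {suc n} i g ne = regular-* (𝕊 N) (regular-gen-difference N i (g F.zero) (ne F.zero)) (regular-differences i (g ∘ F.suc) (ne ∘ F.suc))

  s-swapFin : ∀ {n} (f : Fin n → Fin N) → (∀ {i j} → f i ≡ f j → i ≡ j) → ∀ (h : Hom (𝕊 N) (𝕊 N)) k →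
    (∀ i → ⟪ h ⟫ (gen N (f i)) ≈ gen N (f (swapFin k i))) → ∀ μ → Decreasing μ →
    ⟪ h ⟫ (s (V.tabulate (gen N ∘ f)) μ) ≈ s (V.tabulate (gen N ∘ f)) μ
  s-swapFin f inj h k e μ d = trans (hom-s h (image-tabulate h _ _ e) μ)
    (s-~ (regular-Δ f inj) (tabulate-swapFin k (gen N ∘ f)) μ d)

  s-fixed : ∀ {n} (f : Fin n → Fin N) (h : Hom (𝕊 N) (𝕊 N)) →
    (∀ i → ⟪ h ⟫ (gen N (f i)) ≈ gen N (f i)) → ∀ μ → ⟪ h ⟫ (s (V.tabulate (gen N ∘ f)) μ) ≈ s (V.tabulate (gen N ∘ f)) μ
  s-fixed f h e μ = hom-s h (image-tabulate h _ _ e) μ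

-- Homogeneity through the total Euler derivation

module _ (A : Alg) where
  open Kit A

  addDerivation : Derivation A → Derivation A → Derivation A
  addDerivation d e = record
    { ∂ = λ x → ∂ d x + ∂ e x
    ; ∂-cong = λ p → +-cong (∂-cong d p) (∂-cong e p)
    ; ∂-+ = λ x y → trans (+-cong (∂-+ d x y) (∂-+ e x y)) (solve 4 (λ a b c f → (a :+ b) :+ (c :+ f) := (a :+ c) :+ (b :+ f)) refl _ _ _ _)
    ; ∂-* = λ x y → trans (+-cong (∂-* d x y) (∂-* e x y))
        (solve 6 (λ x y a b c f → (a :* y :+ x :* b) :+ (c :* y :+ x :* f) := (a :+ c) :* y :+ x :* (b :+ f)) refl x y _ _ _ _)
    ; ∂-ι = λ z → trans (+-cong (∂-ι d z) (∂-ι e z)) (+-identityˡ _) }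

  zeroDerivation : Derivation A
  zeroDerivation = record { ∂ = λ _ → 0# ; ∂-cong = λ _ → refl ; ∂-+ = λ _ _ → sym (+-identityˡ _)
    ; ∂-* = λ x y → sym (trans (+-cong (zeroˡ y) (zeroʳ x)) (+-identityˡ _)) ; ∂-ι = λ _ → refl }

total : ∀ N → Derivation (𝕊 N)
total zero = zeroDerivation (𝕊 0)
total (suc N) = addDerivation (𝕊 (suc N)) (SeriesMaps.euler (𝕊 N)) (SeriesMaps.mapDerivation (𝕊 N) (total N))

total-gen : ∀ N i → 𝕂._≈_ N (∂ (total N) (gen N i)) (gen N i)
total-gen (suc N) F.zero zero = trans (+-cong (zeroʳ _) (θ-0 (𝕊 N) (total N))) (+-identityˡ _) where open 𝕂 N
total-gen (suc N) F.zero (suc zero) = trans (+-cong (trans (*-congʳ 1-homo) (*-identityˡ _)) (trans (∂-cong (total N) (sym 1-homo)) (∂-ι (total N) (+ 1)))) (+-identityʳ _) where open 𝕂 N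
total-gen (suc N) F.zero (suc (suc k)) = trans (+-cong (zeroʳ _) (θ-0 (𝕊 N) (total N))) (+-identityˡ _) where open 𝕂 N
total-gen (suc N) (F.suc i) zero = trans (+-cong (trans (*-congʳ 0-homo) (zeroˡ _)) (total-gen N i)) (+-identityˡ _) where open 𝕂 N
total-gen (suc N) (F.suc i) (suc k) = trans (+-cong (zeroʳ _) (θ-0 (𝕊 N) (total N))) (+-identityˡ _) where open 𝕂 N

at-total : ∀ N f α → at N (∂ (total N) f) α ≡ + V.sum α *ᶻ at N f α
at-total zero f [] = ≡.sym (ℤP.*-zeroˡ f)
at-total (suc N) f (k ∷ α) = ≡.trans (at-+ N (𝕂._*_ N (𝕂.ι N (+ k)) (f k)) _ α) (≡.trans (≡.cong₂ _+ᶻ_ (at-ι* N (+ k) (f k) α) (at-total N (f k) α))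
  (≡.sym (ℤP.*-distribʳ-+ (at N (f k) α) (+ k) (+ V.sum α))))

Homogeneous : ∀ N → ℕ → ℂ N → Set
Homogeneous N d f = 𝕂._≈_ N (∂ (total N) f) (𝕂._*_ N (𝕂.ι N (+ d)) f)

-- At the exponent α the Euler equation says that (|α| - d) times the coefficient is 0, and the
-- integers have no zero divisors.
homogeneous-at : ∀ N d f → Homogeneous N d f → ∀ α → V.sum α ≢ d → at N f α ≡ + 0
homogeneous-at N d f h α ne with ℤP.i*j≡0⇒i≡0∨j≡0 (+ V.sum α -ᶻ + d) product
  where
  product : (+ V.sum α -ᶻ + d) *ᶻ at N f α ≡ + 0
  product = ≡.trans (ℤK.solve 3 (λ a b z → (a ℤK.:- b) ℤK.:* z ℤK.:= a ℤK.:* z ℤK.:- b ℤK.:* z) ≡.refl (+ V.sum α) (+ d) (at N f α))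
    (≡.trans (≡.cong₂ _-ᶻ_ (≡.sym (at-total N f α)) (≡.sym (at-ι* N (+ d) f α))) (≡.trans (≡.cong (_-ᶻ at N (𝕂._*_ N (𝕂.ι N (+ d)) f) α) (at-cong N h α)) (ℤP.+-inverseʳ (at N (𝕂._*_ N (𝕂.ι N (+ d)) f) α))))
... | inj₁ e = ⊥-elim (ne (ℤP.+-injective (ℤP.i-j≡0⇒i≡j (+ V.sum α) (+ d) e)))
... | inj₂ e = e

homogeneous-∏ : ∀ N {I : Set} (is : List I) (f : I → ℂ N) → (∀ i → Homogeneous N 1 (f i)) → Homogeneous N (L.length is) (𝕂.∏ N is f)
homogeneous-∏ N [] f h = trans (∂-cong (total N) (sym 1-homo)) (trans (∂-ι (total N) (+ 1)) (sym (trans (*-congʳ 0-homo) (zeroˡ _))))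
  where open 𝕂 N
homogeneous-∏ N (i ∷ is) f h = trans (∂-* (total N) _ _) (trans (+-cong (*-congʳ (h i)) (*-congˡ (homogeneous-∏ N is f h)))
  (trans (solve 3 (λ x p k → con (+ 1) :* x :* p :+ x :* (k :* p) := (con (+ 1) :+ k) :* (x :* p)) refl _ _ _) (*-congʳ (sym (+-homo (+ 1) (+ L.length is))))))
  where open 𝕂 N

-- The dominance order, expressed by the sums of the last entries.
SuffixSums : ∀ {n} → Vec ℕ n → Vec ℕ n → Set
SuffixSums [] [] = ⊤
SuffixSums (a ∷ α) (m ∷ μ) = m ℕ.+ V.sum μ ≤ a ℕ.+ V.sum α × SuffixSums α μ

infix 4 _⊴_
_⊴_ : ∀ {n} → Vec ℕ n → Vec ℕ n → Set
α ⊴ μ = V.sum α ≡ V.sum μ × SuffixSums α μ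

interlaced-tail-sum : ∀ {n m′} (μ ν : Vec ℕ n) → Interlaced (m′ ∷ μ) ν → V.sum μ ≤ V.sum ν
interlaced-tail-sum [] [] _ = z≤n
interlaced-tail-sum (m ∷ μ) (v ∷ ν) (p , _ , i) = ℕP.+-mono-≤ p (interlaced-tail-sum μ ν i)

-- Interlacing puts each entry of μ below the corresponding entry of ν, so suffix sums of μ are
-- smaller still.
suffixSums-interlaced : ∀ {n} (α ν : Vec ℕ n) m μ → Interlaced (m ∷ μ) ν → SuffixSums α ν → SuffixSums α μ
suffixSums-interlaced [] [] m [] _ _ = tt
suffixSums-interlaced (a ∷ α) (v ∷ ν) m (m′ ∷ μ) (p , q , i) (s , r) =
  ℕP.≤-trans (ℕP.+-mono-≤ p (interlaced-tail-sum μ ν i)) s , suffixSums-interlaced α ν m′ μ i r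

smallest≤head : ∀ {n} m (μ : Vec ℕ n) → Decreasing (m ∷ μ) → smallest (m ∷ μ) ≤ m
smallest≤head m [] _ = ℕP.≤-refl
smallest≤head m (m′ ∷ μ) (p , d) = ℕP.≤-trans (smallest≤head m′ μ d) p

-- Coefficients of a Schur polynomial in its first variable

module BranchCoefficients (A : Alg) where
  open Kit A
  open PowerSeries A
  open Alternants series
  module KS = Kit series

  y : Series
  y = indeterminate

  y^-⊛ : ∀ e F c → ((y KS.^ e) ⊛ F) (e ℕ.+ c) ≈ F c
  y^-⊛ zero F c = ⊛-identityˡ F c
  y^-⊛ (suc e) F c = trans (⊛-assoc y (y KS.^ e) F (suc (e ℕ.+ c))) (trans (indeterminate-⊛ ((y KS.^ e) ⊛ F) (suc (e ℕ.+ c))) (y^-⊛ e F c))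

  -- `Z` is a property of coefficients stable under sums. Vanishing and being an integer multiple of
  -- a fixed element are the instances, so one traversal of the branching sum serves both.
  module _ (Z : Carrier → Set) (Z-cong : ∀ {x y} → x ≈ y → Z y → Z x) (Z-0 : Z 0#) (Z-+ : ∀ {x y} → Z x → Z y → Z (x + y)) where
    y^-vanish : ∀ e F a → (∀ c → e ℕ.+ c ≡ a → Z (F c)) → Z (((y KS.^ e) ⊛ F) a)
    y^-vanish zero F a h = Z-cong (⊛-identityˡ F a) (h a ≡.refl)
    y^-vanish (suc e) F zero h = Z-cong (trans (⊛-assoc y (y KS.^ e) F zero) (indeterminate-⊛ ((y KS.^ e) ⊛ F) zero)) Z-0
    y^-vanish (suc e) F (suc a) h = Z-cong (trans (⊛-assoc y (y KS.^ e) F (suc a)) (indeterminate-⊛ ((y KS.^ e) ⊛ F) (suc a)))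
      (y^-vanish e F a λ c p → h c (≡.cong suc p))

    interval-vanish : ∀ b k (g : ℕ → Series) c →
      (∀ v c′ j → b ≤ v → v ≤ b ℕ.+ k → v ℕ.+ j ≡ b ℕ.+ k → j ℕ.+ c′ ≡ c → Z (g v c′)) → Z (interval y b k g c)
    interval-vanish b zero g c h = h b c 0 ℕP.≤-refl (ℕP.m≤m+n b 0) ≡.refl ≡.refl
    interval-vanish b (suc k) g c h = Z-+ (Z-cong (indeterminate-⊛ (interval y b k g) c) (shifted c h)) (h (suc (b ℕ.+ k)) c 0
      (ℕP.≤-trans (ℕP.m≤m+n b k) (ℕP.n≤1+n _)) (ℕP.≤-reflexive (≡.sym (ℕP.+-suc b k))) (≡.trans (ℕP.+-identityʳ _) (≡.sym (ℕP.+-suc b k))) ≡.refl)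
      where
      shifted : ∀ c → (∀ v c′ j → b ≤ v → v ≤ b ℕ.+ suc k → v ℕ.+ j ≡ b ℕ.+ suc k → j ℕ.+ c′ ≡ c → Z (g v c′)) → Z (shift (interval y b k g) c)
      shifted zero h = Z-0
      shifted (suc c) h = interval-vanish b k g c λ v c′ j p q r s → h v c′ (suc j) p (ℕP.≤-trans q (ℕP.+-monoʳ-≤ b (ℕP.n≤1+n k)))
        (≡.trans (ℕP.+-suc v j) (≡.trans (≡.cong suc r) (≡.sym (ℕP.+-suc b k)))) (≡.cong suc s)

    branch-vanish : ∀ {n} (μ : Vec ℕ (suc n)) (φ : Vec ℕ n → Carrier) c → Decreasing μ →
      (∀ ν → Interlaced μ ν → V.sum ν ℕ.+ (smallest μ ℕ.+ c) ≡ V.sum μ → Z (φ ν)) → Z (branch y μ (const ∘ φ) c)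
    branch-vanish (m ∷ []) φ zero d h = h [] tt ≡.refl
    branch-vanish (m ∷ []) φ (suc c) d h = Z-0
    branch-vanish (m ∷ m′ ∷ μ) φ c (p , d) h = interval-vanish m′ (m ∸ m′) _ c λ v c′ j q r s t →
      branch-vanish (m′ ∷ μ) (φ ∘ (v ∷_)) c′ d λ ν i e → h (v ∷ ν) (q , ℕP.≤-trans r (ℕP.≤-reflexive (ℕP.m+[n∸m]≡n p)) , i)
        (count v j c′ (V.sum ν) (smallest (m′ ∷ μ)) (≡.trans s (ℕP.m+[n∸m]≡n p)) t e)
      where
      open +-*-Solver using () renaming (solve to solveℕ; _:+_ to _⊞_; _:=_ to _⊜_)
      count : ∀ v j c′ sν e → v ℕ.+ j ≡ m → j ℕ.+ c′ ≡ c → sν ℕ.+ (e ℕ.+ c′) ≡ V.sum (m′ ∷ μ) → v ℕ.+ sν ℕ.+ (e ℕ.+ c) ≡ m ℕ.+ V.sum (m′ ∷ μ)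
      count v j c′ sν e ≡.refl ≡.refl q = ≡.trans (solveℕ 5 (λ v s e j c → v ⊞ s ⊞ (e ⊞ (j ⊞ c)) ⊜ v ⊞ j ⊞ (s ⊞ (e ⊞ c))) ≡.refl v sν e j c′) (≡.cong (v ℕ.+ j ℕ.+_) q)

  -- The power y^m is the highest one: an interlacing ν has at least the size of μ, with equality
  -- only for ν = μ.
  branch-top : ∀ {n} m (μ : Vec ℕ n) (φ : Vec ℕ n → Carrier) c → Decreasing (m ∷ μ) → smallest (m ∷ μ) ℕ.+ c ≡ m →
    branch y (m ∷ μ) (const ∘ φ) c ≈ φ μ
  branch-top m [] φ c _ e with c | ℕP.+-cancelˡ-≡ m c 0 (≡.trans e (≡.sym (ℕP.+-identityʳ m)))
  ... | .0 | ≡.refl = refl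
  branch-top m (m′ ∷ μ) φ c (p , d) e = trans (reflexive (≡.cong (interval y m′ k g) c≡)) (trans (interval-top k) (branch-top m′ μ (φ ∘ (m′ ∷_)) c′ d c′≡))
    where
    k = m ∸ m′
    es = smallest (m′ ∷ μ)
    c′ = m′ ∸ es
    c′≡ : es ℕ.+ c′ ≡ m′
    c′≡ = ℕP.m+[n∸m]≡n (smallest≤head m′ μ d)
    c≡ : c ≡ k ℕ.+ c′
    c≡ = ℕP.+-cancelˡ-≡ es c (k ℕ.+ c′) (≡.trans e (≡.sym (≡.trans (≡.cong (es ℕ.+_) (ℕP.+-comm k c′)) (≡.trans (≡.sym (ℕP.+-assoc es c′ k)) (≡.trans (≡.cong (ℕ._+ k) c′≡) (ℕP.m+[n∸m]≡n p))))))
    g : ℕ → Series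
    g v = branch y (m′ ∷ μ) (const ∘ φ ∘ (v ∷_))
    beyond : ∀ v c″ → c′ < c″ → g v c″ ≈ 0#
    -- A nonzero coefficient at such a power would need a ν smaller in size than the tail that it
    -- interlaces.
    beyond v c″ lt = branch-vanish (_≈ 0#) trans refl (λ a b → trans (+-cong a b) (+-identityˡ _)) (m′ ∷ μ) (φ ∘ (v ∷_)) c″ d
      λ ν i q → ⊥-elim (ℕP.<-irrefl (≡.sym q) (ℕP.≤-trans (ℕP.+-monoˡ-≤ (V.sum μ) (ℕP.≤-reflexive (≡.cong suc (≡.sym c′≡))))
        (ℕP.≤-trans (ℕP.+-mono-≤ (ℕP.≤-trans (ℕP.≤-reflexive (≡.sym (ℕP.+-suc es c′))) (ℕP.+-monoʳ-≤ es lt)) (interlaced-tail-sum μ ν i))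
          (ℕP.≤-reflexive (ℕP.+-comm (es ℕ.+ c″) (V.sum ν))))))
    interval-top : ∀ k → interval y m′ k g (k ℕ.+ c′) ≈ g m′ c′
    interval-top zero = refl
    interval-top (suc k) = trans (+-cong (trans (indeterminate-⊛ (interval y m′ k g) (suc (k ℕ.+ c′))) (interval-top k)) (beyond (suc (m′ ℕ.+ k)) (suc (k ℕ.+ c′)) (s≤s (ℕP.m≤n+m c′ k))))
      (+-identityʳ _)

  module _ {n : ℕ} (x : Fin n → Carrier) (κ : Carrier) where
    private
      module AS = Alternants A
      φ : Vec ℕ n → Carrier
      φ ν = AS.s (V.tabulate x) ν * κ

    s-coefficient : ∀ (μ : Vec ℕ (suc n)) → Decreasing μ →
      (s (y ∷ V.tabulate (const ∘ x)) μ ⊛ const κ) ≋ ((y KS.^ smallest μ) ⊛ branch y μ (const ∘ φ))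
    s-coefficient μ d = KS.trans {s (y ∷ V.tabulate (const ∘ x)) μ ⊛ const κ} (KS.*-assoc (y KS.^ smallest μ) _ _) (KS.*-congˡ {y KS.^ smallest μ}
      (KS.trans (KS.sym (branch-* y μ (const κ) _ d)) (branch-cong y μ d λ ν i →
        KS.trans (KS.*-congʳ {const κ} (KS.sym (hom-s (SeriesMaps.constHom A) (image-tabulate (SeriesMaps.constHom A) _ _ λ i → KS.refl {const (x i)}) ν)))
          (KS.sym (const-* (AS.s (V.tabulate x) ν) κ)))))

    s-vanish : ∀ (Z : Carrier → Set) → (∀ {x y} → x ≈ y → Z y → Z x) → Z 0# → (∀ {x y} → Z x → Z y → Z (x + y)) →
      ∀ (μ : Vec ℕ (suc n)) → Decreasing μ → ∀ a → (∀ ν → Interlaced μ ν → V.sum ν ℕ.+ a ≡ V.sum μ → Z (φ ν)) →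
      Z ((s (y ∷ V.tabulate (const ∘ x)) μ ⊛ const κ) a)
    s-vanish Z Z-cong Z-0 Z-+ μ d a h = Z-cong (s-coefficient μ d a)
      (y^-vanish Z Z-cong Z-0 Z-+ (smallest μ) _ a λ c e → branch-vanish Z Z-cong Z-0 Z-+ μ φ c d λ ν i e′ →
        h ν i (≡.trans (≡.cong (V.sum ν ℕ.+_) (≡.sym e)) e′))

    s-top : ∀ m (μ : Vec ℕ n) → Decreasing (m ∷ μ) → (s (y ∷ V.tabulate (const ∘ x)) (m ∷ μ) ⊛ const κ) m ≈ φ μ
    s-top m μ d = trans (s-coefficient (m ∷ μ) d m) (trans (reflexive (≡.cong ((y KS.^ e) ⊛ B) (≡.sym c≡)))
      (trans (y^-⊛ e B c) (branch-top m μ φ c d c≡)))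
      where
      e = smallest (m ∷ μ)
      c = m ∸ e
      B : Series
      B = branch y (m ∷ μ) (const ∘ φ)
      c≡ : e ℕ.+ c ≡ m
      c≡ = ℕP.m+[n∸m]≡n (smallest≤head m μ d)

decreasing-tail : ∀ {n} m (μ : Vec ℕ n) → Decreasing (m ∷ μ) → Decreasing μ
decreasing-tail m [] _ = tt
decreasing-tail m (m′ ∷ μ) (_ , d) = d

interlaced-undominated : ∀ {n a m} {α : Vec ℕ n} {μ : Vec ℕ n} ν → ¬ (a ∷ α ⊴ m ∷ μ) → Interlaced (m ∷ μ) ν →
  V.sum ν ℕ.+ a ≡ m ℕ.+ V.sum μ → ¬ (α ⊴ ν)
interlaced-undominated {a = a} {m} {α} {μ} ν nd i e (t , r) = nd (sum≡ , ℕP.≤-reflexive (≡.sym sum≡) , suffixSums-interlaced α ν m μ i r)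
  where
  sum≡ : a ℕ.+ V.sum α ≡ m ℕ.+ V.sum μ
  sum≡ = ≡.trans (ℕP.+-comm a _) (≡.trans (≡.cong (ℕ._+ a) t) e)

-- Leading terms of products of Schur polynomials in two alphabets

module _ (m : ℕ) where
  embed : ∀ n → Hom (𝕊 m) (𝕊 (n ℕ.+ m))
  embed zero = idHom (𝕊 m)
  embed (suc n) = record
    { ⟪_⟫ = ⟪ c ⟫ ∘ ⟪ h ⟫ ; ⟪⟫-cong = ⟪⟫-cong c ∘ ⟪⟫-cong h
    ; ⟪⟫-+ = λ x y → S.trans {⟪ c ⟫ (⟪ h ⟫ (x 𝕂m.+ y))} (⟪⟫-cong c (⟪⟫-+ h x y)) (⟪⟫-+ c _ _)
    ; ⟪⟫-* = λ x y → S.trans {⟪ c ⟫ (⟪ h ⟫ (x 𝕂m.* y))} (⟪⟫-cong c (⟪⟫-* h x y)) (⟪⟫-* c _ _)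
    ; ⟪⟫-ι = λ z → ⟪⟫-cong c (⟪⟫-ι h z) }
    where
    module S = 𝕂 (suc n ℕ.+ m)
    module 𝕂m = 𝕂 m
    h = embed n
    c = SeriesMaps.constHom (𝕊 (n ℕ.+ m))

  embed-gen : ∀ n (j : Fin m) → ⟪ embed n ⟫ (gen m j) ≡ gen (n ℕ.+ m) (n F.↑ʳ j)
  embed-gen zero j = ≡.refl
  embed-gen (suc n) j = ≡.cong (PowerSeries.const (𝕊 (n ℕ.+ m))) (embed-gen n j)

  atX : ∀ n → ℂ (n ℕ.+ m) → Vec ℕ n → ℂ m
  atX zero f [] = f
  atX (suc n) f (a ∷ α) = atX n (f a) α

  at-atX : ∀ n f (α : Vec ℕ n) β → at (n ℕ.+ m) f (α V.++ β) ≡ at m (atX n f α) β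
  at-atX zero f [] β = ≡.refl
  at-atX (suc n) f (a ∷ α) β = at-atX n (f a) α β

  open Kit (𝕊 m)

  atX-cong : ∀ n {f g} → 𝕂._≈_ (n ℕ.+ m) f g → ∀ α → atX n f α ≈ atX n g α
  atX-cong zero e [] = e
  atX-cong (suc n) e (a ∷ α) = atX-cong n (e a) α

  atX-0 : ∀ n α → atX n (𝕂.0# (n ℕ.+ m)) α ≈ 0#
  atX-0 zero [] = refl
  atX-0 (suc n) (a ∷ α) = atX-0 n α

  atX-+ : ∀ n f g α → atX n (𝕂._+_ (n ℕ.+ m) f g) α ≈ atX n f α + atX n g α
  atX-+ zero f g [] = refl
  atX-+ (suc n) f g (a ∷ α) = atX-+ n (f a) (g a) α

  sX : ∀ n → Vec ℕ n → ℂ (n ℕ.+ m)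
  sX n = Alternants.s (𝕊 (n ℕ.+ m)) (V.tabulate (λ i → gen (n ℕ.+ m) (i F.↑ˡ m)))

  -- Taking the coefficient of the first variable passes to interlacing ν of the right size. If such
  -- a ν dominated the rest of α, then the original partition would dominate all of α, by
  -- `interlaced-undominated`.
  sX-dominated : ∀ n (μ : Vec ℕ n) (κ : ℂ m) α → Decreasing μ → ¬ (α ⊴ μ) → atX n (𝕂._*_ (n ℕ.+ m) (sX n μ) (⟪ embed n ⟫ κ)) α ≈ 0#
  sX-dominated zero [] κ [] d nd = ⊥-elim (nd (≡.refl , tt))
  sX-dominated (suc n) (m₀ ∷ μ) κ (a ∷ α) d nd = s-vanish (λ i → gen (n ℕ.+ m) (i F.↑ˡ m)) (⟪ embed n ⟫ κ)
    (λ f → atX n f α ≈ 0#) (λ e z → trans (atX-cong n e α) z) (atX-0 n α)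
    (λ {f} {g} p q → trans (atX-+ n f g α) (trans (+-cong p q) (+-identityˡ _)))
    (m₀ ∷ μ) d a λ ν i e → sX-dominated n ν κ α (interlaced-decreasing (m₀ ∷ μ) ν i) (interlaced-undominated ν nd i e)
    where open BranchCoefficients (𝕊 (n ℕ.+ m))

  -- The integer is a Kostka number. This lets the coefficients in y be studied after those in x
  -- have been extracted.
  sX-integral : ∀ n (μ : Vec ℕ n) (κ : ℂ m) α → Decreasing μ → ∃ λ z → atX n (𝕂._*_ (n ℕ.+ m) (sX n μ) (⟪ embed n ⟫ κ)) α ≈ ι z * κ
  sX-integral zero [] κ [] d = + 1 , *-congʳ (sym 1-homo)
  sX-integral (suc n) μ κ (a ∷ α) d = s-vanish (λ i → gen (n ℕ.+ m) (i F.↑ˡ m)) (⟪ embed n ⟫ κ)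
    (λ f → ∃ λ z → atX n f α ≈ ι z * κ) (λ { e (z , p) → z , trans (atX-cong n e α) p })
    (+ 0 , trans (atX-0 n α) (sym (trans (*-congʳ 0-homo) (zeroˡ κ))))
    (λ { {f} {g} (z , p) (w , q) → z +ᶻ w , trans (atX-+ n f g α) (trans (+-cong p q) (trans (sym (distribʳ κ _ _)) (*-congʳ (sym (+-homo z w))))) })
    μ d a λ ν i e → sX-integral n ν κ α (interlaced-decreasing μ ν i)
    where open BranchCoefficients (𝕊 (n ℕ.+ m))

  sX-leading : ∀ n (μ : Vec ℕ n) (κ : ℂ m) → Decreasing μ → atX n (𝕂._*_ (n ℕ.+ m) (sX n μ) (⟪ embed n ⟫ κ)) μ ≈ κ
  sX-leading zero [] κ d = *-identityˡ κ
  sX-leading (suc n) (m₀ ∷ μ) κ d = trans (atX-cong n (s-top (λ i → gen (n ℕ.+ m) (i F.↑ˡ m)) (⟪ embed n ⟫ κ) m₀ μ d) μ)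
    (sX-leading n μ κ (decreasing-tail m₀ μ d))
    where open BranchCoefficients (𝕊 (n ℕ.+ m))

sG : ∀ n → Vec ℕ n → ℂ n
sG n = Alternants.s (𝕊 n) (V.tabulate (gen n))

sG-dominated : ∀ n (μ α : Vec ℕ n) z → Decreasing μ → ¬ (α ⊴ μ) → at n (𝕂._*_ n (sG n μ) (𝕂.ι n z)) α ≡ + 0
sG-dominated zero [] [] z d nd = ⊥-elim (nd (≡.refl , tt))
sG-dominated (suc n) (m ∷ μ) (a ∷ α) z d nd = s-vanish (gen n) (𝕂.ι n z) (λ f → at n f α ≡ + 0) (λ e p → ≡.trans (at-cong n e α) p) (at-0 n α)
  (λ {f} {g} p q → ≡.trans (at-+ n f g α) (≡.cong₂ _+ᶻ_ p q))
  (m ∷ μ) d a λ ν i e → sG-dominated n ν α z (interlaced-decreasing (m ∷ μ) ν i) (interlaced-undominated ν nd i e)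
  where open BranchCoefficients (𝕊 n)

sG-leading : ∀ n (μ : Vec ℕ n) z → Decreasing μ → at n (𝕂._*_ n (sG n μ) (𝕂.ι n z)) μ ≡ z
sG-leading zero [] z d = ℤP.*-identityˡ z
sG-leading (suc n) (m ∷ μ) z d = ≡.trans (at-cong n (s-top (gen n) (𝕂.ι n z) m μ d) μ) (sG-leading n μ z (decreasing-tail m μ d))
  where open BranchCoefficients (𝕊 n)

module _ (n m : ℕ) where
  private module K = 𝕂 (n ℕ.+ m)

  sY : Vec ℕ m → ℂ (n ℕ.+ m)
  sY = Alternants.s (𝕊 (n ℕ.+ m)) (V.tabulate (λ j → gen (n ℕ.+ m) (n F.↑ʳ j)))

  sY-embed : ∀ μ → ⟪ embed m n ⟫ (sG m μ) K.≈ sY μ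
  sY-embed μ = hom-s (embed m n) (image-tabulate (embed m n) _ _ λ j → K.reflexive (embed-gen m n j)) μ

  schurProduct : Vec ℕ n → Vec ℕ m → ℂ (n ℕ.+ m)
  schurProduct la mu = sX m n la K.* sY mu

  schurProduct-at : ∀ la mu α β → at (n ℕ.+ m) (schurProduct la mu) (α V.++ β) ≡ at m (atX m n (sX m n la K.* ⟪ embed m n ⟫ (sG m mu)) α) β
  schurProduct-at la mu α β = ≡.trans (at-cong (n ℕ.+ m) (K.*-congˡ (K.sym (sY-embed mu))) (α V.++ β)) (at-atX m n _ α β)

  schurProduct-dominatedˡ : ∀ la mu α β → Decreasing la → ¬ (α ⊴ la) → at (n ℕ.+ m) (schurProduct la mu) (α V.++ β) ≡ + 0
  schurProduct-dominatedˡ la mu α β d nd = ≡.trans (schurProduct-at la mu α β)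
    (≡.trans (at-cong m (sX-dominated m n la (sG m mu) α d nd) β) (at-0 m β))

  sG-scaled : ∀ mu β z → at m (𝕂._*_ m (𝕂.ι m z) (sG m mu)) β ≡ z *ᶻ at m (𝕂._*_ m (sG m mu) (𝕂.ι m (+ 1))) β
  sG-scaled mu β z = ≡.trans (at-ι* m z (sG m mu) β) (≡.cong (z *ᶻ_) (at-cong m (M.sym (M.trans (M.*-congˡ M.1-homo) (M.*-identityʳ (sG m mu)))) β))
    where module M = 𝕂 m

  schurProduct-dominatedʳ : ∀ la mu α β → Decreasing la → Decreasing mu → ¬ (β ⊴ mu) → at (n ℕ.+ m) (schurProduct la mu) (α V.++ β) ≡ + 0
  schurProduct-dominatedʳ la mu α β d d′ nd with sX-integral m n la (sG m mu) α d
  ... | z , e = ≡.trans (schurProduct-at la mu α β) (≡.trans (at-cong m e β) (≡.trans (sG-scaled mu β z)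
    (≡.trans (≡.cong (z *ᶻ_) (sG-dominated m mu β (+ 1) d′ nd)) (ℤP.*-zeroʳ z))))

  schurProduct-leading : ∀ la mu → Decreasing la → Decreasing mu → at (n ℕ.+ m) (schurProduct la mu) (la V.++ mu) ≡ + 1
  schurProduct-leading la mu d d′ = ≡.trans (schurProduct-at la mu la mu) (≡.trans (at-cong m (M.trans (sX-leading m n la (sG m mu) d)
    (M.sym (M.trans (M.*-congˡ M.1-homo) (M.*-identityʳ (sG m mu))))) mu) (sG-leading m mu (+ 1) d′))
    where module M = 𝕂 m

-- Expansion of symmetric polynomials in Schur polynomials

suffixSums-≤ : ∀ {n} (α μ : Vec ℕ n) → SuffixSums α μ → V.sum μ ≤ V.sum α
suffixSums-≤ [] [] _ = z≤n
suffixSums-≤ (a ∷ α) (m ∷ μ) (p , _) = p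

rowEnergy : ∀ {n} → Vec ℕ n → ℕ
rowEnergy μ = energy (staircase μ)

excess : ∀ {n} → Vec ℕ n → Vec ℕ n → ℤ
excess α μ = + V.sum α -ᶻ + V.sum μ

excess-≥0 : ∀ {n} (α μ : Vec ℕ n) → SuffixSums α μ → + 0 ℤ.≤ excess α μ
excess-≥0 α μ p = ℤP.i≤j⇒0≤j-i (ℤ.+≤+ (suffixSums-≤ α μ p))

-- Abel summation: the energy is a sum of a convex function of the parts of
-- μ + ρ, and the weights w = m + a + 2ρ + 1 of the part differences decrease
-- by at least 2 from one row to the next.
energy-gap : ∀ {n} m a (μ α : Vec ℕ n) → Decreasing (m ∷ μ) → Decreasing (a ∷ α) → SuffixSums α μ →
  + 0 ℤ.≤ (+ rowEnergy (m ∷ μ) -ᶻ + rowEnergy (a ∷ α)) +ᶻ excess (a ∷ α) (m ∷ μ) *ᶻ (+ m +ᶻ + a +ᶻ (+ n +ᶻ + n) +ᶻ + 1) -ᶻ + 2 *ᶻ excess α μ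
energy-gap {n} m a μ α dm da ss = ≡.subst (+ 0 ℤ.≤_) (≡.sym (≡.trans rewritten (reduce (+ m) (+ a) (+ n) (+ rowEnergy μ) (+ rowEnergy α) (+ V.sum μ) (+ V.sum α)))) (remaining μ α dm da ss)
  where
  pos : ∀ {k} b (β : Vec ℕ k) → + rowEnergy (b ∷ β) ≡ (+ k +ᶻ + b) *ᶻ (+ 1 +ᶻ (+ k +ᶻ + b)) +ᶻ + rowEnergy β
  pos {k} b β = ≡.cong (_+ᶻ + rowEnergy β) (ℤP.pos-* (k ℕ.+ b) (suc (k ℕ.+ b)))
  rewritten : (+ rowEnergy (m ∷ μ) -ᶻ + rowEnergy (a ∷ α)) +ᶻ excess (a ∷ α) (m ∷ μ) *ᶻ (+ m +ᶻ + a +ᶻ (+ n +ᶻ + n) +ᶻ + 1) -ᶻ + 2 *ᶻ excess α μ ≡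
    (((+ n +ᶻ + m) *ᶻ (+ 1 +ᶻ (+ n +ᶻ + m)) +ᶻ + rowEnergy μ) -ᶻ ((+ n +ᶻ + a) *ᶻ (+ 1 +ᶻ (+ n +ᶻ + a)) +ᶻ + rowEnergy α))
      +ᶻ ((+ a +ᶻ + V.sum α) -ᶻ (+ m +ᶻ + V.sum μ)) *ᶻ (+ m +ᶻ + a +ᶻ (+ n +ᶻ + n) +ᶻ + 1) -ᶻ + 2 *ᶻ (+ V.sum α -ᶻ + V.sum μ)
  rewritten = ≡.cong₂ (λ u v → (u -ᶻ v) +ᶻ ((+ a +ᶻ + V.sum α) -ᶻ (+ m +ᶻ + V.sum μ)) *ᶻ (+ m +ᶻ + a +ᶻ (+ n +ᶻ + n) +ᶻ + 1) -ᶻ + 2 *ᶻ (+ V.sum α -ᶻ + V.sum μ)) (pos m μ) (pos a α)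
  open ℤK using (solve; _:=_; _:+_; _:*_; _:-_; con)
  reduce : ∀ m a n e f s t →
    (((n +ᶻ m) *ᶻ (+ 1 +ᶻ (n +ᶻ m)) +ᶻ e) -ᶻ ((n +ᶻ a) *ᶻ (+ 1 +ᶻ (n +ᶻ a)) +ᶻ f))
      +ᶻ ((a +ᶻ t) -ᶻ (m +ᶻ s)) *ᶻ (m +ᶻ a +ᶻ (n +ᶻ n) +ᶻ + 1) -ᶻ + 2 *ᶻ (t -ᶻ s)
    ≡ (e -ᶻ f) +ᶻ (t -ᶻ s) *ᶻ (m +ᶻ a +ᶻ (n +ᶻ n) -ᶻ + 1)
  reduce = solve 7 (λ m a n e f s t →
    (((n :+ m) :* (con (+ 1) :+ (n :+ m)) :+ e) :- ((n :+ a) :* (con (+ 1) :+ (n :+ a)) :+ f))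
      :+ ((a :+ t) :- (m :+ s)) :* (m :+ a :+ (n :+ n) :+ con (+ 1)) :- con (+ 2) :* (t :- s)
    := (e :- f) :+ (t :- s) :* (m :+ a :+ (n :+ n) :- con (+ 1))) ≡.refl
  remaining : ∀ {n} (μ α : Vec ℕ n) → Decreasing (m ∷ μ) → Decreasing (a ∷ α) → SuffixSums α μ →
    + 0 ℤ.≤ (+ rowEnergy μ -ᶻ + rowEnergy α) +ᶻ (+ V.sum α -ᶻ + V.sum μ) *ᶻ (+ m +ᶻ + a +ᶻ (+ n +ᶻ + n) -ᶻ + 1)
  remaining [] [] _ _ _ = ℤP.≤-reflexive (≡.sym (ℤP.*-zeroˡ (+ m +ᶻ + a +ᶻ (+ 0 +ᶻ + 0) -ᶻ + 1)))
  remaining {suc n′} (m′ ∷ μ) (a′ ∷ α) (p , dm) (q , da) ss₀@(_ , ss) = ≡.subst (+ 0 ℤ.≤_)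
    (split (+ m) (+ a) (+ m′) (+ a′) (+ n′) (+ rowEnergy (m′ ∷ μ) -ᶻ + rowEnergy (a′ ∷ α)) (excess (a′ ∷ α) (m′ ∷ μ)) (excess α μ))
    (ℤP.+-mono-≤ (ℤP.+-mono-≤ (energy-gap m′ a′ μ α dm da ss)
      (nonneg-* 0 _ _ (ℤP.i≤j⇒0≤j-i (ℤ.+≤+ {m′ ℕ.+ V.sum μ} {a′ ℕ.+ V.sum α} (suffixSums-≤ (a′ ∷ α) (m′ ∷ μ) ss₀))) (ℤP.+-mono-≤ (ℤP.i≤j⇒0≤j-i (ℤ.+≤+ p)) (ℤP.i≤j⇒0≤j-i (ℤ.+≤+ q)))))
      (nonneg-* 0 (+ 2) _ (ℤ.+≤+ z≤n) (excess-≥0 α μ ss)))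
    where
    split : ∀ m a m′ a′ n e d d′ → (e +ᶻ d *ᶻ (m′ +ᶻ a′ +ᶻ (n +ᶻ n) +ᶻ + 1) -ᶻ + 2 *ᶻ d′) +ᶻ d *ᶻ ((m -ᶻ m′) +ᶻ (a -ᶻ a′)) +ᶻ + 2 *ᶻ d′
      ≡ e +ᶻ d *ᶻ (m +ᶻ a +ᶻ ((+ 1 +ᶻ n) +ᶻ (+ 1 +ᶻ n)) -ᶻ + 1)
    split = solve 8 (λ m a m′ a′ n e d d′ → (e :+ d :* (m′ :+ a′ :+ (n :+ n) :+ con (+ 1)) :- con (+ 2) :* d′) :+ d :* ((m :- m′) :+ (a :- a′)) :+ con (+ 2) :* d′
      := e :+ d :* (m :+ a :+ ((con (+ 1) :+ n) :+ (con (+ 1) :+ n)) :- con (+ 1))) ≡.refl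

-- Equal totals make the weighted boundary term of `energy-gap` vanish.
energy-gap-balanced : ∀ {n} m a (μ α : Vec ℕ n) → Decreasing (m ∷ μ) → Decreasing (a ∷ α) → a ∷ α ⊴ m ∷ μ →
  + 2 *ᶻ excess α μ ℤ.≤ + rowEnergy (m ∷ μ) -ᶻ + rowEnergy (a ∷ α)
energy-gap-balanced {n} m a μ α dm da (e , _ , ss) = ℤP.0≤i-j⇒j≤i (≡.subst (+ 0 ℤ.≤_)
  (≡.trans (≡.cong (λ d → E +ᶻ d *ᶻ w -ᶻ + 2 *ᶻ excess α μ) (≡.trans (≡.cong (λ s → + s -ᶻ + V.sum (m ∷ μ)) e) (ℤP.+-inverseʳ (+ V.sum (m ∷ μ)))))
    (ℤK.solve 3 (λ e w d → e ℤK.:+ ℤK.con (+ 0) ℤK.:* w ℤK.:- d ℤK.:= e ℤK.:- d) ≡.refl E w (+ 2 *ᶻ excess α μ)))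
  (energy-gap m a μ α dm da ss))
  where
  E = + rowEnergy (m ∷ μ) -ᶻ + rowEnergy (a ∷ α)
  w = + m +ᶻ + a +ᶻ (+ n +ᶻ + n) +ᶻ + 1

energy-mono : ∀ {n} (α μ : Vec ℕ n) → Decreasing α → Decreasing μ → α ⊴ μ → rowEnergy α ≤ rowEnergy μ
energy-mono [] [] _ _ _ = z≤n
energy-mono (a ∷ α) (m ∷ μ) da dm dom@(_ , _ , ss) = ℤP.drop‿+≤+ (ℤP.0≤i-j⇒j≤i
  (ℤP.≤-trans (nonneg-* 0 (+ 2) _ (ℤ.+≤+ z≤n) (excess-≥0 α μ ss)) (energy-gap-balanced m a μ α dm da dom)))

-- Equality leaves no room in `energy-gap-balanced`: the tails have equal sums, hence the heads
-- agree, and the tails are compared in turn.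
energy-injective : ∀ {n} (α μ : Vec ℕ n) → Decreasing α → Decreasing μ → α ⊴ μ → rowEnergy α ≡ rowEnergy μ → α ≡ μ
energy-injective [] [] _ _ _ _ = ≡.refl
energy-injective {suc n} (a ∷ α) (m ∷ μ) da dm dom@(e , _ , ss) eq = ≡.cong₂ _∷_ heads
  (energy-injective α μ (decreasing-tail a α da) (decreasing-tail m μ dm) (sums , ss)
    (ℕP.+-cancelˡ-≡ ((n ℕ.+ a) ℕ.* suc (n ℕ.+ a)) _ _ (≡.trans eq (≡.cong (λ b → (n ℕ.+ b) ℕ.* suc (n ℕ.+ b) ℕ.+ rowEnergy μ) (≡.sym heads)))))
  where
  sums : V.sum α ≡ V.sum μ
  sums = ℕP.≤-antisym (ℤP.drop‿+≤+ (ℤP.i-j≤0⇒i≤j (ℤP.*-cancelˡ-≤-pos (excess α μ) (+ 0) (+ 2)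
    (ℤP.≤-trans (energy-gap-balanced m a μ α dm da dom) (ℤP.≤-reflexive (≡.trans (≡.cong (λ k → + rowEnergy (m ∷ μ) -ᶻ + k) eq) (ℤP.+-inverseʳ (+ rowEnergy (m ∷ μ)))))))))
    (suffixSums-≤ α μ ss)
  heads : a ≡ m
  heads = ℕP.+-cancelʳ-≡ (V.sum α) a m (≡.trans e (≡.cong (m ℕ.+_) (≡.sym sums)))

-- Lexicographic order, unitriangular systems and sorting

infix 4 _<ₗ_
_<ₗ_ : ∀ {n} → Vec ℕ n → Vec ℕ n → Set
[] <ₗ [] = ⊥
(a ∷ α) <ₗ (b ∷ β) = a < b ⊎ (a ≡ b × α <ₗ β)

⊴-tail : ∀ {n a m} {α μ : Vec ℕ n} → a ∷ α ⊴ m ∷ μ → a ≡ m → α ⊴ μ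
⊴-tail {a = a} {α = α} {μ} (e , _ , s) ≡.refl = ℕP.+-cancelˡ-≡ a (V.sum α) (V.sum μ) e , s

⊴-head : ∀ {n a m} {α μ : Vec ℕ n} → a ∷ α ⊴ m ∷ μ → ¬ (m < a)
⊴-head {α = α} {μ} (e , _ , s) lt = ℕP.<-irrefl (≡.sym e) (ℕP.+-mono-<-≤ lt (suffixSums-≤ α μ s))

-- At the first difference α has the larger entry, so its initial sum exceeds that of μ there.
lex-⊴ : ∀ {n} (μ α : Vec ℕ n) → μ <ₗ α → ¬ (α ⊴ μ)
lex-⊴ [] [] ()
lex-⊴ (m ∷ μ) (a ∷ α) (inj₁ lt) dom = ⊴-head {α = α} dom lt
lex-⊴ (m ∷ μ) (a ∷ α) (inj₂ (e , lt)) dom = lex-⊴ μ α lt (⊴-tail {α = α} dom (≡.sym e))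

lex-++ : ∀ {n m} (μ α : Vec ℕ n) (ν β : Vec ℕ m) → (μ V.++ ν) <ₗ (α V.++ β) → α ⊴ μ → ¬ (β ⊴ ν)
lex-++ [] [] ν β lt _ = lex-⊴ ν β lt
lex-++ (m ∷ μ) (a ∷ α) ν β (inj₁ lt) dom = ⊥-elim (⊴-head {α = α} dom lt)
lex-++ (m ∷ μ) (a ∷ α) ν β (inj₂ (e , lt)) dom = lex-++ μ α ν β lt (⊴-tail {α = α} dom (≡.sym e))

-- Listed in descending lexicographic order, as forward substitution wants leading monomials first.
-- Bounding the entries by D covers every vector of sum at most D.
vectors : ℕ → ∀ N → List (Vec ℕ N)
vectors D zero = [] ∷ []
vectors D (suc N) = concatMap (λ a → map (a ∷_) (vectors D N)) (L.downFrom (suc D))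

vectors-descending : ∀ D N → AllPairs (λ p q → q <ₗ p) (vectors D N)
vectors-descending D zero = [] ∷ []
vectors-descending D (suc N) = AllPairsP.concat⁺
  (AllP.map⁺ (All.tabulate λ {a} _ → AllPairsP.map⁺ (AllPairs.map (λ lt → inj₂ (≡.refl , lt)) (vectors-descending D N))))
  (AllPairsP.map⁺ (AllPairsP.applyDownFrom⁺₁ id (suc D) λ {i} {j} j<i _ →
    AllP.map⁺ (All.tabulate λ _ → AllP.map⁺ (All.tabulate λ _ → inj₁ j<i))))

∈-vectors : ∀ D N (v : Vec ℕ N) → V.sum v ≤ D → v ∈ vectors D N
∈-vectors D zero [] _ = here ≡.refl
∈-vectors D (suc N) (a ∷ v) le = ∈-concatMap⁺ (λ a → map (a ∷_) (vectors D N))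
  (lose (∈-downFrom⁺ (s≤s (ℕP.≤-trans (ℕP.m≤m+n a _) le))) (∈-map⁺ (a ∷_) (∈-vectors D N v (ℕP.≤-trans (ℕP.m≤n+m _ a) le))))

∑-zero-All : ∀ {I : Set} {is : List I} {f : I → ℤ} → All (λ i → f i ≡ + 0) is → ℤK.∑ is f ≡ + 0
∑-zero-All [] = ≡.refl
∑-zero-All (e ∷ es) = ≡.cong₂ _+ᶻ_ e (∑-zero-All es)

-- Forward substitution: at the first index only its own column contributes, so that coefficient is
-- forced to be the value of `g`; subtract its column and continue. The unit diagonal keeps
-- everything integral.
unitriangular : ∀ {I : Set} (M : I → I → ℤ) ps → AllPairs (λ p q → M p q ≡ + 0) ps → All (λ p → M p p ≡ + 1) ps →
  ∀ (g : I → ℤ) → ∃ λ (Ls : List (ℤ × I)) → map proj₂ Ls ≡ ps × All (λ p → g p ≡ ℤK.∑ Ls (λ (a , q) → a *ᶻ M p q)) ps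
unitriangular M [] _ _ g = [] , ≡.refl , []
unitriangular M (p ∷ ps) (z ∷ zs) (o ∷ os) g with unitriangular M ps zs os (λ q → g q -ᶻ g p *ᶻ M q p)
... | Ls , e , es = (g p , p) ∷ Ls , ≡.cong (p ∷_) e
    , ≡.sym (≡.trans (≡.cong₂ _+ᶻ_ (≡.trans (≡.cong (g p *ᶻ_) o) (ℤP.*-identityʳ (g p)))
        (∑-zero-All (All.map (λ {(a , q)} e′ → ≡.trans (≡.cong (a *ᶻ_) e′) (ℤP.*-zeroʳ a)) (AllP.map⁻ {f = proj₂} (≡.subst (All (λ q → M p q ≡ + 0)) (≡.sym e) z))))) (ℤP.+-identityʳ (g p)))
    ∷ All.map (λ {q} e′ → ≡.trans (ℤK.solve 2 (λ x y → x ℤK.:= y ℤK.:+ (x ℤK.:- y)) ≡.refl (g q) (g p *ᶻ M q p)) (≡.cong (g p *ᶻ M q p +ᶻ_) e′)) es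

SwapInvariant : ∀ {n} → (Vec ℕ n → ℤ) → Set
SwapInvariant G = ∀ k v → G (swapVec k v) ≡ G v

-- One pass of insertion sort. The bound c stands for the entry in front; whenever `a` moves past b,
-- the role of the bound is handed to b.
insert-zero : ∀ {n} (G : Vec ℕ (suc n) → ℤ) → SwapInvariant G → ∀ c → (∀ v → Decreasing (c ∷ v) → G v ≡ + 0) →
  ∀ a (β : Vec ℕ n) → a ≤ c → Decreasing (c ∷ β) → G (a ∷ β) ≡ + 0
insert-zero G sym c z a [] le d = z (a ∷ []) (le , tt)
insert-zero G sym c z a (b ∷ β) le (q , d) with ℕP.≤-total b a
... | inj₁ b≤a = z (a ∷ b ∷ β) (le , b≤a , d)
... | inj₂ a≤b = ≡.trans (≡.sym (sym here (a ∷ b ∷ β)))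
    (insert-zero (G ∘ (b ∷_)) (λ k v → sym (there k) (b ∷ v)) b (λ v d′ → z (b ∷ v) (q , d′)) a β a≤b d)

zero-on-decreasing : ∀ {n} (G : Vec ℕ n → ℤ) → SwapInvariant G → (∀ v → Decreasing v → G v ≡ + 0) → ∀ v → G v ≡ + 0
-- The total of v bounds every entry and so serves as an initial entry in front of the sorted part.
zero-on-decreasing G sym z v = bounded G sym (V.sum v) (λ u d → z u (decreasing-tail (V.sum v) u d)) v ℕP.≤-refl
  where
  bounded : ∀ {n} (G : Vec ℕ n → ℤ) → SwapInvariant G → ∀ c → (∀ v → Decreasing (c ∷ v) → G v ≡ + 0) → ∀ v → V.sum v ≤ c → G v ≡ + 0
  bounded G sym c z [] _ = z [] tt
  bounded G sym c z (a ∷ v) le = bounded (G ∘ (a ∷_)) (λ k u → sym (there k) (a ∷ u)) c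
    (λ u d → insert-zero G sym c z a u (ℕP.≤-trans (ℕP.m≤m+n a _) le) d) v (ℕP.≤-trans (ℕP.m≤n+m _ a) le)

decreasing? : ∀ {n} (v : Vec ℕ n) → Dec (Decreasing v)
decreasing? [] = yes tt
decreasing? (a ∷ []) = yes tt
decreasing? (a ∷ b ∷ v) = (b ℕ.≤? a) ×-dec decreasing? (b ∷ v)

suffixSums? : ∀ {n} (α μ : Vec ℕ n) → Dec (SuffixSums α μ)
suffixSums? [] [] = yes tt
suffixSums? (a ∷ α) (m ∷ μ) = (_ ℕ.≤? _) ×-dec suffixSums? α μ

_⊴?_ : ∀ {n} (α μ : Vec ℕ n) → Dec (α ⊴ μ)
α ⊴? μ = (_ ℕ.≟ _) ×-dec suffixSums? α μ

-- Junk (non-decreasing) vectors become 0, so that indices need no side condition.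
clamp : ∀ {n} → Vec ℕ n → Vec ℕ n
clamp {n} v = if does (decreasing? v) then v else V.replicate n 0

clamp-decreasing : ∀ {n} (v : Vec ℕ n) → Decreasing (clamp v)
clamp-decreasing {n} v with decreasing? v
... | yes d = d
... | no _ = decreasing-zero n

clamp-id : ∀ {n} (v : Vec ℕ n) → Decreasing v → clamp v ≡ v
clamp-id v d with decreasing? v
... | yes _ = ≡.refl
... | no nd = ⊥-elim (nd d)

module Expansion (n m : ℕ) where
  N = n ℕ.+ m
  private module K = 𝕂 N

  xPart : Vec ℕ N → Vec ℕ n
  xPart p = V.take n p
  yPart : Vec ℕ N → Vec ℕ m
  yPart p = V.drop n p

  basis : Vec ℕ N → ℂ N
  basis p = schurProduct n m (clamp (xPart p)) (clamp (yPart p))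

  Good : ℕ → Vec ℕ N → Set
  Good r p = (Decreasing (xPart p) × Decreasing (yPart p)) × V.sum p ≡ r

  good? : ∀ r p → Dec (Good r p)
  good? r p = (decreasing? (xPart p) ×-dec decreasing? (yPart p)) ×-dec (V.sum p ℕ.≟ r)

  indices : ℕ → List (Vec ℕ N)
  indices r = L.filter (good? r) (vectors r N)

  -- For good indices these are products of two Kostka numbers.
  M : Vec ℕ N → Vec ℕ N → ℤ
  M p q = at N (basis q) p

  Dominated : Vec ℕ N → Vec ℕ N → Set
  Dominated p q = xPart p ⊴ xPart q × yPart p ⊴ yPart q

  M-undominated : ∀ p q {r} → Good r q → ¬ Dominated p q → M p q ≡ + 0
  M-undominated p q ((dx , dy) , _) nd = ≡.trans (≡.cong (at N (basis q)) (≡.sym (VP.take++drop≡id n p))) (cases (xPart p ⊴? xPart q))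
    where
    cases : Dec (xPart p ⊴ xPart q) → at N (basis q) (xPart p V.++ yPart p) ≡ + 0
    cases (no ¬x) = schurProduct-dominatedˡ n m _ _ (xPart p) (yPart p) (clamp-decreasing (xPart q)) (≡.subst (λ v → ¬ (xPart p ⊴ v)) (≡.sym (clamp-id (xPart q) dx)) ¬x)
    cases (yes x) = schurProduct-dominatedʳ n m _ _ (xPart p) (yPart p) (clamp-decreasing (xPart q)) (clamp-decreasing (yPart q))
      (≡.subst (λ v → ¬ (yPart p ⊴ v)) (≡.sym (clamp-id (yPart q) dy)) λ y → nd (x , y))

  M-diagonal : ∀ p {r} → Good r p → M p p ≡ + 1
  M-diagonal p ((dx , dy) , _) = ≡.trans (≡.cong (at N (basis p)) (≡.trans (≡.sym (VP.take++drop≡id n p))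
      (≡.sym (≡.cong₂ V._++_ (clamp-id (xPart p) dx) (clamp-id (yPart p) dy)))))
    (schurProduct-leading n m _ _ (clamp-decreasing (xPart p)) (clamp-decreasing (yPart p)))

  indices-triangular : ∀ r → AllPairs (λ p q → M p q ≡ + 0) (indices r)
  indices-triangular r = weaken (AllPairsP.filter⁺ (good? r) (vectors-descending r N)) (AllP.all-filter (good? r) (vectors r N))
    where
    weaken : ∀ {ps} → AllPairs (λ p q → q <ₗ p) ps → All (Good r) ps → AllPairs (λ p q → M p q ≡ + 0) ps
    weaken [] [] = []
    weaken {p ∷ ps} (lt ∷ lts) (g ∷ gs) = All.zipWith (λ { {q} (l , h) → M-undominated p q h λ (x , y) →
        lex-++ (xPart q) (xPart p) (yPart q) (yPart p) (≡.subst₂ _<ₗ_ (≡.sym (VP.take++drop≡id n q)) (≡.sym (VP.take++drop≡id n p)) l) x y }) (lt , gs) ∷ weaken lts gs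

  Symmetric : ℂ N → Set
  Symmetric f = (∀ (k : Adjacent n) → ⟪ swapHom (adjacentˡ m k) ⟫ f K.≈ f) × (∀ (k : Adjacent m) → ⟪ swapHom (adjacentʳ n k) ⟫ f K.≈ f)

  basis-symmetric : ∀ p → Symmetric (basis p)
  basis-symmetric p =
      (λ k → K.trans (⟪⟫-* (swapHom (adjacentˡ m k)) _ _) (K.*-cong
        (s-swapFin N (F._↑ˡ m) (FP.↑ˡ-injective m _ _) (swapHom (adjacentˡ m k)) k
          (λ i → K.trans (swapHom-gen (adjacentˡ m k) _) (K.reflexive (≡.cong (gen N) (swapFin-ˡˡ m k i)))) _ (clamp-decreasing (xPart p)))
        (s-fixed N (n F.↑ʳ_) (swapHom (adjacentˡ m k))
          (λ j → K.trans (swapHom-gen (adjacentˡ m k) _) (K.reflexive (≡.cong (gen N) (swapFin-ˡʳ m k j)))) _)))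
    , (λ k → K.trans (⟪⟫-* (swapHom (adjacentʳ n k)) _ _) (K.*-cong
        (s-fixed N (F._↑ˡ m) (swapHom (adjacentʳ n k))
          (λ i → K.trans (swapHom-gen (adjacentʳ n k) _) (K.reflexive (≡.cong (gen N) (swapFin-ʳˡ n k i)))) _)
        (s-swapFin N (n F.↑ʳ_) (FP.↑ʳ-injective n _ _) (swapHom (adjacentʳ n k)) k
          (λ j → K.trans (swapHom-gen (adjacentʳ n k) _) (K.reflexive (≡.cong (gen N) (swapFin-ʳʳ n k j)))) _ (clamp-decreasing (yPart p)))))

  combination : List (ℤ × Vec ℕ N) → ℂ N
  combination Ls = K.∑ Ls λ (a , q) → K.ι a K.* basis q

  at-combination : ∀ Ls α → at N (combination Ls) α ≡ ℤK.∑ Ls (λ (a , q) → a *ᶻ M α q)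
  at-combination Ls α = ≡.trans (at-∑ N Ls _ α) (ℤK.∑-cong Ls λ (a , q) → at-ι* N a (basis q) α)

  combination-swap : ∀ {h : Hom (𝕊 N) (𝕊 N)} → (∀ p → ⟪ h ⟫ (basis p) K.≈ basis p) → ∀ Ls → ⟪ h ⟫ (combination Ls) K.≈ combination Ls
  combination-swap {h} e Ls = K.trans (⟪⟫-∑ h Ls _) (K.∑-cong Ls λ (a , q) → K.trans (⟪⟫-* h _ _) (K.*-cong (⟪⟫-ι h a) (e q)))

  -- Triangularity matches the coefficients at pairs of partitions of total size r. Both sides are
  -- symmetric in each alphabet, so sorting extends the equality to all exponents.
  expansion : ∀ r f → Homogeneous N r f → Symmetric f → ∃ λ Ls → map proj₂ Ls ≡ indices r × f K.≈ combination Ls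
  expansion r f hom (symX , symY) with unitriangular M (indices r) (indices-triangular r) (All.map (λ {p} → M-diagonal p) (AllP.all-filter (good? r) (vectors r N))) (at N f)
  ... | Ls , e , es = Ls , e , at-ext N λ p → ≡.trans (≡.cong (at N f) (≡.sym (VP.take++drop≡id n p)))
        (≡.trans (ℤP.i-j≡0⇒i≡j _ _ (vanish (xPart p) (yPart p))) (≡.cong (at N (combination Ls)) (VP.take++drop≡id n p)))
    where
    G : Vec ℕ n → Vec ℕ m → ℤ
    G α β = at N f (α V.++ β) -ᶻ at N (combination Ls) (α V.++ β)
    invariant : ∀ k → ⟪ swapHom k ⟫ f K.≈ f → (∀ p → ⟪ swapHom k ⟫ (basis p) K.≈ basis p) → ∀ p →
      at N f (swapVec k p) -ᶻ at N (combination Ls) (swapVec k p) ≡ at N f p -ᶻ at N (combination Ls) p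
    invariant k h h′ p = ≡.cong₂ _-ᶻ_ (≡.trans (≡.sym (at-swapHom k f p)) (at-cong N h p))
      (≡.trans (≡.sym (at-swapHom k (combination Ls) p)) (at-cong N (combination-swap {swapHom k} h′ Ls) p))
    goodAll : All (Good r) (map proj₂ Ls)
    goodAll = ≡.subst (All (Good r)) (≡.sym e) (AllP.all-filter (good? r) (vectors r N))
    onDecreasing : ∀ α β → Decreasing α → Decreasing β → G α β ≡ + 0
    onDecreasing α β dα dβ with V.sum (α V.++ β) ℕ.≟ r
    ... | yes s≡ = ≡.trans (≡.cong (_-ᶻ at N (combination Ls) p) (≡.trans (All.lookup es mem) (≡.sym (at-combination Ls p)))) (ℤP.+-inverseʳ (at N (combination Ls) p))
      where
      p = α V.++ β
      mem : p ∈ indices r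
      mem = ∈-filter⁺ (good? r) (∈-vectors r N p (ℕP.≤-reflexive s≡))
        ((≡.subst Decreasing (≡.sym (take-++ α β)) dα , ≡.subst Decreasing (≡.sym (drop-++ α β)) dβ) , s≡)
        where
        take-++ : ∀ {n} (α : Vec ℕ n) (β : Vec ℕ m) → V.take n (α V.++ β) ≡ α
        take-++ [] β = ≡.refl
        take-++ (a ∷ α) β = ≡.cong (a ∷_) (take-++ α β)
        drop-++ : ∀ {n} (α : Vec ℕ n) (β : Vec ℕ m) → V.drop n (α V.++ β) ≡ β
        drop-++ [] β = ≡.refl
        drop-++ (a ∷ α) β = drop-++ α β
    -- In another degree `f` vanishes by homogeneity, and so does each basis element, because
    -- dominance preserves sums.
    ... | no s≢ = ≡.cong₂ _-ᶻ_ (homogeneous-at N r f hom (α V.++ β) s≢)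
      (≡.trans (at-combination Ls (α V.++ β)) (∑-zero-All (All.map (λ {(a , q)} g → ≡.trans (≡.cong (a *ᶻ_)
        (M-undominated (α V.++ β) q g λ (x , y) → s≢ (≡.trans (sum-parts (α V.++ β)) (≡.trans (≡.cong₂ ℕ._+_ (proj₁ x) (proj₁ y)) (≡.trans (≡.sym (sum-parts q)) (proj₂ g)))))) (ℤP.*-zeroʳ a))
        (AllP.map⁻ goodAll))))
      where
      sum-parts : ∀ (p : Vec ℕ N) → V.sum p ≡ V.sum (xPart p) ℕ.+ V.sum (yPart p)
      sum-parts p = ≡.trans (≡.cong V.sum (≡.sym (VP.take++drop≡id n p))) (VP.sum-++ (xPart p))
    vanish : ∀ α β → G α β ≡ + 0
    vanish α β = zero-on-decreasing (λ α → G α β)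
      (λ k α → ≡.trans (≡.cong (λ p → at N f p -ᶻ at N (combination Ls) p) (≡.sym (swapVec-++ˡ k α β)))
        (invariant (adjacentˡ m k) (symX k) (λ p → proj₁ (basis-symmetric p) k) (α V.++ β)))
      (λ α dα → zero-on-decreasing (G α)
        (λ k β → ≡.trans (≡.cong (λ p → at N f p -ᶻ at N (combination Ls) p) (≡.sym (swapVec-++ʳ k α β)))
          (invariant (adjacentʳ n k) (symY k) (λ p → proj₂ (basis-symmetric p) k) (α V.++ β)))
        (λ β dβ → onDecreasing α β dα dβ) β) α

module SchurConstants (A : Alg) where
  open Kit A
  open SecondOrder A
  open Alternants A

  ∂-zero-branch : ∀ (d : Derivation A) {n y} (μ : Vec ℕ (suc n)) {φ : Vec ℕ n → Carrier} →
    ∂ d y ≈ 0# → (∀ ν → ∂ d (φ ν) ≈ 0#) → ∂ d (branch y μ φ) ≈ 0#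
  ∂-zero-branch d (m ∷ []) e f = f []
  ∂-zero-branch d {y = y} (m ∷ m′ ∷ μ) {φ} e f = ∂-zero-interval (m ∸ m′)
    where
    ∂-zero-interval : ∀ k → ∂ d (interval y m′ k (λ v → branch y (m′ ∷ μ) (φ ∘ (v ∷_)))) ≈ 0#
    ∂-zero-interval zero = ∂-zero-branch d (m′ ∷ μ) e (f ∘ (m′ ∷_))
    ∂-zero-interval (suc k) = trans (∂-+ d _ _) (trans (+-cong (∂-zero-* d e (∂-zero-interval k)) (∂-zero-branch d (m′ ∷ μ) e (f ∘ (_ ∷_)))) (+-identityˡ _))

  ∂-zero-s : ∀ (d : Derivation A) {n} (x : Fin n → Carrier) → (∀ i → ∂ d (x i) ≈ 0#) → ∀ μ → ∂ d (s (V.tabulate x) μ) ≈ 0#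
  ∂-zero-s d {zero} x e [] = ∂-1 d
  ∂-zero-s d {suc n} x e μ = ∂-zero-* d (∂-zero-^ d (smallest μ) (e F.zero)) (∂-zero-branch d μ (e F.zero) (∂-zero-s d (x ∘ F.suc) (e ∘ F.suc)))

∑-only : ∀ {X I : Set} (key : X → I) {xs : List X} → AllPairs (λ x y → key x ≢ key y) xs → ∀ {x₀} → x₀ ∈ xs →
  (f : X → ℤ) → (∀ {x} → x ∈ xs → key x ≢ key x₀ → f x ≡ + 0) → ℤK.∑ xs f ≡ f x₀
∑-only key (ne ∷ nes) {x₀} (here ≡.refl) f z = ≡.trans (≡.cong (f x₀ +ᶻ_) (∑-zero-All (All.tabulate λ i → z (there i) (λ e → All.lookup ne i (≡.sym e))))) (ℤP.+-identityʳ (f x₀))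
∑-only key (ne ∷ nes) {x₀} (there i) f z = ≡.trans (≡.cong₂ _+ᶻ_ (z (here ≡.refl) (All.lookup ne i)) (∑-only key nes i f (z ∘ there))) (ℤP.+-identityˡ (f x₀))

Positive : ℤ → Set
Positive z = ∃ λ k → z ≡ + suc k

positive-* : ∀ {a b} → Positive a → Positive b → Positive (a *ᶻ b)
positive-* (j , ≡.refl) (k , ≡.refl) = _ , ≡.refl

positive-square : ∀ z → z ≢ + 0 → Positive (z *ᶻ z)
positive-square (+ zero) ne = ⊥-elim (ne ≡.refl)
positive-square (+ suc k) _ = _ , ≡.refl
positive-square -[1+ k ] _ = _ , ≡.refl

positive-! : ∀ r → Positive (+ (r !))
positive-! zero = 0 , ≡.refl
positive-! (suc r) = ≡.subst Positive (≡.sym (ℤP.pos-* (suc r) (r !))) (positive-* (r , ≡.refl) (positive-! r))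

positive-cancel : ∀ {a b} → Positive b → + 0 ℤ.≤ a *ᶻ b → + 0 ℤ.≤ a
positive-cancel {a} (k , ≡.refl) p = ℤP.*-cancelʳ-≤-pos (+ 0) a (+ suc k) (≡.subst (ℤ._≤ a *ᶻ + suc k) (≡.sym (ℤP.*-zeroˡ (+ suc k))) p)

-- Isolating one coefficient by squares of shifted Casimir operators

module Positivity (n m : ℕ) where
  open Expansion n m
  open Kit (𝕊 N)
  open SecondOrder (𝕊 N)

  allCoordinates : Coordinates N
  allCoordinates = record { X = gen N ; D = θ N ; D-same = θ-gen-same N ; D-diff = θ-gen-diff N }

  open Fermions (𝕊 N) allCoordinates

  inX : Fin n → Fin N
  inX = F._↑ˡ m
  inY : Fin m → Fin N
  inY = n F.↑ʳ_

  inX≢inY : ∀ i j → inX i ≢ inY j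
  inX≢inY i j e = disjoint i j e
    where
    disjoint : ∀ {n} (i : Fin n) (j : Fin m) → i F.↑ˡ m ≢ n F.↑ʳ j
    disjoint (F.suc i) j e = disjoint i j (FP.suc-injective e)

  injX : ∀ {i j} → inX i ≡ inX j → i ≡ j
  injX = FP.↑ˡ-injective m _ _
  injY : ∀ {i j} → inY i ≡ inY j → i ≡ j
  injY = FP.↑ʳ-injective n _ _

  actX = action inX injX
  actY = action inY injY
  InvX InvY Inv : ∀ {r} → (Vec Site r → ℤ) → Set
  InvX = Invariant (𝕊 N) Qs wt actX
  InvY = Invariant (𝕊 N) Qs wt actY
  Inv Ψ = InvX Ψ × InvY Ψ
  CasX CasY : ∀ {r} → (Vec Site r → ℤ) → Vec Site r → ℤ
  CasX = Cas (𝕊 N) Qs wt actX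
  CasY = Cas (𝕊 N) Qs wt actY

  -- The two algebras move disjoint sets of letters, so the Casimir operator of one commutes with
  -- both kinds of operators, E and F, of the other.
  CasX-invY : ∀ {r} {Ψ : Vec Site r → ℤ} → InvY Ψ → InvY (CasX Ψ)
  CasX-invY {Ψ = Ψ} inv i j ne qs = begin
    dΓ (E (inY i) (inY j)) (CasX Ψ) qs ≡⟨ Cas-commute (𝕊 N) Qs wt actX _ (λ k l → E-commute (inX k) (inX l) (inY i) (inY j) (inX≢inY l i) (inX≢inY k j ∘ ≡.sym)) Ψ qs ⟩
    CasX (dΓ (E (inY i) (inY j)) Ψ) qs ≡⟨ Cas-cong (𝕊 N) Qs wt actX (inv i j ne) qs ⟩
    CasX (λ q → -ᶻ dΓ (F (inY i) (inY j)) Ψ q) qs ≡⟨ Cas-neg (𝕊 N) Qs wt actX _ qs ⟩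
    -ᶻ CasX (dΓ (F (inY i) (inY j)) Ψ) qs ≡⟨ ≡.cong -ᶻ_ (≡.sym (Cas-commute (𝕊 N) Qs wt actX _ (λ k l → E-F-commute (inX k) (inX l) (inY i) (inY j)) Ψ qs)) ⟩
    -ᶻ dΓ (F (inY i) (inY j)) (CasX Ψ) qs ∎
    where open ≡.≡-Reasoning

  CasY-invX : ∀ {r} {Ψ : Vec Site r → ℤ} → InvX Ψ → InvX (CasY Ψ)
  CasY-invX {Ψ = Ψ} inv i j ne qs = begin
    dΓ (E (inX i) (inX j)) (CasY Ψ) qs ≡⟨ Cas-commute (𝕊 N) Qs wt actY _ (λ k l → E-commute (inY k) (inY l) (inX i) (inX j) (inX≢inY i l ∘ ≡.sym) (inX≢inY j k)) Ψ qs ⟩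
    CasY (dΓ (E (inX i) (inX j)) Ψ) qs ≡⟨ Cas-cong (𝕊 N) Qs wt actY (inv i j ne) qs ⟩
    CasY (λ q → -ᶻ dΓ (F (inX i) (inX j)) Ψ q) qs ≡⟨ Cas-neg (𝕊 N) Qs wt actY _ qs ⟩
    -ᶻ CasY (dΓ (F (inX i) (inX j)) Ψ) qs ≡⟨ ≡.cong -ᶻ_ (≡.sym (Cas-commute (𝕊 N) Qs wt actY _ (λ k l → E-F-commute (inY k) (inY l) (inX i) (inX j)) Ψ qs)) ⟩
    -ᶻ dΓ (F (inX i) (inX j)) (CasY Ψ) qs ∎
    where open ≡.≡-Reasoning

  -- C - z for the total Casimir operator C of gl(n) × gl(m).
  shifted : ℤ → ∀ {r} → (Vec Site r → ℤ) → Vec Site r → ℤ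
  shifted z Ψ qs = -ᶻ z *ᶻ Ψ qs +ᶻ (CasX Ψ qs +ᶻ CasY Ψ qs)

  invariant-combine : ∀ {k} {inc : Fin k → Fin N} {inj : ∀ {i j} → inc i ≡ inc j → i ≡ j} → let I = λ {r} → Invariant (𝕊 N) Qs wt (action inc inj) {r} in
    ∀ {r} z {Ψ Φ Χ : Vec Site r → ℤ} → I Ψ → I Φ → I Χ → I (λ qs → z *ᶻ Ψ qs +ᶻ (Φ qs +ᶻ Χ qs))
  invariant-combine {inc = inc} z {Ψ} {Φ} {Χ} i₁ i₂ i₃ i j ne qs = begin
    dΓ e (λ qs → z *ᶻ Ψ qs +ᶻ (Φ qs +ᶻ Χ qs)) qs
      ≡⟨ ≡.trans (dΓ-linear e z Ψ _ qs) (≡.cong (z *ᶻ dΓ e Ψ qs +ᶻ_) (dΓ-+ e Φ Χ qs)) ⟩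
    z *ᶻ dΓ e Ψ qs +ᶻ (dΓ e Φ qs +ᶻ dΓ e Χ qs)
      ≡⟨ ≡.cong₂ (λ u v → z *ᶻ u +ᶻ v) (i₁ i j ne qs) (≡.cong₂ _+ᶻ_ (i₂ i j ne qs) (i₃ i j ne qs)) ⟩
    z *ᶻ -ᶻ dΓ g Ψ qs +ᶻ (-ᶻ dΓ g Φ qs +ᶻ -ᶻ dΓ g Χ qs)
      ≡⟨ ℤK.solve 4 (λ z a b c → z ℤK.:* (ℤK.:- a) ℤK.:+ (ℤK.:- b ℤK.:+ ℤK.:- c) ℤK.:= ℤK.:- (z ℤK.:* a ℤK.:+ (b ℤK.:+ c))) ≡.refl z (dΓ g Ψ qs) (dΓ g Φ qs) (dΓ g Χ qs) ⟩
    -ᶻ (z *ᶻ dΓ g Ψ qs +ᶻ (dΓ g Φ qs +ᶻ dΓ g Χ qs))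
      ≡⟨ ≡.cong -ᶻ_ (≡.sym (≡.trans (dΓ-linear g z Ψ _ qs) (≡.cong (z *ᶻ dΓ g Ψ qs +ᶻ_) (dΓ-+ g Φ Χ qs)))) ⟩
    -ᶻ dΓ g (λ qs → z *ᶻ Ψ qs +ᶻ (Φ qs +ᶻ Χ qs)) qs ∎
    where
    open ≡.≡-Reasoning
    e = E (inc i) (inc j)
    g = F (inc i) (inc j)

  shifted-invariant : ∀ z {r} {Ψ : Vec Site r → ℤ} → Inv Ψ → Inv (shifted z Ψ)
  shifted-invariant z {Ψ = Ψ} (ix , iy) =
      invariant-combine {inc = inX} {injX} (-ᶻ z) ix (Cas-invariant (𝕊 N) Qs wt actX ix) (CasY-invX ix)
    , invariant-combine {inc = inY} {injY} (-ᶻ z) iy (CasX-invY iy) (Cas-invariant (𝕊 N) Qs wt actY iy)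

  eigX eigY c : Vec ℕ N → ℤ
  eigX p = eigenvalue (clamp (xPart p))
  eigY p = eigenvalue (clamp (yPart p))
  c p = eigX p +ᶻ eigY p

  module _ (Ls : List (ℤ × Vec ℕ N)) where
    Expands : Carrier → (ℤ × Vec ℕ N → ℤ) → Set
    Expands f g = f ≈ ∑ Ls λ x → ι (g x) * basis (proj₂ x)

    module _ {r} {Ψ Ψ′ : Vec Site r → ℤ} (inv : Inv Ψ) (inv′ : Inv Ψ′) (g : ℤ × Vec ℕ N → ℤ) (e : Expands P.⟨ Ψ , Ψ′ ⟩ g) where
      expands-CasX : Expands P.⟨ CasX Ψ , Ψ′ ⟩ (λ x → g x *ᶻ eigX (proj₂ x))
      expands-CasX = trans (pairing-Cas (𝕊 N) Qs wt actX (proj₁ inv) (proj₁ inv′))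
        (trans (casimir-s (subCoordinates inX injX) (trace-relations (𝕊 N) Qs wt actX (proj₁ inv) (proj₁ inv′)) (regular-Δ N inX injX) Ls g (clamp ∘ xPart ∘ proj₂) (sY n m ∘ clamp ∘ yPart ∘ proj₂)
          (λ x → clamp-decreasing (xPart (proj₂ x)))
          (λ k x → SchurConstants.∂-zero-s (𝕊 N) (θ N (inX k)) _ (λ j → θ-gen-diff N (inX k) (inY j) (inX≢inY k j)) (clamp (yPart (proj₂ x)))) e)
          (∑-cong Ls λ x → trans (sym (*-assoc _ _ _)) (*-congʳ (sym (*-homo (g x) (eigX (proj₂ x)))))))

      expands-CasY : Expands P.⟨ CasY Ψ , Ψ′ ⟩ (λ x → g x *ᶻ eigY (proj₂ x))
      expands-CasY = trans (pairing-Cas (𝕊 N) Qs wt actY (proj₂ inv) (proj₂ inv′))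
        (trans (casimir-s (subCoordinates inY injY) (trace-relations (𝕊 N) Qs wt actY (proj₂ inv) (proj₂ inv′)) (regular-Δ N inY injY) Ls g (clamp ∘ yPart ∘ proj₂) (sX m n ∘ clamp ∘ xPart ∘ proj₂)
          (λ x → clamp-decreasing (yPart (proj₂ x)))
          (λ k x → SchurConstants.∂-zero-s (𝕊 N) (θ N (inY k)) _ (λ j → θ-gen-diff N (inY k) (inX j) (inX≢inY j k ∘ ≡.sym)) (clamp (xPart (proj₂ x))))
          (trans e (∑-cong Ls λ x → *-congˡ (*-comm _ _))))
          (∑-cong Ls λ x → trans (sym (*-assoc _ _ _)) (*-cong (sym (*-homo (g x) (eigY (proj₂ x)))) (*-comm _ _))))

      expands-shifted : ∀ z → Expands P.⟨ shifted z Ψ , Ψ′ ⟩ (λ x → g x *ᶻ (c (proj₂ x) -ᶻ z))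
      expands-shifted z = begin
        P.⟨ shifted z Ψ , Ψ′ ⟩
          ≈⟨ trans (P.pairing-linear (-ᶻ z) Ψ _ Ψ′) (+-cong (*-congˡ e) (trans (P.pairing-+ (CasX Ψ) (CasY Ψ) Ψ′) (+-cong expands-CasX expands-CasY))) ⟩
        ι (-ᶻ z) * ∑ Ls (λ x → ι (g x) * basis (proj₂ x)) + (∑ Ls (λ x → ι (g x *ᶻ eigX (proj₂ x)) * basis (proj₂ x)) + ∑ Ls (λ x → ι (g x *ᶻ eigY (proj₂ x)) * basis (proj₂ x)))
          ≈⟨ +-cong (sym (∑-*ˡ Ls _ _)) (sym (∑-+ Ls _ _)) ⟩
        ∑ Ls (λ x → ι (-ᶻ z) * (ι (g x) * basis (proj₂ x))) + ∑ Ls (λ x → ι (g x *ᶻ eigX (proj₂ x)) * basis (proj₂ x) + ι (g x *ᶻ eigY (proj₂ x)) * basis (proj₂ x))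
          ≈⟨ sym (∑-+ Ls _ _) ⟩
        ∑ Ls (λ x → ι (-ᶻ z) * (ι (g x) * basis (proj₂ x)) + (ι (g x *ᶻ eigX (proj₂ x)) * basis (proj₂ x) + ι (g x *ᶻ eigY (proj₂ x)) * basis (proj₂ x)))
          ≈⟨ ∑-cong Ls (λ x → trans (+-cong (sym (ι-** (-ᶻ z) (g x) _)) (sym (trans (*-congʳ (+-homo _ _)) (distribʳ _ _ _))))
               (trans (sym (trans (*-congʳ (+-homo _ _)) (distribʳ _ _ _))) (*-congʳ (reflexive (≡.cong ι (rearrange z (g x) (eigX (proj₂ x)) (eigY (proj₂ x)))))))) ⟩
        ∑ Ls (λ x → ι (g x *ᶻ (c (proj₂ x) -ᶻ z)) * basis (proj₂ x)) ∎
        where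
        open R≈
        rearrange : ∀ z g a b → -ᶻ z *ᶻ g +ᶻ (g *ᶻ a +ᶻ g *ᶻ b) ≡ g *ᶻ ((a +ᶻ b) -ᶻ z)
        rearrange = ℤK.solve 4 (λ z g a b → (ℤK.:- z) ℤK.:* g ℤK.:+ (g ℤK.:* a ℤK.:+ g ℤK.:* b) ℤK.:= g ℤK.:* ((a ℤK.:+ b) ℤK.:- z)) ≡.refl

    squares : List ℤ → Vec ℕ N → ℤ
    squares [] q = + 1
    squares (z ∷ zs) q = (c q -ᶻ z) *ᶻ (c q -ᶻ z) *ᶻ squares zs q

    -- Replacing Ψ by (C - z)Ψ in one argument of the pairing multiplies each Schur coefficient by c
    -- - z; the symmetry of the pairing gives the same factor for the second argument. The pairing
    -- of (C - z)Ψ with itself therefore carries the square, and the remaining z are treated in the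
    -- same way.
    squares-nonneg : ∀ zs {r} (Ψ : Vec Site r → ℤ) → Inv Ψ → ∀ g → Expands P.⟨ Ψ , Ψ ⟩ g →
      ∀ p → + 0 ℤ.≤ ℤK.∑ Ls (λ x → g x *ᶻ squares zs (proj₂ x) *ᶻ M p (proj₂ x))
    squares-nonneg [] Ψ inv g e p = ≡.subst (+ 0 ℤ.≤_)
      (≡.trans (at-cong N e p) (≡.trans (at-∑ N Ls _ p) (ℤK.∑-cong Ls λ x → ≡.trans (at-ι* N (g x) (basis (proj₂ x)) p)
        (≡.cong (_*ᶻ M p (proj₂ x)) (≡.sym (ℤP.*-identityʳ (g x)))))))
      (nonneg-at N _ (nonneg-pairing N Qs wt (λ q → nonneg-gen N (proj₁ q)) Ψ) p)
    squares-nonneg (z ∷ zs) Ψ inv g e p = ≡.subst (+ 0 ℤ.≤_)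
      (ℤK.∑-cong Ls λ x → ≡.cong (_*ᶻ M p (proj₂ x)) (regroup (g x) (c (proj₂ x) -ᶻ z) (squares zs (proj₂ x))))
      (squares-nonneg zs (shifted z Ψ) inv₁ _
        (expands-shifted inv inv₁ (λ x → g x *ᶻ (c (proj₂ x) -ᶻ z)) (trans (P.pairing-sym Ψ (shifted z Ψ)) (expands-shifted inv inv g e z)) z) p)
      where
      inv₁ = shifted-invariant z inv
      regroup : ∀ g d s → g *ᶻ d *ᶻ d *ᶻ s ≡ g *ᶻ (d *ᶻ d *ᶻ s)
      regroup = ℤK.solve 3 (λ g d s → g ℤK.:* d ℤK.:* d ℤK.:* s ℤK.:= g ℤK.:* (d ℤK.:* d ℤK.:* s)) ≡.refl

    squares-zero : ∀ {zs q} → c q ∈ zs → squares zs q ≡ + 0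
    squares-zero {z ∷ zs} {q} (here e) = ≡.trans (≡.cong (λ d → d *ᶻ d *ᶻ squares zs q) (≡.trans (≡.cong (_-ᶻ z) e) (ℤP.+-inverseʳ z))) (ℤP.*-zeroˡ (squares zs q))
    squares-zero {z ∷ zs} {q} (there i) = ≡.trans (≡.cong ((c q -ᶻ z) *ᶻ (c q -ᶻ z) *ᶻ_) (squares-zero i)) (ℤP.*-zeroʳ ((c q -ᶻ z) *ᶻ (c q -ᶻ z)))

    squares-positive : ∀ {zs q} → All (λ z → c q ≢ z) zs → Positive (squares zs q)
    squares-positive [] = 0 , ≡.refl
    squares-positive {z ∷ zs} {q} (ne ∷ nes) = positive-* (positive-square (c q -ᶻ z) (ne ∘ ℤP.i-j≡0⇒i≡j (c q) z)) (squares-positive nes)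

  -- Under dominance the energy is monotone in each alphabet, so equality of the sums forces
  -- equality of both energies, and `energy-injective` applies twice.
  c-separates : ∀ {r} p q → Good r p → Good r q → Dominated p q → c p ≡ c q → p ≡ q
  c-separates p q ((dx , dy) , _) ((dx′ , dy′) , _) (domX , domY) e = ≡.trans (≡.sym (VP.take++drop≡id n p))
    (≡.trans (≡.cong₂ V._++_ (energy-injective (xPart p) (xPart q) dx dx′ domX eqX) (energy-injective (yPart p) (yPart q) dy dy′ domY eqY)) (VP.take++drop≡id n q))
    where
    leX = energy-mono (xPart p) (xPart q) dx dx′ domX
    leY = energy-mono (yPart p) (yPart q) dy dy′ domY
    sums : rowEnergy (xPart p) ℕ.+ rowEnergy (yPart p) ≡ rowEnergy (xPart q) ℕ.+ rowEnergy (yPart q)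
    sums = ℤP.+-injective (≡.trans (unshift p dx dy) (≡.trans (≡.cong (λ k → k +ᶻ (+ zx +ᶻ + zy)) e) (≡.sym (unshift q dx′ dy′))))
      where
      zx = rowEnergy (V.replicate n 0)
      zy = rowEnergy (V.replicate m 0)
      unshift : ∀ p → Decreasing (xPart p) → Decreasing (yPart p) → + rowEnergy (xPart p) +ᶻ + rowEnergy (yPart p) ≡ c p +ᶻ (+ zx +ᶻ + zy)
      unshift p d d′ = ≡.trans (≡.cong₂ (λ u v → + rowEnergy u +ᶻ + rowEnergy v) (≡.sym (clamp-id (xPart p) d)) (≡.sym (clamp-id (yPart p) d′)))
        (ℤK.solve 4 (λ a b x y → a ℤK.:+ b ℤK.:= ((a ℤK.:- x) ℤK.:+ (b ℤK.:- y)) ℤK.:+ (x ℤK.:+ y)) ≡.refl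
          (+ rowEnergy (clamp (xPart p))) (+ rowEnergy (clamp (yPart p))) (+ zx) (+ zy))
    eqX : rowEnergy (xPart p) ≡ rowEnergy (xPart q)
    eqX = ℕP.≤-antisym leX (ℕP.+-cancelʳ-≤ (rowEnergy (yPart p)) _ _ (ℕP.≤-trans (ℕP.+-monoʳ-≤ (rowEnergy (xPart q)) leY) (ℕP.≤-reflexive (≡.sym sums))))
    eqY : rowEnergy (yPart p) ≡ rowEnergy (yPart q)
    eqY = ℕP.≤-antisym leY (ℕP.+-cancelˡ-≤ (rowEnergy (xPart p)) _ _ (ℕP.≤-trans (ℕP.+-monoˡ-≤ (rowEnergy (yPart q)) leX) (ℕP.≤-reflexive (≡.sym sums))))

  Closed : ∀ {k} → (Fin k → Fin N) → List (Subset N) → Set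
  Closed inc bs = ∀ i j → i ≢ j → ∀ {b} → b ∈ bs → (inc j ∈ᵇ b) ≡ true → (inc i ∈ᵇ b) ≡ false → ((b V.[ inc j ]≔ false) V.[ inc i ]≔ true) ∈ bs

  -- For a fixed p, the coefficient of x^p after filtering is the coefficient sought times R! and a
  -- product of nonzero squares; the left side is nonnegative, and the positive factors cancel.
  coefficients-nonneg : ∀ bs → AllPairs _≢_ bs → Closed inX bs → Closed inY bs →
    ∀ r Ls → map proj₂ Ls ≡ indices r → ∏ bs W ≈ combination Ls → All (λ x → + 0 ℤ.≤ proj₁ x) Ls
  coefficients-nonneg bs uniq closedX closedY r Ls ind e = All.tabulate λ { {(a , p)} mem → nonneg a p mem }
    where
    F! = + (L.length bs !)
    goodAll : ∀ {x} → x ∈ Ls → Good r (proj₂ x)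
    goodAll i = All.lookup (AllP.all-filter (good? r) (vectors r N)) (≡.subst (_ ∈_) ind (∈-map⁺ proj₂ i))
    keys : AllPairs (λ x y → proj₂ x ≢ proj₂ y) Ls
    keys = AllPairsP.map⁻ (≡.subst (AllPairs _≢_) (≡.sym ind) (distinct (indices-triangular r) (AllP.all-filter (good? r) (vectors r N))))
      where
      distinct : ∀ {ps} → AllPairs (λ p q → M p q ≡ + 0) ps → All (Good r) ps → AllPairs _≢_ ps
      distinct [] [] = []
      distinct {p ∷ ps} (z ∷ zs) (g ∷ gs) = All.map (λ { {q} z ≡.refl → 1≢0 (≡.trans (≡.sym (M-diagonal p g)) z) }) z ∷ distinct zs gs
        where
        1≢0 : + 1 ≢ + 0
        1≢0 ()
    expands : Expands Ls P.⟨ Ω bs , Ω bs ⟩ (λ x → F! *ᶻ proj₁ x)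
    expands = trans (Ω-norm bs uniq) (trans (*-congˡ e) (trans (sym (∑-*ˡ Ls _ _)) (∑-cong Ls λ x → sym (ι-** F! (proj₁ x) _))))
    nonneg : ∀ a p → (a , p) ∈ Ls → + 0 ℤ.≤ a
    nonneg a p mem = positive-cancel (positive-! (L.length bs)) (positive-cancel (squares-positive Ls zs≢)
      (≡.subst (+ 0 ℤ.≤_) (≡.trans single simplify) (squares-nonneg Ls zs (Ω bs) (Ω-invariant bs inX injX closedX , Ω-invariant bs inY injY closedY) _ expands p)))
      where
      differs? : ∀ z → Dec (c p ≢ z)
      differs? z with c p ℤP.≟ z
      ... | yes e = no λ ne → ne e
      ... | no ne = yes ne
      -- Every eigenvalue that occurs, except that of p; the squares built from these kill all
      -- eigenvalues but one.
      zs = L.filter differs? (map (c ∘ proj₂) Ls)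
      zs≢ : All (λ z → c p ≢ z) zs
      zs≢ = AllP.all-filter differs? (map (c ∘ proj₂) Ls)
      term : ℤ × Vec ℕ N → ℤ
      term x = F! *ᶻ proj₁ x *ᶻ squares Ls zs (proj₂ x) *ᶻ M p (proj₂ x)
      single : ℤK.∑ Ls term ≡ term (a , p)
      single = ∑-only proj₂ keys mem term λ {x} i ne → cases x i ne (c p ℤP.≟ c (proj₂ x))
        where
        cases : ∀ x → x ∈ Ls → proj₂ x ≢ p → Dec (c p ≡ c (proj₂ x)) → term x ≡ + 0
        -- An index with the eigenvalue of p but different from p cannot dominate p, so its basis
        -- element lacks the monomial x^p.
        cases x i ne (yes eq) = ≡.trans (≡.cong (F! *ᶻ proj₁ x *ᶻ squares Ls zs (proj₂ x) *ᶻ_)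
          (M-undominated p (proj₂ x) (goodAll i) λ dom → ne (≡.sym (c-separates p (proj₂ x) (goodAll mem) (goodAll i) dom eq)))) (ℤP.*-zeroʳ (F! *ᶻ proj₁ x *ᶻ squares Ls zs (proj₂ x)))
        cases x i ne (no neq) = ≡.trans (≡.cong (λ k → F! *ᶻ proj₁ x *ᶻ k *ᶻ M p (proj₂ x)) (squares-zero Ls {zs} {proj₂ x} (∈-filter⁺ differs? (∈-map⁺ (c ∘ proj₂) i) neq)))
          (≡.trans (≡.cong (_*ᶻ M p (proj₂ x)) (ℤP.*-zeroʳ (F! *ᶻ proj₁ x))) (ℤP.*-zeroˡ (M p (proj₂ x))))
      simplify : term (a , p) ≡ a *ᶻ F! *ᶻ squares Ls zs p
      simplify = ≡.trans (≡.cong (F! *ᶻ a *ᶻ squares Ls zs p *ᶻ_) (M-diagonal p (goodAll mem)))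
        (≡.trans (ℤP.*-identityʳ _) (≡.cong (_*ᶻ squares Ls zs p) (ℤP.*-comm F! a)))

-- Boolean comparisons

infix 4 _≤ᶠ_
-- Successors on both sides cancel by definition, which keeps the comparison of row lengths in step
-- with the recursion of `colOK-extend`.
_≤ᶠ_ : ℕ → ℕ → Bool
zero ≤ᶠ n = true
suc m ≤ᶠ zero = false
suc m ≤ᶠ suc n = m ≤ᶠ n

≤ᶠ-true : ∀ {m n} → m ≤ n → (m ≤ᶠ n) ≡ true
≤ᶠ-true z≤n = ≡.refl
≤ᶠ-true (s≤s p) = ≤ᶠ-true p

≤ᶠ-false : ∀ {m n} → n < m → (m ≤ᶠ n) ≡ false
≤ᶠ-false {suc m} {zero} _ = ≡.refl
≤ᶠ-false {suc m} {suc n} (s≤s p) = ≤ᶠ-false p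

≤ᵇ-true : ∀ {m n} → m ≤ n → (m ℕ.≤ᵇ n) ≡ true
≤ᵇ-true {m} {n} p with m ℕ.≤ᵇ n | ℕP.≤⇒≤ᵇ p
... | true | _ = ≡.refl

≤ᵇ-false : ∀ {m n} → n < m → (m ℕ.≤ᵇ n) ≡ false
≤ᵇ-false {m} {n} p with m ℕ.≤ᵇ n | ℕP.≤ᵇ⇒≤ m n
... | false | _ = ≡.refl
... | true | f = ⊥-elim (ℕP.<-irrefl ≡.refl (ℕP.<-≤-trans p (f tt)))

Row : ℕ → Set
Row n = List (Fin n)

-- Column conditions of semistandard tableaux

-- The row above a given one; nothing stands above the first row.
Above : ℕ → Set
Above n = Maybe (Row n)

colOK′ : ∀ {n} → Above n → Row n → Bool
colOK′ nothing r = true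
colOK′ (just u) r = colOK u r

fits : ∀ {n} → Above n → ℕ → Bool
fits nothing l = true
fits (just u) l = l ≤ᶠ L.length u

-- The conditions on a semistandard tableau, regrouped so that each row is tested only against the
-- row above it; this allows a recursion from the top down.
chain : ∀ {n} → Above n → List (Row n) → Bool
chain p [] = true
chain p (r ∷ rs) = (colOK′ p r ∧ rowOK r) ∧ chain (just r) rs

isSSYT-chain : ∀ {n} (T : List (Row n)) → isSSYT T ≡ chain nothing T
isSSYT-chain [] = ≡.refl
isSSYT-chain (r ∷ []) with rowOK r
... | true = ≡.refl
... | false = ≡.refl
isSSYT-chain (r ∷ r′ ∷ rs) = ≡.trans (≡.cong (λ b → rowOK r ∧ colOK r r′ ∧ b) (isSSYT-chain (r′ ∷ rs))) (assoc (rowOK r) (colOK r r′) (rowOK r′) (chain (just r′) rs))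
  where
  assoc : ∀ a b c d → a ∧ b ∧ (c ∧ d) ≡ a ∧ ((b ∧ c) ∧ d)
  assoc false b c d = ≡.refl
  assoc true false c d = ≡.refl
  assoc true true c d = ≡.refl

headOK : ∀ {n} → Fin n → Row n → Bool
headOK a [] = true
headOK a (b ∷ r) = toℕ a ℕ.≤ᵇ toℕ b

rowOK-∷ : ∀ {n} (a : Fin n) r → rowOK (a ∷ r) ≡ headOK a r ∧ rowOK r
rowOK-∷ a [] = ≡.refl
rowOK-∷ a (b ∷ r) = ≡.refl

-- A weakly increasing row over n + 1 letters consists of a row over n letters followed by copies of
-- the top letter.
extend : ∀ {n} → Row n → ℕ → Row (suc n)
extend {n} u k = map F.inject₁ u ++ L.replicate k (F.fromℕ n)

extendAbove : ∀ {n} → Above n → ℕ → Above (suc n)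
extendAbove nothing k = nothing
extendAbove (just u) k = just (extend u k)

headOK-inject : ∀ {n} (i : Fin n) u k → headOK (F.inject₁ i) (extend u k) ≡ headOK i u
headOK-inject i [] zero = ≡.refl
headOK-inject {n} i [] (suc k) = ≤ᵇ-true (ℕP.≤-trans (ℕP.≤-reflexive (FP.toℕ-inject₁ i)) (ℕP.≤-trans (ℕP.<⇒≤ (FP.toℕ<n i)) (ℕP.≤-reflexive (≡.sym (FP.toℕ-fromℕ n)))))
headOK-inject i (b ∷ u) k = ≡.cong₂ ℕ._≤ᵇ_ (FP.toℕ-inject₁ i) (FP.toℕ-inject₁ b)

headOK-top-∷ : ∀ {n} (b : Fin n) u k → headOK (F.fromℕ n) (extend (b ∷ u) k) ≡ false
headOK-top-∷ {n} b u k = ≤ᵇ-false (≡.subst₂ _<_ (≡.sym (FP.toℕ-inject₁ b)) (≡.sym (FP.toℕ-fromℕ n)) (FP.toℕ<n b))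

headOK-top-[] : ∀ {n} k → headOK (F.fromℕ n) (extend [] k) ≡ true
headOK-top-[] zero = ≡.refl
headOK-top-[] {n} (suc k) = ≤ᵇ-true {toℕ (F.fromℕ n)} ℕP.≤-refl

<ᵇ-false : ∀ {m n} → n ≤ m → (m ℕ.<ᵇ n) ≡ false
<ᵇ-false {m} {n} p = ≤ᵇ-false {suc m} {n} (s≤s p)

<ᵇ-true : ∀ {m n} → m < n → (m ℕ.<ᵇ n) ≡ true
<ᵇ-true {m} {n} p = ≤ᵇ-true {suc m} {n} p

colOK-[] : ∀ {n} (r : Row n) → colOK r [] ≡ true
colOK-[] [] = ≡.refl
colOK-[] (_ ∷ _) = ≡.refl

-- Nothing can stand below a top letter, whereas a top letter may stand below any smaller one. Hence
-- the whole lower row must fit under the part `u` of the upper row; this is half of the interlacing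
-- condition.
colOK-extend : ∀ {n} (u u′ : Row n) a k → colOK (extend u a) (extend u′ k) ≡ colOK u u′ ∧ (L.length u′ ℕ.+ k ≤ᶠ L.length u)
colOK-extend {n} [] (b ∷ u′) zero k = ≡.refl
colOK-extend {n} [] (b ∷ u′) (suc a) k = ≡.cong (_∧ colOK (extend [] a) (extend u′ k))
  (<ᵇ-false (≡.subst₂ _≤_ (≡.sym (FP.toℕ-inject₁ b)) (≡.sym (FP.toℕ-fromℕ n)) (ℕP.<⇒≤ (FP.toℕ<n b))))
colOK-extend (c ∷ u) (b ∷ u′) a k = ≡.trans (≡.cong₂ _∧_ (≡.cong₂ ℕ._<ᵇ_ (FP.toℕ-inject₁ c) (FP.toℕ-inject₁ b)) (colOK-extend u u′ a k))
  (assoc (toℕ c ℕ.<ᵇ toℕ b) (colOK u u′) (L.length u′ ℕ.+ k ≤ᶠ L.length u))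
  where
  assoc : ∀ x y z → x ∧ (y ∧ z) ≡ (x ∧ y) ∧ z
  assoc false y z = ≡.refl
  assoc true y z = ≡.refl
colOK-extend u [] a zero = ≡.trans (colOK-[] (extend u a)) (≡.sym (≡.cong (_∧ true) (colOK-[] u)))
colOK-extend [] [] zero (suc k) = ≡.refl
colOK-extend {n} [] [] (suc a) (suc k) = ≡.cong (_∧ colOK (extend {n} [] a) (extend {n} [] k)) (<ᵇ-false {toℕ (F.fromℕ n)} ℕP.≤-refl)
colOK-extend {n} (c ∷ u) [] a (suc k) = ≡.trans (≡.cong₂ _∧_ (<ᵇ-true (≡.subst₂ _<_ (≡.sym (FP.toℕ-inject₁ c)) (≡.sym (FP.toℕ-fromℕ n)) (FP.toℕ<n c))) (colOK-extend u [] a k))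
  (≡.cong (_∧ (k ≤ᶠ L.length u)) (colOK-[] u))

colOK′-extend : ∀ {n} (p : Above n) u′ a k → colOK′ (extendAbove p a) (extend u′ k) ≡ colOK′ p u′ ∧ fits p (L.length u′ ℕ.+ k)
colOK′-extend nothing u′ a k = ≡.refl
colOK′-extend (just u) u′ a k = colOK-extend u u′ a k

colOK′-[] : ∀ {n} (p : Above n) → colOK′ p [] ≡ true
colOK′-[] nothing = ≡.refl
colOK′-[] (just u) = colOK-[] u

-- d rows have been used up to p; since entries below p are at least d, a tableau
-- over n letters has at most n nonempty rows.
Deep : ∀ {n} → ℕ → Above n → Set
Deep {n} d p = ∀ (b : Fin n) r → colOK′ p (b ∷ r) ≡ true → d ≤ toℕ b

deep-nothing : ∀ {n} → Deep {n} 0 nothing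
deep-nothing b r _ = z≤n

deep-suc : ∀ {n d} {p : Above n} u → Deep d p → colOK′ p u ≡ true → Deep (suc d) (just u)
deep-suc [] deep e b r ()
deep-suc {d = d} (a ∷ u) deep e b r e′ with toℕ a ℕ.<ᵇ toℕ b in lt
... | true = ℕP.≤-trans (s≤s (deep a u e)) (ℕP.<ᵇ⇒< (toℕ a) (toℕ b) (≡.subst T (≡.sym lt) tt))
deep-suc {d = d} (a ∷ u) deep e b r () | false

strip : List ℕ → List ℕ
strip [] = []
strip (zero ∷ ls) = []
strip (suc a ∷ ls) = suc a ∷ strip ls

-- Generating functions of tableaux and the branching rule

module Tableaux (A : Alg) where
  open Kit A
  open Alternants A

  ⟦_⟧ : Bool → Carrier
  ⟦ b ⟧ = if b then 1# else 0#

  ⟦∧⟧ : ∀ a b → ⟦ a ∧ b ⟧ ≈ ⟦ a ⟧ * ⟦ b ⟧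
  ⟦∧⟧ true b = sym (*-identityˡ _)
  ⟦∧⟧ false b = sym (zeroˡ _)

  ⟦⟧-cong : ∀ {a b} → a ≡ b → ⟦ a ⟧ ≈ ⟦ b ⟧
  ⟦⟧-cong e = reflexive (≡.cong ⟦_⟧ e)

  ⟦⟧-true : ∀ {b} → b ≡ true → ∀ z → ⟦ b ⟧ * z ≈ z
  ⟦⟧-true ≡.refl z = *-identityˡ z

  ⟦⟧-false : ∀ {b} → b ≡ false → ∀ z → ⟦ b ⟧ * z ≈ 0#
  ⟦⟧-false ≡.refl z = zeroˡ z

  ⟦⟧-guard : ∀ b {z z′} → (b ≡ true → z ≈ z′) → ⟦ b ⟧ * z ≈ ⟦ b ⟧ * z′
  ⟦⟧-guard true e = *-congˡ (e ≡.refl)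
  ⟦⟧-guard false e = trans (zeroˡ _) (sym (zeroˡ _))

  ∑-filterᵇ : ∀ {I : Set} (p : I → Bool) is f → ∑ (filterᵇ p is) f ≈ ∑ is (λ i → ⟦ p i ⟧ * f i)
  ∑-filterᵇ p [] f = refl
  ∑-filterᵇ p (i ∷ is) f with p i
  ... | true = +-cong (sym (*-identityˡ _)) (∑-filterᵇ p is f)
  ... | false = trans (∑-filterᵇ p is f) (sym (trans (+-congʳ (zeroˡ _)) (+-identityˡ _)))

  ∑-cong-All : ∀ {I : Set} {P : I → Set} {is : List I} {f g} → All P is → (∀ i → P i → f i ≈ g i) → ∑ is f ≈ ∑ is g
  ∑-cong-All [] e = refl
  ∑-cong-All (p ∷ ps) e = +-cong (e _ p) (∑-cong-All ps e)

  letters : ∀ n → List (Fin n)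
  letters n = V.toList (V.allFin n)

  ∑-letters : ∀ n (f : Fin (suc n) → Carrier) → ∑ (letters (suc n)) f ≈ ∑ (letters n) (f ∘ F.inject₁) + f (F.fromℕ n)
  ∑-letters n f = trans (∑-tabulate (suc n) id f) (trans (split n f) (+-congʳ (sym (∑-tabulate n id (f ∘ F.inject₁)))))
    where
    open Indexed A using (∑-fins)
    ∑-tabulate : ∀ n {I : Set} (h : Fin n → I) (f : I → Carrier) → ∑ (V.toList (V.tabulate h)) f ≈ ∑ (fins n) (f ∘ h)
    ∑-tabulate zero h f = refl
    ∑-tabulate (suc n) h f = trans (+-congˡ (∑-tabulate n (h ∘ F.suc) f)) (sym (∑-fins n (f ∘ h)))
    split : ∀ n (f : Fin (suc n) → Carrier) → ∑ (fins (suc n)) f ≈ ∑ (fins n) (f ∘ F.inject₁) + f (F.fromℕ n)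
    split zero f = trans (+-identityʳ _) (sym (+-identityˡ _))
    split (suc n) f = trans (∑-fins (suc n) f) (trans (+-congˡ (split n (f ∘ F.suc)))
      (trans (sym (+-assoc _ _ _)) (+-congʳ (sym (∑-fins n (f ∘ F.inject₁))))))

  ∑-rows : ∀ n l f → ∑ (rowsOfLen n (suc l)) f ≈ ∑ (letters n) (λ i → ∑ (rowsOfLen n l) (λ r → f (i ∷ r)))
  ∑-rows n l f = trans (∑-concatMap _ (letters n) f) (∑-cong (letters n) λ i → ∑-map (i ∷_) (rowsOfLen n l) f)

  rows-length : ∀ n l → All (λ r → L.length r ≡ l) (rowsOfLen n l)
  rows-length n zero = ≡.refl ∷ []
  rows-length n (suc l) = AllP.concat⁺ (AllP.map⁺ {xs = V.toList (V.allFin n)} (All.tabulate λ {i} _ → AllP.map⁺ {f = i ∷_} (All.map (≡.cong suc) (rows-length n l))))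

  -- ∑ of g v k over v + k = l
  antidiagonal : ℕ → (ℕ → ℕ → Carrier) → Carrier
  antidiagonal zero g = g 0 0
  antidiagonal (suc l) g = antidiagonal l (λ v k → g v (suc k)) + g (suc l) 0

  antidiagonal-cong : ∀ l {g h} → (∀ v k → v ℕ.+ k ≡ l → g v k ≈ h v k) → antidiagonal l g ≈ antidiagonal l h
  antidiagonal-cong zero e = e 0 0 ≡.refl
  antidiagonal-cong (suc l) e = +-cong (antidiagonal-cong l λ v k p → e v (suc k) (≡.trans (ℕP.+-suc v k) (≡.cong suc p))) (e (suc l) 0 (ℕP.+-identityʳ (suc l)))

  antidiagonal-∑ : ∀ {I : Set} l (is : List I) (g : I → ℕ → ℕ → Carrier) → ∑ is (λ i → antidiagonal l (g i)) ≈ antidiagonal l (λ v k → ∑ is (λ i → g i v k))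
  antidiagonal-∑ zero is g = refl
  antidiagonal-∑ (suc l) is g = trans (∑-+ is _ _) (+-congʳ (antidiagonal-∑ l is _))

  antidiagonal-shift : ∀ l (g : ℕ → ℕ → Carrier) → antidiagonal (suc l) g ≈ antidiagonal l (λ v k → g (suc v) k) + g 0 (suc l)
  antidiagonal-shift zero g = +-comm _ _
  antidiagonal-shift (suc l) g = trans (+-congʳ (antidiagonal-shift l (λ v k → g v (suc k))))
    (solve 3 (λ a b c → a :+ b :+ c := a :+ c :+ b) refl _ _ _)

  antidiagonal-first : ∀ l (g : ℕ → ℕ → Carrier) → (∀ v k → g (suc v) k ≈ 0#) → antidiagonal l g ≈ g 0 l
  antidiagonal-first zero g z = refl
  antidiagonal-first (suc l) g z = trans (+-cong (antidiagonal-first l _ (λ v k → z v (suc k))) (z l 0)) (+-identityʳ _)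

  antidiagonal-interval : ∀ y l (h : ℕ → Carrier) → antidiagonal l (λ v k → y ^ k * h v) ≈ interval y 0 l h
  antidiagonal-interval y zero h = *-identityˡ _
  antidiagonal-interval y (suc l) h = +-cong
    (trans (antidiagonal-cong l λ v k _ → *-assoc _ _ _) (trans (antidiagonal-* l) (*-congˡ (antidiagonal-interval y l h)))) (*-identityˡ _)
    where
    antidiagonal-* : ∀ l {g} → antidiagonal l (λ v k → y * g v k) ≈ y * antidiagonal l g
    antidiagonal-* zero = refl
    antidiagonal-* (suc l) = trans (+-congʳ (antidiagonal-* l)) (sym (distribˡ _ _ _))

  interval-from : ∀ y b k (g : ℕ → Carrier) → (∀ v → v < b → g v ≈ 0#) → interval y 0 (b ℕ.+ k) g ≈ interval y b k g
  interval-from y b zero g z = trans (reflexive (≡.cong (λ j → interval y 0 j g) (ℕP.+-identityʳ b))) (last b z)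
    where
    vanish : ∀ b → (∀ v → v ≤ b → g v ≈ 0#) → interval y 0 b g ≈ 0#
    vanish zero z = z 0 z≤n
    vanish (suc b) z = trans (+-cong (trans (*-congˡ (vanish b λ v p → z v (ℕP.≤-trans p (ℕP.n≤1+n b)))) (zeroʳ y)) (z (suc b) ℕP.≤-refl)) (+-identityˡ _)
    last : ∀ b → (∀ v → v < b → g v ≈ 0#) → interval y 0 b g ≈ g b
    last zero z = refl
    last (suc b) z = trans (+-congʳ (trans (*-congˡ (vanish b λ v p → z v (s≤s p))) (zeroʳ y))) (+-identityˡ _)
  interval-from y b (suc k) g z = trans (reflexive (≡.cong (λ j → interval y 0 j g) (ℕP.+-suc b k)))
    (+-congʳ (*-congˡ (interval-from y b k g z)))

  -- Induction on the length: a letter below the top one may head an extended row exactly when it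
  -- may head the part `u`, while the top letter may only head a row of top letters, which is the
  -- summand with v = 0.
  ∑-rows-extend : ∀ n l (φ : Row (suc n) → Carrier) → ∑ (rowsOfLen (suc n) l) (λ r → ⟦ rowOK r ⟧ * φ r) ≈
    antidiagonal l (λ v k → ∑ (rowsOfLen n v) (λ u → ⟦ rowOK u ⟧ * φ (extend u k)))
  ∑-rows-extend n zero φ = refl
  ∑-rows-extend n (suc l) φ = begin
    ∑ (rowsOfLen (suc n) (suc l)) (λ r → ⟦ rowOK r ⟧ * φ r)
      ≈⟨ trans (∑-rows (suc n) l _) (∑-letters n _) ⟩
    ∑ (letters n) (λ i → ∑ (rowsOfLen (suc n) l) (λ r → ⟦ rowOK (F.inject₁ i ∷ r) ⟧ * φ (F.inject₁ i ∷ r)))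
      + ∑ (rowsOfLen (suc n) l) (λ r → ⟦ rowOK (F.fromℕ n ∷ r) ⟧ * φ (F.fromℕ n ∷ r))
      ≈⟨ +-cong (trans (∑-cong (letters n) λ i → trans (first (F.inject₁ i)) (antidiagonal-cong l λ v k _ → ∑-cong (rowsOfLen n v) λ u →
                   trans (*-congˡ (*-congʳ (⟦⟧-cong (headOK-inject i u k)))) (sym (unfold i u k)))) (antidiagonal-∑ l (letters n) _))
                (trans (first (F.fromℕ n)) (trans (antidiagonal-first l _ λ v k → trans (∑-rows n v _) (∑-zero (letters n) λ i → ∑-zero (rowsOfLen n v) λ u →
                   trans (*-congˡ (⟦⟧-false (headOK-top-∷ i u k) _)) (zeroʳ _)))
                   (+-congʳ (*-congˡ (⟦⟧-true (headOK-top-[] {n} l) _))))) ⟩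
    antidiagonal l (λ v k → ∑ (letters n) (λ i → ∑ (rowsOfLen n v) (λ u → ⟦ rowOK (i ∷ u) ⟧ * φ (extend (i ∷ u) k))))
      + ∑ (rowsOfLen n 0) (λ u → ⟦ rowOK u ⟧ * φ (extend u (suc l)))
      ≈⟨ +-congʳ (antidiagonal-cong l λ v k _ → sym (∑-rows n v _)) ⟩
    antidiagonal l (λ v k → ∑ (rowsOfLen n (suc v)) (λ u → ⟦ rowOK u ⟧ * φ (extend u k)))
      + ∑ (rowsOfLen n 0) (λ u → ⟦ rowOK u ⟧ * φ (extend u (suc l)))
      ≈⟨ sym (antidiagonal-shift l (λ v k → ∑ (rowsOfLen n v) (λ u → ⟦ rowOK u ⟧ * φ (extend u k)))) ⟩
    antidiagonal (suc l) (λ v k → ∑ (rowsOfLen n v) (λ u → ⟦ rowOK u ⟧ * φ (extend u k))) ∎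
    where
    open R≈
    first : ∀ a → ∑ (rowsOfLen (suc n) l) (λ r → ⟦ rowOK (a ∷ r) ⟧ * φ (a ∷ r)) ≈
      antidiagonal l (λ v k → ∑ (rowsOfLen n v) (λ u → ⟦ rowOK u ⟧ * (⟦ headOK a (extend u k) ⟧ * φ (a ∷ extend u k))))
    first a = trans (∑-cong (rowsOfLen (suc n) l) λ r → trans (*-congʳ (trans (⟦⟧-cong (rowOK-∷ a r)) (⟦∧⟧ (headOK a r) (rowOK r))))
        (solve 3 (λ h r p → h :* r :* p := r :* (h :* p)) refl _ _ _))
      (∑-rows-extend n l (λ r → ⟦ headOK a r ⟧ * φ (a ∷ r)))
    unfold : ∀ i u k → ⟦ rowOK (i ∷ u) ⟧ * φ (extend (i ∷ u) k) ≈ ⟦ rowOK u ⟧ * (⟦ headOK i u ⟧ * φ (extend (i ∷ u) k))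
    unfold i u k = trans (*-congʳ (trans (⟦⟧-cong (rowOK-∷ i u)) (⟦∧⟧ (headOK i u) (rowOK u)))) (solve 3 (λ h r p → h :* r :* p := r :* (h :* p)) refl _ _ _)

  rowWeight : ∀ {n} → (Fin n → Carrier) → Row n → Carrier
  rowWeight x r = ∏ r x

  rowWeight-extend : ∀ {n} (x : Fin (suc n) → Carrier) u k → rowWeight x (extend u k) ≈ x (F.fromℕ n) ^ k * rowWeight (x ∘ F.inject₁) u
  rowWeight-extend x [] zero = sym (*-identityˡ _)
  rowWeight-extend x [] (suc k) = trans (*-congˡ (rowWeight-extend x [] k)) (sym (*-assoc _ _ _))
  rowWeight-extend x (a ∷ u) k = trans (*-congˡ (rowWeight-extend x u k)) (solve 3 (λ a y u → a :* (y :* u) := y :* (a :* u)) refl _ _ _)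

  weightedTableaux : ∀ {n} → (Fin n → Carrier) → Above n → List ℕ → Carrier
  weightedTableaux {n} x p ls = ∑ (fillings n ls) (λ T → ⟦ chain p T ⟧ * ∏ T (rowWeight x))

  weightedTableaux-∷ : ∀ {n} (x : Fin n → Carrier) p l ls → weightedTableaux x p (l ∷ ls) ≈
    ∑ (rowsOfLen n l) (λ r → ⟦ rowOK r ⟧ * (⟦ colOK′ p r ⟧ * (rowWeight x r * weightedTableaux x (just r) ls)))
  weightedTableaux-∷ {n} x p l ls = trans (∑-concatMap _ (rowsOfLen n l) _) (∑-cong (rowsOfLen n l) λ r →
    trans (∑-map (r ∷_) (fillings n ls) _) (trans (∑-cong (fillings n ls) λ T →
      trans (*-congʳ (trans (⟦∧⟧ (colOK′ p r ∧ rowOK r) (chain (just r) T)) (*-congʳ (⟦∧⟧ (colOK′ p r) (rowOK r)))))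
        (solve 5 (λ c r h w t → c :* r :* h :* (w :* t) := (r :* (c :* w)) :* (h :* t)) refl _ _ _ _ _))
      (trans (∑-*ˡ (fillings n ls) _ _) (solve 4 (λ r c w t → (r :* (c :* w)) :* t := r :* (c :* (w :* t))) refl _ _ _ _))))

  weightedTableaux-[] : ∀ {n} (x : Fin n → Carrier) p → weightedTableaux x p [] ≈ 1#
  weightedTableaux-[] x p = trans (+-identityʳ _) (*-identityˡ _)

  -- The length condition depends on v + k = l alone and leaves the sum as a constant. `H` expresses
  -- that the rows below do not notice the number k of top letters.
  weightedTableaux-extend : ∀ {n} (x : Fin (suc n) → Carrier) p a l ls →
    let y = x (F.fromℕ n) ; x′ = x ∘ F.inject₁ in
    (H : Row n → Carrier) → (∀ u k → weightedTableaux x (just (extend u k)) ls ≈ H u) →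
    weightedTableaux x (extendAbove p a) (l ∷ ls) ≈
    ⟦ fits p l ⟧ * interval y 0 l (λ v → ∑ (rowsOfLen n v) (λ u → ⟦ rowOK u ⟧ * (⟦ colOK′ p u ⟧ * (rowWeight x′ u * H u))))
  weightedTableaux-extend {n} x p a l ls H e = begin
    weightedTableaux x (extendAbove p a) (l ∷ ls)
      ≈⟨ trans (weightedTableaux-∷ x (extendAbove p a) l ls) (∑-rows-extend n l _) ⟩
    antidiagonal l (λ v k → ∑ (rowsOfLen n v) (λ u → ⟦ rowOK u ⟧ * (⟦ colOK′ (extendAbove p a) (extend u k) ⟧ * (rowWeight x (extend u k) * weightedTableaux x (just (extend u k)) ls))))
      ≈⟨ antidiagonal-cong l (λ v k v+k → trans (∑-cong-All (rows-length n v) (λ u len → trans (*-congˡ (*-cong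
           (trans (⟦⟧-cong (≡.trans (colOK′-extend p u a k) (≡.cong (λ j → colOK′ p u ∧ fits p j) (≡.trans (≡.cong (ℕ._+ k) len) v+k)))) (⟦∧⟧ (colOK′ p u) (fits p l)))
           (*-cong (rowWeight-extend x u k) (e u k))))
           (solve 6 (λ r c f y w h → r :* (c :* f :* (y :* w :* h)) := (y :* f) :* (r :* (c :* (w :* h)))) refl _ _ _ _ _ _)))
           (trans (∑-*ˡ (rowsOfLen n v) _ _) (*-assoc _ _ _))) ⟩
    antidiagonal l (λ v k → y ^ k * (⟦ fits p l ⟧ * G v))
      ≈⟨ antidiagonal-interval y l _ ⟩
    interval y 0 l (λ v → ⟦ fits p l ⟧ * G v)
      ≈⟨ interval-* l ⟩
    ⟦ fits p l ⟧ * interval y 0 l G ∎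
    where
    open R≈
    y = x (F.fromℕ n)
    G : ℕ → Carrier
    G v = ∑ (rowsOfLen n v) (λ u → ⟦ rowOK u ⟧ * (⟦ colOK′ p u ⟧ * (rowWeight (x ∘ F.inject₁) u * H u)))
    interval-* : ∀ l → interval y 0 l (λ v → ⟦ fits p l ⟧ * G v) ≈ ⟦ fits p l ⟧ * interval y 0 l G
    interval-* l = go ⟦ fits p l ⟧ l
      where
      go : ∀ c l → interval y 0 l (λ v → c * G v) ≈ c * interval y 0 l G
      go c zero = refl
      go c (suc l) = trans (+-congʳ (*-congˡ (go c l))) (solve 4 (λ y c i g → y :* (c :* i) :+ c :* g := c :* (y :* i :+ g)) refl _ _ _ _)

  branch-∑ : ∀ {k} y (μ : Vec ℕ (suc k)) → Decreasing μ → ∀ {I : Set} (is : List I) (c : I → Carrier) (φ : I → Vec ℕ k → Carrier) →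
    ∑ is (λ i → c i * branch y μ (φ i)) ≈ branch y μ (λ ν → ∑ is (λ i → c i * φ i ν))
  branch-∑ y μ d [] c φ = sym (trans (branch-cong y μ d λ ν _ → sym (zeroʳ 0#)) (trans (branch-* y μ 0# (λ _ → 0#) d) (zeroʳ _)))
  branch-∑ y μ d (i ∷ is) c φ = trans (+-congˡ (branch-∑ y μ d is c φ)) (sym (trans
    (branch-cong y μ d λ ν _ → solve 3 (λ a b s → a :* b :+ s := a :* b :- :- s) refl (c i) (φ i ν) _)
    (trans (branch-linear y μ (c i) (φ i) _ d) (+-congˡ (trans (-‿cong (trans (branch-cong y μ d λ ν _ → solve 1 (λ s → :- s := s :* con (-ᶻ (+ 1))) refl _)
      (branch-* y μ (ι (-ᶻ (+ 1))) _ d))) (solve 1 (λ s → :- (s :* con (-ᶻ (+ 1))) := s) refl _))))))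

  -- Removing the top letter from every row leaves the tableaux of an interlacing shape. The
  -- induction runs below a given row `p`, extended by any number `a` of top letters, and `d` rows
  -- deep.
  weightedTableaux-branch : ∀ {n k} (x : Fin (suc n) → Carrier) d p a (μ : Vec ℕ (suc k)) → d ℕ.+ k ≡ n → Deep d p → Decreasing μ →
    let y = x (F.fromℕ n) ; x′ = x ∘ F.inject₁ in
    weightedTableaux x (extendAbove p a) (V.toList μ) ≈
    ⟦ fits p (V.head μ) ⟧ * (y ^ smallest μ * branch y μ (λ ν → weightedTableaux x′ p (V.toList ν)))
  weightedTableaux-branch {n} {zero} x d p a (m ∷ []) dk deep _ = trans
    (weightedTableaux-extend x p a m [] (λ _ → 1#) (λ u k → weightedTableaux-[] x (just (extend u k))))
    (*-congˡ (trans (only m) (*-congˡ (sym (weightedTableaux-[] x′ p)))))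
    where
    y = x (F.fromℕ n)
    x′ = x ∘ F.inject₁
    G : ℕ → Carrier
    G v = ∑ (rowsOfLen n v) (λ u → ⟦ rowOK u ⟧ * (⟦ colOK′ p u ⟧ * (rowWeight x′ u * 1#)))
    -- At depth d = n no letter below the top one is left, so the final row consists of top letters
    -- and contributes y^m.
    blocked : ∀ i u → colOK′ p (i ∷ u) ≡ false
    blocked i u with colOK′ p (i ∷ u) in e
    ... | false = ≡.refl
    ... | true = ⊥-elim (ℕP.<-irrefl ≡.refl (ℕP.<-≤-trans (FP.toℕ<n i) (ℕP.≤-trans (ℕP.≤-reflexive (≡.trans (≡.sym dk) (ℕP.+-identityʳ d))) (deep i u e))))
    empty : ∀ v → G (suc v) ≈ 0#
    empty v = trans (∑-rows n v _) (∑-zero (letters n) λ i → ∑-zero (rowsOfLen n v) λ u → trans (*-congˡ (⟦⟧-false (blocked i u) _)) (zeroʳ _))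
    only : ∀ l → interval y 0 l G ≈ y ^ l * 1#
    only zero = trans (+-identityʳ _) (*-congˡ (trans (⟦⟧-true (colOK′-[] p) _) (*-identityˡ _)))
    only (suc l) = trans (+-cong (*-congˡ (only l)) (empty l)) (trans (+-identityʳ _) (sym (*-assoc _ _ _)))
  weightedTableaux-branch {n} {suc k} x d p a (m ∷ m′ ∷ μ) dk deep (le , dec) = begin
    weightedTableaux x (extendAbove p a) (m ∷ V.toList μ′)
      ≈⟨ weightedTableaux-extend x p a m (V.toList μ′) (λ u → weightedTableaux x (extendAbove (just u) 0) (V.toList μ′))
           (λ u j → independent u j) ⟩
    ⟦ fits p m ⟧ * interval y 0 m (λ v → ∑ (rowsOfLen n v) (λ u → ⟦ rowOK u ⟧ * (⟦ colOK′ p u ⟧ * (rowWeight x′ u * weightedTableaux x (extendAbove (just u) 0) (V.toList μ′)))))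
      ≈⟨ *-congˡ (interval-cong y 0 m λ v _ _ → step v) ⟩
    -- The guard says that the next row fits under the v smaller letters; it raises the lower limit
    -- of the interval from 0 to m′.
    ⟦ fits p m ⟧ * interval y 0 m (λ v → ⟦ m′ ≤ᶠ v ⟧ * (y ^ e * B v))
      ≈⟨ *-congˡ (trans (reflexive (≡.cong (λ j → interval y 0 j (λ v → ⟦ m′ ≤ᶠ v ⟧ * (y ^ e * B v))) (≡.sym (ℕP.m+[n∸m]≡n le))))
           (interval-from y m′ (m ∸ m′) _ λ v lt → ⟦⟧-false (≤ᶠ-false lt) _)) ⟩
    ⟦ fits p m ⟧ * interval y m′ (m ∸ m′) (λ v → ⟦ m′ ≤ᶠ v ⟧ * (y ^ e * B v))
      ≈⟨ *-congˡ (trans (interval-cong y m′ (m ∸ m′) λ v q _ → trans (⟦⟧-true (≤ᶠ-true q) _) (*-comm _ _)) (trans (interval-scale (m ∸ m′)) (*-comm _ _))) ⟩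
    ⟦ fits p m ⟧ * (y ^ e * interval y m′ (m ∸ m′) B) ∎
    where
    open R≈
    y = x (F.fromℕ n)
    x′ = x ∘ F.inject₁
    μ′ = m′ ∷ μ
    e = smallest μ′
    sdk : suc d ℕ.+ k ≡ n
    sdk = ≡.trans (≡.sym (ℕP.+-suc d k)) dk
    B : ℕ → Carrier
    B v = branch y μ′ (λ ν → weightedTableaux x′ p (v ∷ V.toList ν))
    interval-scale : ∀ j → interval y m′ j (λ v → B v * y ^ e) ≈ interval y m′ j B * y ^ e
    interval-scale zero = refl
    interval-scale (suc j) = trans (+-congʳ (*-congˡ (interval-scale j))) (solve 4 (λ y i z b → y :* (i :* z) :+ b :* z := (y :* i :+ b) :* z) refl _ _ _ _)
    -- The next row meets the row above only through the column condition, where by `colOK-extend`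
    -- the number of top letters j does not appear.
    independent : ∀ u j → weightedTableaux x (just (extend u j)) (V.toList μ′) ≈ weightedTableaux x (extendAbove (just u) 0) (V.toList μ′)
    independent u j = trans (go j) (sym (go 0))
      where
      go : ∀ j → weightedTableaux x (just (extend u j)) (V.toList μ′) ≈ _
      go j = weightedTableaux-extend x (just u) j m′ (V.toList μ) (λ u → weightedTableaux x (just (extend u 0)) (V.toList μ)) (λ u j → rest μ u j)
        where
        rest : ∀ {k} (μ : Vec ℕ k) u j → weightedTableaux x (just (extend u j)) (V.toList μ) ≈ weightedTableaux x (just (extend u 0)) (V.toList μ)
        rest [] u j = refl
        rest (m ∷ μ) u j = trans (weightedTableaux-extend x (just u) j m (V.toList μ) _ (rest μ)) (sym (weightedTableaux-extend x (just u) 0 m (V.toList μ) _ (rest μ)))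
    step : ∀ v → ∑ (rowsOfLen n v) (λ u → ⟦ rowOK u ⟧ * (⟦ colOK′ p u ⟧ * (rowWeight x′ u * weightedTableaux x (extendAbove (just u) 0) (V.toList μ′)))) ≈
      ⟦ m′ ≤ᶠ v ⟧ * (y ^ e * B v)
    step v = begin
      ∑ (rowsOfLen n v) (λ u → ⟦ rowOK u ⟧ * (⟦ colOK′ p u ⟧ * (rowWeight x′ u * weightedTableaux x (extendAbove (just u) 0) (V.toList μ′))))
        ≈⟨ ∑-cong-All (rows-length n v) (λ u len → *-congˡ (⟦⟧-guard (colOK′ p u) λ ok → *-congˡ
             (trans (weightedTableaux-branch x (suc d) (just u) 0 μ′ sdk (deep-suc {p = p} u deep ok) dec)
               (*-congʳ (⟦⟧-cong (≡.cong (m′ ≤ᶠ_) len)))))) ⟩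
      ∑ (rowsOfLen n v) (λ u → ⟦ rowOK u ⟧ * (⟦ colOK′ p u ⟧ * (rowWeight x′ u * (⟦ m′ ≤ᶠ v ⟧ * (y ^ e * branch y μ′ (λ ν → weightedTableaux x′ (just u) (V.toList ν)))))))
        ≈⟨ ∑-cong (rowsOfLen n v) (λ u → solve 6 (λ r c w f z b → r :* (c :* (w :* (f :* (z :* b)))) := (f :* z) :* ((r :* (c :* w)) :* b)) refl _ _ _ _ _ _) ⟩
      ∑ (rowsOfLen n v) (λ u → (⟦ m′ ≤ᶠ v ⟧ * y ^ e) * ((⟦ rowOK u ⟧ * (⟦ colOK′ p u ⟧ * rowWeight x′ u)) * branch y μ′ (λ ν → weightedTableaux x′ (just u) (V.toList ν))))
        ≈⟨ trans (∑-*ˡ (rowsOfLen n v) _ _) (*-congˡ (branch-∑ y μ′ dec (rowsOfLen n v) _ _)) ⟩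
      (⟦ m′ ≤ᶠ v ⟧ * y ^ e) * branch y μ′ (λ ν → ∑ (rowsOfLen n v) (λ u → (⟦ rowOK u ⟧ * (⟦ colOK′ p u ⟧ * rowWeight x′ u)) * weightedTableaux x′ (just u) (V.toList ν)))
        ≈⟨ trans (*-assoc _ _ _) (*-congˡ (*-congˡ (branch-cong y μ′ dec λ ν _ → trans (∑-cong (rowsOfLen n v) λ u →
             solve 4 (λ r c w t → r :* (c :* w) :* t := r :* (c :* (w :* t))) refl _ _ _ _) (sym (weightedTableaux-∷ x′ p v (V.toList ν)))))) ⟩
      ⟦ m′ ≤ᶠ v ⟧ * (y ^ e * B v) ∎

  -- Tableaux lose their largest letter first, so the variables arrive in reverse order; symmetry of
  -- `s` restores it later.
  descending : ∀ {n} → (Fin n → Carrier) → Vec Carrier n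
  descending {zero} x = []
  descending {suc n} x = x (F.fromℕ n) ∷ descending (x ∘ F.inject₁)

  weightedTableaux-s : ∀ {n} (x : Fin n → Carrier) μ → Decreasing μ → weightedTableaux x nothing (V.toList μ) ≈ s (descending x) μ
  weightedTableaux-s {zero} x [] _ = weightedTableaux-[] x nothing
  weightedTableaux-s {suc n} x μ d = trans (weightedTableaux-branch x 0 nothing 0 μ ≡.refl deep-nothing d)
    (trans (*-identityˡ _) (*-congˡ (branch-cong _ μ d λ ν i → weightedTableaux-s (x ∘ F.inject₁) ν (interlaced-decreasing μ ν i))))

  descending-~ : ∀ {n} (x : Fin n → Carrier) → V.tabulate x ~ descending x
  descending-~ {zero} x = ~-refl
  descending-~ {suc n} x = ≡.subst (_~ descending x) (≡.sym (tabulate-∷ʳ x))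
    (~-trans (∷ʳ-~ (V.tabulate (x ∘ F.inject₁)) (x (F.fromℕ n))) (~-prep _ (descending-~ (x ∘ F.inject₁))))
    where
    tabulate-∷ʳ : ∀ {n} (x : Fin (suc n) → Carrier) → V.tabulate x ≡ V.tabulate (x ∘ F.inject₁) V.∷ʳ x (F.fromℕ n)
    tabulate-∷ʳ {zero} x = ≡.refl
    tabulate-∷ʳ {suc n} x = ≡.cong (x F.zero ∷_) (tabulate-∷ʳ (x ∘ F.suc))

  weightedTableaux-zeros : ∀ {n} (x : Fin n → Carrier) p {k} (μ : Vec ℕ k) → Decreasing (0 ∷ μ) → weightedTableaux x p (V.toList μ) ≈ 1#
  weightedTableaux-zeros x p [] _ = weightedTableaux-[] x p
  weightedTableaux-zeros x p (zero ∷ μ) (_ , d) = trans (weightedTableaux-∷ x p 0 (V.toList μ))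
    (trans (+-identityʳ _) (trans (*-identityˡ _) (trans (⟦⟧-true (colOK′-[] p) _) (trans (*-identityˡ _) (weightedTableaux-zeros x (just []) μ d)))))

  -- Partitions have positive parts only, whereas vectors are padded with zeros. Empty rows
  -- contribute the factor 1.
  weightedTableaux-strip : ∀ {n} (x : Fin n → Carrier) p {k} (μ : Vec ℕ k) → Decreasing μ → weightedTableaux x p (strip (V.toList μ)) ≈ weightedTableaux x p (V.toList μ)
  weightedTableaux-strip x p [] _ = refl
  weightedTableaux-strip x p (zero ∷ μ) d = trans (weightedTableaux-[] x p) (sym (weightedTableaux-zeros x p (zero ∷ μ) (z≤n , d)))
  weightedTableaux-strip {n} x p (suc a ∷ μ) d = trans (weightedTableaux-∷ x p (suc a) (strip (V.toList μ)))
    (trans (∑-cong (rowsOfLen n (suc a)) λ r → *-congˡ (*-congˡ (*-congˡ (weightedTableaux-strip x (just r) μ (decreasing-tail (suc a) μ d)))))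
      (sym (weightedTableaux-∷ x p (suc a) (V.toList μ))))

-- Evaluation of formal sums

module Evaluation (A : Alg) where
  open Kit A

  monomial : ∀ {k} → Mono k → (Fin k → Carrier) → Carrier
  monomial [] x = 1#
  monomial (e ∷ d) x = x F.zero ^ e * monomial d (x ∘ F.suc)

  eval : ∀ {k} → Poly k → (Fin k → Carrier) → Carrier
  eval p x = ∑ p λ (c , d) → ι (+ c) * monomial d x

  monomial-0 : ∀ {k} (x : Fin k → Carrier) → monomial (V.replicate k 0) x ≈ 1#
  monomial-0 {zero} x = refl
  monomial-0 {suc k} x = trans (*-identityˡ _) (monomial-0 (x ∘ F.suc))

  monomial-unit : ∀ {k} (i : Fin k) x → monomial (unitMono i) x ≈ x i
  monomial-unit F.zero x = trans (*-congˡ (monomial-0 (x ∘ F.suc))) (trans (*-identityʳ _) (*-identityʳ _))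
  monomial-unit (F.suc i) x = trans (*-identityˡ _) (monomial-unit i (x ∘ F.suc))

  monomial-+ : ∀ {k} (d e : Mono k) x → monomial (V.zipWith ℕ._+_ d e) x ≈ monomial d x * monomial e x
  monomial-+ [] [] x = sym (*-identityˡ _)
  monomial-+ (a ∷ d) (b ∷ e) x = trans (*-cong (^-+ (x F.zero) a b) (monomial-+ d e (x ∘ F.suc)))
    (solve 4 (λ p q r s → p :* q :* (r :* s) := p :* r :* (q :* s)) refl _ _ _ _)

  monomial-++ : ∀ {n m} (d : Mono n) (e : Mono m) x → monomial (d V.++ e) x ≈ monomial d (x ∘ (F._↑ˡ m)) * monomial e (x ∘ (n F.↑ʳ_))
  monomial-++ [] e x = sym (*-identityˡ _)
  monomial-++ (a ∷ d) e x = trans (*-congˡ (monomial-++ d e (x ∘ F.suc))) (sym (*-assoc _ _ _))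

  module _ {k} (x : Fin k → Carrier) where
    eval-1 : eval 1P x ≈ 1#
    eval-1 = trans (+-identityʳ _) (trans (*-cong 1-homo (monomial-0 x)) (*-identityˡ _))

    eval-var : ∀ i → eval (var i) x ≈ x i
    eval-var i = trans (+-identityʳ _) (trans (*-cong 1-homo (monomial-unit i x)) (*-identityˡ _))

    eval-* : ∀ p q → eval (p *P q) x ≈ eval p x * eval q x
    eval-* p q = trans (∑-concatMap _ p _) (trans (∑-cong p λ (c , d) → trans (∑-map _ q _) (trans (∑-cong q λ (c′ , d′) →
        trans (*-cong (trans (reflexive (≡.cong ι (ℤP.pos-* c c′))) (*-homo (+ c) (+ c′))) (monomial-+ d d′ x))
          (solve 4 (λ a b u v → a :* b :* (u :* v) := a :* u :* (b :* v)) refl _ _ _ _))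
        (∑-*ˡ q _ _))) (∑-*ʳ p _ _))

    eval-∑ : ∀ {I : Set} (is : List I) f → eval (sumP (map f is)) x ≈ ∑ is (λ i → eval (f i) x)
    eval-∑ [] f = refl
    eval-∑ (i ∷ is) f = trans (∑-++ (f i) _ _) (+-congˡ (eval-∑ is f))

    eval-∏ : ∀ ps → eval (prodP ps) x ≈ ∏ ps (λ p → eval p x)
    eval-∏ [] = eval-1
    eval-∏ (p ∷ ps) = trans (eval-* p (prodP ps)) (*-congˡ (eval-∏ ps))

    eval-scale : ∀ a p → eval (scaleP a p) x ≈ ι (+ a) * eval p x
    eval-scale a p = trans (∑-map _ p _) (trans (∑-cong p λ (c , d) →
      trans (*-congʳ (trans (reflexive (≡.cong ι (ℤP.pos-* a c))) (*-homo (+ a) (+ c)))) (*-assoc _ _ _)) (∑-*ˡ p _ _))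

  eval-liftX : ∀ {n} m (p : Poly n) x → eval (liftX m p) x ≈ eval p (x ∘ (F._↑ˡ m))
  eval-liftX {n} m p x = trans (∑-map _ p _) (∑-cong p λ (c , d) → *-congˡ
    (trans (monomial-++ d (V.replicate m 0) x) (trans (*-congˡ (monomial-0 (x ∘ (n F.↑ʳ_)))) (*-identityʳ _))))

  eval-liftY : ∀ n {m} (p : Poly m) x → eval (liftY n p) x ≈ eval p (x ∘ (n F.↑ʳ_))
  eval-liftY n {m} p x = trans (∑-map _ p _) (∑-cong p λ (c , d) → *-congˡ
    (trans (monomial-++ (V.replicate n 0) d x) (trans (*-congʳ (monomial-0 (x ∘ (F._↑ˡ m)))) (*-identityˡ _))))

  ∏-++ : ∀ {I : Set} (is js : List I) f → ∏ (is ++ js) f ≈ ∏ is f * ∏ js f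
  ∏-++ [] js f = sym (*-identityˡ _)
  ∏-++ (i ∷ is) js f = trans (*-congˡ (∏-++ is js f)) (sym (*-assoc _ _ _))

  ∏-map : ∀ {I J : Set} (h : I → J) is f → ∏ (map h is) f ≈ ∏ is (f ∘ h)
  ∏-map h [] f = refl
  ∏-map h (i ∷ is) f = *-congˡ (∏-map h is f)

  ∏-concatMap : ∀ {I J : Set} (h : I → List J) is f → ∏ (concatMap h is) f ≈ ∏ is (λ i → ∏ (h i) f)
  ∏-concatMap h [] f = refl
  ∏-concatMap h (i ∷ is) f = trans (∏-++ (h i) _ f) (*-congˡ (∏-concatMap h is f))

  ∏-* : ∀ {I : Set} (is : List I) f g → ∏ is (λ i → f i * g i) ≈ ∏ is f * ∏ is g
  ∏-* [] f g = sym (*-identityˡ _)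
  ∏-* (i ∷ is) f g = trans (*-congˡ (∏-* is f g)) (solve 4 (λ a b c d → a :* b :* (c :* d) := a :* c :* (b :* d)) refl _ _ _ _)

  ∏-filterᵇ : ∀ {I : Set} (p : I → Bool) is f → ∏ (filterᵇ p is) f ≈ ∏ is (λ i → if p i then f i else 1#)
  ∏-filterᵇ p [] f = refl
  ∏-filterᵇ p (i ∷ is) f with p i
  ... | true = *-congˡ (∏-filterᵇ p is f)
  ... | false = trans (∏-filterᵇ p is f) (sym (*-identityˡ _))

  monomial-content : ∀ {n} (x : Fin n → Carrier) T → monomial (content T) x ≈ ∏ T (λ r → ∏ r x)
  monomial-content x [] = monomial-0 x
  monomial-content {n} x (r ∷ T) = trans (row r) (*-congˡ (monomial-content x T))
    where
    row : ∀ (r : List (Fin n)) → monomial (L.foldr (λ a v → V.zipWith ℕ._+_ (unitMono a) v) (content T) r) x ≈ ∏ r x * monomial (content T) x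
    row [] = sym (*-identityˡ _)
    row (a ∷ r) = trans (monomial-+ (unitMono a) _ x) (trans (*-cong (monomial-unit a x) (row r)) (sym (*-assoc _ _ _)))

  open Tableaux A

  eval-schur : ∀ {n} (x : Fin n → Carrier) la → eval (schur n la) x ≈ weightedTableaux x nothing (proj₁ la)
  eval-schur {n} x la = trans (∑-map _ (SSYTs n la) _) (trans (∑-filterᵇ isSSYT (fillings n (proj₁ la)) _)
    (∑-cong (fillings n (proj₁ la)) λ T → *-cong (⟦⟧-cong (isSSYT-chain T)) (trans (*-cong 1-homo (monomial-content x T)) (*-identityˡ _))))

  ∏-subsets : ∀ n (f : Subset (suc n) → Carrier) → ∏ (allSubsets (suc n)) f ≈ ∏ (allSubsets n) (λ s → f (false ∷ s) * f (true ∷ s))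
  ∏-subsets n f = trans (∏-concatMap _ (allSubsets n) f) (∏-cong (allSubsets n) λ s → *-congˡ (*-identityʳ _))

  ∏-swapVec : ∀ {n} (k : Adjacent n) (f : Subset n → Carrier) → ∏ (allSubsets n) (f ∘ swapVec k) ≈ ∏ (allSubsets n) f
  ∏-swapVec {suc (suc n)} here f = trans (∏-subsets (suc n) _) (trans (∏-subsets n _) (trans (∏-cong (allSubsets n) λ s →
      solve 4 (λ a b c d → a :* b :* (c :* d) := a :* c :* (b :* d)) refl _ _ _ _)
    (sym (trans (∏-subsets (suc n) _) (∏-subsets n _)))))
  ∏-swapVec {suc n} (there k) f = trans (∏-subsets n _) (trans (∏-* (allSubsets n) _ _) (trans (*-cong (∏-swapVec k (f ∘ (false ∷_))) (∏-swapVec k (f ∘ (true ∷_))))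
    (trans (sym (∏-* (allSubsets n) _ _)) (sym (∏-subsets n f)))))

  ∏-subsetsOfSize-swap : ∀ {n} j (k : Adjacent n) (f : Subset n → Carrier) → ∏ (subsetsOfSize n j) (f ∘ swapVec k) ≈ ∏ (subsetsOfSize n j) f
  ∏-subsetsOfSize-swap {n} j k f = trans (∏-filterᵇ _ (allSubsets n) _) (trans (∏-cong (allSubsets n) λ S →
      reflexive (≡.cong (λ c → if c ℕ.≡ᵇ j then f (swapVec k S) else 1#) (≡.sym (size-swapVec k S))))
    (trans (∏-swapVec k (λ S → if ∣ S ∣ ℕ.≡ᵇ j then f S else 1#)) (sym (∏-filterᵇ _ (allSubsets n) _))))
    where
    size-swapVec : ∀ {n} (k : Adjacent n) (S : Subset n) → ∣ swapVec k S ∣ ≡ ∣ S ∣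
    size-swapVec here (true ∷ true ∷ S) = ≡.refl
    size-swapVec here (true ∷ false ∷ S) = ≡.refl
    size-swapVec here (false ∷ true ∷ S) = ≡.refl
    size-swapVec here (false ∷ false ∷ S) = ≡.refl
    size-swapVec (there k) (true ∷ S) = ≡.cong suc (size-swapVec k S)
    size-swapVec (there k) (false ∷ S) = size-swapVec k S

  linearForm : ∀ {N} → (Fin N → Carrier) → Subset N → Carrier
  linearForm {N} x u = ∑ (fins N) λ a → ι (membership (a ∈ᵇ u)) * x a

  open Indexed A

  linearForm-elems : ∀ {n} (x : Fin n → Carrier) S → ∑ (elems S) x ≈ linearForm x S
  linearForm-elems x [] = refl
  linearForm-elems {suc n} x (b ∷ S) = trans (∑-++ (if b then F.zero ∷ [] else []) (map F.suc (elems S)) x)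
    (trans (+-cong (head b) (trans (∑-map F.suc (elems S) x) (linearForm-elems (x ∘ F.suc) S))) (sym (∑-fins n _)))
    where
    head : ∀ b → ∑ (if b then F.zero ∷ [] else []) x ≈ ι (membership b) * x F.zero
    head true = trans (+-identityʳ _) (sym (trans (*-congʳ 1-homo) (*-identityˡ _)))
    head false = sym (trans (*-congʳ 0-homo) (zeroˡ _))

  linearForm-++ : ∀ {n m} (x : Fin (n ℕ.+ m) → Carrier) S T → linearForm x (S V.++ T) ≈ linearForm (x ∘ (F._↑ˡ m)) S + linearForm (x ∘ (n F.↑ʳ_)) T
  linearForm-++ x [] T = sym (+-identityˡ _)
  linearForm-++ {suc n} {m} x (b ∷ S) T = trans (∑-fins (n ℕ.+ m) _) (trans (+-congˡ (linearForm-++ (x ∘ F.suc) S T))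
    (trans (sym (+-assoc _ _ _)) (+-congʳ (sym (∑-fins n _)))))

  ∑-swapFin : ∀ {N} (k : Adjacent N) (f : Fin N → Carrier) → ∑ (fins N) (f ∘ swapFin k) ≈ ∑ (fins N) f
  ∑-swapFin (here {N}) f = trans (∑-fins (suc N) _) (trans (+-congˡ (∑-fins N _)) (trans (solve 3 (λ a b c → a :+ (b :+ c) := b :+ (a :+ c)) refl _ _ _)
    (sym (trans (∑-fins (suc N) _) (+-congˡ (∑-fins N _))))))
  ∑-swapFin (there {N} k) f = trans (∑-fins N _) (trans (+-congˡ (∑-swapFin k (f ∘ F.suc))) (sym (∑-fins N f)))

  linearForm-swap : ∀ {N} (k : Adjacent N) (x : Fin N → Carrier) u → linearForm (x ∘ swapFin k) u ≈ linearForm x (swapVec k u)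
  linearForm-swap {N} k x u = trans (∑-cong (fins N) λ a → *-congʳ (reflexive (≡.cong (ι ∘ membership) (≡.sym (lookup-swap k u a)))))
    (∑-swapFin k (λ a → ι (membership (a ∈ᵇ swapVec k u)) * x a))
    where
    lookup-swap : ∀ {N} (k : Adjacent N) (u : Subset N) a → V.lookup (swapVec k u) (swapFin k a) ≡ V.lookup u a
    lookup-swap here (b ∷ c ∷ u) F.zero = ≡.refl
    lookup-swap here (b ∷ c ∷ u) (F.suc F.zero) = ≡.refl
    lookup-swap here (b ∷ c ∷ u) (F.suc (F.suc a)) = ≡.refl
    lookup-swap (there k) (b ∷ u) F.zero = ≡.refl
    lookup-swap (there k) (b ∷ u) (F.suc a) = lookup-swap k u a

hom-monomial : ∀ {A B : Alg} (h : Hom A B) {k} (d : Mono k) x → Kit._≈_ B (⟪ h ⟫ (Evaluation.monomial A d x)) (Evaluation.monomial B d (⟪ h ⟫ ∘ x))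
hom-monomial h [] x = ⟪⟫-1 h
hom-monomial {B = B} h (e ∷ d) x = trans (⟪⟫-* h _ _) (*-cong (⟪⟫-^ h _ e) (hom-monomial h d (x ∘ F.suc)))
  where open Kit B

hom-linearForm : ∀ {A B : Alg} (h : Hom A B) {N} (x : Fin N → Kit.Carrier A) u → Kit._≈_ B (⟪ h ⟫ (Evaluation.linearForm A x u)) (Evaluation.linearForm B (⟪ h ⟫ ∘ x) u)
hom-linearForm {B = B} h {N} x u = trans (⟪⟫-∑ h (fins N) _) (∑-cong (fins N) λ a → trans (⟪⟫-* h _ _) (*-congʳ (⟪⟫-ι h _)))
  where open Kit B

module _ where
  open Evaluation

  genMonomial : ∀ N → Mono N → ℂ N
  genMonomial N d = monomial (𝕊 N) d (gen N)

  genMonomial-∷ : ∀ N a (d : Mono N) → let open Kit (𝕊 (suc N)) in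
    genMonomial (suc N) (a ∷ d) ≈ gen (suc N) F.zero ^ a * PowerSeries.const (𝕊 N) (genMonomial N d)
  genMonomial-∷ N a d = *-congˡ {gen (suc N) F.zero ^ a} (sym (hom-monomial (SeriesMaps.constHom (𝕊 N)) d (gen N)))
    where open Kit (𝕊 (suc N))

  power-coefficient : ∀ N a b M (α : Vec ℕ N) → a ≢ b → at N (PowerSeries._⊛_ (𝕊 N) (𝕂._^_ (suc N) (gen (suc N) F.zero) a) (PowerSeries.const (𝕊 N) M) b) α ≡ + 0
  power-coefficient N a b M α ne = BranchCoefficients.y^-vanish (𝕊 N) (λ f → at N f α ≡ + 0) (λ e p → ≡.trans (at-cong N e α) p) (at-0 N α)
    (λ {f} {g} p q → ≡.trans (at-+ N f g α) (≡.cong₂ _+ᶻ_ p q)) a (PowerSeries.const (𝕊 N) M) b λ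
      { zero e → ⊥-elim (ne (≡.trans (≡.sym (ℕP.+-identityʳ a)) e)) ; (suc c) e → at-0 N α }

  at-genMonomial-same : ∀ N (d : Mono N) → at N (genMonomial N d) d ≡ + 1
  at-genMonomial-same zero [] = ≡.refl
  at-genMonomial-same (suc N) (a ∷ d) = ≡.trans (at-cong (suc N) (genMonomial-∷ N a d) (a ∷ d))
    (≡.trans (at-cong N (K.trans (K.reflexive (≡.cong (F ) (≡.sym (ℕP.+-identityʳ a)))) (BranchCoefficients.y^-⊛ (𝕊 N) a _ 0)) d) (at-genMonomial-same N d))
    where
    module K = 𝕂 N
    F : ℕ → ℂ N
    F = PowerSeries._⊛_ (𝕊 N) (𝕂._^_ (suc N) (gen (suc N) F.zero) a) (PowerSeries.const (𝕊 N) (genMonomial N d))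

  at-genMonomial-diff : ∀ N (d e : Mono N) → d ≢ e → at N (genMonomial N d) e ≡ + 0
  at-genMonomial-diff zero [] [] ne = ⊥-elim (ne ≡.refl)
  at-genMonomial-diff (suc N) (a ∷ d) (b ∷ e) ne = ≡.trans (at-cong (suc N) (genMonomial-∷ N a d) (b ∷ e)) (cases (a ℕ.≟ b))
    where
    module K = 𝕂 N
    F : ℕ → ℂ N
    F = PowerSeries._⊛_ (𝕊 N) (𝕂._^_ (suc N) (gen (suc N) F.zero) a) (PowerSeries.const (𝕊 N) (genMonomial N d))
    cases : Dec (a ≡ b) → at N (F b) e ≡ + 0
    cases (no a≢b) = power-coefficient N a b (genMonomial N d) e a≢b
    cases (yes ≡.refl) = ≡.trans (at-cong N (K.trans (K.reflexive (≡.cong F (≡.sym (ℕP.+-identityʳ a)))) (BranchCoefficients.y^-⊛ (𝕊 N) a _ 0)) e)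
      (at-genMonomial-diff N d e (ne ∘ ≡.cong (a ∷_)))

  at-eval : ∀ N (p : Poly N) e → at N (eval (𝕊 N) p (gen N)) e ≡ + coeff p e
  at-eval N [] e = at-0 N e
  at-eval N ((c , d) ∷ p) e = ≡.trans (at-+ N (K.ι (+ c) K.* genMonomial N d) _ e) (≡.cong₂ _+ᶻ_ (≡.trans (at-ι* N (+ c) (genMonomial N d) e) term) (at-eval N p e))
    where
    module K = 𝕂 N
    term : + c *ᶻ at N (genMonomial N d) e ≡ + (if does (VP.≡-dec ℕP._≟_ d e) then c else 0)
    term with VP.≡-dec ℕP._≟_ d e
    ... | yes ≡.refl = ≡.trans (≡.cong (+ c *ᶻ_) (at-genMonomial-same N d)) (ℤP.*-identityʳ (+ c))
    ... | no ne = ≡.trans (≡.cong (+ c *ᶻ_) (at-genMonomial-diff N d e ne)) (ℤP.*-zeroʳ (+ c))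

  -- Evaluation at the independent variables of `𝕊 N` keeps every coefficient, so identities of
  -- formal sums may be proved in the power series ring.
  eval-injective : ∀ N (p q : Poly N) → 𝕂._≈_ N (eval (𝕊 N) p (gen N)) (eval (𝕊 N) q (gen N)) → p ≈P q
  eval-injective N p q h e = ℤP.+-injective (≡.trans (≡.sym (at-eval N p e)) (≡.trans (at-cong N h e) (at-eval N q e)))

-- Subsets of a given size

∈-allSubsets : ∀ {n} (S : Subset n) → S ∈ allSubsets n
∈-allSubsets [] = here ≡.refl
∈-allSubsets (false ∷ S) = ∈-concatMap⁺ _ (lose (∈-allSubsets S) (here ≡.refl))
∈-allSubsets (true ∷ S) = ∈-concatMap⁺ _ (lose (∈-allSubsets S) (there (here ≡.refl)))

allSubsets-distinct : ∀ n → AllPairs _≢_ (allSubsets n)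
allSubsets-distinct zero = [] ∷ []
allSubsets-distinct (suc n) = AllPairsP.concat⁺ (AllP.map⁺ (All.tabulate λ _ → ((λ ()) ∷ []) ∷ [] ∷ []))
  (AllPairsP.map⁺ (AllPairs.map (λ ne → ((ne ∘ VP.∷-injectiveʳ) ∷ (λ ()) ∷ []) ∷ ((λ ()) ∷ (ne ∘ VP.∷-injectiveʳ) ∷ []) ∷ []) (allSubsets-distinct n)))

∈-subsetsOfSize⁺ : ∀ {n j} {S : Subset n} → ∣ S ∣ ≡ j → S ∈ subsetsOfSize n j
∈-subsetsOfSize⁺ {n} {j} {S} e = ∈-filter⁺ (λ S → T? (∣ S ∣ ℕ.≡ᵇ j)) (∈-allSubsets S) (ℕP.≡⇒≡ᵇ ∣ S ∣ j e)

∈-subsetsOfSize⁻ : ∀ {n j} {S : Subset n} → S ∈ subsetsOfSize n j → ∣ S ∣ ≡ j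
∈-subsetsOfSize⁻ {n} {j} {S} i = ℕP.≡ᵇ⇒≡ ∣ S ∣ j (proj₂ (∈-filter⁻ (λ S → T? (∣ S ∣ ℕ.≡ᵇ j)) {xs = allSubsets n} i))

∣insert∣ : ∀ {n} (S : Subset n) i → (i ∈ᵇ S) ≡ false → ∣ S V.[ i ]≔ true ∣ ≡ suc ∣ S ∣
∣insert∣ (false ∷ S) F.zero _ = ≡.refl
∣insert∣ (true ∷ S) (F.suc i) e = ≡.cong suc (∣insert∣ S i e)
∣insert∣ (false ∷ S) (F.suc i) e = ∣insert∣ S i e

∣remove∣ : ∀ {n} (S : Subset n) i → (i ∈ᵇ S) ≡ true → suc ∣ S V.[ i ]≔ false ∣ ≡ ∣ S ∣
∣remove∣ (true ∷ S) F.zero _ = ≡.refl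
∣remove∣ (true ∷ S) (F.suc i) e = ≡.cong suc (∣remove∣ S i e)
∣remove∣ (false ∷ S) (F.suc i) e = ∣remove∣ S i e

∣move∣ : ∀ {n} (S : Subset n) i j → i ≢ j → (j ∈ᵇ S) ≡ true → (i ∈ᵇ S) ≡ false → ∣ (S V.[ j ]≔ false) V.[ i ]≔ true ∣ ≡ ∣ S ∣
∣move∣ S i j ne p q = ≡.trans (∣insert∣ (S V.[ j ]≔ false) i (≡.trans (VP.lookup∘updateAt′ i j ne S) q)) (∣remove∣ S j p)

toPartition : ∀ {n} (μ : Vec ℕ n) → Decreasing μ → Partition
toPartition μ d = strip (V.toList μ) , linked μ d , positive (V.toList μ)
  where
  linked : ∀ {n} (μ : Vec ℕ n) → Decreasing μ → Linked ℕ._≥_ (strip (V.toList μ))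
  linked [] _ = []
  linked (zero ∷ μ) _ = []
  linked (suc a ∷ []) _ = [-]
  linked (suc a ∷ zero ∷ μ) _ = [-]
  linked (suc a ∷ suc b ∷ μ) (p , d) = p ∷ linked (suc b ∷ μ) d
  positive : ∀ ls → All (λ p → 1 ≤ p) (strip ls)
  positive [] = []
  positive (zero ∷ ls) = []
  positive (suc a ∷ ls) = s≤s z≤n ∷ positive ls

-- The product over pairs of subsets

module _ (n m j k : ℕ) where
  open Expansion n m
  open Positivity n m using (coefficients-nonneg; Closed; inX; inY; injX; injY)
  open Kit (𝕊 N)
  open Evaluation (𝕊 N)
  open Tableaux (𝕊 N)
  open Alternants (𝕊 N)

  -- The basis of U inside the exterior algebra on all N letters.
  sites : List (Subset N)
  sites = concatMap (λ S → map (S V.++_) (subsetsOfSize m k)) (subsetsOfSize n j)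

  ∈-sites⁺ : ∀ {S : Subset n} {T : Subset m} → ∣ S ∣ ≡ j → ∣ T ∣ ≡ k → (S V.++ T) ∈ sites
  ∈-sites⁺ {S} e e′ = ∈-concatMap⁺ (λ S → map (S V.++_) (subsetsOfSize m k)) (lose (∈-subsetsOfSize⁺ e) (∈-map⁺ (S V.++_) (∈-subsetsOfSize⁺ e′)))

  ∈-sites⁻ : ∀ {b} → b ∈ sites → ∃ λ (S : Subset n) → ∃ λ (T : Subset m) → b ≡ S V.++ T × ∣ S ∣ ≡ j × ∣ T ∣ ≡ k
  ∈-sites⁻ i with find (∈-concatMap⁻ (λ S → map (S V.++_) (subsetsOfSize m k)) i)
  ... | S , S∈ , b∈ with ∈-map⁻ (S V.++_) b∈
  ... | T , T∈ , e = S , T , e , ∈-subsetsOfSize⁻ S∈ , ∈-subsetsOfSize⁻ T∈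

  sites-distinct : AllPairs _≢_ sites
  sites-distinct = AllPairsP.concat⁺
    (AllP.map⁺ (All.tabulate λ {S} _ → AllPairsP.map⁺ (AllPairs.map (λ ne → ne ∘ VP.++-injectiveʳ S S) (AllPairsP.filter⁺ _ (allSubsets-distinct m)))))
    (AllPairsP.map⁺ (AllPairs.map (λ {S} {S′} ne → AllP.map⁺ (All.tabulate λ _ → AllP.map⁺ (All.tabulate λ _ → ne ∘ VP.++-injectiveˡ S S′)))
      (AllPairsP.filter⁺ _ (allSubsets-distinct n))))

  -- Exchanging a letter for another of the same alphabet changes neither size, so U is stable under
  -- gl(n).
  sites-closedX : Closed inX sites
  sites-closedX i i′ ne b∈ p q with ∈-sites⁻ b∈
  ... | S , T , ≡.refl , e , e′ = ≡.subst (_∈ sites)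
    (≡.sym (≡.trans (≡.cong (V._[ inX i ]≔ true) (VP.[]≔-++-↑ˡ S T i′)) (VP.[]≔-++-↑ˡ (S V.[ i′ ]≔ false) T i)))
    (∈-sites⁺ {(S V.[ i′ ]≔ false) V.[ i ]≔ true} {T} (≡.trans (∣move∣ S i i′ ne (≡.trans (≡.sym (VP.lookup-++ˡ S T i′)) p) (≡.trans (≡.sym (VP.lookup-++ˡ S T i)) q)) e) e′)

  sites-closedY : Closed inY sites
  sites-closedY i i′ ne b∈ p q with ∈-sites⁻ b∈
  ... | S , T , ≡.refl , e , e′ = ≡.subst (_∈ sites)
    (≡.sym (≡.trans (≡.cong (V._[ inY i ]≔ true) (VP.[]≔-++-↑ʳ S T i′)) (VP.[]≔-++-↑ʳ S (T V.[ i′ ]≔ false) i)))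
    (∈-sites⁺ {S} {(T V.[ i′ ]≔ false) V.[ i ]≔ true} e (≡.trans (∣move∣ T i i′ ne (≡.trans (≡.sym (VP.lookup-++ʳ S T i′)) p) (≡.trans (≡.sym (VP.lookup-++ʳ S T i)) q)) e′))

  form : Subset N → Carrier
  form = linearForm (gen N)

  f : Carrier
  f = ∏ sites form

  ∏-sites : ∀ (g : Subset N → Carrier) → ∏ sites g ≈ ∏ (subsetsOfSize n j) (λ S → ∏ (subsetsOfSize m k) (λ T → g (S V.++ T)))
  ∏-sites g = trans (∏-concatMap _ (subsetsOfSize n j) g) (∏-cong (subsetsOfSize n j) λ S → ∏-map (S V.++_) (subsetsOfSize m k) g)

  eval-Pjk : eval (Pjk n m j k) (gen N) ≈ f
  eval-Pjk = begin
    eval (Pjk n m j k) (gen N)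
      ≈⟨ eval-∏ (gen N) (concatMap (λ S → map (λ T → XS m S +P YT n T) (subsetsOfSize m k)) (subsetsOfSize n j)) ⟩
    ∏ (concatMap (λ S → map (λ T → XS m S +P YT n T) (subsetsOfSize m k)) (subsetsOfSize n j)) (λ p → eval p (gen N))
      ≈⟨ trans (∏-concatMap _ (subsetsOfSize n j) _) (∏-cong (subsetsOfSize n j) λ S → trans (∏-map _ (subsetsOfSize m k) _) (∏-cong (subsetsOfSize m k) λ T → factor S T)) ⟩
    ∏ (subsetsOfSize n j) (λ S → ∏ (subsetsOfSize m k) (λ T → form (S V.++ T)))
      ≈⟨ sym (∏-sites form) ⟩
    f ∎
    where
    open R≈
    factor : ∀ S T → eval (XS m S +P YT n T) (gen N) ≈ form (S V.++ T)
    factor S T = begin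
      eval (XS m S +P YT n T) (gen N)
        ≈⟨ ∑-++ (XS m S) (YT n T) _ ⟩
      eval (XS m S) (gen N) + eval (YT n T) (gen N)
        ≈⟨ +-cong (trans (eval-∑ (gen N) (elems S) (xv m)) (∑-cong (elems S) λ i → eval-var (gen N) (inX i)))
                  (trans (eval-∑ (gen N) (elems T) (yv n)) (∑-cong (elems T) λ i → eval-var (gen N) (inY i))) ⟩
      ∑ (elems S) (gen N ∘ inX) + ∑ (elems T) (gen N ∘ inY)
        ≈⟨ +-cong (linearForm-elems _ S) (linearForm-elems _ T) ⟩
      linearForm (gen N ∘ inX) S + linearForm (gen N ∘ inY) T
        ≈⟨ sym (linearForm-++ (gen N) S T) ⟩
      form (S V.++ T) ∎

  f-homogeneous : Homogeneous N (L.length sites) f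
  f-homogeneous = homogeneous-∏ N sites form λ u → trans (∂-∑ (𝕊 N) (total N) (fins N) _)
    (trans (∑-cong (fins N) λ a → trans (SecondOrder.∂-constant-* (𝕊 N) (total N) (gen N a) (∂-ι (total N) (membership (a ∈ᵇ u)))) (*-congˡ (total-gen N a)))
      (sym (trans (*-congʳ 1-homo) (*-identityˡ _))))

  swap-form : ∀ (l : Adjacent N) u → ⟪ swapHom l ⟫ (form u) ≈ form (swapVec l u)
  swap-form l u = trans (hom-linearForm (swapHom l) (gen N) u)
    (trans (∑-cong (fins N) λ a → *-congˡ (swapHom-gen l a)) (linearForm-swap l (gen N) u))

  f-symmetric : Symmetric f
  f-symmetric = (λ l → trans (swapped (adjacentˡ m l)) (trans (∏-cong (subsetsOfSize n j) λ S → ∏-cong (subsetsOfSize m k) λ T →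
                    reflexive (≡.cong form (swapVec-++ˡ l S T)))
                  (trans (∏-subsetsOfSize-swap j l (λ S → ∏ (subsetsOfSize m k) (λ T → form (S V.++ T)))) (sym (∏-sites form)))))
              , (λ l → trans (swapped (adjacentʳ n l)) (trans (∏-cong (subsetsOfSize n j) λ S →
                    trans (∏-cong (subsetsOfSize m k) λ T → reflexive (≡.cong form (swapVec-++ʳ l S T))) (∏-subsetsOfSize-swap k l (λ T → form (S V.++ T))))
                  (sym (∏-sites form))))
    where
    swapped : ∀ (l : Adjacent N) → ⟪ swapHom l ⟫ f ≈ ∏ (subsetsOfSize n j) (λ S → ∏ (subsetsOfSize m k) (λ T → form (swapVec l (S V.++ T))))
    swapped l = trans (⟪⟫-∏ (swapHom l) sites form) (trans (∏-sites _) (∏-cong (subsetsOfSize n j) λ S → ∏-cong (subsetsOfSize m k) λ T → swap-form l (S V.++ T)))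

  -- Joins the two descriptions of a Schur polynomial: tableaux without empty rows on one side, the
  -- branching recursion with its variables in ascending order on the other.
  eval-toPartition : ∀ {l} (inc : Fin l → Fin N) → (∀ {i i′} → inc i ≡ inc i′ → i ≡ i′) → ∀ μ (d : Decreasing μ) →
    eval (schur l (toPartition μ d)) (gen N ∘ inc) ≈ s (V.tabulate (gen N ∘ inc)) μ
  eval-toPartition inc inj μ d = trans (eval-schur (gen N ∘ inc) (toPartition μ d)) (trans (weightedTableaux-strip _ nothing μ d)
    (trans (weightedTableaux-s _ μ d) (s-~ (regular-Δ N inc inj) (descending-~ (gen N ∘ inc)) μ d)))

  toTerm : ℤ × Vec ℕ N → ℕ × Partition × Partition
  toTerm (a , p) = ℤ.∣ a ∣ , toPartition (clamp (xPart p)) (clamp-decreasing (xPart p)) , toPartition (clamp (yPart p)) (clamp-decreasing (yPart p))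

  -- `h` abstracts the summand of the final expansion and is known through its values on triples.
  -- Nonnegativity is used to write the coefficient a as its absolute value.
  eval-terms : ∀ (h : ℕ × Partition × Partition → Poly N) → (∀ a la mu → h (a , la , mu) ≡ scaleP a (liftX m (schur n la) *P liftY n (schur m mu))) →
    ∀ {Ls} → All (λ x → + 0 ℤ.≤ proj₁ x) Ls → eval (sumP (map h (map toTerm Ls))) (gen N) ≈ combination Ls
  eval-terms h e {Ls} pos = trans (eval-∑ (gen N) (map toTerm Ls) h) (trans (∑-map toTerm Ls _) (∑-cong-All pos term))
    where
    term : ∀ x → + 0 ℤ.≤ proj₁ x → eval (h (toTerm x)) (gen N) ≈ ι (proj₁ x) * basis (proj₂ x)
    term (a , p) nonneg = begin
      eval (h (toTerm (a , p))) (gen N)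
        ≈⟨ reflexive (≡.cong (λ q → eval q (gen N)) (e ℤ.∣ a ∣ la mu)) ⟩
      eval (scaleP ℤ.∣ a ∣ (liftX m (schur n la) *P liftY n (schur m mu))) (gen N)
        ≈⟨ eval-scale (gen N) ℤ.∣ a ∣ (liftX m (schur n la) *P liftY n (schur m mu)) ⟩
      ι (+ ℤ.∣ a ∣) * eval (liftX m (schur n la) *P liftY n (schur m mu)) (gen N)
        ≈⟨ *-cong (reflexive (≡.cong ι (ℤP.0≤i⇒+∣i∣≡i nonneg))) (eval-* (gen N) (liftX m (schur n la)) (liftY n (schur m mu))) ⟩
      ι a * (eval (liftX m (schur n la)) (gen N) * eval (liftY n (schur m mu)) (gen N))
        ≈⟨ *-congˡ (*-cong
             (trans (eval-liftX m (schur n la) (gen N)) (eval-toPartition inX injX (clamp (xPart p)) (clamp-decreasing (xPart p))))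
             (trans (eval-liftY n (schur m mu) (gen N)) (eval-toPartition inY injY (clamp (yPart p)) (clamp-decreasing (yPart p))))) ⟩
      ι a * basis p ∎
      where
      open R≈
      la = toPartition (clamp (xPart p)) (clamp-decreasing (xPart p))
      mu = toPartition (clamp (yPart p)) (clamp-decreasing (yPart p))

  schur-positive : ∀ (h : ℕ × Partition × Partition → Poly N) → (∀ a la mu → h (a , la , mu) ≡ scaleP a (liftX m (schur n la) *P liftY n (schur m mu))) →
    ∃ λ Ts → Pjk n m j k ≈P sumP (map h Ts)
  schur-positive h e = conclude (expansion (L.length sites) f f-homogeneous f-symmetric)
    where
    conclude : (∃ λ Ls → map proj₂ Ls ≡ indices (L.length sites) × f ≈ combination Ls) → ∃ λ Ts → Pjk n m j k ≈P sumP (map h Ts)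
    conclude (Ls , ind , expanded) = map toTerm Ls , eval-injective N (Pjk n m j k) (sumP (map h (map toTerm Ls)))
      (trans eval-Pjk (trans expanded (sym (eval-terms h e
        (coefficients-nonneg sites sites-distinct sites-closedX sites-closedY (L.length sites) Ls ind expanded)))))

theorem3p2 : (n m j k : ℕ) → 1 ≤ j → 1 ≤ k →
    ∃ λ (L : List (ℕ × Partition × Partition)) →
    Pjk n m j k ≈P
    sumP (map (λ { (a , la , mu) → scaleP a (liftX m (schur n la) *P liftY n (schur m mu)) }) L)
theorem3p2 n m j k _ _ = schur-positive n m j k _ (λ _ _ _ → ≡.refl)
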